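{- For any $m\in\mathbb Z_{\ge1}$, \[\sum_{k=0}^m\binom{m-k}{\lfloor (m-k)/2\rfloor}\sum_{1\le i_1<\cdots<i_k\le m}\ \prod_{j=1}^k(x_{i_j}^2+x_{i_j}^{ -2})=\sum_{\ell=0}^{\lfloor m/2\rfloor}\ \sum_{z=0}^{\lfloor m/2\rfloor-\ell}(-1)^z\chi^{\operatorname{Sp}(2m)}_{(2^{m-2\ell-2z},1^{2z})}.\]
   Context: $\chi_\lambda^{\operatorname{Sp}(2m)}=\chi_\lambda^{\operatorname{Sp}(2m)}(x_1^{\pm1},\dots,x_m^{\pm1})$ is the character of the irreducible representation of $\operatorname{Sp}(2m,\mathbb C)$ with highest weight the partition $\lambda$, evaluated at a torus element with eigenvalues $x_1^{\pm1},\dots,x_m^{\pm1}$; $(2^c,1^d)$ is the partition with $c$ parts $2$ followed by $d$ parts $1$; $\chi_\emptyset=1$. The sum over $1\le i_1<\cdots<i_k\le m$ is set equal to $1$ when $k=0$. -}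

module Defs where

open import Algebra.Bundles using (AbelianGroup; CommutativeRing; RawMonoid; Semiring)
open import Algebra.Morphism.Structures using (IsMonoidHomomorphism)
import Algebra.Construct.DirectProduct as DirectProduct
import Algebra.Definitions.RawSemiring as RawSemiringDefinitions
import Algebra.Properties.Ring as RingProperties
import Algebra.Properties.Semiring.Sum as SemiringSum
import Algebra.Solver.Ring.NaturalCoefficients.Default as SemiringSolver
open import Data.Fin.Base as Fin using (Fin; zero; suc; toℕ; splitAt; _↑ˡ_; _↑ʳ_)
open import Data.List.Base as List using (List; []; _∷_; _++_)
open import Data.Nat.Base as ℕ using (ℕ; zero; suc; z≤n; s≤s)
import Data.Nat.Properties as ℕ
open import Data.Product.Base using (∃; _×_; _,_; proj₁; proj₂)
open import Data.Sum.Base using (_⊎_; inj₁; inj₂; [_,_]′)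
open import Data.Vec.Base as Vec using (Vec; []; _∷_)
open import Level using (0ℓ)
open import Relation.Binary.Core using (Rel)
open import Relation.Binary.Structures using (IsStrictTotalOrder)
open import Relation.Nullary using (¬_)
import Relation.Binary.Reasoning.Setoid as SetoidReasoning

-- The real numbers, by the axioms that determine them classically up to
-- unique isomorphism: a Dedekind-complete ordered field.  The order is
-- trichotomous, so this is the classical continuum.
record Reals : Set₁ where
  field
    commutativeRing : CommutativeRing 0ℓ 0ℓ

  open CommutativeRing commutativeRing

  infix 4 _<_

  field
    _<_                : Rel Carrier 0ℓ
    isStrictTotalOrder : IsStrictTotalOrder _≈_ _<_
    1≉0                : ¬ 1# ≈ 0#
    inverse            : ∀ x → ¬ x ≈ 0# → ∃ λ y → x * y ≈ 1#
    +-mono-<           : ∀ x y z → x < y → x + z < y + z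
    *-pos              : ∀ x y → 0# < x → 0# < y → 0# < x * y

  -- x ≤ y is written ¬ y < x.
  IsUpperBound : (Carrier → Set) → Carrier → Set
  IsUpperBound S b = ∀ x → S x → ¬ b < x

  field
    supremum : (S : Carrier → Set) → ∃ S → ∃ (IsUpperBound S) →
               ∃ λ s → IsUpperBound S s × (∀ b → IsUpperBound S b → ¬ b < s)

private
  module Identities (R : CommutativeRing 0ℓ 0ℓ) where
    open CommutativeRing R
    open RingProperties ring using (-1*x≈-x)
    open SemiringSolver commutativeSemiring using (solve; _:=_; _:+_; _:*_)
    open SetoidReasoning setoid

    minus : ∀ x y → x - y ≈ x + - 1# * y
    minus x y = +-congˡ (sym (-1*x≈-x y))

    assoc-re : ∀ a b c d e f → (a * c - b * d) * e - (a * d + b * c) * f ≈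
                               a * (c * e - d * f) - b * (c * f + d * e)
    assoc-re a b c d e f = begin
      (a * c - b * d) * e - (a * d + b * c) * f
        ≈⟨ trans (minus _ _) (+-congʳ (*-congʳ (minus _ _))) ⟩
      (a * c + - 1# * (b * d)) * e + - 1# * ((a * d + b * c) * f)
        ≈⟨ solve 7 (λ n a b c d e f →
             ((a :* c :+ n :* (b :* d)) :* e :+ n :* ((a :* d :+ b :* c) :* f)) :=
             (a :* (c :* e :+ n :* (d :* f)) :+ n :* (b :* (c :* f :+ d :* e))))
             refl (- 1#) a b c d e f ⟩
      a * (c * e + - 1# * (d * f)) + - 1# * (b * (c * f + d * e))
        ≈⟨ trans (minus _ _) (+-congʳ (*-congˡ (minus _ _))) ⟨
      a * (c * e - d * f) - b * (c * f + d * e) ∎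

    assoc-im : ∀ a b c d e f → (a * c - b * d) * f + (a * d + b * c) * e ≈
                               a * (c * f + d * e) + b * (c * e - d * f)
    assoc-im a b c d e f = begin
      (a * c - b * d) * f + (a * d + b * c) * e
        ≈⟨ +-congʳ (*-congʳ (minus _ _)) ⟩
      (a * c + - 1# * (b * d)) * f + (a * d + b * c) * e
        ≈⟨ solve 7 (λ n a b c d e f →
             ((a :* c :+ n :* (b :* d)) :* f :+ (a :* d :+ b :* c) :* e) :=
             (a :* (c :* f :+ d :* e) :+ b :* (c :* e :+ n :* (d :* f))))
             refl (- 1#) a b c d e f ⟩
      a * (c * f + d * e) + b * (c * e + - 1# * (d * f))
        ≈⟨ +-congˡ (*-congˡ (minus _ _)) ⟨
      a * (c * f + d * e) + b * (c * e - d * f) ∎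

    distrib-re : ∀ a b c d e f → a * (c + e) - b * (d + f) ≈ (a * c - b * d) + (a * e - b * f)
    distrib-re a b c d e f = begin
      a * (c + e) - b * (d + f)
        ≈⟨ minus _ _ ⟩
      a * (c + e) + - 1# * (b * (d + f))
        ≈⟨ solve 7 (λ n a b c d e f →
             (a :* (c :+ e) :+ n :* (b :* (d :+ f))) :=
             ((a :* c :+ n :* (b :* d)) :+ (a :* e :+ n :* (b :* f))))
             refl (- 1#) a b c d e f ⟩
      (a * c + - 1# * (b * d)) + (a * e + - 1# * (b * f))
        ≈⟨ +-cong (minus _ _) (minus _ _) ⟨
      (a * c - b * d) + (a * e - b * f) ∎

    distrib-im : ∀ a b c d e f → a * (d + f) + b * (c + e) ≈ (a * d + b * c) + (a * f + b * e)
    distrib-im = solve 6 (λ a b c d e f →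
      (a :* (d :+ f) :+ b :* (c :+ e)) := ((a :* d :+ b :* c) :+ (a :* f :+ b :* e))) refl

-- The ring R[i]; the pair (a , b) stands for a + b i.
module _ (R : CommutativeRing 0ℓ 0ℓ) where
  open CommutativeRing R

  infix 4 _≈ᵖ_
  infixl 7 _*ᵖ_

  _≈ᵖ_ : Carrier × Carrier → Carrier × Carrier → Set
  (a , b) ≈ᵖ (c , d) = (a ≈ c) × (b ≈ d)

  _*ᵖ_ : Carrier × Carrier → Carrier × Carrier → Carrier × Carrier
  (a , b) *ᵖ (c , d) = (a * c - b * d) , (a * d + b * c)

  private
    open Identities R
    open RingProperties ring using (-0#≈0#)
    open SetoidReasoning setoid

    *ᵖ-comm : ∀ u v → (u *ᵖ v) ≈ᵖ (v *ᵖ u)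
    *ᵖ-comm (a , b) (c , d) =
      +-cong (*-comm a c) (-‿cong (*-comm b d)) ,
      trans (+-comm _ _) (+-cong (*-comm b c) (*-comm a d))

    *ᵖ-identityˡ : ∀ u → ((1# , 0#) *ᵖ u) ≈ᵖ u
    *ᵖ-identityˡ (a , b) =
      (begin
        1# * a - 0# * b  ≈⟨ +-cong (*-identityˡ a) (-‿cong (zeroˡ b)) ⟩
        a - 0#           ≈⟨ +-congˡ -0#≈0# ⟩
        a + 0#           ≈⟨ +-identityʳ a ⟩
        a                ∎) ,
      trans (+-cong (*-identityˡ b) (zeroˡ a)) (+-identityʳ b)

    ≈ᵖ-trans : ∀ {u v w} → u ≈ᵖ v → v ≈ᵖ w → u ≈ᵖ w
    ≈ᵖ-trans (p , q) (r , s) = trans p r , trans q s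

    distribˡᵖ : ∀ u v w → (u *ᵖ (proj₁ v + proj₁ w , proj₂ v + proj₂ w)) ≈ᵖ
                (proj₁ (u *ᵖ v) + proj₁ (u *ᵖ w) , proj₂ (u *ᵖ v) + proj₂ (u *ᵖ w))
    distribˡᵖ (a , b) (c , d) (e , f) = distrib-re a b c d e f , distrib-im a b c d e f

  adjoinI : CommutativeRing 0ℓ 0ℓ
  adjoinI = record
    { Carrier = Carrier × Carrier
    ; _≈_ = _≈ᵖ_
    ; _+_ = λ { (a , b) (c , d) → a + c , b + d }
    ; _*_ = _*ᵖ_
    ; -_ = λ { (a , b) → - a , - b }
    ; 0# = 0# , 0#
    ; 1# = 1# , 0#
    ; isCommutativeRing = record
      { isRing = record
        { +-isAbelianGroup = isAbelianGroup
        ; *-cong = λ { (p , q) (r , s) →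
            +-cong (*-cong p r) (-‿cong (*-cong q s)) ,
            +-cong (*-cong p s) (*-cong q r) }
        ; *-assoc = λ { (a , b) (c , d) (e , f) →
            assoc-re a b c d e f , assoc-im a b c d e f }
        ; *-identity = *ᵖ-identityˡ ,
            λ u → ≈ᵖ-trans (*ᵖ-comm u (1# , 0#)) (*ᵖ-identityˡ u)
        ; distrib = distribˡᵖ ,
            λ { u v w → ≈ᵖ-trans (*ᵖ-comm (proj₁ v + proj₁ w , proj₂ v + proj₂ w) u)
                  (≈ᵖ-trans (distribˡᵖ u v w)
                    ( +-cong (proj₁ (*ᵖ-comm u v)) (proj₁ (*ᵖ-comm u w))
                    , +-cong (proj₂ (*ᵖ-comm u v)) (proj₂ (*ᵖ-comm u w)))) }
        }
      ; *-comm = *ᵖ-comm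
      }
    }
    where
    open AbelianGroup (DirectProduct.abelianGroup +-abelianGroup +-abelianGroup)
      using (isAbelianGroup)

complexNumbers : Reals → CommutativeRing 0ℓ 0ℓ
complexNumbers ℝ = adjoinI (Reals.commutativeRing ℝ)

-- Partitions with at most m parts, padded with zeros to length m.
record Partition (m : ℕ) : Set where
  field
    part       : Fin m → ℕ
    decreasing : ∀ {i j} → i Fin.≤ j → part j ℕ.≤ part i

twoOneZero : ℕ → ℕ → ℕ → ℕ
twoOneZero zero    zero    i       = 0
twoOneZero zero    (suc d) zero    = 1
twoOneZero zero    (suc d) (suc i) = twoOneZero zero d i
twoOneZero (suc c) d       zero    = 2
twoOneZero (suc c) d       (suc i) = twoOneZero c d i

private
  twoOneZero≤1 : ∀ d i → twoOneZero 0 d i ℕ.≤ 1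
  twoOneZero≤1 zero    i       = z≤n
  twoOneZero≤1 (suc d) zero    = s≤s z≤n
  twoOneZero≤1 (suc d) (suc i) = twoOneZero≤1 d i

  twoOneZero≤2 : ∀ c d i → twoOneZero c d i ℕ.≤ 2
  twoOneZero≤2 zero    d i       = ℕ.m≤n⇒m≤1+n (twoOneZero≤1 d i)
  twoOneZero≤2 (suc c) d zero    = ℕ.≤-refl
  twoOneZero≤2 (suc c) d (suc i) = twoOneZero≤2 c d i

  twoOneZero-decreasing : ∀ c d {i j} → i ℕ.≤ j → twoOneZero c d j ℕ.≤ twoOneZero c d i
  twoOneZero-decreasing zero    zero    p             = z≤n
  twoOneZero-decreasing zero    (suc d) {j = j} z≤n   = twoOneZero≤1 (suc d) j
  twoOneZero-decreasing zero    (suc d) (s≤s p)       = twoOneZero-decreasing zero d p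
  twoOneZero-decreasing (suc c) d       {j = j} z≤n   = twoOneZero≤2 (suc c) d j
  twoOneZero-decreasing (suc c) d       (s≤s p)       = twoOneZero-decreasing c d p

-- The partition (2^c , 1^d).  It is meant for c + d ≤ m only; otherwise the
-- entries beyond the m-th are dropped.
⟨2^_,1^_⟩ : ∀ {m} → ℕ → ℕ → Partition m
⟨2^ c ,1^ d ⟩ = record
  { part       = λ i → twoOneZero c d (toℕ i)
  ; decreasing = twoOneZero-decreasing c d
  }

-- All k-tuples i₁ < ⋯ < i_k of elements of Fin m, each listed once.
increasing : (k m : ℕ) → List (Vec (Fin m) k)
increasing zero    m       = [] ∷ []
increasing (suc k) zero    = []
increasing (suc k) (suc m) =
  List.map (λ is → zero ∷ Vec.map suc is) (increasing k m) ++
  List.map (Vec.map suc) (increasing (suc k) m)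

module Symplectic (K : CommutativeRing 0ℓ 0ℓ) where

  open CommutativeRing K public
    using (Carrier; _≈_; _+_; _*_; -_; 0#; 1#)
  open RawSemiringDefinitions (Semiring.rawSemiring (CommutativeRing.semiring K)) public
    using (sum; product; _^_)
    renaming (_×_ to _·_)

  private
    module K = CommutativeRing K
    open SemiringSum K.semiring
      using (sum-cong-≋; sum-replicate-zero; *-distribˡ-sum; *-distribʳ-sum; ∑-comm)
    open RingProperties K.ring using (-‿distribʳ-*)
    module ≈-Reasoning = SetoidReasoning K.setoid

  Vector : ℕ → Set
  Vector n = Fin n → Carrier

  Matrix : ℕ → Set
  Matrix n = Fin n → Fin n → Carrier

  infix 4 _≈ᵛ_ _≈ᴹ_

  _≈ᵛ_ : ∀ {n} → Vector n → Vector n → Set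
  v ≈ᵛ w = ∀ i → v i ≈ w i

  _≈ᴹ_ : ∀ {n} → Matrix n → Matrix n → Set
  A ≈ᴹ B = ∀ i j → A i j ≈ B i j

  0ᵛ : ∀ {n} → Vector n
  0ᵛ i = 0#

  infixl 6 _+ᵛ_
  infixr 7 _∙ᵛ_ _▹_
  infixr 7 _*ᴹ_

  _+ᵛ_ : ∀ {n} → Vector n → Vector n → Vector n
  (v +ᵛ w) i = v i + w i

  _∙ᵛ_ : ∀ {n} → Carrier → Vector n → Vector n
  (a ∙ᵛ v) i = a * v i

  _▹_ : ∀ {n} → Matrix n → Vector n → Vector n
  (A ▹ v) i = sum λ j → A i j * v j

  _*ᴹ_ : ∀ {n} → Matrix n → Matrix n → Matrix n
  (A *ᴹ B) i j = sum λ k → A i k * B k j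

  _ᵀ : ∀ {n} → Matrix n → Matrix n
  (A ᵀ) i j = A j i

  diagonal : ∀ {n} → Vector n → Matrix n
  diagonal t zero    zero    = t zero
  diagonal t zero    (suc j) = 0#
  diagonal t (suc i) zero    = 0#
  diagonal t (suc i) (suc j) = diagonal (λ k → t (suc k)) i j

  1ᴹ : ∀ {n} → Matrix n
  1ᴹ = diagonal λ _ → 1#

  trace : ∀ {n} → Matrix n → Carrier
  trace A = sum λ i → A i i

  matrixMonoid : ℕ → RawMonoid 0ℓ 0ℓ
  matrixMonoid n = record
    { Carrier = Matrix n
    ; _≈_     = _≈ᴹ_
    ; _∙_     = _*ᴹ_
    ; ε       = 1ᴹ
    }

  *ᴹ-cong : ∀ {n} {A A′ B B′ : Matrix n} → A ≈ᴹ A′ → B ≈ᴹ B′ → A *ᴹ B ≈ᴹ A′ *ᴹ B′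
  *ᴹ-cong p q i j = sum-cong-≋ λ k → K.*-cong (p i k) (q k j)

  *ᴹ-assoc : ∀ {n} (A B C : Matrix n) → (A *ᴹ B) *ᴹ C ≈ᴹ A *ᴹ (B *ᴹ C)
  *ᴹ-assoc {n} A B C i j = begin
    sum (λ k → sum (λ l → A i l * B l k) * C k j)
      ≈⟨ sum-cong-≋ (λ k → *-distribʳ-sum (C k j) (λ l → A i l * B l k)) ⟩
    sum (λ k → sum (λ l → A i l * B l k * C k j))
      ≈⟨ ∑-comm (λ k l → A i l * B l k * C k j) ⟩
    sum (λ l → sum (λ k → A i l * B l k * C k j))
      ≈⟨ sum-cong-≋ (λ l → sum-cong-≋ (λ k → K.*-assoc (A i l) (B l k) (C k j))) ⟩
    sum (λ l → sum (λ k → A i l * (B l k * C k j)))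
      ≈⟨ sum-cong-≋ (λ l → *-distribˡ-sum (A i l) (λ k → B l k * C k j)) ⟨
    sum (λ l → A i l * sum (λ k → B l k * C k j)) ∎
    where open ≈-Reasoning

  ᵀ-*ᴹ : ∀ {n} (A B : Matrix n) → (A *ᴹ B) ᵀ ≈ᴹ B ᵀ *ᴹ A ᵀ
  ᵀ-*ᴹ A B i j = sum-cong-≋ λ k → K.*-comm (A j k) (B k i)

  sum-0 : ∀ {n} (f : Vector n) → f ≈ᵛ 0ᵛ → sum f ≈ 0#
  sum-0 {n} f p = K.trans (sum-cong-≋ p) (sum-replicate-zero n)

  diagonal-ᵀ : ∀ {n} (t : Vector n) i j → diagonal t i j ≈ diagonal t j i
  diagonal-ᵀ t zero    zero    = K.refl
  diagonal-ᵀ t zero    (suc j) = K.refl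
  diagonal-ᵀ t (suc i) zero    = K.refl
  diagonal-ᵀ t (suc i) (suc j) = diagonal-ᵀ (λ k → t (suc k)) i j

  sum-diagonal : ∀ {n} (t v : Vector n) i → sum (λ k → diagonal t i k * v k) ≈ t i * v i
  sum-diagonal t v zero    =
    K.trans (K.+-congˡ (sum-0 _ λ k → K.zeroˡ (v (suc k)))) (K.+-identityʳ _)
  sum-diagonal t v (suc i) =
    K.trans (K.+-cong (K.zeroˡ (v zero)) (sum-diagonal _ (λ k → v (suc k)) i)) (K.+-identityˡ _)

  -- The symplectic group Sp(2m): the isometries of the form with block matrix
  --   J = (  0  1 )
  --       ( -1  0 ).

  Jblock : ∀ {m} → Fin m ⊎ Fin m → Fin m ⊎ Fin m → Carrier
  Jblock (inj₁ a) (inj₁ b) = 0#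
  Jblock (inj₁ a) (inj₂ b) = 1ᴹ a b
  Jblock (inj₂ a) (inj₁ b) = - 1ᴹ a b
  Jblock (inj₂ a) (inj₂ b) = 0#

  J : ∀ m → Matrix (m ℕ.+ m)
  J m i j = Jblock (splitAt m i) (splitAt m j)

  record Sp (m : ℕ) : Set where
    field
      matrix     : Matrix (m ℕ.+ m)
      symplectic : matrix ᵀ *ᴹ J m *ᴹ matrix ≈ᴹ J m

  open Sp public

  diagonal-form : ∀ {n} (t : Vector n) (A : Matrix n) i j →
                  (diagonal t ᵀ *ᴹ A *ᴹ diagonal t) i j ≈ t i * (t j * A i j)
  diagonal-form t A i j = begin
    sum (λ k → diagonal t k i * sum (λ l → A k l * diagonal t l j))
      ≈⟨ sum-cong-≋ (λ k → K.*-cong (diagonal-ᵀ t k i)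
           (K.trans (sum-cong-≋ (λ l → K.trans (K.*-comm _ _) (K.*-congʳ (diagonal-ᵀ t l j))))
                    (sum-diagonal t (A k) j))) ⟩
    sum (λ k → diagonal t i k * (t j * A k j))
      ≈⟨ sum-diagonal t (λ k → t j * A k j) i ⟩
    t i * (t j * A i j) ∎
    where open ≈-Reasoning

  spMonoid : ℕ → RawMonoid 0ℓ 0ℓ
  spMonoid m = record
    { Carrier = Sp m
    ; _≈_     = λ g h → matrix g ≈ᴹ matrix h
    ; _∙_     = λ g h → record
      { matrix     = matrix g *ᴹ matrix h
      ; symplectic = product-symplectic g h
      }
    ; ε       = record
      { matrix     = 1ᴹ
      ; symplectic = λ i j → K.trans (diagonal-form (λ _ → 1#) (J m) i j)
                               (K.trans (K.*-identityˡ _) (K.*-identityˡ _))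
      }
    }
    where
    product-symplectic : ∀ g h → (matrix g *ᴹ matrix h) ᵀ *ᴹ J m *ᴹ (matrix g *ᴹ matrix h) ≈ᴹ J m
    product-symplectic g h i j = begin
      ((G *ᴹ H) ᵀ *ᴹ J m *ᴹ (G *ᴹ H)) i j
        ≈⟨ *ᴹ-cong (ᵀ-*ᴹ G H) (λ a b → K.sym (*ᴹ-assoc (J m) G H a b)) i j ⟩
      ((H ᵀ *ᴹ G ᵀ) *ᴹ ((J m *ᴹ G) *ᴹ H)) i j
        ≈⟨ *ᴹ-assoc (H ᵀ) (G ᵀ) ((J m *ᴹ G) *ᴹ H) i j ⟩
      (H ᵀ *ᴹ (G ᵀ *ᴹ ((J m *ᴹ G) *ᴹ H))) i j
        ≈⟨ *ᴹ-cong {A = H ᵀ} (λ _ _ → K.refl) (λ a b → K.sym (*ᴹ-assoc (G ᵀ) (J m *ᴹ G) H a b)) i j ⟩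
      (H ᵀ *ᴹ ((G ᵀ *ᴹ (J m *ᴹ G)) *ᴹ H)) i j
        ≈⟨ *ᴹ-cong {A = H ᵀ} (λ _ _ → K.refl) (*ᴹ-cong {B = H} (symplectic g) (λ _ _ → K.refl)) i j ⟩
      (H ᵀ *ᴹ (J m *ᴹ H)) i j
        ≈⟨ symplectic h i j ⟩
      J m i j ∎
      where
      open ≈-Reasoning
      G = matrix g
      H = matrix h

  -- An m-tuple of units x_i, given together with their inverses.
  record Torus (m : ℕ) : Set where
    field
      val     : Fin m → Carrier
      inv     : Fin m → Carrier
      inverse : ∀ i → val i * inv i ≈ 1#

  open Torus public

  inverse-entries : ∀ {n} (x y : Vector n) → (∀ i → x i * y i ≈ 1#) →
                    ∀ a b → x a * (y b * 1ᴹ a b) ≈ 1ᴹ a b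
  inverse-entries x y p zero    zero    =
    K.trans (K.*-congˡ (K.*-identityʳ _)) (p zero)
  inverse-entries x y p zero    (suc b) =
    K.trans (K.*-congˡ (K.zeroʳ _)) (K.zeroʳ _)
  inverse-entries x y p (suc a) zero    =
    K.trans (K.*-congˡ (K.zeroʳ _)) (K.zeroʳ _)
  inverse-entries x y p (suc a) (suc b) =
    inverse-entries (λ i → x (suc i)) (λ i → y (suc i)) (λ i → p (suc i)) a b

  eigenvalue : ∀ {m} → Torus m → Fin m ⊎ Fin m → Carrier
  eigenvalue x = [ val x , inv x ]′

  -- diag(x₁ , … , x_m , x₁⁻¹ , … , x_m⁻¹)
  torusElement : ∀ {m} → Torus m → Sp m
  torusElement {m} x = record
    { matrix     = diagonal λ i → eigenvalue x (splitAt m i)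
    ; symplectic = λ i j → K.trans (diagonal-form _ (J m) i j) (preserves (splitAt m i) (splitAt m j))
    }
    where
    preserves : ∀ s t → eigenvalue x s * (eigenvalue x t * Jblock s t) ≈ Jblock s t
    preserves (inj₁ a) (inj₁ b) = K.trans (K.*-congˡ (K.zeroʳ _)) (K.zeroʳ _)
    preserves (inj₁ a) (inj₂ b) = inverse-entries (val x) (inv x) (inverse x) a b
    preserves (inj₂ a) (inj₁ b) = begin
      inv x a * (val x b * - 1ᴹ a b)    ≈⟨ K.*-congˡ (-‿distribʳ-* _ _) ⟨
      inv x a * - (val x b * 1ᴹ a b)    ≈⟨ -‿distribʳ-* _ _ ⟨
      - (inv x a * (val x b * 1ᴹ a b))  ≈⟨ K.-‿cong (inverse-entries (inv x) (val x)
                                             (λ i → K.trans (K.*-comm _ _) (inverse x i)) a b) ⟩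
      - 1ᴹ a b                          ∎
      where open ≈-Reasoning
    preserves (inj₂ a) (inj₂ b) = K.trans (K.*-congˡ (K.zeroʳ _)) (K.zeroʳ _)

  -- The Borel subgroup is the stabiliser of the flag ⟨e₁⟩ ⊂ ⟨e₁ , e₂⟩ ⊂ ⋯ ⊂
  -- ⟨e₁ , … , e_m⟩, so that the positive roots are ε_a - ε_b (a < b),
  -- ε_a + ε_b (a < b) and 2ε_a.  Its unipotent radical consists of the symplectic
  --   ( A  B )
  --   ( 0  D )
  -- with A upper unitriangular; D is then the inverse transpose of A.
  record IsPositiveUnipotent {m : ℕ} (g : Sp m) : Set where
    field
      upperLeft : ∀ {a b : Fin m} → b Fin.≤ a → matrix g (a ↑ˡ m) (b ↑ˡ m) ≈ 1ᴹ a b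
      lowerLeft : ∀ (a b : Fin m) → matrix g (m ↑ʳ a) (b ↑ˡ m) ≈ 0#

  -- Polynomials in the entries of an n × n matrix.
  data Polynomial (n : ℕ) : Set where
    con       : Carrier → Polynomial n
    var       : Fin n → Fin n → Polynomial n
    _:+_ _:*_ : Polynomial n → Polynomial n → Polynomial n

  evaluate : ∀ {n} → Polynomial n → Matrix n → Carrier
  evaluate (con a)   A = a
  evaluate (var i j) A = A i j
  evaluate (p :+ q)  A = evaluate p A + evaluate q A
  evaluate (p :* q)  A = evaluate p A * evaluate q A

  -- A rational representation of Sp(2m) on Kⁿ.  The inverse of g is - J gᵀ J, so
  -- every regular function on Sp(2m) is a polynomial in the entries of g.
  record Representation (m n : ℕ) : Set where
    field
      ρ              : Sp m → Matrix n
      isHomomorphism : IsMonoidHomomorphism (spMonoid m) (matrixMonoid n) ρ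
      rational       : ∀ i j → ∃ λ p → ∀ g → ρ g i j ≈ evaluate p (matrix g)

  weight : ∀ {m} → Partition m → Torus m → Carrier
  weight μ t = product λ i → val t i ^ Partition.part μ i

  module _ {m n : ℕ} (V : Representation m n) where
    open Representation V using (ρ)

    record IsInvariantSubspace (W : Vector n → Set) : Set where
      field
        respects  : ∀ {v w} → v ≈ᵛ w → W v → W w
        zero∈     : W 0ᵛ
        +-closed  : ∀ {v w} → W v → W w → W (v +ᵛ w)
        ∙-closed  : ∀ a {v} → W v → W (a ∙ᵛ v)
        invariant : ∀ g {v} → W v → W (ρ g ▹ v)

    -- V ≠ 0 and the only invariant subspaces are 0 and V; the latter in the form
    -- that an invariant subspace with a nonzero element is all of V, which avoids
    -- deciding whether an arbitrary predicate is 0.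
    record IsIrreducible : Set₁ where
      field
        nontrivial : ∃ λ (v : Vector n) → ¬ v ≈ᵛ 0ᵛ
        simple     : ∀ W → IsInvariantSubspace W →
                     ∀ v → W v → ¬ v ≈ᵛ 0ᵛ → ∀ w → W w

    record HasHighestWeight (μ : Partition m) : Set where
      field
        vector      : Vector n
        nonzero     : ¬ vector ≈ᵛ 0ᵛ
        unipotent   : ∀ g → IsPositiveUnipotent g → ρ g ▹ vector ≈ᵛ vector
        eigenvalues : ∀ t → ρ (torusElement t) ▹ vector ≈ᵛ weight μ t ∙ᵛ vector

    character : Torus m → Carrier
    character x = trace (ρ (torusElement x))

  -- χ is the character, as a function on the torus, of the irreducible
  -- representation of Sp(2m) with highest weight μ.
  record IsIrreducibleCharacter {m : ℕ} (μ : Partition m) (χ : Torus m → Carrier) : Set₁ where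
    field
      dimension      : ℕ
      representation : Representation m dimension
      irreducible    : IsIrreducible representation
      highestWeight  : HasHighestWeight representation μ
      isCharacter    : ∀ x → χ x ≈ character representation x

  infix 5 ∑≤-syntax

  ∑≤-syntax : ℕ → (ℕ → Carrier) → Carrier
  ∑≤-syntax n f = sum {suc n} λ k → f (toℕ k)

  syntax ∑≤-syntax n (λ k → e) = ∑[ k ≤ n ] e

  -- ∑_{i₁ < ⋯ < i_k} ∏_j y_{i_j}
  elementarySum : ∀ {m} → ℕ → (Fin m → Carrier) → Carrier
  elementarySum {m} k y =
    List.foldr _+_ 0# (List.map (λ is → product λ j → y (Vec.lookup is j)) (increasing k m))

{-# OPTIONS --safe #-}
module Submission where

-- The character of highest weight μ is x^μ plus strictly dominated monomials, it is
-- invariant under the Weyl group, and it is an eigenfunction of the radial part of the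
-- Casimir operator, which is found by moving root vectors cyclically around the trace.
-- These properties determine it: the highest exponent of the difference of two such
-- functions would be dominant, strictly dominated by μ and of the same Casimir eigenvalue
-- |μ + ρ|² - |ρ|², which is impossible.  Put X_i = x_i + x_i⁻¹ and let γ_n be the
-- coefficients of (y - y⁻¹) ∏ (X_i + y + y⁻¹).  The dual Jacobi–Trudi determinants, which
-- are 2 × 2 for the partitions (2^c,1^d), have the same properties, so they are the
-- characters, and the right-hand side telescopes to Σ_l (γ_{2l+1}² - γ_{2l+2}²).
-- The left-hand side is the sum of the coefficients of y⁰ and y¹ in
-- ∏ (x_i² + x_i⁻² + y + y⁻¹).  The two agree because ∏ (x_i² + x_i⁻² + y² + y⁻²) is the
-- product of the values of ∏ (X_i + t + t⁻¹) at t = i y and t = - i y.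

open import Algebra.Bundles using (CommutativeRing; RawMonoid)
open import Algebra.Morphism.Structures using (IsMonoidHomomorphism)
import Algebra.Properties.AbelianGroup as AbelianGroupProperties
import Algebra.Properties.CommutativeMonoid.Sum as CommutativeMonoidSum
import Algebra.Properties.Monoid.Mult as MonoidMult
import Algebra.Properties.Monoid.Mult.TCOptimised as MonoidMultTCOptimised
import Algebra.Properties.Ring as RingProperties
import Algebra.Properties.Semiring.Mult as SemiringMult
import Algebra.Properties.Semiring.Sum as SemiringSum
import Algebra.Solver.Ring as RingSolver
open import Algebra.Solver.Ring.AlmostCommutativeRing using (fromCommutativeRing; _-Raw-AlmostCommutative⟶_)
open import Data.Empty using (⊥-elim)
open import Data.Fin.Base as Fin using (Fin; zero; suc; toℕ; splitAt; _↑ˡ_; _↑ʳ_; fromℕ<; join)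
import Data.Fin.Properties as Fin
open import Data.Integer.Base as ℤ using (ℤ; +_; -[1+_]; +0; +[1+_]; _⊖_; ∣_∣)
import Data.Integer.Properties as ℤ
import Data.Integer.Solver as ℤSolver
open import Data.List.Base as List using (List; []; _∷_; _++_)
open import Data.List.Membership.Propositional using (_∈_)
open import Data.List.Membership.Propositional.Properties using (∈-map⁺)
import Data.List.Properties as List
open import Data.List.Relation.Unary.All as All using (All; []; _∷_)
open import Data.List.Relation.Unary.All.Properties using (++⁺)
open import Data.List.Relation.Unary.Any using (here; there)
open import Data.Maybe.Base using (Maybe; just; nothing)
open import Data.Nat.Base as ℕ using (ℕ; zero; suc; _≤_; _∸_; ⌊_/2⌋)
open import Data.Nat.Combinatorics using (_C_; nCk+nC[k+1]≡[n+1]C[k+1]; nCk≡nC[n∸k]; nCn≡1)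
import Data.Nat.Properties as ℕ
open import Data.Product.Base using (∃; _×_; _,_; proj₁; proj₂)
open import Data.Sum.Base as Sum using (_⊎_; inj₁; inj₂; [_,_]′)
open import Data.Unit.Base using (⊤; tt)
open import Data.Vec.Base as Vec using (Vec; []; _∷_)
open import Data.Vec.Properties using (lookup-map)
open import Function.Base using (_∘_)
open import Level using (0ℓ)
open import Relation.Binary.Definitions using (tri<; tri≈; tri>)
open import Relation.Binary.PropositionalEquality as ≡ using (_≡_; _≢_; _≗_)
import Relation.Binary.Reasoning.Setoid as SetoidReasoning
open import Relation.Binary.Structures using (IsStrictTotalOrder)
open import Relation.Nullary using (¬_; Dec; yes; no)
open import Relation.Nullary.Decidable using (_×-dec_)
open import Defs

-- The characters are given only as traces of irreducible representations, with no formula attached,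
-- so everything has to come from the matrices `ρ g`. Differentiation is therefore algebraic. The
-- entries of `ρ` are polynomials, their restrictions to transvections and to the torus are finite
-- formal sums, and an identity holding at every group element is differentiated by showing that
-- formal sums with equal values have equal pairings with every function. This needs one element of
-- infinite multiplicative order, the number 2, hence characteristic zero; the case distinctions
-- need decidable equality, which trichotomy of the order on the reals supplies. The radial operator
-- has the denominators x_a - x_a⁻¹ and X_a - X_c, so it is evaluated only away from the root
-- hyperplanes. Its constant term at infinity, taken along a strictly dominant one-parameter
-- subgroup through powers of 2, stands in for an analytic limit, and this is where 2ρ appears. The
-- parameters p = m + 2 - c and q = m + 1 - (c + d) of the determinants are those for which the
-- leading exponent is (2^c,1^d).

record IsCharZeroField (K : CommutativeRing 0ℓ 0ℓ) : Set where
  open CommutativeRing K hiding (zero)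
  open MonoidMult +-monoid using () renaming (_×_ to _·_)
  infix 4 _≟_
  field
    _≟_     : ∀ x y → Dec (x ≈ y)
    inverse : ∀ x → ¬ x ≈ 0# → ∃ λ y → x * y ≈ 1#
    n·1≉0   : ∀ n → ¬ suc n · 1# ≈ 0#

-- Integers inside a commutative ring and a field

module Arithmetic (K : CommutativeRing 0ℓ 0ℓ) where
  open CommutativeRing K hiding (zero)
  open RingProperties ring using (-‿distribˡ-*; -‿distribʳ-*; -0#≈0#; -‿involutive)
  open AbelianGroupProperties +-abelianGroup using (⁻¹-∙-comm)
  open SemiringMult semiring using (×-homo-+; ×1-homo-*) renaming (_×_ to _·_)
  open MonoidMultTCOptimised +-monoid using (×ᵤ≈×) renaming (_×_ to _×′_)
  open SetoidReasoning setoid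

  -- The optimised multiples make `ι (+ 1)` compute to `1#` and `ι (+ 2)` to `2#`, so the integer
  -- constants of the ring solver match these elements definitionally.
  ι : ℤ → Carrier
  ι (+ n)    = n ×′ 1#
  ι -[1+ n ] = - (suc n ×′ 1#)

  private
    ν : ℕ → Carrier
    ν n = n · 1#

    ν′ : ∀ n → n ×′ 1# ≈ ν n
    ν′ n = sym (×ᵤ≈× n 1#)

  ι-nonneg : ∀ n → ι (+ n) ≈ n · 1#
  ι-nonneg = ν′

  ι-neg : ∀ i → ι (ℤ.- i) ≈ - ι i
  ι-neg +0         = sym -0#≈0#
  ι-neg +[1+ n ]   = refl
  ι-neg -[1+ n ]   = sym (-‿involutive _)

  private
    ι-⊖ : ∀ m n → ι (m ⊖ n) ≈ ν m - ν n
    ι-⊖ m zero = begin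
      ι (m ⊖ 0) ≡⟨⟩
      m ×′ 1# ≈⟨ ν′ m ⟩
      ν m ≈⟨ +-identityʳ _ ⟨
      ν m + 0# ≈⟨ +-congˡ -0#≈0# ⟨
      ν m - ν 0 ∎
    ι-⊖ zero (suc n) = trans (-‿cong (ν′ (suc n))) (sym (+-identityˡ _))
    ι-⊖ (suc m) (suc n) = begin
      ι (suc m ⊖ suc n) ≡⟨ ≡.cong ι (ℤ.[1+m]⊖[1+n]≡m⊖n m n) ⟩
      ι (m ⊖ n) ≈⟨ ι-⊖ m n ⟩
      ν m - ν n ≈⟨ +-identityˡ _ ⟨
      0# + (ν m - ν n) ≈⟨ +-congʳ (-‿inverseʳ 1#) ⟨
      (1# - 1#) + (ν m - ν n) ≈⟨ +-assoc _ _ _ ⟩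
      1# + (- 1# + (ν m - ν n)) ≈⟨ +-congˡ (+-assoc _ _ _) ⟨
      1# + ((- 1# + ν m) - ν n) ≈⟨ +-congˡ (+-congʳ (+-comm _ _)) ⟩
      1# + ((ν m - 1#) - ν n) ≈⟨ +-congˡ (+-assoc _ _ _) ⟩
      1# + (ν m + (- 1# - ν n)) ≈⟨ +-assoc _ _ _ ⟨
      ν (suc m) + (- 1# - ν n) ≈⟨ +-congˡ (⁻¹-∙-comm _ _) ⟩
      ν (suc m) - ν (suc n) ∎

  ι-+ : ∀ i j → ι (i ℤ.+ j) ≈ ι i + ι j
  ι-+ (+ m) (+ n) = begin
    ι (+ (m ℕ.+ n)) ≈⟨ ν′ (m ℕ.+ n) ⟩
    ν (m ℕ.+ n) ≈⟨ ×-homo-+ 1# m n ⟩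
    ν m + ν n ≈⟨ +-cong (ν′ m) (ν′ n) ⟨
    ι (+ m) + ι (+ n) ∎
  ι-+ (+ m) -[1+ n ] = trans (ι-⊖ m (suc n)) (sym (+-cong (ν′ m) (-‿cong (ν′ (suc n)))))
  ι-+ -[1+ m ] (+ n) = trans (ι-⊖ n (suc m))
    (trans (+-comm _ _) (sym (+-cong (-‿cong (ν′ (suc m))) (ν′ n))))
  ι-+ -[1+ m ] -[1+ n ] = begin
    - (suc (suc (m ℕ.+ n)) ×′ 1#) ≈⟨ -‿cong (ν′ (suc (suc (m ℕ.+ n)))) ⟩
    - ν (suc (suc (m ℕ.+ n))) ≡⟨ ≡.cong (λ k → - ν (suc k)) (ℕ.+-suc m n) ⟨
    - ν (suc m ℕ.+ suc n) ≈⟨ -‿cong (×-homo-+ 1# (suc m) (suc n)) ⟩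
    - (ν (suc m) + ν (suc n)) ≈⟨ ⁻¹-∙-comm _ _ ⟨
    - ν (suc m) - ν (suc n) ≈⟨ +-cong (-‿cong (ν′ (suc m))) (-‿cong (ν′ (suc n))) ⟨
    ι -[1+ m ] + ι -[1+ n ] ∎

  private
    ι-*⁺ : ∀ m n → ι (+ m ℤ.* + n) ≈ ι (+ m) * ι (+ n)
    ι-*⁺ m n = begin
      ι (+ m ℤ.* + n) ≡⟨ ≡.cong ι (ℤ.pos-* m n) ⟨
      ι (+ (m ℕ.* n)) ≈⟨ ν′ (m ℕ.* n) ⟩
      ν (m ℕ.* n) ≈⟨ ×1-homo-* m n ⟩
      ν m * ν n ≈⟨ *-cong (ν′ m) (ν′ n) ⟨
      ι (+ m) * ι (+ n) ∎

  ι-* : ∀ i j → ι (i ℤ.* j) ≈ ι i * ι j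
  ι-* (+ m) (+ n) = ι-*⁺ m n
  ι-* (+ m) -[1+ n ] = begin
    ι (+ m ℤ.* ℤ.- + suc n) ≡⟨ ≡.cong ι (ℤ.neg-distribʳ-* (+ m) (+ suc n)) ⟨
    ι (ℤ.- (+ m ℤ.* + suc n)) ≈⟨ ι-neg (+ m ℤ.* + suc n) ⟩
    - ι (+ m ℤ.* + suc n) ≈⟨ -‿cong (ι-*⁺ m (suc n)) ⟩
    - (ι (+ m) * ι (+ suc n)) ≈⟨ -‿distribʳ-* _ _ ⟩
    ι (+ m) * ι -[1+ n ] ∎
  ι-* -[1+ m ] (+ n) = begin
    ι (ℤ.- + suc m ℤ.* + n) ≡⟨ ≡.cong ι (ℤ.neg-distribˡ-* (+ suc m) (+ n)) ⟨
    ι (ℤ.- (+ suc m ℤ.* + n)) ≈⟨ ι-neg (+ suc m ℤ.* + n) ⟩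
    - ι (+ suc m ℤ.* + n) ≈⟨ -‿cong (ι-*⁺ (suc m) n) ⟩
    - (ι (+ suc m) * ι (+ n)) ≈⟨ -‿distribˡ-* _ _ ⟩
    ι -[1+ m ] * ι (+ n) ∎
  ι-* -[1+ m ] -[1+ n ] = begin
    ι (+ suc m ℤ.* + suc n) ≈⟨ ι-*⁺ (suc m) (suc n) ⟩
    ι (+ suc m) * ι (+ suc n) ≈⟨ -‿involutive _ ⟨
    - - (ι (+ suc m) * ι (+ suc n)) ≈⟨ -‿cong (-‿distribˡ-* _ _) ⟩
    - (ι -[1+ m ] * ι (+ suc n)) ≈⟨ -‿distribʳ-* _ _ ⟩
    ι -[1+ m ] * ι -[1+ n ] ∎

  ι-morphism : ℤ.+-*-rawRing -Raw-AlmostCommutative⟶ fromCommutativeRing K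
  ι-morphism = record
    { ⟦_⟧ = ι ; +-homo = ι-+ ; *-homo = ι-* ; -‿homo = ι-neg ; 0-homo = refl ; 1-homo = refl }

  private
    ι-≟ : ∀ i j → Maybe (ι i ≈ ι j)
    ι-≟ i j with i ℤ.≟ j
    ... | yes p = just (reflexive (≡.cong ι p))
    ... | no  _ = nothing

  open RingSolver ℤ.+-*-rawRing (fromCommutativeRing K) ι-morphism ι-≟ public
    using (solve; _:=_; _:+_; _:*_; _:-_; :-_; con; Polynomial)

  :0 :1 :2 :-1 : ∀ {n} → Polynomial n
  :0  = con +0
  :1  = con (+ 1)
  :2  = con (+ 2)
  :-1 = :- con (+ 1)

  open CommutativeMonoidSum +-commutativeMonoid public
    using (sum; ∑-distrib-+; ∑-comm; sum-replicate-zero)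
    renaming (sum-cong-≋ to sum-cong)
  open SemiringSum semiring public using (*-distribˡ-sum; *-distribʳ-sum)

  sum-zero : ∀ {n} (f : Fin n → Carrier) → (∀ i → f i ≈ 0#) → sum f ≈ 0#
  sum-zero {n} f p = trans (sum-cong p) (sum-replicate-zero n)

  sum-neg : ∀ {n} (f : Fin n → Carrier) → sum (λ i → - f i) ≈ - sum f
  sum-neg {zero}  f = sym -0#≈0#
  sum-neg {suc n} f = trans (+-congˡ (sum-neg (λ i → f (suc i)))) (⁻¹-∙-comm _ _)

  sum-constant : ∀ n x → sum {n} (λ _ → x) ≈ ι (+ n) * x
  sum-constant zero    x = sym (zeroˡ x)
  sum-constant (suc n) x = trans (+-congˡ (sum-constant n x)) (trans (solve 2 (λ n x → x :+ n :* x := (:1 :+ n) :* x) refl (ι (+ n)) x) (*-congʳ (sym (ι-+ (+ 1) (+ n)))))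

  x-y≈0⇒x≈y : ∀ {x y} → x - y ≈ 0# → x ≈ y
  x-y≈0⇒x≈y {x} {y} p = begin
    x ≈⟨ solve 2 (λ x y → x := (x :- y) :+ y) refl x y ⟩
    (x - y) + y ≈⟨ +-congʳ p ⟩
    0# + y ≈⟨ +-identityˡ y ⟩
    y ∎

  x≈y⇒x-y≈0 : ∀ {x y} → x ≈ y → x - y ≈ 0#
  x≈y⇒x-y≈0 {x} {y} p = trans (+-congʳ p) (-‿inverseʳ y)

  2# : Carrier
  2# = 1# + 1#

module FieldArithmetic (K : CommutativeRing 0ℓ 0ℓ) (F : IsCharZeroField K) where
  open CommutativeRing K hiding (zero)
  open Arithmetic K
  open IsCharZeroField F public using (_≟_; inverse; n·1≉0)
  open SetoidReasoning setoid

  *-cancelˡ-0 : ∀ {x y} → ¬ x ≈ 0# → x * y ≈ 0# → y ≈ 0#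
  *-cancelˡ-0 {x} {y} x≉0 p with inverse x x≉0
  ... | z , q = begin
    y ≈⟨ *-identityˡ y ⟨
    1# * y ≈⟨ *-congʳ q ⟨
    x * z * y ≈⟨ solve 3 (λ x z y → x :* z :* y := z :* (x :* y)) refl x z y ⟩
    z * (x * y) ≈⟨ *-congˡ p ⟩
    z * 0# ≈⟨ zeroʳ z ⟩
    0# ∎

  *-cancelˡ : ∀ {x y z} → ¬ x ≈ 0# → x * y ≈ x * z → y ≈ z
  *-cancelˡ {x} {y} {z} x≉0 p = x-y≈0⇒x≈y (*-cancelˡ-0 x≉0 (begin
    x * (y - z) ≈⟨ solve 3 (λ x y z → x :* (y :- z) := x :* y :- x :* z) refl x y z ⟩
    x * y - x * z ≈⟨ x≈y⇒x-y≈0 p ⟩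
    0# ∎))

  *-nonzero : ∀ {x y} → ¬ x ≈ 0# → ¬ y ≈ 0# → ¬ x * y ≈ 0#
  *-nonzero p q r = q (*-cancelˡ-0 p r)

  1≉0 : ¬ 1# ≈ 0#
  1≉0 p = n·1≉0 0 (trans (+-identityʳ 1#) p)

  ι-nonzero : ∀ {i} → i ≢ +0 → ¬ ι i ≈ 0#
  ι-nonzero {+0}       p q = p ≡.refl
  ι-nonzero {+[1+ n ]} p q = n·1≉0 n (trans (sym (ι-nonneg (suc n))) q)
  ι-nonzero { -[1+ n ] } p q = n·1≉0 n (trans (sym (ι-nonneg (suc n))) (begin
    ι (+ suc n) ≈⟨ ι-neg -[1+ n ] ⟩
    - ι -[1+ n ] ≈⟨ -‿cong q ⟩
    - 0# ≈⟨ solve 0 (:- :0 := :0) refl ⟩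
    0# ∎))

  ι-injective : ∀ {i j} → ι i ≈ ι j → i ≡ j
  ι-injective {i} {j} p with i ℤ.- j ℤ.≟ +0
  ... | yes q = ℤ.i-j≡0⇒i≡j i j q
  ... | no  q = ⊥-elim (ι-nonzero q (begin
    ι (i ℤ.- j) ≈⟨ ι-+ i (ℤ.- j) ⟩
    ι i + ι (ℤ.- j) ≈⟨ +-congˡ (ι-neg j) ⟩
    ι i - ι j ≈⟨ x≈y⇒x-y≈0 p ⟩
    0# ∎))

  2≉0 : ¬ 2# ≈ 0#
  2≉0 = ι-nonzero {+ 2} λ ()

open ℤSolver.+-*-Solver using () renaming (solve to ℤsolve; _:=_ to _⊜_; _:+_ to _⊞_; _:-_ to _⊟_; _:*_ to _⊠_; :-_ to ⊟_; con to #)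

-- Integer exponents and separating functionals

Exponent : ℕ → Set
Exponent m = Fin m → ℤ

module _ where
  open AbelianGroupProperties ℤ.+-0-abelianGroup using (∙-cancelˡ)

  dot : ∀ {m} → Exponent m → Exponent m → ℤ
  dot {zero}  h ν = +0
  dot {suc m} h ν = h zero ℤ.* ν zero ℤ.+ dot (h ∘ suc) (ν ∘ suc)

  unit : ∀ {m} → Fin m → Exponent m
  unit zero    zero    = + 1
  unit zero    (suc c) = +0
  unit (suc a) zero    = +0
  unit (suc a) (suc c) = unit a c

  -- The strictly dominant coweights: those positive on every positive root ε_a - ε_c, ε_a + ε_c (a
  -- < c) and 2ε_a.
  Decreasing : ∀ {m} → Exponent m → Set
  Decreasing {zero}  h = ⊤
  Decreasing {suc m} h = +0 ℤ.< h zero × (∀ a → h (suc a) ℤ.< h zero) × Decreasing (h ∘ suc)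

  Separates : ∀ {m} → Exponent m → List (Exponent m) → Set
  Separates h l = ∀ {ν κ} → ν ∈ l → κ ∈ l → dot h ν ≡ dot h κ → ν ≗ κ

  private
    bound : ∀ {A : Set} (f : A → ℤ) (l : List A) → ∃ λ B → ∀ {a} → a ∈ l → ∣ f a ∣ ℕ.≤ B
    bound f []      = 0 , λ ()
    bound f (a ∷ l) with bound f l
    ... | B , p = ∣ f a ∣ ℕ.⊔ B , λ
      { (here ≡.refl) → ℕ.m≤m⊔n _ _ ; (there q) → ℕ.≤-trans (p q) (ℕ.m≤n⊔m _ _) }

    boundF : ∀ {m} (h : Exponent m) → ∃ λ B → ∀ a → ∣ h a ∣ ℕ.≤ B
    boundF {zero}  h = 0 , λ ()
    boundF {suc m} h with boundF (h ∘ suc)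
    ... | B , p = ∣ h zero ∣ ℕ.⊔ B , λ
      { zero → ℕ.m≤m⊔n _ _ ; (suc a) → ℕ.≤-trans (p a) (ℕ.m≤n⊔m _ _) }

    small-multiple : ∀ h z → ∣ h ℤ.* z ∣ ℕ.< ∣ h ∣ → z ≡ +0
    small-multiple h +0         p = ≡.refl
    small-multiple h +[1+ n ]   p = ⊥-elim (ℕ.<⇒≱ p (≡.subst (∣ h ∣ ℕ.≤_) (≡.sym (ℤ.abs-* h +[1+ n ])) (ℕ.m≤m*n ∣ h ∣ (suc n))))
    small-multiple h -[1+ n ]   p = ⊥-elim (ℕ.<⇒≱ p (≡.subst (∣ h ∣ ℕ.≤_) (≡.sym (ℤ.abs-* h -[1+ n ])) (ℕ.m≤m*n ∣ h ∣ (suc n))))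

    i≤∣i∣ : ∀ i → i ℤ.≤ + ∣ i ∣
    i≤∣i∣ (+ n)    = ℤ.≤-refl
    i≤∣i∣ -[1+ n ] = ℤ.-≤+

  -- A mixed-radix encoding. The leading entry exceeds every difference of values on the tails, so
  -- equal products force equal heads, and the tails are separated recursively. The summand `T` puts
  -- it above all later entries as well, which keeps `h` strictly dominant.
  separating : ∀ {m} (l : List (Exponent m)) → ∃ λ h → Decreasing h × Separates h l
  separating {zero}  l = (λ ()) , tt , λ _ _ _ ()
  separating {suc m} l with separating (List.map (_∘ suc) l)
  ... | h′ , dec′ , sep′ with bound (λ ν → dot h′ (ν ∘ suc)) l | boundF h′
  ... | B , B-bound | T , C-bound = h , (ℤ.+<+ (ℕ.s≤s ℕ.z≤n) , below , dec′) , sep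
    where
    top : ℕ
    top = suc (B ℕ.+ B ℕ.+ T)
    h : Exponent (suc m)
    h zero    = + top
    h (suc a) = h′ a
    below : ∀ a → h′ a ℤ.< + top
    below a = ℤ.≤-<-trans (i≤∣i∣ (h′ a)) (ℤ.+<+ (ℕ.s≤s (ℕ.≤-trans (C-bound a) (ℕ.m≤n+m T (B ℕ.+ B)))))
    sep : Separates h l
    sep {ν} {κ} ν∈ κ∈ eq = λ { zero → head≡ ; (suc a) → tail≡ a }
      where
      d = dot h′ (ν ∘ suc)
      d′ = dot h′ (κ ∘ suc)
      difference : + top ℤ.* (ν zero ℤ.- κ zero) ≡ d′ ℤ.- d
      difference = ≡.trans
        (ℤsolve 4 (λ t a b d → t ⊠ (a ⊟ b) ⊜ ((t ⊠ a ⊞ d) ⊟ d) ⊟ t ⊠ b)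
          ≡.refl (+ top) (ν zero) (κ zero) d)
        (≡.trans (≡.cong (λ z → (z ℤ.- d) ℤ.- + top ℤ.* κ zero) eq)
        (ℤsolve 4 (λ t b d d′ → ((t ⊠ b ⊞ d′) ⊟ d) ⊟ t ⊠ b ⊜ d′ ⊟ d)
          ≡.refl (+ top) (κ zero) d d′))
      head≡ : ν zero ≡ κ zero
      head≡ = ℤ.i-j≡0⇒i≡j _ _ (small-multiple (+ top) _ (≡.subst (λ z → ∣ z ∣ ℕ.< top) (≡.sym difference)
        (ℕ.s≤s (ℕ.≤-trans (ℤ.∣i-j∣≤∣i∣+∣j∣ d′ d)
          (ℕ.≤-trans (ℕ.+-mono-≤ (B-bound κ∈) (B-bound ν∈)) (ℕ.m≤m+n (B ℕ.+ B) T))))))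
      tail≡ : (ν ∘ suc) ≗ (κ ∘ suc)
      tail≡ = sep′ (∈-map⁺ (_∘ suc) ν∈) (∈-map⁺ (_∘ suc) κ∈)
        (∙-cancelˡ (+ top ℤ.* ν zero) d d′ (≡.trans eq (≡.cong (λ z → + top ℤ.* z ℤ.+ d′) (≡.sym head≡))))

-- Formal sums and their pairings with functions

module FormalSums (K : CommutativeRing 0ℓ 0ℓ) where
  open CommutativeRing K hiding (zero)
  open Arithmetic K
  open SetoidReasoning setoid

  -- Unreduced: exponents may repeat and cancel. Information is read off through pairings
  -- `⟨ φ , p ⟩`; evaluation at a point, coefficients and derivatives are all choices of `φ`.
  Terms : Set → Set
  Terms M = List (Carrier × M)

  exponents : ∀ {M} → Terms M → List M
  exponents = List.map proj₂

  ⟨_,_⟩ : ∀ {M} → (M → Carrier) → Terms M → Carrier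
  ⟨ φ , [] ⟩          = 0#
  ⟨ φ , (c , e) ∷ p ⟩ = c * φ e + ⟨ φ , p ⟩

  AllExp : ∀ {M} → (M → Set) → Terms M → Set
  AllExp P = All (P ∘ proj₂)

  module _ {M : Set} where
    pair-cong-All : ∀ {φ ψ : M → Carrier} {p} → AllExp (λ e → φ e ≈ ψ e) p → ⟨ φ , p ⟩ ≈ ⟨ ψ , p ⟩
    pair-cong-All []       = refl
    pair-cong-All (q ∷ qs) = +-cong (*-congˡ q) (pair-cong-All qs)

    pair-cong : ∀ {φ ψ : M → Carrier} p → (∀ e → φ e ≈ ψ e) → ⟨ φ , p ⟩ ≈ ⟨ ψ , p ⟩
    pair-cong p q = pair-cong-All (All.universal (λ t → q (proj₂ t)) p)

    pair-0 : ∀ (p : Terms M) → ⟨ (λ _ → 0#) , p ⟩ ≈ 0#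
    pair-0 []            = refl
    pair-0 ((c , e) ∷ p) = trans (+-cong (zeroʳ c) (pair-0 p)) (+-identityˡ 0#)

    pair-++ : ∀ (φ : M → Carrier) p q → ⟨ φ , p ++ q ⟩ ≈ ⟨ φ , p ⟩ + ⟨ φ , q ⟩
    pair-++ φ []            q = sym (+-identityˡ _)
    pair-++ φ ((c , e) ∷ p) q = trans (+-congˡ (pair-++ φ p q)) (sym (+-assoc _ _ _))

    pair-+ : ∀ (φ ψ : M → Carrier) p → ⟨ (λ e → φ e + ψ e) , p ⟩ ≈ ⟨ φ , p ⟩ + ⟨ ψ , p ⟩
    pair-+ φ ψ []            = sym (+-identityˡ 0#)
    pair-+ φ ψ ((c , e) ∷ p) = trans (+-congˡ (pair-+ φ ψ p))
      (solve 5 (λ c x y s t → c :* (x :+ y) :+ (s :+ t) := (c :* x :+ s) :+ (c :* y :+ t)) refl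
        c (φ e) (ψ e) ⟨ φ , p ⟩ ⟨ ψ , p ⟩)

    pair-* : ∀ a (φ : M → Carrier) p → ⟨ (λ e → a * φ e) , p ⟩ ≈ a * ⟨ φ , p ⟩
    pair-* a φ []            = sym (zeroʳ a)
    pair-* a φ ((c , e) ∷ p) = trans (+-congˡ (pair-* a φ p))
      (solve 4 (λ a c x s → c :* (a :* x) :+ a :* s := a :* (c :* x :+ s)) refl a c (φ e) ⟨ φ , p ⟩)

    pair-*ʳ : ∀ a (φ : M → Carrier) p → ⟨ (λ e → φ e * a) , p ⟩ ≈ ⟨ φ , p ⟩ * a
    pair-*ʳ a φ p = trans (pair-cong p (λ e → *-comm (φ e) a)) (trans (pair-* a φ p) (*-comm a _))

    pair-sum : ∀ {n} (φ : Fin n → M → Carrier) p → ⟨ (λ e → sum λ i → φ i e) , p ⟩ ≈ sum λ i → ⟨ φ i , p ⟩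
    pair-sum {zero}  φ p = pair-0 p
    pair-sum {suc n} φ p = trans (pair-+ (φ zero) _ p) (+-congˡ (pair-sum (φ ∘ suc) p))

    weighted : (M → Carrier) → Terms M → Terms M
    weighted w = List.map λ (c , e) → c * w e , e

    pair-weighted : ∀ w (φ : M → Carrier) p → ⟨ φ , weighted w p ⟩ ≈ ⟨ (λ e → w e * φ e) , p ⟩
    pair-weighted w φ []            = refl
    pair-weighted w φ ((c , e) ∷ p) = +-cong (*-assoc c (w e) (φ e)) (pair-weighted w φ p)

    scale : Carrier → Terms M → Terms M
    scale a = weighted λ _ → a

    pair-scale : ∀ a (φ : M → Carrier) p → ⟨ φ , scale a p ⟩ ≈ a * ⟨ φ , p ⟩
    pair-scale a φ p = trans (pair-weighted _ φ p) (pair-* a φ p)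

    weighted-All : ∀ {P : M → Set} {w} p → AllExp P p → AllExp P (weighted w p)
    weighted-All []      []       = []
    weighted-All (t ∷ p) (q ∷ qs) = q ∷ weighted-All p qs

    concatSum : ∀ {n} → (Fin n → Terms M) → Terms M
    concatSum {zero}  f = []
    concatSum {suc n} f = f zero ++ concatSum (f ∘ suc)

    pair-concatSum : ∀ {n} (φ : M → Carrier) (f : Fin n → Terms M) →
                     ⟨ φ , concatSum f ⟩ ≈ sum λ i → ⟨ φ , f i ⟩
    pair-concatSum {zero}  φ f = refl
    pair-concatSum {suc n} φ f = trans (pair-++ φ (f zero) _) (+-congˡ (pair-concatSum φ (f ∘ suc)))

    combination : ∀ {n} → (Fin n → Carrier) → (Fin n → Terms M) → Terms M
    combination c f = concatSum λ k → scale (c k) (f k)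

    pair-combination : ∀ {n} φ (c : Fin n → Carrier) (f : Fin n → Terms M) →
                       ⟨ φ , combination c f ⟩ ≈ sum λ k → c k * ⟨ φ , f k ⟩
    pair-combination φ c f = trans (pair-concatSum φ (λ k → scale (c k) (f k)))
      (sum-cong λ k → pair-scale (c k) φ (f k))

    pair-combinationʳ : ∀ {n} φ (c : Fin n → Carrier) (f : Fin n → Terms M) →
                        ⟨ φ , combination c f ⟩ ≈ sum λ k → ⟨ φ , f k ⟩ * c k
    pair-combinationʳ φ c f = trans (pair-combination φ c f) (sum-cong λ k → *-comm (c k) ⟨ φ , f k ⟩)

    concatSum-All : ∀ {n} {P : M → Set} (f : Fin n → Terms M) → (∀ k → AllExp P (f k)) → AllExp P (concatSum f)
    concatSum-All {zero}  f p = []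
    concatSum-All {suc n} f p = ++⁺ (p zero) (concatSum-All (f ∘ suc) (p ∘ suc))

    combination-All : ∀ {n} {P : M → Set} c (f : Fin n → Terms M) → (∀ k → AllExp P (f k)) → AllExp P (combination c f)
    combination-All c f p = concatSum-All _ λ k → weighted-All (f k) (p k)

  reindex : ∀ {M N : Set} → (M → N) → Terms M → Terms N
  reindex f = List.map λ (c , e) → c , f e

  pair-reindex : ∀ {M N : Set} (f : M → N) (φ : N → Carrier) p → ⟨ φ , reindex f p ⟩ ≈ ⟨ φ ∘ f , p ⟩
  pair-reindex f φ []            = refl
  pair-reindex f φ ((c , e) ∷ p) = +-congˡ (pair-reindex f φ p)

  reindex-All : ∀ {M N : Set} {P : M → Set} {Q : N → Set} (f : M → N) → (∀ {e} → P e → Q (f e)) →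
                ∀ p → AllExp P p → AllExp Q (reindex f p)
  reindex-All f h []      []       = []
  reindex-All f h (t ∷ p) (q ∷ qs) = h q ∷ reindex-All f h p qs

  module Convolution {M : Set} (_∙_ : M → M → M) where
    infixl 7 _⊛_
    _⊛_ : Terms M → Terms M → Terms M
    []            ⊛ q = []
    ((c , e) ∷ p) ⊛ q = scale c (reindex (e ∙_) q) ++ p ⊛ q

    pair-⊛ : ∀ φ p q → ⟨ φ , p ⊛ q ⟩ ≈ ⟨ (λ e → ⟨ (λ e′ → φ (e ∙ e′)) , q ⟩) , p ⟩
    pair-⊛ φ []            q = refl
    pair-⊛ φ ((c , e) ∷ p) q = trans (pair-++ φ (scale c (reindex (e ∙_) q)) (p ⊛ q))
      (+-cong (trans (pair-scale c φ (reindex (e ∙_) q)) (*-congˡ (pair-reindex (e ∙_) φ q))) (pair-⊛ φ p q))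

    pair-⊗ : ∀ (φ ψ : M → Carrier) p q → ⟨ (λ e → ⟨ (λ e′ → φ e * ψ e′) , q ⟩) , p ⟩ ≈ ⟨ φ , p ⟩ * ⟨ ψ , q ⟩
    pair-⊗ φ ψ p q = trans (pair-cong p (λ e → pair-* (φ e) ψ q)) (pair-*ʳ ⟨ ψ , q ⟩ φ p)

    pair-multiplicative : ∀ φ → (∀ e e′ → φ (e ∙ e′) ≈ φ e * φ e′) →
                          ∀ p q → ⟨ φ , p ⊛ q ⟩ ≈ ⟨ φ , p ⟩ * ⟨ φ , q ⟩
    pair-multiplicative φ h p q = trans (pair-⊛ φ p q)
      (trans (pair-cong p (λ e → pair-cong q (h e))) (pair-⊗ φ φ p q))

    -- Leibniz's rule for a point derivation: `φ` is evaluation at a point and `δ` a derivative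
    -- there.
    pair-derivation : ∀ φ δ → (∀ e e′ → δ (e ∙ e′) ≈ δ e * φ e′ + φ e * δ e′) →
                      ∀ p q → ⟨ δ , p ⊛ q ⟩ ≈ ⟨ δ , p ⟩ * ⟨ φ , q ⟩ + ⟨ φ , p ⟩ * ⟨ δ , q ⟩
    pair-derivation φ δ h p q = begin
      ⟨ δ , p ⊛ q ⟩
        ≈⟨ trans (pair-⊛ δ p q) (pair-cong p (λ e → trans (pair-cong q (h e)) (pair-+ _ _ q))) ⟩
      ⟨ (λ e → ⟨ (λ e′ → δ e * φ e′) , q ⟩ + ⟨ (λ e′ → φ e * δ e′) , q ⟩) , p ⟩
        ≈⟨ pair-+ _ _ p ⟩
      _ ≈⟨ +-cong (pair-⊗ δ φ p q) (pair-⊗ φ δ p q) ⟩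
      ⟨ δ , p ⟩ * ⟨ φ , q ⟩ + ⟨ φ , p ⟩ * ⟨ δ , q ⟩ ∎

    ⊛-All : ∀ {P Q R : M → Set} → (∀ {e e′} → P e → Q e′ → R (e ∙ e′)) →
            ∀ {p q} → AllExp P p → AllExp Q q → AllExp R (p ⊛ q)
    ⊛-All h []       qs = []
    ⊛-All {P} {Q} {R} h {(c , e) ∷ p} {q} (x ∷ xs) qs = ++⁺ (shifted q qs) (⊛-All h xs qs)
      where
      shifted : ∀ q → AllExp Q q → AllExp R (scale c (reindex (e ∙_) q))
      shifted []      []       = []
      shifted (t ∷ q) (y ∷ ys) = h x y ∷ shifted q ys

-- Integer powers and torus monomials

module Powers (K : CommutativeRing 0ℓ 0ℓ) where
  open CommutativeRing K hiding (zero)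
  open Arithmetic K
  open Symplectic K using (_^_; Torus; val; inv)
  open SetoidReasoning setoid

  -- y plays the role of x⁻¹.
  pow : Carrier → Carrier → ℤ → Carrier
  pow x y (+ n)    = x ^ n
  pow x y -[1+ n ] = y ^ suc n

  ^-+ : ∀ x m n → x ^ (m ℕ.+ n) ≈ x ^ m * x ^ n
  ^-+ x zero    n = sym (*-identityˡ _)
  ^-+ x (suc m) n = trans (*-congˡ (^-+ x m n)) (sym (*-assoc _ _ _))

  ^-* : ∀ x y n → (x * y) ^ n ≈ x ^ n * y ^ n
  ^-* x y zero    = sym (*-identityˡ 1#)
  ^-* x y (suc n) = trans (*-congˡ (^-* x y n))
    (solve 4 (λ x y a b → (x :* y) :* (a :* b) := (x :* a) :* (y :* b)) refl x y (x ^ n) (y ^ n))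

  module _ (x y : Carrier) (xy≈1 : x * y ≈ 1#) where
    pow-⊖ : ∀ m n → pow x y (m ⊖ n) ≈ x ^ m * y ^ n
    pow-⊖ m       zero    = sym (*-identityʳ _)
    pow-⊖ zero    (suc n) = sym (*-identityˡ _)
    pow-⊖ (suc m) (suc n) = begin
      pow x y (suc m ⊖ suc n) ≡⟨ ≡.cong (pow x y) (ℤ.[1+m]⊖[1+n]≡m⊖n m n) ⟩
      pow x y (m ⊖ n) ≈⟨ pow-⊖ m n ⟩
      x ^ m * y ^ n ≈⟨ *-identityˡ _ ⟨
      1# * (x ^ m * y ^ n) ≈⟨ *-congʳ xy≈1 ⟨
      x * y * (x ^ m * y ^ n) ≈⟨ solve 4 (λ x y a b → x :* y :* (a :* b) := (x :* a) :* (y :* b)) refl x y (x ^ m) (y ^ n) ⟩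
      x ^ suc m * y ^ suc n ∎

    pow-+ : ∀ i j → pow x y (i ℤ.+ j) ≈ pow x y i * pow x y j
    pow-+ (+ m)    (+ n)    = ^-+ x m n
    pow-+ (+ m)    -[1+ n ] = pow-⊖ m (suc n)
    pow-+ -[1+ m ] (+ n)    = trans (pow-⊖ n (suc m)) (*-comm _ _)
    pow-+ -[1+ m ] -[1+ n ] = trans (reflexive (≡.cong (λ k → y ^ suc k) (≡.sym (ℕ.+-suc m n)))) (^-+ y (suc m) (suc n))

    pow-inverse : ∀ i → pow x y i * pow x y (ℤ.- i) ≈ 1#
    pow-inverse i = trans (sym (pow-+ i (ℤ.- i))) (reflexive (≡.cong (pow x y) (ℤ.+-inverseʳ i)))

  pow-swap : ∀ x y i → pow y x i ≈ pow x y (ℤ.- i)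
  pow-swap x y +0       = refl
  pow-swap x y +[1+ n ] = refl
  pow-swap x y -[1+ n ] = refl

  pow-mul : ∀ x y x′ y′ i → pow (x * x′) (y * y′) i ≈ pow x y i * pow x′ y′ i
  pow-mul x y x′ y′ (+ n)    = ^-* x x′ n
  pow-mul x y x′ y′ -[1+ n ] = ^-* y y′ (suc n)

  pow-pow : ∀ x y → x * y ≈ 1# → ∀ i j → pow (pow x y i) (pow x y (ℤ.- i)) j ≈ pow x y (i ℤ.* j)
  pow-pow x y xy i = λ { (+ n) → pos i n ; -[1+ n ] → trans (pos (ℤ.- i) (suc n)) (reflexive (≡.cong (pow x y) (flip n))) }
    where
    pos : ∀ i n → pow x y i ^ n ≈ pow x y (i ℤ.* + n)
    pos i zero    = reflexive (≡.cong (pow x y) (≡.sym (ℤ.*-zeroʳ i)))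
    pos i (suc n) = begin
      pow x y i * pow x y i ^ n ≈⟨ *-congˡ (pos i n) ⟩
      pow x y i * pow x y (i ℤ.* + n) ≈⟨ pow-+ x y xy i (i ℤ.* + n) ⟨
      pow x y (i ℤ.+ i ℤ.* + n) ≡⟨ ≡.cong (pow x y) (≡.sym (ℤ.*-suc i (+ n))) ⟩
      pow x y (i ℤ.* + suc n) ∎
    flip : ∀ n → (ℤ.- i) ℤ.* + suc n ≡ i ℤ.* -[1+ n ]
    flip n = ≡.trans (≡.sym (ℤ.neg-distribˡ-* i (+ suc n))) (ℤ.neg-distribʳ-* i (+ suc n))

  monomialAt : ∀ {m} → (Fin m → Carrier) → (Fin m → Carrier) → Exponent m → Carrier
  monomialAt {zero}  v w ν = 1#
  monomialAt {suc m} v w ν = pow (v zero) (w zero) (ν zero) * monomialAt (v ∘ suc) (w ∘ suc) (ν ∘ suc)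

  monomial : ∀ {m} → Torus m → Exponent m → Carrier
  monomial x = monomialAt (val x) (inv x)

  infixl 6 _+ᵉ_
  _+ᵉ_ : ∀ {m} → Exponent m → Exponent m → Exponent m
  (ν +ᵉ κ) a = ν a ℤ.+ κ a

  monomialAt-cong : ∀ {m} (v w : Fin m → Carrier) {ν κ : Exponent m} → ν ≗ κ → monomialAt v w ν ≈ monomialAt v w κ
  monomialAt-cong {zero}  v w p = refl
  monomialAt-cong {suc m} v w p = *-cong (reflexive (≡.cong (pow _ _) (p zero))) (monomialAt-cong _ _ (p ∘ suc))

  monomial-cong : ∀ {m} (x : Torus m) {ν κ : Exponent m} → ν ≗ κ → monomial x ν ≈ monomial x κ
  monomial-cong x = monomialAt-cong (val x) (inv x)

  monomialAt-+ : ∀ {m} (v w : Fin m → Carrier) → (∀ i → v i * w i ≈ 1#) → ∀ ν κ →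
                 monomialAt v w (ν +ᵉ κ) ≈ monomialAt v w ν * monomialAt v w κ
  monomialAt-+ {zero}  v w p ν κ = sym (*-identityˡ 1#)
  monomialAt-+ {suc m} v w p ν κ = trans
    (*-cong (pow-+ _ _ (p zero) (ν zero) (κ zero)) (monomialAt-+ (v ∘ suc) (w ∘ suc) (p ∘ suc) (ν ∘ suc) (κ ∘ suc)))
    (solve 4 (λ a b c d → (a :* b) :* (c :* d) := (a :* c) :* (b :* d)) refl _ _ _ _)

  monomial-+ : ∀ {m} (x : Torus m) ν κ → monomial x (ν +ᵉ κ) ≈ monomial x ν * monomial x κ
  monomial-+ x = monomialAt-+ (val x) (inv x) (Symplectic.Torus.inverse x)

  infixl 7 _*ᵗ_
  _*ᵗ_ : ∀ {m} → Torus m → Torus m → Torus m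
  x *ᵗ y = record
    { val = λ i → val x i * val y i ; inv = λ i → inv x i * inv y i
    ; inverse = λ i → trans
        (solve 4 (λ a b c d → (a :* b) :* (c :* d) := (a :* c) :* (b :* d)) refl (val x i) (val y i) (inv x i) (inv y i))
        (trans (*-cong (Symplectic.Torus.inverse x i) (Symplectic.Torus.inverse y i)) (*-identityˡ 1#)) }

  monomialAt-*ᵗ : ∀ {m} (v w v′ w′ : Fin m → Carrier) ν →
    monomialAt (λ i → v i * v′ i) (λ i → w i * w′ i) ν ≈ monomialAt v w ν * monomialAt v′ w′ ν
  monomialAt-*ᵗ {zero}  v w v′ w′ ν = sym (*-identityˡ 1#)
  monomialAt-*ᵗ {suc m} v w v′ w′ ν = trans
    (*-cong (pow-mul _ _ _ _ (ν zero)) (monomialAt-*ᵗ (v ∘ suc) (w ∘ suc) (v′ ∘ suc) (w′ ∘ suc) (ν ∘ suc)))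
    (solve 4 (λ a b c d → (a :* b) :* (c :* d) := (a :* c) :* (b :* d)) refl _ _ _ _)

  monomial-*ᵗ : ∀ {m} (x y : Torus m) ν → monomial (x *ᵗ y) ν ≈ monomial x ν * monomial y ν
  monomial-*ᵗ x y = monomialAt-*ᵗ (val x) (inv x) (val y) (inv y)

-- Linear independence of monomials

module LinearIndependence (K : CommutativeRing 0ℓ 0ℓ) (F : IsCharZeroField K) where
  open CommutativeRing K hiding (zero)
  open Arithmetic K
  open FieldArithmetic K F
  open FormalSums K
  open Powers K
  open Symplectic K using (_^_; Torus; val; inv)
  open SetoidReasoning setoid

  ½ : Carrier
  ½ = proj₁ (inverse 2# 2≉0)

  2½≈1 : 2# * ½ ≈ 1#
  2½≈1 = proj₂ (inverse 2# 2≉0)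

  2^ : ℤ → Carrier
  2^ = pow 2# ½

  2^-+ : ∀ i j → 2^ (i ℤ.+ j) ≈ 2^ i * 2^ j
  2^-+ = pow-+ 2# ½ 2½≈1

  2^-inverse : ∀ i → 2^ i * 2^ (ℤ.- i) ≈ 1#
  2^-inverse = pow-inverse 2# ½ 2½≈1

  private
    2^n≈ι : ∀ n → 2# ^ n ≈ ι (+ (2 ℕ.^ n))
    2^n≈ι zero    = refl
    2^n≈ι (suc n) = begin
      2# * 2# ^ n ≈⟨ *-congˡ (2^n≈ι n) ⟩
      ι (+ 2) * ι (+ (2 ℕ.^ n)) ≈⟨ ι-* (+ 2) (+ (2 ℕ.^ n)) ⟨
      ι (+ 2 ℤ.* + (2 ℕ.^ n)) ≡⟨ ≡.cong ι (ℤ.pos-* 2 (2 ℕ.^ n)) ⟨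
      ι (+ (2 ℕ.^ suc n)) ∎

    2^+≉1 : ∀ n → ¬ 2^ +[1+ n ] ≈ 1#
    2^+≉1 n p = even≢1 (2 ℕ.^ n) (ℤ.+-injective (ι-injective {+ (2 ℕ.^ suc n)} {+ 1} (trans (sym (2^n≈ι (suc n))) p)))
      where
      even≢1 : ∀ k → 2 ℕ.* k ≢ 1
      even≢1 (suc k) q with () ← ≡.trans (≡.sym (ℕ.+-suc k (k ℕ.+ 0))) (ℕ.suc-injective q)

  -- In characteristic zero a relation 2ⁿ⁺¹ = 1 would hold between integers, one of them even and
  -- the other odd. So 2 is not a root of unity, and its powers serve as independent values.
  2^-≉1 : ∀ i → 2^ i ≈ 1# → i ≡ +0
  2^-≉1 +0       p = ≡.refl
  2^-≉1 +[1+ n ] p = ⊥-elim (2^+≉1 n p)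
  2^-≉1 -[1+ n ] p = ⊥-elim (2^+≉1 n (begin
    2^ +[1+ n ] ≈⟨ *-identityʳ _ ⟨
    2^ +[1+ n ] * 1# ≈⟨ *-congˡ p ⟨
    2^ +[1+ n ] * 2^ -[1+ n ] ≈⟨ 2^-inverse +[1+ n ] ⟩
    1# ∎))

  2^-injective : ∀ i j → 2^ i ≈ 2^ j → i ≡ j
  2^-injective i j p = ℤ.i-j≡0⇒i≡j i j (2^-≉1 (i ℤ.- j) (begin
    2^ (i ℤ.- j) ≈⟨ 2^-+ i (ℤ.- j) ⟩
    2^ i * 2^ (ℤ.- j) ≈⟨ *-congʳ p ⟩
    2^ j * 2^ (ℤ.- j) ≈⟨ 2^-inverse j ⟩
    1# ∎))

  2^≉0 : ∀ i → ¬ 2^ i ≈ 0#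
  2^≉0 i p = 1≉0 (begin
    1# ≈⟨ 2^-inverse i ⟨
    2^ i * 2^ (ℤ.- i) ≈⟨ *-congʳ p ⟩
    0# * 2^ (ℤ.- i) ≈⟨ zeroˡ _ ⟩
    0# ∎)

  [_]ᶻ : ℤ → ℤ → Carrier
  [ n ]ᶻ k with k ℤ.≟ n
  ... | yes _ = 1#
  ... | no  _ = 0#

  -- Artin's argument: the translate by 2 separates any two exponents, so the first
  -- term can be eliminated.
  independentᴸ : ∀ l (p : Terms ℤ) → List.length p ≡ l →
                 (∀ j → ⟨ (λ n → 2^ (+ suc j ℤ.* n)) , p ⟩ ≈ 0#) → ∀ φ → ⟨ φ , p ⟩ ≈ 0#
  independentᴸ l       []            len h φ = refl
  independentᴸ (suc l) ((c , n) ∷ p) len h φ = begin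
    c * φ n + ⟨ φ , p ⟩ ≈⟨ +-congˡ (concentrated φ) ⟩
    c * φ n + φ n * ⟨ [ n ]ᶻ , p ⟩ ≈⟨ solve 3 (λ c x s → c :* x :+ x :* s := (c :+ s) :* x) refl c (φ n) ⟨ [ n ]ᶻ , p ⟩ ⟩
    (c + ⟨ [ n ]ᶻ , p ⟩) * φ n ≈⟨ *-congʳ coefficient ⟩
    0# * φ n ≈⟨ zeroˡ _ ⟩
    0# ∎
    where
    rest : ℕ → Carrier
    rest j = ⟨ (λ k → 2^ (+ suc j ℤ.* k)) , p ⟩
    step : ∀ j k → 2^ (+ suc (suc j) ℤ.* k) ≈ 2^ k * 2^ (+ suc j ℤ.* k)
    step j k = trans (reflexive (≡.cong 2^ (ℤ.suc-* (+ suc j) k))) (2^-+ k (+ suc j ℤ.* k))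
    eliminated : ∀ j → ⟨ (λ k → 2^ (+ suc j ℤ.* k)) , weighted (λ k → 2^ k - 2^ n) p ⟩ ≈ 0#
    eliminated j = begin
      ⟨ (λ k → 2^ (+ suc j ℤ.* k)) , weighted (λ k → 2^ k - 2^ n) p ⟩
        ≈⟨ pair-weighted _ _ p ⟩
      ⟨ (λ k → (2^ k - 2^ n) * 2^ (+ suc j ℤ.* k)) , p ⟩
        ≈⟨ pair-cong p (λ k → trans (solve 3 (λ a b s → (a :- b) :* s := a :* s :+ (:- b) :* s) refl (2^ k) (2^ n) _) (+-congʳ (sym (step j k)))) ⟩
      ⟨ (λ k → 2^ (+ suc (suc j) ℤ.* k) + - 2^ n * 2^ (+ suc j ℤ.* k)) , p ⟩
        ≈⟨ trans (pair-+ _ _ p) (+-congˡ (pair-* _ _ p)) ⟩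
      rest (suc j) + - 2^ n * rest j
        ≈⟨ solve 5 (λ r s b c t → r :+ (:- b) :* s := (c :* (b :* t) :+ r) :- b :* (c :* t :+ s)) refl (rest (suc j)) (rest j) (2^ n) c (2^ (+ suc j ℤ.* n)) ⟩
      (c * (2^ n * 2^ (+ suc j ℤ.* n)) + rest (suc j)) - 2^ n * (c * 2^ (+ suc j ℤ.* n) + rest j)
        ≈⟨ +-cong (trans (+-congʳ (*-congˡ (sym (step j n)))) (h (suc j))) (-‿cong (trans (*-congˡ (h j)) (zeroʳ _))) ⟩
      0# - 0#
        ≈⟨ -‿inverseʳ 0# ⟩
      0# ∎
    -- Division by `2^ k - 2^ n` undoes the elimination away from `n`. The default 0 at `k = n` fits
    -- `split`, which carries the value at `n` by `[ n ]ᶻ`.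
    divided : (ℤ → Carrier) → ℤ → Carrier
    divided φ k with k ℤ.≟ n
    ... | yes _ = 0#
    ... | no k≢n = proj₁ (inverse (2^ k - 2^ n) λ q → k≢n (2^-injective k n (x-y≈0⇒x≈y q))) * φ k
    split : ∀ φ k → φ k ≈ (2^ k - 2^ n) * divided φ k + φ n * [ n ]ᶻ k
    split φ k with k ℤ.≟ n
    ... | yes ≡.refl = solve 2 (λ x b → x := (b :- b) :* :0 :+ x :* :1) refl (φ n) (2^ n)
    ... | no k≢n = begin
      φ k ≈⟨ *-identityˡ _ ⟨
      1# * φ k ≈⟨ *-congʳ (proj₂ iv) ⟨
      (2^ k - 2^ n) * proj₁ iv * φ k ≈⟨ solve 4 (λ a i x y → a :* i :* x := a :* (i :* x) :+ y :* :0) refl (2^ k - 2^ n) (proj₁ iv) (φ k) (φ n) ⟩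
      _ ∎
      where iv = inverse (2^ k - 2^ n) λ q → k≢n (2^-injective k n (x-y≈0⇒x≈y q))
    concentrated : ∀ φ → ⟨ φ , p ⟩ ≈ φ n * ⟨ [ n ]ᶻ , p ⟩
    concentrated φ = begin
      ⟨ φ , p ⟩
        ≈⟨ trans (pair-cong p (split φ)) (pair-+ _ _ p) ⟩
      ⟨ (λ k → (2^ k - 2^ n) * divided φ k) , p ⟩ + ⟨ (λ k → φ n * [ n ]ᶻ k) , p ⟩
        ≈⟨ +-cong (trans (sym (pair-weighted _ _ p)) (independent′ (divided φ))) (pair-* _ _ p) ⟩
      0# + φ n * ⟨ [ n ]ᶻ , p ⟩
        ≈⟨ +-identityˡ _ ⟩
      φ n * ⟨ [ n ]ᶻ , p ⟩ ∎
      where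
      independent′ : ∀ ψ → ⟨ ψ , weighted (λ k → 2^ k - 2^ n) p ⟩ ≈ 0#
      independent′ = independentᴸ l (weighted (λ k → 2^ k - 2^ n) p)
        (≡.trans (List.length-map _ p) (ℕ.suc-injective len)) eliminated
    coefficient : c + ⟨ [ n ]ᶻ , p ⟩ ≈ 0#
    coefficient = *-cancelˡ-0 (2^≉0 (+ 1 ℤ.* n)) (begin
      2^ (+ 1 ℤ.* n) * (c + ⟨ [ n ]ᶻ , p ⟩)
        ≈⟨ solve 3 (λ b c s → b :* (c :+ s) := c :* b :+ b :* s) refl (2^ (+ 1 ℤ.* n)) c ⟨ [ n ]ᶻ , p ⟩ ⟩
      c * 2^ (+ 1 ℤ.* n) + 2^ (+ 1 ℤ.* n) * ⟨ [ n ]ᶻ , p ⟩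
        ≈⟨ +-congˡ (concentrated _) ⟨
      c * 2^ (+ 1 ℤ.* n) + rest 0
        ≈⟨ h 0 ⟩
      0# ∎)

  independent₁ : ∀ (p : Terms ℤ) → (∀ j → ⟨ (λ n → 2^ (+ suc j ℤ.* n)) , p ⟩ ≈ 0#) → ∀ φ → ⟨ φ , p ⟩ ≈ 0#
  independent₁ p = independentᴸ _ p ≡.refl

  -- The one-parameter subgroup with coweight `h`, at the parameter 2^(j+1). Along it a monomial in
  -- several variables becomes a power of 2, which reduces independence to one variable.
  point : ∀ {m} → Exponent m → ℕ → Torus m
  point h j = record
    { val     = λ a → 2^ (+ suc j ℤ.* h a)
    ; inv     = λ a → 2^ (ℤ.- (+ suc j ℤ.* h a))
    ; inverse = λ a → 2^-inverse (+ suc j ℤ.* h a) }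

  monomial-point : ∀ {m} (h : Exponent m) j ν → monomial (point h j) ν ≈ 2^ (+ suc j ℤ.* dot h ν)
  monomial-point {zero}  h j ν = reflexive (≡.cong 2^ (≡.sym (ℤ.*-zeroʳ (+ suc j))))
  monomial-point {suc m} h j ν = begin
    pow (2^ (+ suc j ℤ.* h zero)) _ (ν zero) * monomial (point (h ∘ suc) j) (ν ∘ suc)
      ≈⟨ *-cong (pow-pow 2# ½ 2½≈1 (+ suc j ℤ.* h zero) (ν zero)) (monomial-point (h ∘ suc) j (ν ∘ suc)) ⟩
    2^ (+ suc j ℤ.* h zero ℤ.* ν zero) * 2^ (+ suc j ℤ.* dot (h ∘ suc) (ν ∘ suc))
      ≈⟨ 2^-+ (+ suc j ℤ.* h zero ℤ.* ν zero) (+ suc j ℤ.* dot (h ∘ suc) (ν ∘ suc)) ⟨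
    2^ (+ suc j ℤ.* h zero ℤ.* ν zero ℤ.+ + suc j ℤ.* dot (h ∘ suc) (ν ∘ suc))
      ≡⟨ ≡.cong 2^ (ℤsolve 4 (λ j h n d → j ⊠ h ⊠ n ⊞ j ⊠ d ⊜ j ⊠ (h ⊠ n ⊞ d)) ≡.refl (+ suc j) (h zero) (ν zero) (dot (h ∘ suc) (ν ∘ suc))) ⟩
    2^ (+ suc j ℤ.* dot h ν) ∎

  -- Exponents are functions and are compared pointwise only, so compatibility with `≗` must be
  -- demanded of whatever is paired with them.
  Respectful : ∀ {m} → (Exponent m → Carrier) → Set
  Respectful φ = ∀ {ν κ} → ν ≗ κ → φ ν ≈ φ κ

  -- A separating `h` makes `dot h` injective on the exponents that occur, so `φ` factors through it
  -- by table lookup (`find`), and the one-variable statement applies to the values of `dot h`.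
  independent : ∀ {m} (p : Terms (Exponent m)) → (∀ x → ⟨ monomial x , p ⟩ ≈ 0#) →
                ∀ φ → Respectful φ → ⟨ φ , p ⟩ ≈ 0#
  independent p hyp φ φ-resp with separating (exponents p)
  ... | h , _ , sep = begin
    ⟨ φ , p ⟩ ≈⟨ pair-cong-All (All.tabulate λ {t} t∈ → find-correct p (λ z → z) (∈-map⁺ proj₂ t∈)) ⟨
    ⟨ find p ∘ dot h , p ⟩ ≈⟨ pair-reindex (dot h) (find p) p ⟨
    ⟨ find p , reindex (dot h) p ⟩
      ≈⟨ independent₁ (reindex (dot h) p) (λ j → trans (pair-reindex (dot h) _ p)
           (trans (pair-cong p (λ ν → sym (monomial-point h j ν))) (hyp (point h j)))) (find p) ⟩
    0# ∎
    where
    find : Terms (Exponent _) → ℤ → Carrier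
    find []            n = 0#
    find ((c , ν) ∷ q) n with dot h ν ℤ.≟ n
    ... | yes _ = φ ν
    ... | no  _ = find q n
    find-correct : ∀ q → (∀ {κ} → κ ∈ exponents q → κ ∈ exponents p) →
                   ∀ {ν} → ν ∈ exponents q → find q (dot h ν) ≈ φ ν
    find-correct ((c , κ) ∷ q) sub {ν} ν∈ with dot h κ ℤ.≟ dot h ν
    ... | yes e = φ-resp (sep (sub (here ≡.refl)) (sub ν∈) e)
    find-correct ((c , κ) ∷ q) sub (here ≡.refl) | no ¬e = ⊥-elim (¬e ≡.refl)
    find-correct ((c , κ) ∷ q) sub (there ν∈)    | no ¬e = find-correct q (sub ∘ there) ν∈

  -- Pairing with it extracts the coefficient of `κ`, with repeated occurrences added up.
  indicator : ∀ {m} → Exponent m → Exponent m → Carrier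
  indicator κ ν with Fin.all? (λ a → ν a ℤ.≟ κ a)
  ... | yes _ = 1#
  ... | no  _ = 0#

  indicator-≗ : ∀ {m} {κ ν : Exponent m} → ν ≗ κ → indicator κ ν ≈ 1#
  indicator-≗ {κ = κ} {ν} p with Fin.all? (λ a → ν a ℤ.≟ κ a)
  ... | yes _ = refl
  ... | no ¬p = ⊥-elim (¬p p)

  indicator-refl : ∀ {m} (κ : Exponent m) → indicator κ κ ≈ 1#
  indicator-refl κ = indicator-≗ {κ = κ} {κ} λ _ → ≡.refl

  indicator-≭ : ∀ {m} {κ ν : Exponent m} → ¬ ν ≗ κ → indicator κ ν ≈ 0#
  indicator-≭ {κ = κ} {ν} ¬p with Fin.all? (λ a → ν a ℤ.≟ κ a)
  ... | yes p = ⊥-elim (¬p p)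
  ... | no  _ = refl

  indicator-respectful : ∀ {m} (κ : Exponent m) → Respectful (indicator κ)
  indicator-respectful κ {ν} {ν′} p with Fin.all? (λ a → ν a ℤ.≟ κ a)
  ... | yes q = sym (indicator-≗ λ a → ≡.trans (≡.sym (p a)) (q a))
  ... | no ¬q = sym (indicator-≭ λ q → ¬q λ a → ≡.trans (p a) (q a))

  pair-indicator-0 : ∀ {m} (κ : Exponent m) p → AllExp (λ ν → ¬ ν ≗ κ) p → ⟨ indicator κ , p ⟩ ≈ 0#
  pair-indicator-0 κ p all = trans (pair-cong-All (All.map indicator-≭ all)) (pair-0 p)

  independent-≈ : ∀ {m} (p q : Terms (Exponent m)) → (∀ x → ⟨ monomial x , p ⟩ ≈ ⟨ monomial x , q ⟩) →
                  ∀ φ → Respectful φ → ⟨ φ , p ⟩ ≈ ⟨ φ , q ⟩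
  independent-≈ p q hyp φ φ-resp = x-y≈0⇒x≈y (trans (sym (difference φ)) (independent (p ++ scale (- 1#) q)
    (λ x → trans (difference (monomial x)) (x≈y⇒x-y≈0 (hyp x))) φ φ-resp))
    where
    difference : ∀ φ → ⟨ φ , p ++ scale (- 1#) q ⟩ ≈ ⟨ φ , p ⟩ - ⟨ φ , q ⟩
    difference φ = trans (pair-++ φ p _) (+-congˡ (trans (pair-scale (- 1#) φ q)
      (solve 1 (λ x → :-1 :* x := :- x) refl _)))

-- Matrices, vectors and traces

module LinearAlgebra (K : CommutativeRing 0ℓ 0ℓ) where
  open CommutativeRing K hiding (zero)
  open Arithmetic K
  open Symplectic K using (Vector; Matrix; _≈ᵛ_; _≈ᴹ_; 0ᵛ; _+ᵛ_; _∙ᵛ_; _▹_; _*ᴹ_; _ᵀ; 1ᴹ; diagonal; trace; sum-diagonal; diagonal-ᵀ; *ᴹ-assoc; *ᴹ-cong) public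
  open SetoidReasoning setoid

  infixl 6 _+ᴹ_
  infixr 7 _∙ᴹ_
  _+ᴹ_ : ∀ {n} → Matrix n → Matrix n → Matrix n
  (A +ᴹ B) i j = A i j + B i j

  _∙ᴹ_ : ∀ {n} → Carrier → Matrix n → Matrix n
  (a ∙ᴹ A) i j = a * A i j

  ⟪_,_⟫ : ∀ {n} → Vector n → Vector n → Carrier
  ⟪ u , v ⟫ = sum λ i → u i * v i

  ⟪⟫-cong : ∀ {n} {u u′ v v′ : Vector n} → u ≈ᵛ u′ → v ≈ᵛ v′ → ⟪ u , v ⟫ ≈ ⟪ u′ , v′ ⟫
  ⟪⟫-cong p q = sum-cong λ i → *-cong (p i) (q i)

  ⟪⟫-comm : ∀ {n} (u v : Vector n) → ⟪ u , v ⟫ ≈ ⟪ v , u ⟫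
  ⟪⟫-comm u v = sum-cong λ i → *-comm (u i) (v i)

  ⟪⟫-+ʳ : ∀ {n} (u v w : Vector n) → ⟪ u , v +ᵛ w ⟫ ≈ ⟪ u , v ⟫ + ⟪ u , w ⟫
  ⟪⟫-+ʳ u v w = trans (sum-cong λ i → distribˡ (u i) (v i) (w i)) (∑-distrib-+ (λ i → u i * v i) (λ i → u i * w i))

  ⟪⟫-∙ʳ : ∀ {n} a (u v : Vector n) → ⟪ u , a ∙ᵛ v ⟫ ≈ a * ⟪ u , v ⟫
  ⟪⟫-∙ʳ a u v = trans (sum-cong λ i → solve 3 (λ u a v → u :* (a :* v) := a :* (u :* v)) refl (u i) a (v i))
    (sym (*-distribˡ-sum a (λ i → u i * v i)))

  ⟪⟫-+ˡ : ∀ {n} (u v w : Vector n) → ⟪ u +ᵛ v , w ⟫ ≈ ⟪ u , w ⟫ + ⟪ v , w ⟫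
  ⟪⟫-+ˡ u v w = trans (⟪⟫-comm _ w) (trans (⟪⟫-+ʳ w u v) (+-cong (⟪⟫-comm w u) (⟪⟫-comm w v)))

  ⟪⟫-∙ˡ : ∀ {n} a (u v : Vector n) → ⟪ a ∙ᵛ u , v ⟫ ≈ a * ⟪ u , v ⟫
  ⟪⟫-∙ˡ a u v = trans (⟪⟫-comm _ v) (trans (⟪⟫-∙ʳ a v u) (*-congˡ (⟪⟫-comm v u)))

  ▹-cong : ∀ {n} {A B : Matrix n} {u v : Vector n} → A ≈ᴹ B → u ≈ᵛ v → A ▹ u ≈ᵛ B ▹ v
  ▹-cong p q i = ⟪⟫-cong (p i) q

  ▹-congˡ : ∀ {n} (A : Matrix n) {u v : Vector n} → u ≈ᵛ v → A ▹ u ≈ᵛ A ▹ v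
  ▹-congˡ A = ▹-cong (λ _ _ → refl)

  ▹-+ : ∀ {n} (A : Matrix n) u v → A ▹ (u +ᵛ v) ≈ᵛ A ▹ u +ᵛ A ▹ v
  ▹-+ A u v i = ⟪⟫-+ʳ (A i) u v

  ▹-∙ : ∀ {n} (A : Matrix n) a u → A ▹ (a ∙ᵛ u) ≈ᵛ a ∙ᵛ (A ▹ u)
  ▹-∙ A a u i = ⟪⟫-∙ʳ a (A i) u

  ▹-0 : ∀ {n} (A : Matrix n) → A ▹ 0ᵛ ≈ᵛ 0ᵛ
  ▹-0 A i = sum-zero _ λ k → zeroʳ (A i k)

  +ᴹ-▹ : ∀ {n} (A B : Matrix n) u → (A +ᴹ B) ▹ u ≈ᵛ A ▹ u +ᵛ B ▹ u
  +ᴹ-▹ A B u i = ⟪⟫-+ˡ (A i) (B i) u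

  ∙ᴹ-▹ : ∀ {n} a (A : Matrix n) u → (a ∙ᴹ A) ▹ u ≈ᵛ a ∙ᵛ (A ▹ u)
  ∙ᴹ-▹ a A u i = ⟪⟫-∙ˡ a (A i) u

  1ᴹ-▹ : ∀ {n} (u : Vector n) → 1ᴹ ▹ u ≈ᵛ u
  1ᴹ-▹ u i = trans (sum-diagonal (λ _ → 1#) u i) (*-identityˡ _)

  *ᴹ-▹ : ∀ {n} (A B : Matrix n) u → (A *ᴹ B) ▹ u ≈ᵛ A ▹ (B ▹ u)
  *ᴹ-▹ A B u i = begin
    sum (λ j → sum (λ k → A i k * B k j) * u j)
      ≈⟨ sum-cong (λ j → *-distribʳ-sum (u j) (λ k → A i k * B k j)) ⟩
    sum (λ j → sum (λ k → A i k * B k j * u j))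
      ≈⟨ ∑-comm (λ j k → A i k * B k j * u j) ⟩
    sum (λ k → sum (λ j → A i k * B k j * u j))
      ≈⟨ sum-cong (λ k → sum-cong (λ j → *-assoc (A i k) (B k j) (u j))) ⟩
    sum (λ k → sum (λ j → A i k * (B k j * u j)))
      ≈⟨ sum-cong (λ k → *-distribˡ-sum (A i k) (λ j → B k j * u j)) ⟨
    sum (λ k → A i k * sum (λ j → B k j * u j)) ∎

  ⟪⟫-adjoint : ∀ {n} (A : Matrix n) u v → ⟪ A ▹ u , v ⟫ ≈ ⟪ u , A ᵀ ▹ v ⟫
  ⟪⟫-adjoint A u v = begin
    sum (λ i → sum (λ k → A i k * u k) * v i)
      ≈⟨ sum-cong (λ i → *-distribʳ-sum (v i) (λ k → A i k * u k)) ⟩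
    sum (λ i → sum (λ k → A i k * u k * v i))
      ≈⟨ ∑-comm (λ i k → A i k * u k * v i) ⟩
    sum (λ k → sum (λ i → A i k * u k * v i))
      ≈⟨ sum-cong (λ k → sum-cong (λ i → solve 3 (λ a u v → a :* u :* v := u :* (a :* v)) refl (A i k) (u k) (v i))) ⟩
    sum (λ k → sum (λ i → u k * (A i k * v i)))
      ≈⟨ sum-cong (λ k → *-distribˡ-sum (u k) (λ i → A i k * v i)) ⟨
    sum (λ k → u k * sum (λ i → A i k * v i)) ∎

  basis : ∀ {n} → Fin n → Vector n
  basis i j = 1ᴹ j i

  ⟪⟫-basisˡ : ∀ {n} i (u : Vector n) → ⟪ basis i , u ⟫ ≈ u i
  ⟪⟫-basisˡ i u = trans (sum-cong λ k → *-congʳ (diagonal-ᵀ _ k i)) (1ᴹ-▹ u i)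

  ⟪⟫-basisʳ : ∀ {n} (u : Vector n) i → ⟪ u , basis i ⟫ ≈ u i
  ⟪⟫-basisʳ u i = trans (⟪⟫-comm u _) (⟪⟫-basisˡ i u)

  1ᴹ-offdiagonal : ∀ {n} {i j : Fin n} → i ≢ j → 1ᴹ i j ≈ 0#
  1ᴹ-offdiagonal {i = zero}  {zero}  p = ⊥-elim (p ≡.refl)
  1ᴹ-offdiagonal {i = zero}  {suc j} p = refl
  1ᴹ-offdiagonal {i = suc i} {zero}  p = refl
  1ᴹ-offdiagonal {i = suc i} {suc j} p = 1ᴹ-offdiagonal (p ∘ ≡.cong suc)

  1ᴹ-diagonal : ∀ {n} (i : Fin n) → 1ᴹ i i ≈ 1#
  1ᴹ-diagonal zero    = refl
  1ᴹ-diagonal (suc i) = 1ᴹ-diagonal i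

  trace-comm : ∀ {n} (A B : Matrix n) → trace (A *ᴹ B) ≈ trace (B *ᴹ A)
  trace-comm A B = trans (∑-comm (λ i k → A i k * B k i)) (sum-cong λ k → sum-cong λ i → *-comm (A i k) (B k i))

  trace-cong : ∀ {n} {A B : Matrix n} → A ≈ᴹ B → trace A ≈ trace B
  trace-cong p = sum-cong λ i → p i i

  trace-+ : ∀ {n} (A B : Matrix n) → trace (A +ᴹ B) ≈ trace A + trace B
  trace-+ A B = ∑-distrib-+ (λ i → A i i) (λ i → B i i)

  trace-∙ : ∀ {n} a (A : Matrix n) → trace (a ∙ᴹ A) ≈ a * trace A
  trace-∙ a A = sym (*-distribˡ-sum a (λ i → A i i))

  *ᴹ-distribʳ : ∀ {n} (A B M : Matrix n) → (A +ᴹ B) *ᴹ M ≈ᴹ A *ᴹ M +ᴹ B *ᴹ M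
  *ᴹ-distribʳ A B M i j = ⟪⟫-+ˡ (A i) (B i) (λ k → M k j)

  *ᴹ-distribˡ : ∀ {n} (A B M : Matrix n) → A *ᴹ (B +ᴹ M) ≈ᴹ A *ᴹ B +ᴹ A *ᴹ M
  *ᴹ-distribˡ A B M i j = ⟪⟫-+ʳ (A i) (λ k → B k j) (λ k → M k j)

  ∙ᴹ-*ᴹ : ∀ {n} a (A B : Matrix n) → (a ∙ᴹ A) *ᴹ B ≈ᴹ a ∙ᴹ (A *ᴹ B)
  ∙ᴹ-*ᴹ a A B i j = ⟪⟫-∙ˡ a (A i) (λ k → B k j)

  *ᴹ-∙ᴹ : ∀ {n} a (A B : Matrix n) → A *ᴹ (a ∙ᴹ B) ≈ᴹ a ∙ᴹ (A *ᴹ B)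
  *ᴹ-∙ᴹ a A B i j = ⟪⟫-∙ʳ a (A i) (λ k → B k j)

-- The symplectic form and generation by transvections

module SymplecticForm (K : CommutativeRing 0ℓ 0ℓ) (F : IsCharZeroField K) (m : ℕ) where
  open CommutativeRing K hiding (zero)
  open Arithmetic K
  open FieldArithmetic K F
  open LinearAlgebra K
  open Symplectic K using (J; Jblock; Sp; matrix; symplectic; spMonoid)
  open SetoidReasoning setoid

  Index : Set
  Index = Fin m ⊎ Fin m

  N : ℕ
  N = m ℕ.+ m

  ω : Vector N → Vector N → Carrier
  ω u v = ⟪ u , J m ▹ v ⟫

  Jblock-antisym : ∀ (s t : Index) → Jblock s t ≈ - Jblock t s
  Jblock-antisym (inj₁ a) (inj₁ b) = solve 0 (:0 := :- :0) refl
  Jblock-antisym (inj₁ a) (inj₂ b) = trans (diagonal-ᵀ _ a b) (solve 1 (λ x → x := :- (:- x)) refl _)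
  Jblock-antisym (inj₂ a) (inj₁ b) = -‿cong (diagonal-ᵀ _ a b)
  Jblock-antisym (inj₂ a) (inj₂ b) = solve 0 (:0 := :- :0) refl

  ω-cong : ∀ {u u′ v v′} → u ≈ᵛ u′ → v ≈ᵛ v′ → ω u v ≈ ω u′ v′
  ω-cong p q = ⟪⟫-cong p (▹-congˡ (J m) q)

  ω-congˡ : ∀ {u v v′} → v ≈ᵛ v′ → ω u v ≈ ω u v′
  ω-congˡ = ω-cong λ _ → refl

  ω-congʳ : ∀ {u u′ v} → u ≈ᵛ u′ → ω u v ≈ ω u′ v
  ω-congʳ p = ω-cong p λ _ → refl

  ω-+ˡ : ∀ u v w → ω (u +ᵛ v) w ≈ ω u w + ω v w
  ω-+ˡ u v w = ⟪⟫-+ˡ u v (J m ▹ w)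

  ω-+ʳ : ∀ u v w → ω u (v +ᵛ w) ≈ ω u v + ω u w
  ω-+ʳ u v w = trans (⟪⟫-cong {u = u} (λ _ → refl) (▹-+ (J m) v w)) (⟪⟫-+ʳ u _ _)

  ω-∙ˡ : ∀ a u v → ω (a ∙ᵛ u) v ≈ a * ω u v
  ω-∙ˡ a u v = ⟪⟫-∙ˡ a u _

  ω-∙ʳ : ∀ a u v → ω u (a ∙ᵛ v) ≈ a * ω u v
  ω-∙ʳ a u v = trans (⟪⟫-cong {u = u} (λ _ → refl) (▹-∙ (J m) a v)) (⟪⟫-∙ʳ a u _)

  ω-antisym : ∀ u v → ω u v ≈ - ω v u
  ω-antisym u v = begin
    ⟪ u , J m ▹ v ⟫ ≈⟨ ⟪⟫-comm u _ ⟩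
    ⟪ J m ▹ v , u ⟫ ≈⟨ ⟪⟫-adjoint (J m) v u ⟩
    ⟪ v , J m ᵀ ▹ u ⟫ ≈⟨ ⟪⟫-cong {u = v} (λ _ → refl) (▹-cong (λ i j → Jblock-antisym (splitAt m j) (splitAt m i)) λ _ → refl) ⟩
    ⟪ v , (λ i → sum λ j → - J m i j * u j) ⟫
      ≈⟨ ⟪⟫-cong {u = v} (λ _ → refl) (λ i → trans (sum-cong λ j → solve 2 (λ a b → (:- a) :* b := :-1 :* (a :* b)) refl (J m i j) (u j)) (sym (*-distribˡ-sum (- 1#) (λ j → J m i j * u j)))) ⟩
    ⟪ v , (- 1#) ∙ᵛ (J m ▹ u) ⟫ ≈⟨ ⟪⟫-∙ʳ (- 1#) v _ ⟩
    - 1# * ω v u ≈⟨ solve 1 (λ x → :-1 :* x := :- x) refl _ ⟩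
    - ω v u ∎

  ω-alternating : ∀ v → ω v v ≈ 0#
  ω-alternating v = *-cancelˡ-0 2≉0 (begin
    2# * ω v v ≈⟨ solve 1 (λ x → :2 :* x := x :+ x) refl _ ⟩
    ω v v + ω v v ≈⟨ +-congˡ (ω-antisym v v) ⟩
    ω v v - ω v v ≈⟨ -‿inverseʳ _ ⟩
    0# ∎)

  ω-invariant : ∀ (g : Sp m) u v → ω (matrix g ▹ u) (matrix g ▹ v) ≈ ω u v
  ω-invariant g u v = begin
    ⟪ G ▹ u , J m ▹ (G ▹ v) ⟫ ≈⟨ ⟪⟫-adjoint G u _ ⟩
    ⟪ u , G ᵀ ▹ (J m ▹ (G ▹ v)) ⟫
      ≈⟨ ⟪⟫-cong {u = u} (λ _ → refl) (λ i → trans (▹-congˡ (G ᵀ) (λ k → sym (*ᴹ-▹ (J m) G v k)) i)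
           (trans (sym (*ᴹ-▹ (G ᵀ) (J m *ᴹ G) v i)) (▹-cong (symplectic g) (λ _ → refl) i))) ⟩
    ⟪ u , J m ▹ v ⟫ ∎
    where G = matrix g

  ω-basis : ∀ i j → ω (basis i) (basis j) ≈ J m i j
  ω-basis i j = trans (⟪⟫-basisˡ i _) (⟪⟫-basisʳ (J m i) j)

  isometry⇒symplectic : ∀ (A : Matrix N) → (∀ u v → ω (A ▹ u) (A ▹ v) ≈ ω u v) → A ᵀ *ᴹ J m *ᴹ A ≈ᴹ J m
  isometry⇒symplectic A iso i j = begin
    (A ᵀ *ᴹ J m *ᴹ A) i j
      ≈⟨ ⟪⟫-cong {u = λ k → A k i} (λ _ → refl) (λ k → ⟪⟫-cong {u = J m k} (λ _ → refl) (λ l → sym (⟪⟫-basisʳ (A l) j))) ⟩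
    ⟪ (λ k → A k i) , J m ▹ (A ▹ basis j) ⟫
      ≈⟨ ⟪⟫-cong (λ k → sym (⟪⟫-basisʳ (A k) i)) (λ _ → refl) ⟩
    ω (A ▹ basis i) (A ▹ basis j)
      ≈⟨ iso (basis i) (basis j) ⟩
    ω (basis i) (basis j)
      ≈⟨ ω-basis i j ⟩
    J m i j ∎

  b : Index → Vector N
  b s = basis (join m m s)

  ω-b : ∀ s t → ω (b s) (b t) ≈ Jblock s t
  ω-b s t = trans (ω-basis (join m m s) (join m m t))
    (reflexive (≡.cong₂ Jblock (Fin.splitAt-join m m s) (Fin.splitAt-join m m t)))

  row : Vector N → Vector N
  row u = J m ᵀ ▹ u

  ⟪row⟫ : ∀ u z → ⟪ row u , z ⟫ ≈ ω u z
  ⟪row⟫ u z = ⟪⟫-adjoint (J m ᵀ) u z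

  -- The element z ↦ ω(w,z) u + ω(u,z) w of the Lie algebra sp(2m) = S²(K²ᵐ).
  X : Vector N → Vector N → Matrix N
  X u w i j = u i * row w j + w i * row u j

  X-▹ : ∀ u w z → X u w ▹ z ≈ᵛ ω w z ∙ᵛ u +ᵛ ω u z ∙ᵛ w
  X-▹ u w z i = begin
    sum (λ j → (u i * row w j + w i * row u j) * z j)
      ≈⟨ ⟪⟫-+ˡ (λ j → u i * row w j) (λ j → w i * row u j) z ⟩
    ⟪ u i ∙ᵛ row w , z ⟫ + ⟪ w i ∙ᵛ row u , z ⟫
      ≈⟨ +-cong (trans (⟪⟫-∙ˡ (u i) (row w) z) (trans (*-congˡ (⟪row⟫ w z)) (*-comm _ _)))
                (trans (⟪⟫-∙ˡ (w i) (row u) z) (trans (*-congˡ (⟪row⟫ u z)) (*-comm _ _))) ⟩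
    ω w z * u i + ω u z * w i ∎

  unipotentMatrix : Vector N → Vector N → Carrier → Matrix N
  unipotentMatrix u w s = 1ᴹ +ᴹ s ∙ᴹ X u w

  unipotentMatrix-▹ : ∀ u w s z → unipotentMatrix u w s ▹ z ≈ᵛ z +ᵛ s ∙ᵛ (ω w z ∙ᵛ u +ᵛ ω u z ∙ᵛ w)
  unipotentMatrix-▹ u w s z i = trans (+ᴹ-▹ 1ᴹ (s ∙ᴹ X u w) z i)
    (+-cong (1ᴹ-▹ z i) (trans (∙ᴹ-▹ s (X u w) z i) (*-congˡ (X-▹ u w z i))))

  abstract
    -- 1 + s X(u,w) is symplectic for ω(u,w) = 0, because then X(u,w)² = 0.
    unipotent-symplectic : ∀ u w → ω u w ≈ 0# → ∀ s → unipotentMatrix u w s ᵀ *ᴹ J m *ᴹ unipotentMatrix u w s ≈ᴹ J m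
    unipotent-symplectic u w uw≈0 s = isometry⇒symplectic U isometry
      where
      U : Matrix N
      U = unipotentMatrix u w s
      expand : ∀ y a b → ω y (s ∙ᵛ (a ∙ᵛ u +ᵛ b ∙ᵛ w)) ≈ s * (a * ω y u + b * ω y w)
      expand y a b = trans (ω-∙ʳ s y _) (*-congˡ (trans (ω-+ʳ y _ _) (+-cong (ω-∙ʳ a y u) (ω-∙ʳ b y w))))
      expandˡ : ∀ y a b → ω (s ∙ᵛ (a ∙ᵛ u +ᵛ b ∙ᵛ w)) y ≈ s * (a * ω u y + b * ω w y)
      expandˡ y a b = trans (ω-∙ˡ s _ y) (*-congˡ (trans (ω-+ˡ _ _ y) (+-cong (ω-∙ˡ a u y) (ω-∙ˡ b w y))))
      wu≈0 : ω w u ≈ 0#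
      wu≈0 = trans (ω-antisym w u) (trans (-‿cong uw≈0) (solve 0 (:- :0 := :0) refl))
      isometry : ∀ y z → ω (U ▹ y) (U ▹ z) ≈ ω y z
      isometry y z = begin
        ω (U ▹ y) (U ▹ z)
          ≈⟨ ω-cong (unipotentMatrix-▹ u w s y) (unipotentMatrix-▹ u w s z) ⟩
        ω (y +ᵛ Δy) (z +ᵛ Δz)
          ≈⟨ trans (ω-+ˡ y Δy _) (+-cong (ω-+ʳ y z Δz) (ω-+ʳ Δy z Δz)) ⟩
        (ω y z + ω y Δz) + (ω Δy z + ω Δy Δz)
          ≈⟨ +-cong (+-congˡ (trans (expand y _ _) (*-congˡ (+-cong (*-congˡ (ω-antisym y u)) (*-congˡ (ω-antisym y w))))))
                    (+-cong (expandˡ z _ _) (trans (expandˡ Δz _ _) (*-congˡ (+-cong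
                      (*-congˡ (trans (expand u _ _) (*-congˡ (+-cong (*-congˡ (ω-alternating u)) (*-congˡ uw≈0)))))
                      (*-congˡ (trans (expand w _ _) (*-congˡ (+-cong (*-congˡ wu≈0) (*-congˡ (ω-alternating w)))))))))) ⟩
        (ω y z + s * (ω w z * - ω u y + ω u z * - ω w y)) + (s * (ω w y * ω u z + ω u y * ω w z) +
          s * (ω w y * (s * (ω w z * 0# + ω u z * 0#)) + ω u y * (s * (ω w z * 0# + ω u z * 0#))))
          ≈⟨ solve 6 (λ yz s wz uy uz wy →
               (yz :+ s :* (wz :* (:- uy) :+ uz :* (:- wy))) :+ (s :* (wy :* uz :+ uy :* wz) :+
                 s :* (wy :* (s :* (wz :* :0 :+ uz :* :0)) :+ uy :* (s :* (wz :* :0 :+ uz :* :0)))) := yz)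
               refl (ω y z) s (ω w z) (ω u y) (ω u z) (ω w y) ⟩
        ω y z ∎
        where
        Δy Δz : Vector N
        Δy = s ∙ᵛ (ω w y ∙ᵛ u +ᵛ ω u y ∙ᵛ w)
        Δz = s ∙ᵛ (ω w z ∙ᵛ u +ᵛ ω u z ∙ᵛ w)

  unipotent : ∀ u w → ω u w ≈ 0# → Carrier → Sp m
  unipotent u w uw≈0 s = record { matrix = unipotentMatrix u w s ; symplectic = unipotent-symplectic u w uw≈0 s }

  transvection : Vector N → Carrier → Sp m
  transvection v = unipotent v v (ω-alternating v)

  transvection-▹ : ∀ v s z → matrix (transvection v s) ▹ z ≈ᵛ z +ᵛ (2# * s * ω v z) ∙ᵛ v
  transvection-▹ v s z i = trans (unipotentMatrix-▹ v v s z i)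
    (+-congˡ (solve 3 (λ s a v → s :* (a :* v :+ a :* v) := :2 :* s :* a :* v) refl s (ω v z) (v i)))

  open RawMonoid (spMonoid m) using () renaming (_∙_ to _∙ˢ_; ε to 1ˢ) public

  -- Transvections carry g e₁ to e₁, then g f₁ to f₁ while fixing e₁, and so on; whenever the
  -- two vectors in question are orthogonal, one passes through a third vector.
  module Generation (P : Sp m → Set)
    (P-cong : ∀ g h → matrix g ≈ᴹ matrix h → P g → P h)
    (P-1 : P 1ˢ)
    (P-transvection : ∀ v s g → P (transvection v s ∙ˢ g) → P g) where

    Fixes : (Index → Set) → Sp m → Set
    Fixes Y g = ∀ t → Y t → matrix g ▹ b t ≈ᵛ b t

    -- The transvection along z - g r with coefficient 1/(2ω(z, g r)) sends g r to z. It keeps the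
    -- vectors already fixed, since ω(z, b_t) = ω(r, b_t) = ω(g r, g b_t) = ω(g r, b_t) makes its
    -- direction orthogonal to them.
    reduce : ∀ (Y : Index → Set) r z g → Fixes Y g → ¬ ω z (matrix g ▹ r) ≈ 0# →
             (∀ t → Y t → ω z (b t) ≈ ω r (b t)) →
             (∀ g′ → Fixes Y g′ → matrix g′ ▹ r ≈ᵛ z → P g′) → P g
    reduce Y r z g fix c≉0 orth k = P-transvection d s g (k g′ fix′ moved)
      where
      u = matrix g ▹ r
      c = ω z u
      2c≉0 = *-nonzero 2≉0 c≉0
      s = proj₁ (inverse (2# * c) 2c≉0)
      d = z +ᵛ (- 1#) ∙ᵛ u
      g′ = transvection d s ∙ˢ g
      ωd : ∀ y → ω d y ≈ ω z y - ω u y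
      ωd y = trans (ω-+ˡ z _ y) (+-congˡ (trans (ω-∙ˡ (- 1#) u y) (solve 1 (λ x → :-1 :* x := :- x) refl _)))
      moved : matrix g′ ▹ r ≈ᵛ z
      moved i = begin
        (matrix g′ ▹ r) i ≈⟨ *ᴹ-▹ (matrix (transvection d s)) (matrix g) r i ⟩
        (matrix (transvection d s) ▹ u) i ≈⟨ transvection-▹ d s u i ⟩
        u i + 2# * s * ω d u * (z i + - 1# * u i)
          ≈⟨ +-congˡ (*-congʳ (*-congˡ (trans (ωd u) (+-congˡ (-‿cong (ω-alternating u)))))) ⟩
        u i + 2# * s * (c - 0#) * (z i + - 1# * u i)
          ≈⟨ solve 4 (λ u s c z → u :+ :2 :* s :* (c :- :0) :* (z :+ :-1 :* u) := u :+ (:2 :* c :* s) :* (z :- u)) refl (u i) s c (z i) ⟩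
        u i + (2# * c * s) * (z i - u i) ≈⟨ +-congˡ (*-congʳ (proj₂ (inverse (2# * c) 2c≉0))) ⟩
        u i + 1# * (z i - u i) ≈⟨ solve 2 (λ u z → u :+ :1 :* (z :- u) := z) refl (u i) (z i) ⟩
        z i ∎
      fix′ : Fixes Y g′
      fix′ t Yt i = begin
        (matrix g′ ▹ b t) i ≈⟨ *ᴹ-▹ (matrix (transvection d s)) (matrix g) (b t) i ⟩
        (matrix (transvection d s) ▹ (matrix g ▹ b t)) i ≈⟨ ▹-congˡ (matrix (transvection d s)) (fix t Yt) i ⟩
        (matrix (transvection d s) ▹ b t) i ≈⟨ transvection-▹ d s (b t) i ⟩
        b t i + 2# * s * ω d (b t) * d i
          ≈⟨ +-congˡ (*-congʳ (*-congˡ (trans (ωd (b t)) (x≈y⇒x-y≈0 (trans (orth t Yt)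
               (trans (sym (ω-invariant g r (b t))) (ω-congˡ (fix t Yt)))))))) ⟩
        b t i + 2# * s * 0# * d i ≈⟨ solve 3 (λ b s d → b :+ :2 :* s :* :0 :* d := b) refl (b t i) s (d i) ⟩
        b t i ∎

    private
      position : Index → ℕ
      position = [ toℕ , toℕ ]′

      Below : ℕ → Index → Set
      Below k t = position t ℕ.< k

      ω-b-0 : ∀ s t → position s ≢ position t → ω (b s) (b t) ≈ 0#
      ω-b-0 s t p = trans (ω-b s t) (block s t p)
        where
        block : ∀ s t → position s ≢ position t → Jblock s t ≈ 0#
        block (inj₁ a) (inj₁ c) p = refl
        block (inj₁ a) (inj₂ c) p = 1ᴹ-offdiagonal (p ∘ ≡.cong toℕ)
        block (inj₂ a) (inj₁ c) p = trans (-‿cong (1ᴹ-offdiagonal (p ∘ ≡.cong toℕ))) (solve 0 (:- :0 := :0) refl)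
        block (inj₂ a) (inj₂ c) p = refl

      module _ (a : Fin m) (k : ℕ) (a≡k : toℕ a ≡ k)
               (continue : ∀ g → Fixes (Below (suc k)) g → P g) where
        e f : Vector N
        e = b (inj₁ a)
        f = b (inj₂ a)

        ef≈1 : ω e f ≈ 1#
        ef≈1 = trans (ω-b (inj₁ a) (inj₂ a)) (1ᴹ-diagonal a)

        fe≈-1 : ω f e ≈ - 1#
        fe≈-1 = trans (ω-antisym f e) (-‿cong ef≈1)

        -1≉0 : ¬ - 1# ≈ 0#
        -1≉0 p = 1≉0 (trans (solve 0 (:1 := :- :-1) refl) (trans (-‿cong p) (solve 0 (:- :0 := :0) refl)))

        e⊥ : ∀ t → Below k t → ω e (b t) ≈ 0#
        e⊥ t t<k = ω-b-0 (inj₁ a) t λ p → ℕ.<-irrefl (≡.trans (≡.sym p) a≡k) t<k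

        f⊥ : ∀ t → Below k t → ω f (b t) ≈ 0#
        f⊥ t t<k = ω-b-0 (inj₂ a) t λ p → ℕ.<-irrefl (≡.trans (≡.sym p) a≡k) t<k

        BelowAndE : Index → Set
        BelowAndE t = Below k t ⊎ t ≡ inj₁ a

        finish : ∀ g → Fixes BelowAndE g → matrix g ▹ f ≈ᵛ f → P g
        finish g fix fixf = continue g fixed
          where
          fixed : Fixes (Below (suc k)) g
          fixed t t<1+k with ℕ.m≤n⇒m<n∨m≡n (ℕ.s≤s⁻¹ t<1+k)
          ... | inj₁ t<k = fix t (inj₁ t<k)
          fixed (inj₁ c) _ | inj₂ c≡k = fix (inj₁ c) (inj₂ (≡.cong inj₁ (Fin.toℕ-injective (≡.trans c≡k (≡.sym a≡k)))))
          fixed (inj₂ c) _ | inj₂ c≡k = ≡.subst (λ d → matrix g ▹ b (inj₂ d) ≈ᵛ b (inj₂ d))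
            (Fin.toℕ-injective (≡.trans a≡k (≡.sym c≡k))) fixf

        fixF : ∀ g → Fixes BelowAndE g → P g
        fixF g fix = cases (ω f (matrix g ▹ f) ≟ 0#)
         where
         cases : Dec (ω f (matrix g ▹ f) ≈ 0#) → P g
         cases (no  c≉0) = reduce BelowAndE f f g fix c≉0 (λ _ _ → refl) finish
         cases (yes c≈0) = reduce BelowAndE f z g fix zu≉0 orth λ g′ fix′ moved →
          reduce BelowAndE f f g′ fix′ (λ p → -1≉0 (trans (sym fz≈-1) (trans (sym (ω-congˡ {f} moved)) p))) (λ _ _ → refl) finish
          where
          -- As g fixes e, ω(e, g f) = ω(g e, g f) = 1. Adding e to f therefore makes the pairing
          -- with g f nonzero, and it changes no pairing with the fixed vectors, all of them
          -- orthogonal to e.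
          z = f +ᵛ e
          fz≈-1 : ω f z ≈ - 1#
          fz≈-1 = trans (ω-+ʳ f f e) (trans (+-cong (ω-alternating f) fe≈-1) (+-identityˡ _))
          zu≉0 : ¬ ω z (matrix g ▹ f) ≈ 0#
          zu≉0 p = 1≉0 (begin
            1# ≈⟨ ef≈1 ⟨
            ω e f ≈⟨ ω-invariant g e f ⟨
            ω (matrix g ▹ e) (matrix g ▹ f) ≈⟨ ω-congʳ (fix (inj₁ a) (inj₂ ≡.refl)) ⟩
            ω e (matrix g ▹ f) ≈⟨ +-identityˡ _ ⟨
            0# + ω e (matrix g ▹ f) ≈⟨ +-congʳ c≈0 ⟨
            ω f (matrix g ▹ f) + ω e (matrix g ▹ f) ≈⟨ ω-+ˡ f e _ ⟨
            ω z (matrix g ▹ f) ≈⟨ p ⟩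
            0# ∎)
          orth : ∀ t → BelowAndE t → ω z (b t) ≈ ω f (b t)
          orth t y = trans (ω-+ˡ f e (b t)) (trans (+-congˡ (e0 t y)) (+-identityʳ _))
            where
            e0 : ∀ t → BelowAndE t → ω e (b t) ≈ 0#
            e0 t (inj₁ t<k)    = e⊥ t t<k
            e0 t (inj₂ ≡.refl) = ω-alternating e

        finishE : ∀ g → Fixes (Below k) g → matrix g ▹ e ≈ᵛ e → P g
        finishE g fix fixe = fixF g λ { t (inj₁ t<k) → fix t t<k ; t (inj₂ ≡.refl) → fixe }

        through : ∀ z g → Fixes (Below k) g → ¬ ω z (matrix g ▹ e) ≈ 0# → ¬ ω e z ≈ 0# →
                  (∀ t → Below k t → ω z (b t) ≈ 0#) → P g
        through z g fix zu≉0 ez≉0 orth = reduce (Below k) e z g fix zu≉0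
          (λ t y → trans (orth t y) (sym (e⊥ t y))) λ g′ fix′ moved →
          reduce (Below k) e e g′ fix′ (λ p → ez≉0 (trans (sym (ω-congˡ {e} moved)) p)) (λ _ _ → refl) finishE

        -- If e and g e are orthogonal, one of g f, f and g f + f pairs nontrivially with both.
        -- Indeed ω(g f, g e) = -1 and ω(e, f) = 1 always hold, and when the two remaining pairings
        -- ω(e, g f) and ω(f, g e) both vanish the sum works.
        fixE : ∀ g → Fixes (Below k) g → P g
        fixE g fix = cases (ω e ge ≟ 0#) (ω e gf ≟ 0#) (ω f ge ≟ 0#)
          where
          ge = matrix g ▹ e
          gf = matrix g ▹ f
          gf·ge : ω gf ge ≈ - 1#
          gf·ge = trans (ω-invariant g f e) fe≈-1
          gf⊥ : ∀ t → Below k t → ω gf (b t) ≈ 0#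
          gf⊥ t y = trans (sym (ω-congˡ {gf} (fix t y))) (trans (ω-invariant g f (b t)) (f⊥ t y))
          cases : Dec (ω e ge ≈ 0#) → Dec (ω e gf ≈ 0#) → Dec (ω f ge ≈ 0#) → P g
          cases (no c≉0) _ _ = reduce (Below k) e e g fix c≉0 (λ _ _ → refl) finishE
          cases (yes _) (no p) _ = through gf g fix (λ q → -1≉0 (trans (sym gf·ge) q)) p gf⊥
          cases (yes _) (yes _) (no q) = through f g fix q (λ r → 1≉0 (trans (sym ef≈1) r)) f⊥
          cases (yes _) (yes p) (yes q) = through (gf +ᵛ f) g fix
            (λ r → -1≉0 (begin
              - 1# ≈⟨ gf·ge ⟨
              ω gf ge ≈⟨ +-identityʳ _ ⟨
              ω gf ge + 0# ≈⟨ +-congˡ q ⟨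
              ω gf ge + ω f ge ≈⟨ ω-+ˡ gf f ge ⟨
              ω (gf +ᵛ f) ge ≈⟨ r ⟩
              0# ∎))
            (λ r → 1≉0 (trans (sym ef≈1) (trans (sym (trans (ω-+ʳ e gf f) (trans (+-congʳ p) (+-identityˡ _)))) r)))
            (λ t y → trans (ω-+ˡ gf f (b t)) (trans (+-cong (gf⊥ t y) (f⊥ t y)) (+-identityˡ 0#)))

      go : ∀ d k → d ℕ.+ k ≡ m → ∀ g → Fixes (Below k) g → P g
      go zero k ≡.refl g fix = P-cong 1ˢ g (λ i j → sym (begin
        matrix g i j ≈⟨ ⟪⟫-basisʳ (matrix g i) j ⟨
        (matrix g ▹ basis j) i ≡⟨ ≡.cong (λ l → (matrix g ▹ basis l) i) (Fin.join-splitAt m m j) ⟨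
        (matrix g ▹ b (splitAt m j)) i ≈⟨ fix (splitAt m j) (position<m (splitAt m j)) i ⟩
        b (splitAt m j) i ≡⟨ ≡.cong (λ l → basis l i) (Fin.join-splitAt m m j) ⟩
        1ᴹ i j ∎)) P-1
        where
        position<m : ∀ t → position t ℕ.< m
        position<m (inj₁ c) = Fin.toℕ<n c
        position<m (inj₂ c) = Fin.toℕ<n c
      go (suc d) k eq g fix = fixE (fromℕ< k<m) k (Fin.toℕ-fromℕ< k<m)
        (go d (suc k) (≡.trans (ℕ.+-suc d k) eq)) g fix
        where
        k<m : k ℕ.< m
        k<m = ≡.subst (k ℕ.<_) eq (ℕ.s≤s (ℕ.m≤n+m k d))

    generation : ∀ g → P g
    generation g = go m 0 (ℕ.+-identityʳ m) g λ t ()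

-- Polynomials along curves and their formal derivatives

module PolynomialCurves (K : CommutativeRing 0ℓ 0ℓ) where
  open CommutativeRing K hiding (zero)
  open Arithmetic K hiding (con; _:+_; _:*_; Polynomial)
  open LinearAlgebra K
  open FormalSums K
  open Symplectic K using (Polynomial; con; var; _:+_; _:*_; evaluate)
  open SetoidReasoning setoid

  derivative : ∀ {n} → Polynomial n → Matrix n → Matrix n → Carrier
  derivative (con a)   A X = 0#
  derivative (var i j) A X = X i j
  derivative (p :+ q)  A X = derivative p A X + derivative q A X
  derivative (p :* q)  A X = derivative p A X * evaluate q A + evaluate p A * derivative q A X

  evaluate-cong : ∀ {n} (p : Polynomial n) {A B : Matrix n} → A ≈ᴹ B → evaluate p A ≈ evaluate p B
  evaluate-cong (con a)   h = refl
  evaluate-cong (var i j) h = h i j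
  evaluate-cong (p :+ q)  h = +-cong (evaluate-cong p h) (evaluate-cong q h)
  evaluate-cong (p :* q)  h = *-cong (evaluate-cong p h) (evaluate-cong q h)

  derivative-cong : ∀ {n} (p : Polynomial n) {A B X Y : Matrix n} → A ≈ᴹ B → X ≈ᴹ Y → derivative p A X ≈ derivative p B Y
  derivative-cong (con a)   h k = refl
  derivative-cong (var i j) h k = k i j
  derivative-cong (p :+ q)  h k = +-cong (derivative-cong p h k) (derivative-cong q h k)
  derivative-cong (p :* q)  h k = +-cong (*-cong (derivative-cong p h k) (evaluate-cong q h))
                                         (*-cong (evaluate-cong p h) (derivative-cong q h k))

  derivative-+ : ∀ {n} (p : Polynomial n) A X Y → derivative p A (X +ᴹ Y) ≈ derivative p A X + derivative p A Y
  derivative-+ (con a)   A X Y = sym (+-identityˡ 0#)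
  derivative-+ (var i j) A X Y = refl
  derivative-+ (p :+ q)  A X Y = trans (+-cong (derivative-+ p A X Y) (derivative-+ q A X Y))
    (interchange (derivative p A X) (derivative p A Y) (derivative q A X) (derivative q A Y))
    where
    interchange : ∀ a b c d → (a + b) + (c + d) ≈ (a + c) + (b + d)
    interchange = solve 4 (λ a b c d → (a S.:+ b) S.:+ (c S.:+ d) := (a S.:+ c) S.:+ (b S.:+ d)) refl
      where module S = Arithmetic K
  derivative-+ (p :* q)  A X Y = trans (+-cong (*-congʳ (derivative-+ p A X Y)) (*-congˡ (derivative-+ q A X Y)))
    (rearrange _ _ _ _ _ _)
    where
    rearrange : ∀ a b c d e f → (a + b) * e + f * (c + d) ≈ (a * e + f * c) + (b * e + f * d)
    rearrange = solve 6 (λ a b c d e f → (a S.:+ b) S.:* e S.:+ f S.:* (c S.:+ d) := (a S.:* e S.:+ f S.:* c) S.:+ (b S.:* e S.:+ f S.:* d)) refl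
      where module S = Arithmetic K

  derivative-∙ : ∀ {n} (p : Polynomial n) A a X → derivative p A (a ∙ᴹ X) ≈ a * derivative p A X
  derivative-∙ (con c)   A a X = sym (zeroʳ a)
  derivative-∙ (var i j) A a X = refl
  derivative-∙ (p :+ q)  A a X = trans (+-cong (derivative-∙ p A a X) (derivative-∙ q A a X)) (sym (distribˡ a _ _))
  derivative-∙ (p :* q)  A a X = trans (+-cong (*-congʳ (derivative-∙ p A a X)) (*-congˡ (derivative-∙ q A a X)))
    (rearrange _ _ _ _ _)
    where
    rearrange : ∀ a x e f y → a * x * e + f * (a * y) ≈ a * (x * e + f * y)
    rearrange = solve 5 (λ a x e f y → a S.:* x S.:* e S.:+ f S.:* (a S.:* y) := a S.:* (x S.:* e S.:+ f S.:* y)) refl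
      where module S = Arithmetic K

  module _ {M : Set} (_∙_ : M → M → M) (ε : M) where
    open Convolution _∙_

    -- Substitution of a curve whose entries are formal sums over a monoid: ℕ for a line with
    -- parameter s, exponents for the torus. Pairing the result with a multiplicative function
    -- evaluates the polynomial, and pairing with a derivation differentiates it along the curve.
    along : ∀ {n} → Polynomial n → (Fin n → Fin n → Terms M) → Terms M
    along (con a)   γ = (a , ε) ∷ []
    along (var i j) γ = γ i j
    along (p :+ q)  γ = along p γ ++ along q γ
    along (p :* q)  γ = along p γ ⊛ along q γ

    along-evaluate : ∀ {n} φ → (∀ e e′ → φ (e ∙ e′) ≈ φ e * φ e′) → φ ε ≈ 1# →
                     ∀ (p : Polynomial n) γ A → (∀ i j → ⟨ φ , γ i j ⟩ ≈ A i j) → ⟨ φ , along p γ ⟩ ≈ evaluate p A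
    along-evaluate φ mult unit (con a)   γ A h = trans (+-identityʳ _) (trans (*-congˡ unit) (*-identityʳ a))
    along-evaluate φ mult unit (var i j) γ A h = h i j
    along-evaluate φ mult unit (p :+ q)  γ A h = trans (pair-++ φ (along p γ) (along q γ))
      (+-cong (along-evaluate φ mult unit p γ A h) (along-evaluate φ mult unit q γ A h))
    along-evaluate φ mult unit (p :* q)  γ A h = trans (pair-multiplicative φ mult (along p γ) (along q γ))
      (*-cong (along-evaluate φ mult unit p γ A h) (along-evaluate φ mult unit q γ A h))

    along-derivative : ∀ {n} φ → (∀ e e′ → φ (e ∙ e′) ≈ φ e * φ e′) → φ ε ≈ 1# →
                       ∀ δ → (∀ e e′ → δ (e ∙ e′) ≈ δ e * φ e′ + φ e * δ e′) → δ ε ≈ 0# →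
                       ∀ (p : Polynomial n) γ A X → (∀ i j → ⟨ φ , γ i j ⟩ ≈ A i j) → (∀ i j → ⟨ δ , γ i j ⟩ ≈ X i j) →
                       ⟨ δ , along p γ ⟩ ≈ derivative p A X
    along-derivative φ mult unit δ der zer (con a)   γ A X h k = trans (+-identityʳ _) (trans (*-congˡ zer) (zeroʳ a))
    along-derivative φ mult unit δ der zer (var i j) γ A X h k = k i j
    along-derivative φ mult unit δ der zer (p :+ q)  γ A X h k = trans (pair-++ δ (along p γ) (along q γ))
      (+-cong (along-derivative φ mult unit δ der zer p γ A X h k) (along-derivative φ mult unit δ der zer q γ A X h k))
    along-derivative φ mult unit δ der zer (p :* q)  γ A X h k = trans (pair-derivation φ δ der (along p γ) (along q γ))
      (+-cong (*-cong (along-derivative φ mult unit δ der zer p γ A X h k) (along-evaluate φ mult unit q γ A h))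
              (*-cong (along-evaluate φ mult unit p γ A h) (along-derivative φ mult unit δ der zer q γ A X h k)))

-- Polynomials in one parameter

module PowerSums (K : CommutativeRing 0ℓ 0ℓ) (F : IsCharZeroField K) where
  open CommutativeRing K hiding (zero)
  open Arithmetic K
  open FormalSums K
  open Powers K
  open LinearIndependence K F
  open Symplectic K using (_^_)
  open SetoidReasoning setoid

  -- The passage from group identities valid for every parameter s to identities between their
  -- coefficients and derivatives. The values at the powers of 2 alone already force it.
  independentℕ : ∀ (p q : Terms ℕ) → (∀ s → ⟨ s ^_ , p ⟩ ≈ ⟨ s ^_ , q ⟩) → ∀ φ → ⟨ φ , p ⟩ ≈ ⟨ φ , q ⟩
  independentℕ p q h φ = x-y≈0⇒x≈y (begin
    ⟨ φ , p ⟩ - ⟨ φ , q ⟩ ≈⟨ difference φ ⟨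
    ⟨ φ , d ⟩ ≈⟨ pair-reindex +_ (φ ∘ ℤ.∣_∣) d ⟨
    ⟨ φ ∘ ℤ.∣_∣ , reindex +_ d ⟩ ≈⟨ independent₁ (reindex +_ d) (λ j → begin
      ⟨ (λ n → 2^ (+ suc j ℤ.* n)) , reindex +_ d ⟩ ≈⟨ pair-reindex +_ _ d ⟩
      ⟨ (λ n → 2^ (+ suc j ℤ.* + n)) , d ⟩ ≈⟨ pair-cong d (λ n → sym (pow-pow 2# ½ 2½≈1 (+ suc j) (+ n))) ⟩
      ⟨ 2^ (+ suc j) ^_ , d ⟩ ≈⟨ difference _ ⟩
      _ ≈⟨ x≈y⇒x-y≈0 (h (2^ (+ suc j))) ⟩
      0# ∎) (φ ∘ ℤ.∣_∣) ⟩
    0# ∎)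
    where
    d = p ++ scale (- 1#) q
    difference : ∀ φ → ⟨ φ , d ⟩ ≈ ⟨ φ , p ⟩ - ⟨ φ , q ⟩
    difference φ = trans (pair-++ φ p _) (+-congˡ (trans (pair-scale (- 1#) φ q)
      (solve 1 (λ x → :-1 :* x := :- x) refl _)))

  -- `coefficient 0` is evaluation at s = 0 and `coefficient 1` the derivative there, hence
  -- multiplicativity for the one and Leibniz's rule for the other. Higher coefficients occur as
  -- divided powers of an exponential.
  coefficient : ℕ → ℕ → Carrier
  coefficient zero    zero    = 1#
  coefficient zero    (suc n) = 0#
  coefficient (suc k) zero    = 0#
  coefficient (suc k) (suc n) = coefficient k n

  coefficient-0-+ : ∀ a b → coefficient 0 (a ℕ.+ b) ≈ coefficient 0 a * coefficient 0 b
  coefficient-0-+ zero    b = sym (*-identityˡ _)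
  coefficient-0-+ (suc a) b = sym (zeroˡ _)

  coefficient-1-+ : ∀ a b → coefficient 1 (a ℕ.+ b) ≈
                    coefficient 1 a * coefficient 0 b + coefficient 0 a * coefficient 1 b
  coefficient-1-+ zero          b = solve 2 (λ x y → x := :0 :* y :+ :1 :* x) refl _ _
  coefficient-1-+ (suc zero)    b = solve 2 (λ x y → x := :1 :* x :+ :0 :* y) refl _ _
  coefficient-1-+ (suc (suc a)) b = solve 2 (λ x y → :0 := :0 :* x :+ :0 :* y) refl _ _

  -- The truncated predecessor is correct at `n = 0` because the factor `ι (+ 0)` vanishes.
  power-derivative : Carrier → ℕ → Carrier
  power-derivative s n = ι (+ n) * s ^ ℕ.pred n

  power-derivative-+ : ∀ s a b → power-derivative s (a ℕ.+ b) ≈ power-derivative s a * s ^ b + s ^ a * power-derivative s b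
  power-derivative-+ s zero    b = solve 3 (λ x y z → x := :0 :* y :* z :+ :1 :* x) refl _ _ _
  power-derivative-+ s (suc a) zero = begin
    ι (+ suc (a ℕ.+ 0)) * s ^ (a ℕ.+ 0) ≡⟨ ≡.cong (λ k → ι (+ suc k) * s ^ k) (ℕ.+-identityʳ a) ⟩
    ι (+ suc a) * s ^ a
      ≈⟨ solve 2 (λ x y → x := x :* :1 :+ y :* (:0 :* :1)) refl _ (s ^ suc a) ⟩
    ι (+ suc a) * s ^ a * 1# + s ^ suc a * (0# * 1#) ∎
  power-derivative-+ s (suc a) (suc b) = begin
    ι (+ (suc a ℕ.+ suc b)) * s ^ (a ℕ.+ suc b)
      ≈⟨ *-cong (ι-+ (+ suc a) (+ suc b)) (^-+ s a (suc b)) ⟩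
    (ι (+ suc a) + ι (+ suc b)) * (s ^ a * (s * s ^ b))
      ≈⟨ solve 5 (λ i j p s q → (i :+ j) :* (p :* (s :* q)) := i :* p :* (s :* q) :+ s :* p :* (j :* q)) refl (ι (+ suc a)) (ι (+ suc b)) (s ^ a) s (s ^ b) ⟩
    _ ∎

  expand-coefficients : ∀ d (φ : ℕ → Carrier) q → AllExp (ℕ._< d) q →
                        ⟨ φ , q ⟩ ≈ sum {d} λ k → φ (toℕ k) * ⟨ coefficient (toℕ k) , q ⟩
  expand-coefficients d φ q bound = begin
    ⟨ φ , q ⟩
      ≈⟨ pair-cong-All (All.map (λ {t} → single d φ (proj₂ t)) bound) ⟩
    ⟨ (λ e → sum {d} λ k → φ (toℕ k) * coefficient (toℕ k) e) , q ⟩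
      ≈⟨ pair-sum {n = d} (λ k e → φ (toℕ k) * coefficient (toℕ k) e) q ⟩
    sum {d} (λ k → ⟨ (λ e → φ (toℕ k) * coefficient (toℕ k) e) , q ⟩)
      ≈⟨ sum-cong {d} (λ k → pair-* (φ (toℕ k)) (coefficient (toℕ k)) q) ⟩
    _ ∎
    where
    single : ∀ d (φ : ℕ → Carrier) n → n ℕ.< d → φ n ≈ sum {d} λ k → φ (toℕ k) * coefficient (toℕ k) n
    single (suc d) φ zero    lt = sym (trans (+-cong (*-identityʳ _) (sum-zero {d} _ λ k → zeroʳ (φ (suc (toℕ k))))) (+-identityʳ _))
    single (suc d) φ (suc n) (ℕ.s≤s lt) = sym (trans (+-cong (zeroʳ _) (sym (single d (φ ∘ suc) n lt))) (+-identityˡ _))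

  exponentBound : ∀ (q : Terms ℕ) → ∃ λ d → AllExp (ℕ._< d) q
  exponentBound []            = 0 , []
  exponentBound ((c , e) ∷ q) with exponentBound q
  ... | d , ps = suc e ℕ.⊔ d , ℕ.m≤m⊔n (suc e) d ∷ All.map (λ p → ℕ.≤-trans p (ℕ.m≤n⊔m (suc e) d)) ps

-- The action of the Lie algebra sp(2m)

module LieAction (K : CommutativeRing 0ℓ 0ℓ) (F : IsCharZeroField K) {m n : ℕ}
                 (V : Symplectic.Representation K m n) where
  open CommutativeRing K hiding (zero)
  open Arithmetic K
  open FieldArithmetic K F
  open LinearAlgebra K
  open FormalSums K
  open Powers K
  open LinearIndependence K F
  open PolynomialCurves K
  open PowerSums K F
  open SymplecticForm K F m
  open Symplectic K using (_^_; Sp; matrix; Jblock; J; val; inv; evaluate; torusElement; eigenvalue)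
  open Symplectic.Representation V using (ρ; isHomomorphism; rational)
  open IsMonoidHomomorphism isHomomorphism using () renaming (⟦⟧-cong to ρ-cong; homo to ρ-∙; ε-homo to ρ-1) public
  open SetoidReasoning setoid

  matrix-ext : ∀ {k} {A B : Matrix k} → (∀ z → A ▹ z ≈ᵛ B ▹ z) → A ≈ᴹ B
  matrix-ext {A = A} {B} h i j = trans (sym (⟪⟫-basisʳ (A i) j)) (trans (h (basis j) i) (⟪⟫-basisʳ (B i) j))

  private
    poly : ∀ i j → Symplectic.Polynomial K N
    poly i j = proj₁ (rational i j)

    poly-ρ : ∀ i j g → ρ g i j ≈ evaluate (poly i j) (matrix g)
    poly-ρ i j = proj₂ (rational i j)

    line : Matrix N → Matrix N → Fin N → Fin N → Terms ℕ
    line A X i j = (A i j , 0) ∷ (X i j , 1) ∷ []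

    line-power : ∀ s A X i j → ⟨ s ^_ , line A X i j ⟩ ≈ (A +ᴹ s ∙ᴹ X) i j
    line-power s A X i j = solve 3 (λ a x s → a :* :1 :+ (x :* (s :* :1) :+ :0) := a :+ s :* x) refl (A i j) (X i j) s

    line-0 : ∀ A X i j → ⟨ coefficient 0 , line A X i j ⟩ ≈ A i j
    line-0 A X i j = solve 2 (λ a x → a :* :1 :+ (x :* :0 :+ :0) := a) refl (A i j) (X i j)

    line-1 : ∀ A X i j → ⟨ coefficient 1 , line A X i j ⟩ ≈ X i j
    line-1 A X i j = solve 2 (λ a x → a :* :0 :+ (x :* :1 :+ :0) := x) refl (A i j) (X i j)

    line-derivative : ∀ s A X i j → ⟨ power-derivative s , line A X i j ⟩ ≈ X i j
    line-derivative s A X i j = solve 2 (λ a x → a :* (:0 :* :1) :+ (x :* (:1 :* :1) :+ :0) := x) refl (A i j) (X i j)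

    lineTerms : Matrix N → Matrix N → Fin n → Fin n → Terms ℕ
    lineTerms A X i j = along ℕ._+_ 0 (poly i j) (line A X)

    lineTerms-power : ∀ A X i j s → ⟨ s ^_ , lineTerms A X i j ⟩ ≈ evaluate (poly i j) (A +ᴹ s ∙ᴹ X)
    lineTerms-power A X i j s = along-evaluate ℕ._+_ 0 (s ^_) (^-+ s) refl (poly i j) (line A X) _ (line-power s A X)

    lineTerms-1 : ∀ A X i j → ⟨ coefficient 1 , lineTerms A X i j ⟩ ≈ derivative (poly i j) A X
    lineTerms-1 A X i j = along-derivative ℕ._+_ 0 (coefficient 0) coefficient-0-+ refl (coefficient 1) coefficient-1-+ refl
      (poly i j) (line A X) A X (line-0 A X) (line-1 A X)

  abstract
    -- The differential of `ρ` at 1 in the direction `X u w`; as sp(2m) is the symmetric square of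
    -- K²ᵐ, it is a symmetric bilinear map on vectors. Bilinearity is formal. Properties that
    -- involve `ρ` have to be proved along curves inside the group, since the chosen polynomials
    -- agree with `ρ` only there.
    D : Vector N → Vector N → Matrix n
    D u w i j = derivative (poly i j) 1ᴹ (X u w)

    private
      row-+ : ∀ u v j → row (u +ᵛ v) j ≈ row u j + row v j
      row-+ = ▹-+ (J m ᵀ)

      row-∙ : ∀ a u j → row (a ∙ᵛ u) j ≈ a * row u j
      row-∙ = ▹-∙ (J m ᵀ)

    D-cong : ∀ {u u′ w w′} → u ≈ᵛ u′ → w ≈ᵛ w′ → D u w ≈ᴹ D u′ w′
    D-cong p q i j = derivative-cong (poly i j) (λ _ _ → refl)
      (λ k l → +-cong (*-cong (p k) (▹-congˡ (J m ᵀ) q l)) (*-cong (q k) (▹-congˡ (J m ᵀ) p l)))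

    D-sym : ∀ u w → D u w ≈ᴹ D w u
    D-sym u w i j = derivative-cong (poly i j) (λ _ _ → refl) (λ k l → +-comm _ _)

    D-+ˡ : ∀ u v w → D (u +ᵛ v) w ≈ᴹ D u w +ᴹ D v w
    D-+ˡ u v w i j = trans (derivative-cong (poly i j) (λ _ _ → refl)
      (λ k l → trans (+-congˡ (*-congˡ (row-+ u v l)))
        (solve 6 (λ u v rw w ru rv → (u :+ v) :* rw :+ w :* (ru :+ rv) := (u :* rw :+ w :* ru) :+ (v :* rw :+ w :* rv)) refl
          (u k) (v k) (row w l) (w k) (row u l) (row v l))))
      (derivative-+ (poly i j) 1ᴹ (X u w) (X v w))

    D-∙ˡ : ∀ a u w → D (a ∙ᵛ u) w ≈ᴹ a ∙ᴹ D u w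
    D-∙ˡ a u w i j = trans (derivative-cong (poly i j) (λ _ _ → refl)
      (λ k l → trans (+-congˡ (*-congˡ (row-∙ a u l)))
        (solve 5 (λ a u rw w ru → a :* u :* rw :+ w :* (a :* ru) := a :* (u :* rw :+ w :* ru)) refl
          a (u k) (row w l) (w k) (row u l))))
      (derivative-∙ (poly i j) 1ᴹ a (X u w))

  D-+ʳ : ∀ u v w → D u (v +ᵛ w) ≈ᴹ D u v +ᴹ D u w
  D-+ʳ u v w i j = trans (D-sym u _ i j) (trans (D-+ˡ v w u i j) (+-cong (D-sym v u i j) (D-sym w u i j)))

  D-∙ʳ : ∀ a u w → D u (a ∙ᵛ w) ≈ᴹ a ∙ᴹ D u w
  D-∙ʳ a u w i j = trans (D-sym u _ i j) (trans (D-∙ˡ a w u i j) (*-congˡ (D-sym w u i j)))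

  D-square : ∀ u v → D (u +ᵛ v) (u +ᵛ v) ≈ᴹ (D u u +ᴹ D v v) +ᴹ 2# ∙ᴹ D u v
  D-square u v i j = trans (D-+ˡ u v _ i j) (trans (+-cong (D-+ʳ u u v i j) (trans (D-+ʳ v u v i j) (+-congʳ (D-sym v u i j))))
    (solve 3 (λ a b c → (a :+ b) :+ (b :+ c) := (a :+ c) :+ :2 :* b) refl (D u u i j) (D u v i j) (D v v i j)))

  -- `X v v` squares to zero, so (1 + rX)(1 + sX) = (1 + sX) + rX: multiplying by transvections
  -- moves along a straight line in matrix space. Derivatives at any point of the one-parameter
  -- group thus reduce to derivatives along `line`.
  add-parameters : ∀ v s r → matrix (transvection v r ∙ˢ transvection v s) ≈ᴹ matrix (transvection v s) +ᴹ r ∙ᴹ X v v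
  add-parameters v s r = matrix-ext λ z k → begin
    (matrix (transvection v r ∙ˢ transvection v s) ▹ z) k ≈⟨ *ᴹ-▹ (matrix (transvection v r)) T z k ⟩
    (matrix (transvection v r) ▹ (T ▹ z)) k ≈⟨ transvection-▹ v r (T ▹ z) k ⟩
    (T ▹ z) k + 2# * r * ω v (T ▹ z) * v k
      ≈⟨ +-congˡ (*-congʳ (*-congˡ (ωT z))) ⟩
    (T ▹ z) k + 2# * r * ω v z * v k
      ≈⟨ +-congˡ (double r (ω v z) (v k)) ⟩
    (T ▹ z) k + r * (ω v z * v k + ω v z * v k) ≈⟨ +-congˡ (*-congˡ (X-▹ v v z k)) ⟨
    (T ▹ z) k + r * (X v v ▹ z) k ≈⟨ +-congˡ (∙ᴹ-▹ r (X v v) z k) ⟨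
    (T ▹ z) k + ((r ∙ᴹ X v v) ▹ z) k ≈⟨ +ᴹ-▹ T (r ∙ᴹ X v v) z k ⟨
    ((T +ᴹ r ∙ᴹ X v v) ▹ z) k ∎
    where
    T = matrix (transvection v s)
    double : ∀ r a v → 2# * r * a * v ≈ r * (a * v + a * v)
    double = solve 3 (λ r a v → :2 :* r :* a :* v := r :* (a :* v :+ a :* v)) refl
    ωT : ∀ z → ω v (T ▹ z) ≈ ω v z
    ωT z = begin
      ω v (T ▹ z) ≈⟨ ω-congˡ {v} (transvection-▹ v s z) ⟩
      ω v (z +ᵛ (2# * s * ω v z) ∙ᵛ v) ≈⟨ ω-+ʳ v z _ ⟩
      ω v z + ω v ((2# * s * ω v z) ∙ᵛ v) ≈⟨ +-congˡ (ω-∙ʳ _ v v) ⟩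
      ω v z + 2# * s * ω v z * ω v v ≈⟨ +-congˡ (trans (*-congˡ (ω-alternating v)) (zeroʳ _)) ⟩
      ω v z + 0# ≈⟨ +-identityʳ _ ⟩
      ω v z ∎

  abstract
    unipotentTerms : Vector N → Vector N → Fin n → Fin n → Terms ℕ
    unipotentTerms u w = lineTerms 1ᴹ (X u w)

    unipotentTerms-power : ∀ u w (uw : ω u w ≈ 0#) s i j → ⟨ s ^_ , unipotentTerms u w i j ⟩ ≈ ρ (unipotent u w uw s) i j
    unipotentTerms-power u w uw s i j = trans (lineTerms-power 1ᴹ (X u w) i j s) (sym (poly-ρ i j (unipotent u w uw s)))

    unipotentTerms-0 : ∀ u w i j → ⟨ coefficient 0 , unipotentTerms u w i j ⟩ ≈ 1ᴹ i j
    unipotentTerms-0 u w i j = trans (along-evaluate ℕ._+_ 0 (coefficient 0) coefficient-0-+ refl (poly i j) (line 1ᴹ (X u w)) 1ᴹ (line-0 1ᴹ (X u w)))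
      (trans (sym (poly-ρ i j 1ˢ)) (ρ-1 i j))

    unipotentTerms-1 : ∀ u w i j → ⟨ coefficient 1 , unipotentTerms u w i j ⟩ ≈ D u w i j
    unipotentTerms-1 u w = lineTerms-1 1ᴹ (X u w)

    -- d/ds ρ(1 + s X) = dρ(X) ρ(1 + s X), as X² = 0.
    transvectionTerms-derivative : ∀ v s i j → ⟨ power-derivative s , unipotentTerms v v i j ⟩ ≈ (D v v *ᴹ ρ (transvection v s)) i j
    transvectionTerms-derivative v s i j = begin
      ⟨ power-derivative s , unipotentTerms v v i j ⟩
        ≈⟨ along-derivative ℕ._+_ 0 (s ^_) (^-+ s) refl (power-derivative s) (power-derivative-+ s) (zeroˡ 1#)
             (poly i j) (line 1ᴹ (X v v)) T (X v v) (line-power s 1ᴹ (X v v)) (line-derivative s 1ᴹ (X v v)) ⟩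
      derivative (poly i j) T (X v v)
        ≈⟨ lineTerms-1 T (X v v) i j ⟨
      ⟨ coefficient 1 , lineTerms T (X v v) i j ⟩
        ≈⟨ independentℕ (lineTerms T (X v v) i j) right equal (coefficient 1) ⟩
      ⟨ coefficient 1 , right ⟩
        ≈⟨ pair-combinationʳ (coefficient 1) (λ k → ρ t k j) (unipotentTerms v v i) ⟩
      sum (λ k → ⟨ coefficient 1 , unipotentTerms v v i k ⟩ * ρ t k j)
        ≈⟨ sum-cong (λ k → *-congʳ (unipotentTerms-1 v v i k)) ⟩
      (D v v *ᴹ ρ t) i j ∎
      where
      t : Sp m
      t = transvection v s
      T : Matrix N
      T = matrix t
      right : Terms ℕ
      right = combination (λ k → ρ t k j) (unipotentTerms v v i)
      equal : ∀ r → ⟨ r ^_ , lineTerms T (X v v) i j ⟩ ≈ ⟨ r ^_ , right ⟩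
      equal r = begin
        ⟨ r ^_ , lineTerms T (X v v) i j ⟩ ≈⟨ lineTerms-power T (X v v) i j r ⟩
        evaluate (poly i j) (T +ᴹ r ∙ᴹ X v v) ≈⟨ evaluate-cong (poly i j) (add-parameters v s r) ⟨
        evaluate (poly i j) (matrix (transvection v r ∙ˢ t)) ≈⟨ poly-ρ i j (transvection v r ∙ˢ t) ⟨
        ρ (transvection v r ∙ˢ t) i j ≈⟨ ρ-∙ (transvection v r) t i j ⟩
        (ρ (transvection v r) *ᴹ ρ t) i j
          ≈⟨ sum-cong (λ k → *-congʳ (unipotentTerms-power v v (ω-alternating v) r i k)) ⟨
        sum (λ k → ⟨ r ^_ , unipotentTerms v v i k ⟩ * ρ t k j)
          ≈⟨ pair-combinationʳ (r ^_) (λ k → ρ t k j) (unipotentTerms v v i) ⟨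
        ⟨ r ^_ , right ⟩ ∎

  private
    conjugate-transvection : ∀ g v s → matrix (g ∙ˢ transvection v s) ≈ᴹ matrix (transvection (matrix g ▹ v) s ∙ˢ g)
    conjugate-transvection g v s = matrix-ext λ z i → begin
      (matrix (g ∙ˢ transvection v s) ▹ z) i ≈⟨ *ᴹ-▹ G (matrix (transvection v s)) z i ⟩
      (G ▹ (matrix (transvection v s) ▹ z)) i ≈⟨ ▹-congˡ G (transvection-▹ v s z) i ⟩
      (G ▹ (z +ᵛ (2# * s * ω v z) ∙ᵛ v)) i ≈⟨ trans (▹-+ G z _ i) (+-congˡ (▹-∙ G _ v i)) ⟩
      (G ▹ z) i + 2# * s * ω v z * (G ▹ v) i ≈⟨ +-congˡ (*-congʳ (*-congˡ (ω-invariant g v z))) ⟨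
      (G ▹ z) i + 2# * s * ω (G ▹ v) (G ▹ z) * (G ▹ v) i ≈⟨ transvection-▹ (G ▹ v) s (G ▹ z) i ⟨
      (matrix (transvection (G ▹ v) s) ▹ (G ▹ z)) i ≈⟨ *ᴹ-▹ (matrix (transvection (G ▹ v) s)) G z i ⟨
      (matrix (transvection (G ▹ v) s ∙ˢ g) ▹ z) i ∎
      where G = matrix g

    -- The coefficient of s in ρ(g) ρ(τ_v(s)) = ρ(τ_{gv}(s)) ρ(g), where τ_v(s) is the transvection
    -- along v.
    equivariant-square : ∀ g v → ρ g *ᴹ D v v ≈ᴹ D (matrix g ▹ v) (matrix g ▹ v) *ᴹ ρ g
    equivariant-square g v i j = begin
      (ρ g *ᴹ D v v) i j
        ≈⟨ sum-cong (λ k → *-congˡ (unipotentTerms-1 v v k j)) ⟨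
      sum (λ k → ρ g i k * ⟨ coefficient 1 , unipotentTerms v v k j ⟩)
        ≈⟨ pair-combination (coefficient 1) (ρ g i) (λ k → unipotentTerms v v k j) ⟨
      ⟨ coefficient 1 , left ⟩ ≈⟨ independentℕ left right equal (coefficient 1) ⟩
      ⟨ coefficient 1 , right ⟩
        ≈⟨ pair-combinationʳ (coefficient 1) (λ k → ρ g k j) (unipotentTerms gv gv i) ⟩
      sum (λ k → ⟨ coefficient 1 , unipotentTerms gv gv i k ⟩ * ρ g k j)
        ≈⟨ sum-cong (λ k → *-congʳ (unipotentTerms-1 gv gv i k)) ⟩
      (D gv gv *ᴹ ρ g) i j ∎
      where
      gv = matrix g ▹ v
      left = combination (ρ g i) (λ k → unipotentTerms v v k j)
      right = combination (λ k → ρ g k j) (unipotentTerms gv gv i)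
      equal : ∀ s → ⟨ s ^_ , left ⟩ ≈ ⟨ s ^_ , right ⟩
      equal s = begin
        ⟨ s ^_ , left ⟩
          ≈⟨ pair-combination (s ^_) (ρ g i) (λ k → unipotentTerms v v k j) ⟩
        sum (λ k → ρ g i k * ⟨ s ^_ , unipotentTerms v v k j ⟩)
          ≈⟨ sum-cong (λ k → *-congˡ (unipotentTerms-power v v (ω-alternating v) s k j)) ⟩
        (ρ g *ᴹ ρ (transvection v s)) i j ≈⟨ ρ-∙ g (transvection v s) i j ⟨
        ρ (g ∙ˢ transvection v s) i j ≈⟨ ρ-cong (conjugate-transvection g v s) i j ⟩
        ρ (transvection gv s ∙ˢ g) i j ≈⟨ ρ-∙ (transvection gv s) g i j ⟩
        (ρ (transvection gv s) *ᴹ ρ g) i j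
          ≈⟨ sum-cong (λ k → *-congʳ (unipotentTerms-power gv gv (ω-alternating gv) s i k)) ⟨
        sum (λ k → ⟨ s ^_ , unipotentTerms gv gv i k ⟩ * ρ g k j)
          ≈⟨ pair-combinationʳ (s ^_) (λ k → ρ g k j) (unipotentTerms gv gv i) ⟨
        ⟨ s ^_ , right ⟩ ∎

    polarize : ∀ {x y a a′ c c′ : Carrier} → (a + c) + 2# * x ≈ (a′ + c′) + 2# * y → a ≈ a′ → c ≈ c′ → x ≈ y
    polarize {x} {y} {a} {a′} {c} {c′} p q r = *-cancelˡ 2≉0 (begin
      2# * x ≈⟨ solve 2 (λ s x → x := (s :+ x) :- s) refl (a + c) (2# * x) ⟩
      ((a + c) + 2# * x) - (a + c) ≈⟨ +-cong p (-‿cong (+-cong q r)) ⟩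
      ((a′ + c′) + 2# * y) - (a′ + c′) ≈⟨ solve 2 (λ s x → (s :+ x) :- s := x) refl (a′ + c′) (2# * y) ⟩
      2# * y ∎)

    *ᴹ-square : ∀ (A : Matrix n) u v i j → (A *ᴹ D (u +ᵛ v) (u +ᵛ v)) i j ≈ ((A *ᴹ D u u) i j + (A *ᴹ D v v) i j) + 2# * (A *ᴹ D u v) i j
    *ᴹ-square A u v i j = trans (*ᴹ-cong {A = A} (λ _ _ → refl) (D-square u v) i j)
      (trans (*ᴹ-distribˡ A (D u u +ᴹ D v v) (2# ∙ᴹ D u v) i j) (+-cong (*ᴹ-distribˡ A (D u u) (D v v) i j) (*ᴹ-∙ᴹ 2# A (D u v) i j)))

    square-*ᴹ : ∀ (A : Matrix n) u v i j → (D (u +ᵛ v) (u +ᵛ v) *ᴹ A) i j ≈ ((D u u *ᴹ A) i j + (D v v *ᴹ A) i j) + 2# * (D u v *ᴹ A) i j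
    square-*ᴹ A u v i j = trans (*ᴹ-cong {B = A} (D-square u v) (λ _ _ → refl) i j)
      (trans (*ᴹ-distribʳ (D u u +ᴹ D v v) (2# ∙ᴹ D u v) A i j) (+-cong (*ᴹ-distribʳ (D u u) (D v v) A i j) (∙ᴹ-*ᴹ 2# (D u v) A i j)))

  -- Polarisation: squares span the symmetric square because 2 is invertible.
  equivariant : ∀ g u v → ρ g *ᴹ D u v ≈ᴹ D (matrix g ▹ u) (matrix g ▹ v) *ᴹ ρ g
  equivariant g u v i j = polarize (begin
    _ ≈⟨ *ᴹ-square (ρ g) u v i j ⟨
    (ρ g *ᴹ D (u +ᵛ v) (u +ᵛ v)) i j ≈⟨ equivariant-square g (u +ᵛ v) i j ⟩
    (D (G ▹ (u +ᵛ v)) (G ▹ (u +ᵛ v)) *ᴹ ρ g) i j ≈⟨ *ᴹ-cong {B = ρ g} (D-cong (▹-+ G u v) (▹-+ G u v)) (λ _ _ → refl) i j ⟩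
    (D (G ▹ u +ᵛ G ▹ v) (G ▹ u +ᵛ G ▹ v) *ᴹ ρ g) i j ≈⟨ square-*ᴹ (ρ g) (G ▹ u) (G ▹ v) i j ⟩
    _ ∎) (equivariant-square g u i j) (equivariant-square g v i j)
    where G = matrix g

  -- The commutator of `X w z` and `X u v` is `X w z` acting as a derivation on the symmetric
  -- product of `u` and `v`, with X(w,z) u = ω(w,u) z + ω(z,u) w. This is its image under the
  -- differential of `ρ`.
  Bracket : Vector N → Vector N → Vector N → Vector N → Matrix n
  Bracket w z u v = (ω w u ∙ᴹ D z v +ᴹ ω w v ∙ᴹ D u z) +ᴹ (ω z u ∙ᴹ D w v +ᴹ ω z v ∙ᴹ D u w)

  private
    -- The coefficient of r in the equivariance of `D u v` under the transvection along `w` with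
    -- parameter `r`. The general bracket follows by polarising in `w`.
    bracket-square : ∀ w u v → D w w *ᴹ D u v ≈ᴹ D u v *ᴹ D w w +ᴹ Bracket w w u v
    bracket-square w u v i j = begin
      (D w w *ᴹ D u v) i j
        ≈⟨ sum-cong (λ k → *-congʳ (unipotentTerms-1 w w i k)) ⟨
      sum (λ k → ⟨ coefficient 1 , unipotentTerms w w i k ⟩ * D u v k j)
        ≈⟨ pair-combinationʳ (coefficient 1) (λ k → D u v k j) (unipotentTerms w w i) ⟨
      ⟨ coefficient 1 , left ⟩ ≈⟨ independentℕ left right equal (coefficient 1) ⟩
      ⟨ coefficient 1 , right ⟩
        ≈⟨ pair-concatSum (coefficient 1) (λ k → moving k ⊛ unipotentTerms w w k j) ⟩
      sum (λ k → ⟨ coefficient 1 , moving k ⊛ unipotentTerms w w k j ⟩)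
        ≈⟨ sum-cong first-order ⟩
      sum (λ k → B i k * 1ᴹ k j + D u v i k * D w w k j)
        ≈⟨ ∑-distrib-+ (λ k → B i k * 1ᴹ k j) (λ k → D u v i k * D w w k j) ⟩
      ⟪ B i , basis j ⟫ + (D u v *ᴹ D w w) i j
        ≈⟨ trans (+-congʳ (⟪⟫-basisʳ (B i) j)) (+-comm _ _) ⟩
      (D u v *ᴹ D w w) i j + B i j ∎
      where
      open Convolution ℕ._+_
      c = ω w u
      d = ω w v
      B = Bracket w w u v
      moving : Fin n → Terms ℕ
      -- The expansion in powers of r of `D` at the moved vectors u + 2rω(w,u) w and v + 2rω(w,v) w,
      -- by bilinearity; its linear coefficient is the bracket.
      moving k = (D u v i k , 0) ∷ (B i k , 1) ∷ (2# * 2# * c * d * D w w i k , 2) ∷ []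
      left = combination (λ k → D u v k j) (unipotentTerms w w i)
      right = concatSum λ k → moving k ⊛ unipotentTerms w w k j
      constant-term : ∀ a b c → a * 1# + (b * 0# + (c * 0# + 0#)) ≈ a
      constant-term = solve 3 (λ a b c → a :* :1 :+ (b :* :0 :+ (c :* :0 :+ :0)) := a) refl
      linear-term : ∀ a b c → a * 0# + (b * 1# + (c * 0# + 0#)) ≈ b
      linear-term = solve 3 (λ a b c → a :* :0 :+ (b :* :1 :+ (c :* :0 :+ :0)) := b) refl
      first-order : ∀ k → ⟨ coefficient 1 , moving k ⊛ unipotentTerms w w k j ⟩ ≈ B i k * 1ᴹ k j + D u v i k * D w w k j
      first-order k = trans
        (pair-derivation (coefficient 0) (coefficient 1) coefficient-1-+ (moving k) (unipotentTerms w w k j))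
        (+-cong (*-cong (linear-term _ _ _) (unipotentTerms-0 w w k j)) (*-cong (constant-term _ _ _) (unipotentTerms-1 w w k j)))
      expanded : ∀ uv r c d uw wv ww →
        (uv + 2# * r * d * uw) + 2# * r * c * (wv + 2# * r * d * ww) ≈
        uv * 1# + (((c * wv + d * uw) + (c * wv + d * uw)) * (r * 1#) + (2# * 2# * c * d * ww * (r * (r * 1#)) + 0#))
      expanded = solve 7 (λ uv r c d uw wv ww →
        (uv :+ :2 :* r :* d :* uw) :+ :2 :* r :* c :* (wv :+ :2 :* r :* d :* ww) :=
        uv :* :1 :+ (((c :* wv :+ d :* uw) :+ (c :* wv :+ d :* uw)) :* (r :* :1) :+
          (:2 :* :2 :* c :* d :* ww :* (r :* (r :* :1)) :+ :0))) refl
      moved : ∀ r k → D (matrix (transvection w r) ▹ u) (matrix (transvection w r) ▹ v) i k ≈ ⟨ r ^_ , moving k ⟩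
      moved r k = begin
        D (matrix (transvection w r) ▹ u) (matrix (transvection w r) ▹ v) i k
          ≈⟨ D-cong (transvection-▹ w r u) (transvection-▹ w r v) i k ⟩
        D (u +ᵛ (2# * r * c) ∙ᵛ w) (v +ᵛ (2# * r * d) ∙ᵛ w) i k
          ≈⟨ D-+ˡ u _ _ i k ⟩
        D u (v +ᵛ (2# * r * d) ∙ᵛ w) i k + D ((2# * r * c) ∙ᵛ w) (v +ᵛ (2# * r * d) ∙ᵛ w) i k
          ≈⟨ +-cong (shifted u) (trans (D-∙ˡ (2# * r * c) w _ i k) (*-congˡ (shifted w))) ⟩
        (D u v i k + 2# * r * d * D u w i k) + 2# * r * c * (D w v i k + 2# * r * d * D w w i k)
          ≈⟨ expanded (D u v i k) r c d (D u w i k) (D w v i k) (D w w i k) ⟩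
        ⟨ r ^_ , moving k ⟩ ∎
        where
        shifted : ∀ y → D y (v +ᵛ (2# * r * d) ∙ᵛ w) i k ≈ D y v i k + 2# * r * d * D y w i k
        shifted y = trans (D-+ʳ y v _ i k) (+-congˡ (D-∙ʳ (2# * r * d) y w i k))
      equal : ∀ r → ⟨ r ^_ , left ⟩ ≈ ⟨ r ^_ , right ⟩
      equal r = begin
        ⟨ r ^_ , left ⟩
          ≈⟨ pair-combinationʳ (r ^_) (λ k → D u v k j) (unipotentTerms w w i) ⟩
        sum (λ k → ⟨ r ^_ , unipotentTerms w w i k ⟩ * D u v k j)
          ≈⟨ sum-cong (λ k → *-congʳ (unipotentTerms-power w w (ω-alternating w) r i k)) ⟩
        (ρ (transvection w r) *ᴹ D u v) i j ≈⟨ equivariant (transvection w r) u v i j ⟩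
        (D (matrix (transvection w r) ▹ u) (matrix (transvection w r) ▹ v) *ᴹ ρ (transvection w r)) i j
          ≈⟨ sum-cong (λ k → *-cong (moved r k) (sym (unipotentTerms-power w w (ω-alternating w) r k j))) ⟩
        sum (λ k → ⟨ r ^_ , moving k ⟩ * ⟨ r ^_ , unipotentTerms w w k j ⟩)
          ≈⟨ sum-cong (λ k → pair-multiplicative (r ^_) (^-+ r) (moving k) (unipotentTerms w w k j)) ⟨
        sum (λ k → ⟨ r ^_ , moving k ⊛ unipotentTerms w w k j ⟩)
          ≈⟨ pair-concatSum (r ^_) (λ k → moving k ⊛ unipotentTerms w w k j) ⟨
        ⟨ r ^_ , right ⟩ ∎

  bracket : ∀ w z u v → D w z *ᴹ D u v ≈ᴹ D u v *ᴹ D w z +ᴹ Bracket w z u v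
  bracket w z u v i j = polarize (begin
    _ ≈⟨ square-*ᴹ (D u v) w z i j ⟨
    (D (w +ᵛ z) (w +ᵛ z) *ᴹ D u v) i j ≈⟨ bracket-square (w +ᵛ z) u v i j ⟩
    (D u v *ᴹ D (w +ᵛ z) (w +ᵛ z)) i j + Bracket (w +ᵛ z) (w +ᵛ z) u v i j
      ≈⟨ +-cong (*ᴹ-square (D u v) w z i j) (+-cong (+-cong A B) (+-cong A B)) ⟩
    _ ≈⟨ solve 11 (λ p q r wu zu wv zv Dwv Dzv Duw Duz →
           ((p :+ q) :+ :2 :* r) :+
           (((wu :+ zu) :* (Dwv :+ Dzv) :+ (wv :+ zv) :* (Duw :+ Duz)) :+ ((wu :+ zu) :* (Dwv :+ Dzv) :+ (wv :+ zv) :* (Duw :+ Duz))) :=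
           ((p :+ ((wu :* Dwv :+ wv :* Duw) :+ (wu :* Dwv :+ wv :* Duw))) :+ (q :+ ((zu :* Dzv :+ zv :* Duz) :+ (zu :* Dzv :+ zv :* Duz)))) :+
           :2 :* (r :+ ((wu :* Dzv :+ wv :* Duz) :+ (zu :* Dwv :+ zv :* Duw))))
           refl ((D u v *ᴹ D w w) i j) ((D u v *ᴹ D z z) i j) ((D u v *ᴹ D w z) i j)
           (ω w u) (ω z u) (ω w v) (ω z v) (D w v i j) (D z v i j) (D u w i j) (D u z i j) ⟩
    _ ∎) (bracket-square w u v i j) (bracket-square z u v i j)
    where
    A : ω (w +ᵛ z) u * D (w +ᵛ z) v i j ≈ (ω w u + ω z u) * (D w v i j + D z v i j)
    A = *-cong (ω-+ˡ w z u) (D-+ˡ w z v i j)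
    B : ω (w +ᵛ z) v * D u (w +ᵛ z) i j ≈ (ω w v + ω z v) * (D u w i j + D u z i j)
    B = *-cong (ω-+ˡ w z v) (D-+ʳ u w z i j)

  -- Each coordinate of the moved vector is constant in s, so its linear coefficient is zero.
  fixed⇒killed : ∀ u w (uw : ω u w ≈ 0#) v → (∀ s → ρ (unipotent u w uw s) ▹ v ≈ᵛ v) → D u w ▹ v ≈ᵛ 0ᵛ
  fixed⇒killed u w uw v fix i = begin
    (D u w ▹ v) i
      ≈⟨ sum-cong (λ j → *-congʳ (unipotentTerms-1 u w i j)) ⟨
    sum (λ j → ⟨ coefficient 1 , unipotentTerms u w i j ⟩ * v j)
      ≈⟨ pair-combinationʳ (coefficient 1) v (unipotentTerms u w i) ⟨
    ⟨ coefficient 1 , left ⟩ ≈⟨ independentℕ left ((v i , 0) ∷ []) equal (coefficient 1) ⟩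
    v i * 0# + 0# ≈⟨ trans (+-identityʳ _) (zeroʳ _) ⟩
    0# ∎
    where
    left = combination v (unipotentTerms u w i)
    equal : ∀ s → ⟨ s ^_ , left ⟩ ≈ v i * 1# + 0#
    equal s = begin
      ⟨ s ^_ , left ⟩ ≈⟨ pair-combinationʳ (s ^_) v (unipotentTerms u w i) ⟩
      sum (λ j → ⟨ s ^_ , unipotentTerms u w i j ⟩ * v j)
        ≈⟨ sum-cong (λ j → *-congʳ (unipotentTerms-power u w uw s i j)) ⟩
      (ρ (unipotent u w uw s) ▹ v) i ≈⟨ fix s i ⟩
      v i ≈⟨ trans (+-identityʳ _) (*-identityʳ _) ⟨
      v i * 1# + 0# ∎

  ι-unit : ∀ {k} (a c : Fin k) → ι (unit a c) ≈ 1ᴹ a c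
  ι-unit zero    zero    = refl
  ι-unit zero    (suc c) = refl
  ι-unit (suc a) zero    = refl
  ι-unit (suc a) (suc c) = ι-unit a c

  -- The weights ε_a of e_a and - ε_a of f_a.
  weightOf : Index → Exponent m
  weightOf (inj₁ a) c = unit a c
  weightOf (inj₂ a) c = ℤ.- unit a c

  private
    monomialAt-0 : ∀ {k} (v w : Fin k → Carrier) ν → (∀ c → ν c ≡ +0) → monomialAt v w ν ≈ 1#
    monomialAt-0 {zero}  v w ν p = refl
    monomialAt-0 {suc k} v w ν p = trans (*-cong (reflexive (≡.cong (pow (v zero) (w zero)) (p zero)))
      (monomialAt-0 (v ∘ suc) (w ∘ suc) (ν ∘ suc) (p ∘ suc))) (*-identityˡ 1#)

    monomialAt-unit : ∀ {k} (v w : Fin k → Carrier) a → monomialAt v w (unit a) ≈ v a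
    monomialAt-unit v w zero    = trans (*-cong (*-identityʳ _) (monomialAt-0 (v ∘ suc) (w ∘ suc) _ λ _ → ≡.refl)) (*-identityʳ _)
    monomialAt-unit v w (suc a) = trans (*-identityˡ _) (monomialAt-unit (v ∘ suc) (w ∘ suc) a)

    monomialAt-neg-unit : ∀ {k} (v w : Fin k → Carrier) a → monomialAt v w (λ c → ℤ.- unit a c) ≈ w a
    monomialAt-neg-unit v w zero    = trans (*-cong (*-identityʳ _) (monomialAt-0 (v ∘ suc) (w ∘ suc) _ λ _ → ≡.refl)) (*-identityʳ _)
    monomialAt-neg-unit v w (suc a) = trans (*-identityˡ _) (monomialAt-neg-unit (v ∘ suc) (w ∘ suc) a)

  monomial-weightOf : ∀ x s → monomial x (weightOf s) ≈ eigenvalue x s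
  monomial-weightOf x (inj₁ a) = monomialAt-unit (val x) (inv x) a
  monomial-weightOf x (inj₂ a) = monomialAt-neg-unit (val x) (inv x) a

  diagonal-* : ∀ {k} (s t : Vector k) i j → diagonal (λ l → s l * t l) i j ≈ s i * diagonal t i j
  diagonal-* s t zero    zero    = refl
  diagonal-* s t zero    (suc j) = sym (zeroʳ _)
  diagonal-* s t (suc i) zero    = sym (zeroʳ _)
  diagonal-* s t (suc i) (suc j) = diagonal-* (s ∘ suc) (t ∘ suc) i j

  diagonal-cong : ∀ {k} {s t : Vector k} → s ≈ᵛ t → diagonal s ≈ᴹ diagonal t
  diagonal-cong p zero    zero    = p zero
  diagonal-cong p zero    (suc j) = refl
  diagonal-cong p (suc i) zero    = refl
  diagonal-cong p (suc i) (suc j) = diagonal-cong (p ∘ suc) i j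

  row-b : ∀ s j → row (b s) j ≈ Jblock s (splitAt m j)
  row-b s j = begin
    row (b s) j ≈⟨ ⟪⟫-basisʳ (row (b s)) j ⟨
    ⟪ row (b s) , basis j ⟫ ≈⟨ ⟪row⟫ (b s) (basis j) ⟩
    ω (b s) (basis j) ≈⟨ ω-basis (join m m s) j ⟩
    J m (join m m s) j ≡⟨ ≡.cong (λ t → Jblock t (splitAt m j)) (Fin.splitAt-join m m s) ⟩
    Jblock s (splitAt m j) ∎

  1ᵇ : Index → Index → Carrier
  1ᵇ (inj₁ a) (inj₁ c) = 1ᴹ a c
  1ᵇ (inj₁ a) (inj₂ c) = 0#
  1ᵇ (inj₂ a) (inj₁ c) = 0#
  1ᵇ (inj₂ a) (inj₂ c) = 1ᴹ a c

  1ᴹ-join : ∀ s t → 1ᴹ (join m m s) (join m m t) ≈ 1ᵇ s t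
  1ᴹ-join (inj₁ a) (inj₁ c) = left a c
    where
    left : ∀ {k l} (a c : Fin k) → 1ᴹ (a ↑ˡ l) (c ↑ˡ l) ≈ 1ᴹ a c
    left zero    zero    = refl
    left zero    (suc c) = refl
    left (suc a) zero    = refl
    left (suc a) (suc c) = left a c
  1ᴹ-join (inj₂ a) (inj₂ c) = right m a c
    where
    right : ∀ l {k} (a c : Fin k) → 1ᴹ (l ↑ʳ a) (l ↑ʳ c) ≈ 1ᴹ a c
    right zero    a c = refl
    right (suc l) a c = right l a c
  1ᴹ-join (inj₁ a) (inj₂ c) = 1ᴹ-offdiagonal λ p → contra (≡.trans (≡.sym (Fin.splitAt-↑ˡ m a m)) (≡.trans (≡.cong (splitAt m) p) (Fin.splitAt-↑ʳ m m c)))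
    where
    contra : inj₁ a ≢ inj₂ c
    contra ()
  1ᴹ-join (inj₂ a) (inj₁ c) = 1ᴹ-offdiagonal λ p → contra (≡.trans (≡.sym (Fin.splitAt-↑ʳ m m a)) (≡.trans (≡.cong (splitAt m) p) (Fin.splitAt-↑ˡ m c m)))
    where
    contra : inj₂ a ≢ inj₁ c
    contra ()

  -- The sign compensates ω(f_a, e_a) = -1: X(e_a, f_a) acts by -1 on e_a and by +1 on f_a, so its
  -- negative has the eigenvalue +1 on the vector of weight ε_a.
  H : Fin m → Matrix n
  H a = (- 1#) ∙ᴹ D (b (inj₁ a)) (b (inj₂ a))

  private
    select : ∀ {k} (a c d : Fin k) → 1ᴹ a c * 1ᴹ c d ≈ 1ᴹ c a * 1ᴹ a d
    select a c d with c Fin.≟ a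
    ... | yes ≡.refl = refl
    ... | no p = trans (trans (*-congʳ (1ᴹ-offdiagonal (p ∘ ≡.sym))) (zeroˡ _)) (sym (trans (*-congʳ (1ᴹ-offdiagonal p)) (zeroˡ _)))

    cartan : ∀ a i j → diagonal (λ l → ι (weightOf (splitAt m l) a)) i j ≈ ((- 1#) ∙ᴹ X (b (inj₁ a)) (b (inj₂ a))) i j
    cartan a i j = begin
      diagonal (λ l → ι (weightOf (splitAt m l) a)) i j
        ≈⟨ diagonal-cong (λ l → sym (*-identityʳ _)) i j ⟩
      diagonal (λ l → ι (weightOf (splitAt m l) a) * 1#) i j
        ≈⟨ diagonal-* (λ l → ι (weightOf (splitAt m l) a)) (λ _ → 1#) i j ⟩
      ι (weightOf (splitAt m i) a) * 1ᴹ i j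
        ≈⟨ *-congˡ (trans (reflexive (≡.cong₂ 1ᴹ (≡.sym (Fin.join-splitAt m m i)) (≡.sym (Fin.join-splitAt m m j)))) (1ᴹ-join (splitAt m i) (splitAt m j))) ⟩
      ι (weightOf (splitAt m i) a) * 1ᵇ (splitAt m i) (splitAt m j)
        ≈⟨ blocks (splitAt m i) (splitAt m j) ⟩
      - 1# * (1ᵇ (splitAt m i) (inj₁ a) * Jblock (inj₂ a) (splitAt m j) + 1ᵇ (splitAt m i) (inj₂ a) * Jblock (inj₁ a) (splitAt m j))
        ≈⟨ *-congˡ (+-cong (*-cong (entry (inj₁ a)) (row-b (inj₂ a) j)) (*-cong (entry (inj₂ a)) (row-b (inj₁ a) j))) ⟨
      - 1# * X (b (inj₁ a)) (b (inj₂ a)) i j ∎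
      where
      entry : ∀ s → b s i ≈ 1ᵇ (splitAt m i) s
      entry s = trans (reflexive (≡.cong (λ l → 1ᴹ l (join m m s)) (≡.sym (Fin.join-splitAt m m i)))) (1ᴹ-join (splitAt m i) s)
      blocks : ∀ s t → ι (weightOf s a) * 1ᵇ s t ≈ - 1# * (1ᵇ s (inj₁ a) * Jblock (inj₂ a) t + 1ᵇ s (inj₂ a) * Jblock (inj₁ a) t)
      blocks (inj₁ c) (inj₁ d) = trans (*-congʳ (trans (ι-unit c a) (diagonal-ᵀ _ c a))) (trans (select a c d)
        (solve 2 (λ x y → x :* y := :-1 :* (x :* (:- y) :+ :0 :* :0)) refl (1ᴹ c a) (1ᴹ a d)))
      blocks (inj₁ c) (inj₂ d) = solve 3 (λ x y z → x :* :0 := :-1 :* (y :* :0 :+ :0 :* z)) refl _ (1ᴹ c a) (1ᴹ a d)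
      blocks (inj₂ c) (inj₁ d) = solve 3 (λ x y z → x :* :0 := :-1 :* (:0 :* y :+ z :* :0)) refl _ (- 1ᴹ a d) (1ᴹ c a)
      blocks (inj₂ c) (inj₂ d) = begin
        ι (ℤ.- unit c a) * 1ᴹ c d ≈⟨ *-congʳ (trans (ι-neg (unit c a)) (-‿cong (trans (ι-unit c a) (diagonal-ᵀ _ c a)))) ⟩
        - 1ᴹ a c * 1ᴹ c d ≈⟨ solve 2 (λ x y → (:- x) :* y := :-1 :* (x :* y)) refl (1ᴹ a c) (1ᴹ c d) ⟩
        - 1# * (1ᴹ a c * 1ᴹ c d) ≈⟨ *-congˡ (select a c d) ⟩
        - 1# * (1ᴹ c a * 1ᴹ a d) ≈⟨ *-congˡ (trans (+-congʳ (zeroˡ 0#)) (+-identityˡ _)) ⟨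
        - 1# * (0# * 0# + 1ᴹ c a * 1ᴹ a d) ∎

    diagonalTerms : ∀ {k} {M : Set} → (Fin k → M) → Fin k → Fin k → Terms M
    diagonalTerms w zero    zero    = (1# , w zero) ∷ []
    diagonalTerms w zero    (suc j) = []
    diagonalTerms w (suc i) zero    = []
    diagonalTerms w (suc i) (suc j) = diagonalTerms (w ∘ suc) i j

    pair-diagonalTerms : ∀ {k} {M : Set} φ (w : Fin k → M) i j → ⟨ φ , diagonalTerms w i j ⟩ ≈ diagonal (φ ∘ w) i j
    pair-diagonalTerms φ w zero    zero    = trans (+-identityʳ _) (*-identityˡ _)
    pair-diagonalTerms φ w zero    (suc j) = refl
    pair-diagonalTerms φ w (suc i) zero    = refl
    pair-diagonalTerms φ w (suc i) (suc j) = pair-diagonalTerms φ (w ∘ suc) i j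

    torusCurve : Fin N → Fin N → Terms (Exponent m)
    torusCurve = diagonalTerms λ l → weightOf (splitAt m l)

  abstract
    torusTerms : Fin n → Fin n → Terms (Exponent m)
    torusTerms i j = along _+ᵉ_ (λ _ → +0) (poly i j) torusCurve

    torusTerms-monomial : ∀ x i j → ⟨ monomial x , torusTerms i j ⟩ ≈ ρ (torusElement x) i j
    torusTerms-monomial x i j = trans
      (along-evaluate _+ᵉ_ (λ _ → +0) (monomial x) (monomial-+ x) (monomialAt-0 (val x) (inv x) _ λ _ → ≡.refl) (poly i j) torusCurve
        (matrix (torusElement x)) (λ k l → trans (pair-diagonalTerms (monomial x) _ k l) (diagonal-cong (λ l → monomial-weightOf x (splitAt m l)) k l)))
      (sym (poly-ρ i j (torusElement x)))

    -- At the identity every monomial takes the value 1, and ν ↦ ν_a is the derivation x_a ∂/∂x_a at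
    -- that point. The tangent vector of the torus curve is `H a`, taken in the defining
    -- representation.
    torusTerms-derivative : ∀ a i j → ⟨ (λ ν → ι (ν a)) , torusTerms i j ⟩ ≈ H a i j
    torusTerms-derivative a i j = begin
      ⟨ (λ ν → ι (ν a)) , torusTerms i j ⟩
        ≈⟨ along-derivative _+ᵉ_ (λ _ → +0) (λ _ → 1#) (λ _ _ → sym (*-identityˡ 1#)) refl (λ ν → ι (ν a))
             (λ ν κ → trans (ι-+ (ν a) (κ a)) (solve 2 (λ x y → x :+ y := x :* :1 :+ :1 :* y) refl (ι (ν a)) (ι (κ a)))) refl
             (poly i j) torusCurve 1ᴹ (diagonal λ l → ι (weightOf (splitAt m l) a))
             (pair-diagonalTerms (λ _ → 1#) _) (pair-diagonalTerms (λ ν → ι (ν a)) _) ⟩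
      derivative (poly i j) 1ᴹ (diagonal λ l → ι (weightOf (splitAt m l) a))
        ≈⟨ derivative-cong (poly i j) (λ _ _ → refl) (cartan a) ⟩
      derivative (poly i j) 1ᴹ ((- 1#) ∙ᴹ X (b (inj₁ a)) (b (inj₂ a)))
        ≈⟨ derivative-∙ (poly i j) 1ᴹ (- 1#) (X (b (inj₁ a)) (b (inj₂ a))) ⟩
      H a i j ∎

  -- The factors stand in reversed order, as commutativity of the torus allows, so that
  -- differentiation in `y` places `H a` on the left.
  torusElement-*ᵗ : ∀ x y → matrix (torusElement (x *ᵗ y)) ≈ᴹ matrix (torusElement y ∙ˢ torusElement x)
  torusElement-*ᵗ x y i j = begin
    diagonal (λ l → eigenvalue (x *ᵗ y) (splitAt m l)) i j
      ≈⟨ diagonal-cong (λ l → split (splitAt m l)) i j ⟩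
    diagonal (λ l → eigenvalue y (splitAt m l) * eigenvalue x (splitAt m l)) i j
      ≈⟨ diagonal-* (λ l → eigenvalue y (splitAt m l)) (λ l → eigenvalue x (splitAt m l)) i j ⟩
    eigenvalue y (splitAt m i) * diagonal (λ l → eigenvalue x (splitAt m l)) i j
      ≈⟨ sum-diagonal (λ l → eigenvalue y (splitAt m l)) (λ k → matrix (torusElement x) k j) i ⟨
    matrix (torusElement y ∙ˢ torusElement x) i j ∎
    where
    split : ∀ s → eigenvalue (x *ᵗ y) s ≈ eigenvalue y s * eigenvalue x s
    split (inj₁ a) = *-comm _ _
    split (inj₂ a) = *-comm _ _

  -- For fixed x, both sides of ρ(xy) = ρ(y) ρ(x) are Laurent polynomials in y. They agree at all y,
  -- hence so do their derivatives at y = 1.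
  torusTerms-θ : ∀ x a i j → ⟨ (λ ν → ι (ν a) * monomial x ν) , torusTerms i j ⟩ ≈ (H a *ᴹ ρ (torusElement x)) i j
  torusTerms-θ x a i j = begin
    ⟨ (λ ν → ι (ν a) * monomial x ν) , torusTerms i j ⟩
      ≈⟨ pair-cong (torusTerms i j) (λ ν → *-comm _ _) ⟩
    ⟨ (λ ν → monomial x ν * ι (ν a)) , torusTerms i j ⟩
      ≈⟨ pair-weighted (monomial x) (λ ν → ι (ν a)) (torusTerms i j) ⟨
    ⟨ (λ ν → ι (ν a)) , weighted (monomial x) (torusTerms i j) ⟩
      ≈⟨ independent-≈ (weighted (monomial x) (torusTerms i j)) right equal (λ ν → ι (ν a)) (λ p → reflexive (≡.cong ι (p a))) ⟩
    ⟨ (λ ν → ι (ν a)) , right ⟩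
      ≈⟨ pair-combinationʳ (λ ν → ι (ν a)) (λ k → ρ (torusElement x) k j) (torusTerms i) ⟩
    sum (λ k → ⟨ (λ ν → ι (ν a)) , torusTerms i k ⟩ * ρ (torusElement x) k j)
      ≈⟨ sum-cong (λ k → *-congʳ (torusTerms-derivative a i k)) ⟩
    (H a *ᴹ ρ (torusElement x)) i j ∎
    where
    right = combination (λ k → ρ (torusElement x) k j) (torusTerms i)
    equal : ∀ y → ⟨ monomial y , weighted (monomial x) (torusTerms i j) ⟩ ≈ ⟨ monomial y , right ⟩
    equal y = begin
      ⟨ monomial y , weighted (monomial x) (torusTerms i j) ⟩ ≈⟨ pair-weighted (monomial x) (monomial y) (torusTerms i j) ⟩
      ⟨ (λ ν → monomial x ν * monomial y ν) , torusTerms i j ⟩ ≈⟨ pair-cong (torusTerms i j) (monomial-*ᵗ x y) ⟨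
      ⟨ monomial (x *ᵗ y) , torusTerms i j ⟩ ≈⟨ torusTerms-monomial (x *ᵗ y) i j ⟩
      ρ (torusElement (x *ᵗ y)) i j ≈⟨ ρ-cong (torusElement-*ᵗ x y) i j ⟩
      ρ (torusElement y ∙ˢ torusElement x) i j ≈⟨ ρ-∙ (torusElement y) (torusElement x) i j ⟩
      (ρ (torusElement y) *ᴹ ρ (torusElement x)) i j ≈⟨ sum-cong (λ k → *-congʳ (torusTerms-monomial y i k)) ⟨
      sum (λ k → ⟨ monomial y , torusTerms i k ⟩ * ρ (torusElement x) k j)
        ≈⟨ pair-combinationʳ (monomial y) (λ k → ρ (torusElement x) k j) (torusTerms i) ⟨
      ⟨ monomial y , right ⟩ ∎

  torusElement-b : ∀ x s → matrix (torusElement x) ▹ b s ≈ᵛ eigenvalue x s ∙ᵛ b s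
  torusElement-b x s i = begin
    (matrix (torusElement x) ▹ b s) i
      ≈⟨ sum-diagonal (λ l → eigenvalue x (splitAt m l)) (b s) i ⟩
    eigenvalue x (splitAt m i) * 1ᴹ i (join m m s)
      ≈⟨ same (i Fin.≟ join m m s) ⟩
    eigenvalue x s * 1ᴹ i (join m m s) ∎
    where
    same : Dec (i ≡ join m m s) → eigenvalue x (splitAt m i) * 1ᴹ i (join m m s) ≈ eigenvalue x s * 1ᴹ i (join m m s)
    same (yes p) = *-congʳ (reflexive (≡.cong (eigenvalue x) (≡.trans (≡.cong (splitAt m) p) (Fin.splitAt-join m m s))))
    same (no p)  = trans (trans (*-congˡ (1ᴹ-offdiagonal p)) (zeroʳ _)) (sym (trans (*-congˡ (1ᴹ-offdiagonal p)) (zeroʳ _)))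

  torus-D : ∀ x s t → ρ (torusElement x) *ᴹ D (b s) (b t) ≈ᴹ (eigenvalue x s * eigenvalue x t) ∙ᴹ (D (b s) (b t) *ᴹ ρ (torusElement x))
  torus-D x s t i j = begin
    (R *ᴹ D (b s) (b t)) i j ≈⟨ equivariant (torusElement x) (b s) (b t) i j ⟩
    (D (matrix (torusElement x) ▹ b s) (matrix (torusElement x) ▹ b t) *ᴹ R) i j
      ≈⟨ *ᴹ-cong {B = R} (λ k l → trans (D-cong (torusElement-b x s) (torusElement-b x t) k l)
           (trans (D-∙ˡ (eigenvalue x s) (b s) _ k l) (trans (*-congˡ (D-∙ʳ (eigenvalue x t) (b s) (b t) k l)) (sym (*-assoc _ _ _))))) (λ _ _ → refl) i j ⟩
    (((eigenvalue x s * eigenvalue x t) ∙ᴹ D (b s) (b t)) *ᴹ R) i j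
      ≈⟨ ∙ᴹ-*ᴹ (eigenvalue x s * eigenvalue x t) (D (b s) (b t)) R i j ⟩
    eigenvalue x s * eigenvalue x t * (D (b s) (b t) *ᴹ R) i j ∎
    where R = ρ (torusElement x)

-- The dominance order

module Dominance where
  psum : ∀ {m} → Exponent m → ℕ → ℤ
  psum ν zero              = +0
  psum {zero}  ν (suc k)   = +0
  psum {suc m} ν (suc k)   = ν zero ℤ.+ psum (ν ∘ suc) k

  infix 4 _≼_ _≺_
  -- The partial sums of μ - ν are its coefficients in the simple roots ε_k - ε_{k+1} and 2ε_m, up
  -- to a factor 2 at the last one. So this is dominance with rational coefficients, without the
  -- parity condition of the root lattice.
  _≼_ : ∀ {m} → Exponent m → Exponent m → Set
  ν ≼ μ = ∀ k → psum ν k ℤ.≤ psum μ k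

  _≺_ : ∀ {m} → Exponent m → Exponent m → Set
  ν ≺ μ = ν ≼ μ × ∃ λ k → psum ν k ℤ.< psum μ k

  psum-cong : ∀ {m} {ν κ : Exponent m} → ν ≗ κ → ∀ k → psum ν k ≡ psum κ k
  psum-cong         p zero    = ≡.refl
  psum-cong {zero}  p (suc k) = ≡.refl
  psum-cong {suc m} p (suc k) = ≡.cong₂ ℤ._+_ (p zero) (psum-cong (p ∘ suc) k)

  psum-+ : ∀ {m} (ν κ : Exponent m) k → psum (λ a → ν a ℤ.+ κ a) k ≡ psum ν k ℤ.+ psum κ k
  psum-+         ν κ zero    = ≡.refl
  psum-+ {zero}  ν κ (suc k) = ≡.refl
  psum-+ {suc m} ν κ (suc k) = ≡.trans (≡.cong (λ z → ν zero ℤ.+ κ zero ℤ.+ z) (psum-+ (ν ∘ suc) (κ ∘ suc) k))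
    (ℤsolve 4 (λ a b c d → a ⊞ b ⊞ (c ⊞ d) ⊜ (a ⊞ c) ⊞ (b ⊞ d)) ≡.refl (ν zero) (κ zero) (psum (ν ∘ suc) k) (psum (κ ∘ suc) k))

  psum-neg : ∀ {m} (ν : Exponent m) k → psum (λ a → ℤ.- ν a) k ≡ ℤ.- psum ν k
  psum-neg         ν zero    = ≡.refl
  psum-neg {zero}  ν (suc k) = ≡.refl
  psum-neg {suc m} ν (suc k) = ≡.trans (≡.cong (λ z → ℤ.- ν zero ℤ.+ z) (psum-neg (ν ∘ suc) k)) (≡.sym (ℤ.neg-distrib-+ (ν zero) _))

  ≼-refl : ∀ {m} (ν : Exponent m) → ν ≼ ν
  ≼-refl ν k = ℤ.≤-refl

  Negative : ∀ {m} → Exponent m → Set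
  Negative σ = (∀ k → psum σ k ℤ.≤ +0) × ∃ λ k → psum σ k ℤ.< +0

  +-≼-≺ : ∀ {m} (σ ν μ : Exponent m) → Negative σ → ν ≼ μ → (λ a → σ a ℤ.+ ν a) ≺ μ
  +-≼-≺ {m} σ ν μ (σ≤ , k , σ<) ν≤ =
    (λ l → ≡.subst₂ ℤ._≤_ (≡.sym (psum-+ σ ν l)) (ℤ.+-identityˡ _) (ℤ.+-mono-≤ (σ≤ l) (ν≤ l))) ,
    k , ≡.subst₂ ℤ._<_ (≡.sym (psum-+ σ ν k)) (ℤ.+-identityˡ _) (ℤ.+-mono-<-≤ σ< (ν≤ k))

  ≺⇒≭ : ∀ {m} {ν μ : Exponent m} → ν ≺ μ → ¬ ν ≗ μ
  ≺⇒≭ (_ , k , lt) p = ℤ.<-irrefl (psum-cong p k) lt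

  psum-0 : ∀ {m} k → psum {m} (λ _ → +0) k ≡ +0
  psum-0         zero    = ≡.refl
  psum-0 {zero}  (suc k) = ≡.refl
  psum-0 {suc m} (suc k) = ≡.trans (ℤ.+-identityˡ _) (psum-0 {m} k)

  private
    psum-unit-zero : ∀ {m} k → psum (unit {suc m} zero) (suc k) ≡ + 1
    psum-unit-zero k = ≡.cong (λ z → + 1 ℤ.+ z) (psum-0 k)

    psum-unit-suc : ∀ {m} (a : Fin m) k → psum (unit (suc a)) (suc k) ≡ psum (unit a) k
    psum-unit-suc a k = ℤ.+-identityˡ _

    psum-unit-nonneg : ∀ {m} (a : Fin m) k → +0 ℤ.≤ psum (unit a) k
    psum-unit-nonneg a       zero    = ℤ.≤-refl
    psum-unit-nonneg zero    (suc k) = ≡.subst (+0 ℤ.≤_) (≡.sym (psum-unit-zero k)) (ℤ.+≤+ ℕ.z≤n)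
    psum-unit-nonneg (suc a) (suc k) = ≡.subst (+0 ℤ.≤_) (≡.sym (psum-unit-suc a k)) (psum-unit-nonneg a k)

    psum-unit≤1 : ∀ {m} (a : Fin m) k → psum (unit a) k ℤ.≤ + 1
    psum-unit≤1 a       zero    = ℤ.+≤+ ℕ.z≤n
    psum-unit≤1 zero    (suc k) = ℤ.≤-reflexive (psum-unit-zero k)
    psum-unit≤1 (suc a) (suc k) = ≡.subst (ℤ._≤ + 1) (≡.sym (psum-unit-suc a k)) (psum-unit≤1 a k)

    psum-unit-antitone : ∀ {m} (a c : Fin m) k → c Fin.≤ a → psum (unit a) k ℤ.≤ psum (unit c) k
    psum-unit-antitone a       c       zero    p = ℤ.≤-refl
    psum-unit-antitone a       zero    (suc k) p = ≡.subst (psum (unit a) (suc k) ℤ.≤_) (≡.sym (psum-unit-zero k)) (psum-unit≤1 a (suc k))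
    psum-unit-antitone (suc a) (suc c) (suc k) (ℕ.s≤s p) = ≡.subst₂ ℤ._≤_ (≡.sym (psum-unit-suc a k)) (≡.sym (psum-unit-suc c k)) (psum-unit-antitone a c k p)

    psum-unit-at : ∀ {m} (a : Fin m) → psum (unit a) (suc (toℕ a)) ≡ + 1
    psum-unit-at zero    = ≡.refl
    psum-unit-at (suc a) = ≡.trans (psum-unit-suc a (suc (toℕ a))) (psum-unit-at a)

    psum-unit-before : ∀ {m} (a c : Fin m) → c Fin.< a → psum (unit a) (suc (toℕ c)) ≡ +0
    psum-unit-before (suc a) zero    p = ≡.refl
    psum-unit-before (suc a) (suc c) (ℕ.s≤s p) = ≡.trans (psum-unit-suc a (suc (toℕ c))) (psum-unit-before a c p)

    neg≤0 : ∀ {i} → +0 ℤ.≤ i → ℤ.- i ℤ.≤ +0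
    neg≤0 = ℤ.neg-mono-≤

  -- The negative roots -ε_a - ε_c, where `a = c` gives the long root -2ε_a. The other negative
  -- roots are handled by `negative-ef`.
  negative-ff : ∀ {m} (a c : Fin m) → Negative (λ d → ℤ.- unit a d ℤ.+ ℤ.- unit c d)
  negative-ff a c = (λ k → ≡.subst (ℤ._≤ +0) (≡.sym (eq k)) (ℤ.+-mono-≤ (neg≤0 (psum-unit-nonneg a k)) (neg≤0 (psum-unit-nonneg c k)))) ,
    suc (toℕ a) , ≡.subst (ℤ._< +0) (≡.sym (≡.trans (eq (suc (toℕ a))) (≡.cong (λ z → ℤ.- z ℤ.+ ℤ.- psum (unit c) (suc (toℕ a))) (psum-unit-at a))))
      (ℤ.+-mono-<-≤ ℤ.-<+ (neg≤0 (psum-unit-nonneg c (suc (toℕ a)))))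
    where
    eq : ∀ k → psum (λ d → ℤ.- unit a d ℤ.+ ℤ.- unit c d) k ≡ ℤ.- psum (unit a) k ℤ.+ ℤ.- psum (unit c) k
    eq k = ≡.trans (psum-+ _ _ k) (≡.cong₂ ℤ._+_ (psum-neg (unit a) k) (psum-neg (unit c) k))

  negative-ef : ∀ {m} (a c : Fin m) → c Fin.< a → Negative (λ d → unit a d ℤ.+ ℤ.- unit c d)
  negative-ef a c p = (λ k → ≡.subst (ℤ._≤ +0) (≡.sym (eq k)) (ℤ.i≤j⇒i-j≤0 (psum-unit-antitone a c k (ℕ.<⇒≤ p)))) ,
    suc (toℕ c) , ≡.subst (ℤ._< +0) (≡.sym (≡.trans (eq (suc (toℕ c))) (≡.cong₂ (λ y z → y ℤ.+ ℤ.- z) (psum-unit-before a c p) (psum-unit-at c)))) ℤ.-<+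
    where
    eq : ∀ k → psum (λ d → unit a d ℤ.+ ℤ.- unit c d) k ≡ psum (unit a) k ℤ.+ ℤ.- psum (unit c) k
    eq k = ≡.trans (psum-+ _ _ k) (≡.cong (λ z → psum (unit a) k ℤ.+ z) (psum-neg (unit c) k))

-- Highest weight modules

module HighestWeightModule (K : CommutativeRing 0ℓ 0ℓ) (F : IsCharZeroField K) {m n : ℕ}
                 (V : Symplectic.Representation K m n) where
  open CommutativeRing K hiding (zero)
  open Arithmetic K
  open FieldArithmetic K F
  open LinearAlgebra K
  open FormalSums K
  open Powers K
  open LinearIndependence K F
  open PowerSums K F
  open SymplecticForm K F m
  open LieAction K F V
  open Dominance
  open Symplectic K using (_^_; matrix; Jblock; val; inv; torusElement; eigenvalue; weight; character; IsInvariantSubspace; IsIrreducible; HasHighestWeight; IsPositiveUnipotent)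
  open Symplectic.Representation V using (ρ)
  open SetoidReasoning setoid

  record IsSubspace (W : Vector n → Set) : Set where
    field
      respects : ∀ {v w} → v ≈ᵛ w → W v → W w
      zero∈    : W 0ᵛ
      +-closed : ∀ {v w} → W v → W w → W (v +ᵛ w)
      ∙-closed : ∀ a {v} → W v → W (a ∙ᵛ v)

    sum-closed : ∀ {k} (v : Fin k → Vector n) → (∀ l → W (v l)) → W (λ i → sum λ l → v l i)
    sum-closed {zero}  v p = zero∈
    sum-closed {suc k} v p = +-closed (p zero) (sum-closed (v ∘ suc) (p ∘ suc))

  module _ {W : Vector n → Set} (isSubspace : IsSubspace W) (closed : ∀ v {w} → W w → W (D v v ▹ w)) where
    open IsSubspace isSubspace

    private
      module _ (v : Vector N) where
        U = unipotentTerms v v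

        Q : ℕ → Matrix n
        Q k i j = ⟨ coefficient k , U i j ⟩

        -- The coefficient of s^k in d/ds ρ(τ_v(s)) = D(v,v) ρ(τ_v(s)). Hence `Q k` is the divided
        -- power D(v,v)^k / k! and transvections act by a terminating exponential series.
        Q-recurrence : ∀ k i j → ι (+ suc k) * Q (suc k) i j ≈ (D v v *ᴹ Q k) i j
        Q-recurrence k i j = begin
          ι (+ suc k) * Q (suc k) i j
            ≈⟨ pair-* (ι (+ suc k)) (coefficient (suc k)) (U i j) ⟨
          ⟨ (λ e → ι (+ suc k) * coefficient (suc k) e) , U i j ⟩
            ≈⟨ pair-cong (U i j) shift ⟩
          ⟨ (λ e → ι (+ e) * coefficient k (ℕ.pred e)) , U i j ⟩
            ≈⟨ left-pair (coefficient k) ⟨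
          ⟨ coefficient k , left ⟩
            ≈⟨ independentℕ left right equal (coefficient k) ⟩
          ⟨ coefficient k , right ⟩
            ≈⟨ pair-combination (coefficient k) (D v v i) (λ l → U l j) ⟩
          (D v v *ᴹ Q k) i j ∎
          where
          left = reindex ℕ.pred (weighted (λ e → ι (+ e)) (U i j))
          right = combination (D v v i) (λ l → U l j)
          left-pair : ∀ φ → ⟨ φ , left ⟩ ≈ ⟨ (λ e → ι (+ e) * φ (ℕ.pred e)) , U i j ⟩
          left-pair φ = trans (pair-reindex ℕ.pred φ (weighted (λ e → ι (+ e)) (U i j))) (pair-weighted (λ e → ι (+ e)) (φ ∘ ℕ.pred) (U i j))
          coefficient-≢ : ∀ k l → k ≢ l → coefficient k l ≈ 0#
          coefficient-≢ zero    zero    p = ⊥-elim (p ≡.refl)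
          coefficient-≢ zero    (suc l) p = refl
          coefficient-≢ (suc k) zero    p = refl
          coefficient-≢ (suc k) (suc l) p = coefficient-≢ k l (p ∘ ≡.cong suc)
          shift : ∀ e → ι (+ suc k) * coefficient (suc k) e ≈ ι (+ e) * coefficient k (ℕ.pred e)
          shift zero    = trans (zeroʳ _) (sym (zeroˡ _))
          shift (suc e) with k ℕ.≟ e
          ... | yes ≡.refl = refl
          ... | no p = trans (*-congˡ (coefficient-≢ k e p)) (trans (zeroʳ _) (sym (trans (*-congˡ (coefficient-≢ k e p)) (zeroʳ _))))
          equal : ∀ s → ⟨ s ^_ , left ⟩ ≈ ⟨ s ^_ , right ⟩
          equal s = begin
            ⟨ s ^_ , left ⟩ ≈⟨ left-pair (s ^_) ⟩
            ⟨ power-derivative s , U i j ⟩ ≈⟨ transvectionTerms-derivative v s i j ⟩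
            (D v v *ᴹ ρ (transvection v s)) i j
              ≈⟨ sum-cong (λ l → *-congˡ (unipotentTerms-power v v (ω-alternating v) s l j)) ⟨
            sum (λ l → D v v i l * ⟨ s ^_ , U l j ⟩)
              ≈⟨ pair-combination (s ^_) (D v v i) (λ l → U l j) ⟨
            ⟨ s ^_ , right ⟩ ∎

        Q-closed : ∀ k {w} → W w → W (Q k ▹ w)
        Q-closed zero    {w} p = respects (λ i → sym (trans (▹-cong (unipotentTerms-0 v v) (λ _ → refl) i) (1ᴹ-▹ w i))) p
        Q-closed (suc k) {w} p = respects divided (∙-closed c (closed v (Q-closed k p)))
          where
          k+1≉0 : ¬ ι (+ suc k) ≈ 0#
          k+1≉0 = ι-nonzero {+ suc k} λ ()
          c = proj₁ (inverse (ι (+ suc k)) k+1≉0)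
          divided : c ∙ᵛ (D v v ▹ (Q k ▹ w)) ≈ᵛ Q (suc k) ▹ w
          divided i = begin
            c * (D v v ▹ (Q k ▹ w)) i ≈⟨ *-congˡ (*ᴹ-▹ (D v v) (Q k) w i) ⟨
            c * ((D v v *ᴹ Q k) ▹ w) i ≈⟨ *-congˡ (▹-cong (Q-recurrence k) (λ _ → refl) i) ⟨
            c * ((ι (+ suc k) ∙ᴹ Q (suc k)) ▹ w) i ≈⟨ *-congˡ (∙ᴹ-▹ (ι (+ suc k)) (Q (suc k)) w i) ⟩
            c * (ι (+ suc k) * (Q (suc k) ▹ w) i) ≈⟨ solve 3 (λ c k x → c :* (k :* x) := (k :* c) :* x) refl c (ι (+ suc k)) _ ⟩
            (ι (+ suc k) * c) * (Q (suc k) ▹ w) i ≈⟨ *-congʳ (proj₂ (inverse (ι (+ suc k)) k+1≉0)) ⟩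
            1# * (Q (suc k) ▹ w) i ≈⟨ *-identityˡ _ ⟩
            (Q (suc k) ▹ w) i ∎

        finiteBound : ∀ {k} (f : Fin k → ℕ) → ∃ λ B → ∀ i → f i ℕ.≤ B
        finiteBound {zero}  f = 0 , λ ()
        finiteBound {suc k} f with finiteBound (f ∘ suc)
        ... | B , p = f zero ℕ.⊔ B , λ { zero → ℕ.m≤m⊔n (f zero) B ; (suc i) → ℕ.≤-trans (p i) (ℕ.m≤n⊔m (f zero) B) }

        -- One bound for all entries, so that the exponential is a single finite combination of the
        -- matrices `Q k`.
        degree : ∃ λ d → ∀ i j → AllExp (ℕ._< d) (U i j)
        degree = proj₁ total , λ i j → All.map (λ lt → ℕ.≤-trans lt (ℕ.≤-trans (proj₂ (rows i) j) (proj₂ total i))) (proj₂ (exponentBound (U i j)))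
          where
          rows : ∀ i → ∃ λ B → ∀ j → proj₁ (exponentBound (U i j)) ℕ.≤ B
          rows i = finiteBound λ j → proj₁ (exponentBound (U i j))
          total : ∃ λ B → ∀ i → proj₁ (rows i) ℕ.≤ B
          total = finiteBound λ i → proj₁ (rows i)

      transvection-closed : ∀ v s {w} → W w → W (ρ (transvection v s) ▹ w)
      transvection-closed v s {w} p = respects expanded
        (sum-closed {d} (λ k → s ^ toℕ k ∙ᵛ (Q v (toℕ k) ▹ w)) λ k → ∙-closed (s ^ toℕ k) (Q-closed v (toℕ k) p))
        where
        d : ℕ
        d = proj₁ (degree v)
        expanded : (λ i → sum {d} λ k → s ^ toℕ k * (Q v (toℕ k) ▹ w) i) ≈ᵛ ρ (transvection v s) ▹ w
        expanded i = begin
          sum {d} (λ k → s ^ toℕ k * sum λ j → Q v (toℕ k) i j * w j)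
            ≈⟨ sum-cong {d} (λ k → *-distribˡ-sum (s ^ toℕ k) (λ j → Q v (toℕ k) i j * w j)) ⟩
          sum {d} (λ k → sum λ j → s ^ toℕ k * (Q v (toℕ k) i j * w j))
            ≈⟨ ∑-comm {d} (λ k j → s ^ toℕ k * (Q v (toℕ k) i j * w j)) ⟩
          sum (λ j → sum {d} λ k → s ^ toℕ k * (Q v (toℕ k) i j * w j))
            ≈⟨ sum-cong (λ j → trans (sum-cong {d} λ k → sym (*-assoc (s ^ toℕ k) (Q v (toℕ k) i j) (w j)))
                 (sym (*-distribʳ-sum {d} (w j) (λ k → s ^ toℕ k * Q v (toℕ k) i j)))) ⟩
          sum (λ j → sum {d} (λ k → s ^ toℕ k * Q v (toℕ k) i j) * w j)
            ≈⟨ sum-cong (λ j → *-congʳ (trans (sym (expand-coefficients d (s ^_) (U v i j) (proj₂ (degree v) i j)))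
                 (unipotentTerms-power v v (ω-alternating v) s i j))) ⟩
          (ρ (transvection v s) ▹ w) i ∎

    -- Stability under the operators `D v v` gives stability under their exponentials, the
    -- transvections, and these generate the group. A transvection is stripped off by applying the
    -- one with the opposite parameter.
    group-closed : ∀ g {w} → W w → W (ρ g ▹ w)
    group-closed = Generation.generation (λ g → ∀ {w} → W w → W (ρ g ▹ w))
      (λ g h p Pg {w} Ww → respects (▹-cong (ρ-cong p) (λ _ → refl)) (Pg Ww))
      (λ {w} Ww → respects (λ i → sym (trans (▹-cong ρ-1 (λ _ → refl) i) (1ᴹ-▹ w i))) Ww)
      (λ v s g P {w} Ww → respects (λ i → begin
        (ρ (transvection v (- s)) ▹ (ρ (transvection v s ∙ˢ g) ▹ w)) i
          ≈⟨ *ᴹ-▹ (ρ (transvection v (- s))) (ρ (transvection v s ∙ˢ g)) w i ⟨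
        ((ρ (transvection v (- s)) *ᴹ ρ (transvection v s ∙ˢ g)) ▹ w) i
          ≈⟨ ▹-cong (λ k l → trans (sym (ρ-∙ (transvection v (- s)) (transvection v s ∙ˢ g) k l)) (ρ-cong (cancel v s g) k l)) (λ _ → refl) i ⟩
        (ρ g ▹ w) i ∎) (transvection-closed v (- s) (P Ww)))
      where
      cancel : ∀ v s g → matrix (transvection v (- s) ∙ˢ (transvection v s ∙ˢ g)) ≈ᴹ matrix g
      cancel v s g i j = begin
        matrix (transvection v (- s) ∙ˢ (transvection v s ∙ˢ g)) i j
          ≈⟨ *ᴹ-assoc (matrix (transvection v (- s))) (matrix (transvection v s)) (matrix g) i j ⟨
        (matrix (transvection v (- s) ∙ˢ transvection v s) *ᴹ matrix g) i j
          ≈⟨ *ᴹ-cong {B = matrix g} (λ k l → trans (add-parameters v s (- s) k l)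
               (solve 3 (λ a s x → (a :+ s :* x) :+ (:- s) :* x := a) refl (1ᴹ k l) s (X v v k l))) (λ _ _ → refl) i j ⟩
        (1ᴹ *ᴹ matrix g) i j
          ≈⟨ 1ᴹ-▹ (λ k → matrix g k j) i ⟩
        matrix g i j ∎

    isInvariantSubspace : IsInvariantSubspace V W
    isInvariantSubspace = record
      { respects = respects ; zero∈ = zero∈ ; +-closed = +-closed ; ∙-closed = ∙-closed ; invariant = group-closed }

  module HighestWeight (irreducible : IsIrreducible V) (μ : Partition m) (highestWeight : HasHighestWeight V μ) where
    open HasHighestWeight highestWeight using (eigenvalues; nonzero) renaming (vector to v; unipotent to unipotent-v)
    open IsIrreducible irreducible using (simple)

    μᵉ : Exponent m
    μᵉ a = + Partition.part μ a

    weight-monomial : ∀ x → weight μ x ≈ monomial x μᵉ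
    weight-monomial x = go (val x) (inv x) (Partition.part μ)
      where
      open Symplectic K using (product)
      go : ∀ {k} (v w : Fin k → Carrier) (p : Fin k → ℕ) → product (λ i → v i ^ p i) ≈ monomialAt v w (λ i → + p i)
      go {zero}  v w p = refl
      go {suc k} v w p = *-congˡ (go (v ∘ suc) (w ∘ suc) (p ∘ suc))

    torus-v : ∀ x i → (ρ (torusElement x) ▹ v) i ≈ monomial x μᵉ * v i
    torus-v x i = trans (eigenvalues x i) (*-congʳ (weight-monomial x))

    H-v : ∀ a → H a ▹ v ≈ᵛ ι (μᵉ a) ∙ᵛ v
    H-v a i = begin
      (H a ▹ v) i ≈⟨ sum-cong (λ j → *-congʳ (torusTerms-derivative a i j)) ⟨
      sum (λ j → ⟨ (λ ν → ι (ν a)) , torusTerms i j ⟩ * v j)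
        ≈⟨ pair-combinationʳ (λ ν → ι (ν a)) v (torusTerms i) ⟨
      ⟨ (λ ν → ι (ν a)) , left ⟩
        ≈⟨ independent-≈ left ((v i , μᵉ) ∷ []) equal (λ ν → ι (ν a)) (λ p → reflexive (≡.cong ι (p a))) ⟩
      v i * ι (μᵉ a) + 0# ≈⟨ trans (+-identityʳ _) (*-comm _ _) ⟩
      ι (μᵉ a) * v i ∎
      where
      left = combination v (torusTerms i)
      equal : ∀ x → ⟨ monomial x , left ⟩ ≈ v i * monomial x μᵉ + 0#
      equal x = begin
        ⟨ monomial x , left ⟩ ≈⟨ pair-combinationʳ (monomial x) v (torusTerms i) ⟩
        sum (λ j → ⟨ monomial x , torusTerms i j ⟩ * v j) ≈⟨ sum-cong (λ j → *-congʳ (torusTerms-monomial x i j)) ⟩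
        (ρ (torusElement x) ▹ v) i ≈⟨ torus-v x i ⟩
        monomial x μᵉ * v i ≈⟨ trans (+-identityʳ _) (*-comm _ _) ⟨
        v i * monomial x μᵉ + 0# ∎

    private
      0≈-0 : - 0# ≈ 0#
      0≈-0 = solve 0 (:- :0 := :0) refl

      ω-ee : ∀ p q → ω (b (inj₁ p)) (b (inj₁ q)) ≈ 0#
      ω-ee p q = ω-b (inj₁ p) (inj₁ q)

      ω-ef : ∀ p q → p ≢ q → ω (b (inj₁ p)) (b (inj₂ q)) ≈ 0#
      ω-ef p q p≢q = trans (ω-b (inj₁ p) (inj₂ q)) (1ᴹ-offdiagonal p≢q)

      row-e : ∀ p c → row (b (inj₁ p)) (c ↑ˡ m) ≈ 0#
      row-e p c = trans (row-b (inj₁ p) (c ↑ˡ m)) (reflexive (≡.cong (Jblock (inj₁ p)) (Fin.splitAt-↑ˡ m c m)))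

      row-f : ∀ q c → row (b (inj₂ q)) (c ↑ˡ m) ≈ - 1ᴹ q c
      row-f q c = trans (row-b (inj₂ q) (c ↑ˡ m)) (reflexive (≡.cong (Jblock (inj₂ q)) (Fin.splitAt-↑ˡ m c m)))

      vanishing : ∀ (i j : Fin N) {x} s u w → X u w i j ≈ 0# → 1ᴹ i j ≈ x → unipotentMatrix u w s i j ≈ x
      vanishing i j s u w p q = trans (+-cong q (trans (*-congˡ p) (zeroʳ s))) (+-identityʳ _)

      positive-ee : ∀ p q s → IsPositiveUnipotent (unipotent (b (inj₁ p)) (b (inj₁ q)) (ω-ee p q) s)
      positive-ee p q s = record
        { upperLeft = λ {a} {c} _ → vanishing (a ↑ˡ m) (c ↑ˡ m) s (b (inj₁ p)) (b (inj₁ q)) (X-0 (a ↑ˡ m) c) (1ᴹ-join (inj₁ a) (inj₁ c))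
        ; lowerLeft = λ a c → vanishing (m ↑ʳ a) (c ↑ˡ m) s (b (inj₁ p)) (b (inj₁ q)) (X-0 (m ↑ʳ a) c) (1ᴹ-join (inj₂ a) (inj₁ c)) }
        where
        X-0 : ∀ i c → X (b (inj₁ p)) (b (inj₁ q)) i (c ↑ˡ m) ≈ 0#
        X-0 i c = trans (+-cong (trans (*-congˡ (row-e q c)) (zeroʳ _)) (trans (*-congˡ (row-e p c)) (zeroʳ _))) (+-identityˡ 0#)

      positive-ef : ∀ p q (p<q : p Fin.< q) s → IsPositiveUnipotent (unipotent (b (inj₁ p)) (b (inj₂ q)) (ω-ef p q (Fin.<⇒≢ p<q)) s)
      positive-ef p q p<q s = record
        { upperLeft = λ {a} {c} c≤a → vanishing (a ↑ˡ m) (c ↑ˡ m) s (b (inj₁ p)) (b (inj₂ q)) (trans (X-col (a ↑ˡ m) c) (trans (*-congʳ (1ᴹ-join (inj₁ a) (inj₁ p))) (corner a c c≤a))) (1ᴹ-join (inj₁ a) (inj₁ c))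
        ; lowerLeft = λ a c → vanishing (m ↑ʳ a) (c ↑ˡ m) s (b (inj₁ p)) (b (inj₂ q)) (trans (X-col (m ↑ʳ a) c) (trans (*-congʳ (1ᴹ-join (inj₂ a) (inj₁ p))) (zeroˡ _))) (1ᴹ-join (inj₂ a) (inj₁ c)) }
        where
        X-col : ∀ i c → X (b (inj₁ p)) (b (inj₂ q)) i (c ↑ˡ m) ≈ b (inj₁ p) i * - 1ᴹ q c
        X-col i c = trans (+-cong (*-congˡ (row-f q c)) (trans (*-congˡ (row-e p c)) (zeroʳ _))) (+-identityʳ _)
        corner : ∀ a c → c Fin.≤ a → 1ᴹ a p * - 1ᴹ q c ≈ 0#
        corner a c c≤a with a Fin.≟ p | q Fin.≟ c
        ... | no a≢p | _ = trans (*-congʳ (1ᴹ-offdiagonal a≢p)) (zeroˡ _)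
        ... | yes _ | no q≢c = trans (*-congˡ (trans (-‿cong (1ᴹ-offdiagonal q≢c)) 0≈-0)) (zeroʳ _)
        ... | yes ≡.refl | yes ≡.refl = ⊥-elim (ℕ.<⇒≱ p<q c≤a)

    killed-ee : ∀ p q → D (b (inj₁ p)) (b (inj₁ q)) ▹ v ≈ᵛ 0ᵛ
    killed-ee p q = fixed⇒killed (b (inj₁ p)) (b (inj₁ q)) (ω-ee p q) v λ s → unipotent-v (unipotent (b (inj₁ p)) (b (inj₁ q)) (ω-ee p q) s) (positive-ee p q s)

    killed-ef : ∀ p q → p Fin.< q → D (b (inj₁ p)) (b (inj₂ q)) ▹ v ≈ᵛ 0ᵛ
    killed-ef p q p<q = fixed⇒killed (b (inj₁ p)) (b (inj₂ q)) (ω-ef p q (Fin.<⇒≢ p<q)) v λ s → unipotent-v (unipotent (b (inj₁ p)) (b (inj₂ q)) (ω-ef p q (Fin.<⇒≢ p<q)) s) (positive-ef p q p<q s)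

    -- The module generated from `v` by the negative root vectors. The inductive presentation keeps
    -- the word of lowering operators, from which the weights are computed later.
    data Span : Vector n → Set where
      base  : Span v
      resp  : ∀ {u w} → u ≈ᵛ w → Span u → Span w
      null  : Span 0ᵛ
      plus  : ∀ {u w} → Span u → Span w → Span (u +ᵛ w)
      times : ∀ a {u} → Span u → Span (a ∙ᵛ u)
      lower : ∀ s t {u} → Negative (λ d → weightOf s d ℤ.+ weightOf t d) → Span u → Span (D (b s) (b t) ▹ u)

    Span-isSubspace : IsSubspace Span
    Span-isSubspace = record { respects = resp ; zero∈ = null ; +-closed = plus ; ∙-closed = times }

    -- Moving D(b_s, b_t) past the lowering operators produces brackets, which act on shorter words.
    Span-D : ∀ s t {u} → Span u → Span (D (b s) (b t) ▹ u)
    Span-D (inj₁ a) (inj₁ c) base = resp (λ i → sym (killed-ee a c i)) null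
    Span-D (inj₁ a) (inj₂ c) base with Fin.<-cmp a c
    ... | tri< a<c _ _ = resp (λ i → sym (killed-ef a c a<c i)) null
    ... | tri≈ _ ≡.refl _ = resp (λ i → begin
      - ι (μᵉ a) * v i ≈⟨ solve 2 (λ a b → (:- a) :* b := :-1 :* (a :* b)) refl (ι (μᵉ a)) (v i) ⟩
      - 1# * (ι (μᵉ a) * v i) ≈⟨ *-congˡ (H-v a i) ⟨
      - 1# * (H a ▹ v) i ≈⟨ *-congˡ (∙ᴹ-▹ (- 1#) (D (b (inj₁ a)) (b (inj₂ a))) v i) ⟩
      - 1# * (- 1# * (D (b (inj₁ a)) (b (inj₂ a)) ▹ v) i) ≈⟨ solve 1 (λ x → :-1 :* (:-1 :* x) := x) refl _ ⟩
      (D (b (inj₁ a)) (b (inj₂ a)) ▹ v) i ∎) (times (- ι (μᵉ a)) base)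
    ... | tri> _ _ c<a = lower (inj₁ a) (inj₂ c) (negative-ef a c c<a) base
    Span-D (inj₂ a) (inj₁ c) base = resp (▹-cong (D-sym (b (inj₁ c)) (b (inj₂ a))) λ _ → refl) (Span-D (inj₁ c) (inj₂ a) base)
    Span-D (inj₂ a) (inj₂ c) base = lower (inj₂ a) (inj₂ c) (negative-ff a c) base
    Span-D s t (resp p su) = resp (▹-congˡ (D (b s) (b t)) p) (Span-D s t su)
    Span-D s t null = resp (λ i → sym (▹-0 (D (b s) (b t)) i)) null
    Span-D s t (plus {u} {w} su sw) = resp (λ i → sym (▹-+ (D (b s) (b t)) u w i)) (plus (Span-D s t su) (Span-D s t sw))
    Span-D s t (times a {u} su) = resp (λ i → sym (▹-∙ (D (b s) (b t)) a u i)) (times a (Span-D s t su))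
    Span-D s t (lower s′ t′ {u} neg su) = resp (λ i → sym (begin
      (D (b s) (b t) ▹ (D (b s′) (b t′) ▹ u)) i ≈⟨ *ᴹ-▹ (D (b s) (b t)) (D (b s′) (b t′)) u i ⟨
      ((D (b s) (b t) *ᴹ D (b s′) (b t′)) ▹ u) i ≈⟨ ▹-cong (bracket (b s) (b t) (b s′) (b t′)) (λ _ → refl) i ⟩
      ((D (b s′) (b t′) *ᴹ D (b s) (b t) +ᴹ Bracket (b s) (b t) (b s′) (b t′)) ▹ u) i
        ≈⟨ +ᴹ-▹ (D (b s′) (b t′) *ᴹ D (b s) (b t)) (Bracket (b s) (b t) (b s′) (b t′)) u i ⟩
      ((D (b s′) (b t′) *ᴹ D (b s) (b t)) ▹ u) i + (Bracket (b s) (b t) (b s′) (b t′) ▹ u) i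
        ≈⟨ +-cong (*ᴹ-▹ (D (b s′) (b t′)) (D (b s) (b t)) u i) (four i) ⟩
      _ ∎)) (plus (lower s′ t′ neg (Span-D s t su))
        (plus (plus (times _ (Span-D t t′ su)) (times _ (Span-D s′ t su))) (plus (times _ (Span-D s t′ su)) (times _ (Span-D s′ s su)))))
      where
      four : ∀ i → (Bracket (b s) (b t) (b s′) (b t′) ▹ u) i ≈
        ((ω (b s) (b s′) * (D (b t) (b t′) ▹ u) i + ω (b s) (b t′) * (D (b s′) (b t) ▹ u) i) +
         (ω (b t) (b s′) * (D (b s) (b t′) ▹ u) i + ω (b t) (b t′) * (D (b s′) (b s) ▹ u) i))
      four i = linear (ω (b s) (b s′)) (ω (b s) (b t′)) (ω (b t) (b s′)) (ω (b t) (b t′))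
        (D (b t) (b t′)) (D (b s′) (b t)) (D (b s) (b t′)) (D (b s′) (b s)) u i
        where
        linear : ∀ a b c d (A B M E : Matrix n) u i → (((a ∙ᴹ A +ᴹ b ∙ᴹ B) +ᴹ (c ∙ᴹ M +ᴹ d ∙ᴹ E)) ▹ u) i ≈
                 (a * (A ▹ u) i + b * (B ▹ u) i) + (c * (M ▹ u) i + d * (E ▹ u) i)
        linear a b c d A B M E u i = trans (+ᴹ-▹ (a ∙ᴹ A +ᴹ b ∙ᴹ B) (c ∙ᴹ M +ᴹ d ∙ᴹ E) u i) (+-cong
          (trans (+ᴹ-▹ (a ∙ᴹ A) (b ∙ᴹ B) u i) (+-cong (∙ᴹ-▹ a A u i) (∙ᴹ-▹ b B u i)))
          (trans (+ᴹ-▹ (c ∙ᴹ M) (d ∙ᴹ E) u i) (+-cong (∙ᴹ-▹ c M u i) (∙ᴹ-▹ d E u i))))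

    private
      expand-vector : ∀ {k} (z : Vector k) → z ≈ᵛ (λ i → sum λ l → z l * basis l i)
      expand-vector z i = sym (trans (sum-cong λ l → *-comm (z l) (basis l i)) (1ᴹ-▹ z i))

    D-sumˡ : ∀ {k} (c : Fin k → Carrier) (z : Fin k → Vector N) w → D (λ i → sum λ l → c l * z l i) w ≈ᴹ (λ i j → sum λ l → c l * D (z l) w i j)
    D-sumˡ {zero}  c z w i j = begin
      D 0ᵛ w i j ≈⟨ D-cong (λ k → sym (zeroˡ 0#)) (λ _ → refl) i j ⟩
      D (0# ∙ᵛ 0ᵛ) w i j ≈⟨ D-∙ˡ 0# 0ᵛ w i j ⟩
      0# * D 0ᵛ w i j ≈⟨ zeroˡ _ ⟩
      0# ∎
    D-sumˡ {suc k} c z w i j = trans (D-+ˡ (c zero ∙ᵛ z zero) (λ i → sum λ l → c (suc l) * z (suc l) i) w i j)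
      (+-cong (D-∙ˡ (c zero) (z zero) w i j) (D-sumˡ (c ∘ suc) (z ∘ suc) w i j))

    private
      matrix-sum-closed : ∀ {k} (c : Fin k → Carrier) (A : Fin k → Matrix n) {u} →
        (∀ l → Span (A l ▹ u)) → Span ((λ i j → sum λ l → c l * A l i j) ▹ u)
      matrix-sum-closed c A {u} p = resp (λ i → begin
        sum (λ l → c l * sum λ j → A l i j * u j) ≈⟨ sum-cong (λ l → trans (*-distribˡ-sum (c l) (λ j → A l i j * u j)) (sum-cong λ j → sym (*-assoc (c l) (A l i j) (u j)))) ⟩
        sum (λ l → sum λ j → c l * A l i j * u j) ≈⟨ ∑-comm (λ l j → c l * A l i j * u j) ⟩
        sum (λ j → sum λ l → c l * A l i j * u j) ≈⟨ sum-cong (λ j → *-distribʳ-sum (u j) (λ l → c l * A l i j)) ⟨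
        sum (λ j → sum (λ l → c l * A l i j) * u j) ∎)
        (IsSubspace.sum-closed Span-isSubspace (λ l → c l ∙ᵛ (A l ▹ u)) λ l → times (c l) (p l))

      Span-basis : ∀ k l {u} → Span u → Span (D (basis k) (basis l) ▹ u)
      Span-basis k l {u} su = ≡.subst₂ (λ k l → Span (D (basis k) (basis l) ▹ u)) (Fin.join-splitAt m m k) (Fin.join-splitAt m m l)
        (Span-D (splitAt m k) (splitAt m l) su)

      Span-left : ∀ z l {u} → Span u → Span (D z (basis l) ▹ u)
      Span-left z l su = resp (▹-cong (λ i j → sym (trans (D-cong (expand-vector z) (λ _ → refl) i j) (D-sumˡ z basis (basis l) i j))) λ _ → refl)
        (matrix-sum-closed z (λ k → D (basis k) (basis l)) λ k → Span-basis k l su)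

      Span-square : ∀ z {u} → Span u → Span (D z z ▹ u)
      Span-square z su = resp (▹-cong (λ i j → sym (trans (D-cong (expand-vector z) (λ _ → refl) i j) (D-sumˡ z basis z i j))) λ _ → refl)
        (matrix-sum-closed z (λ k → D (basis k) z) λ k → resp (▹-cong (D-sym z (basis k)) λ _ → refl) (Span-left z k su))

    everything : ∀ w → Span w
    everything = simple Span (isInvariantSubspace Span-isSubspace Span-square) v base nonzero

    -- ρ(t) w = c x^μ v + strictly lower weights, for t with coordinates x.
    record Decomposition (w : Vector n) : Set where
      field
        leading   : Carrier
        remainder : Fin n → Terms (Exponent m)
        lower-≺   : ∀ i → AllExp (_≺ μᵉ) (remainder i)
        equation  : ∀ x i → (ρ (torusElement x) ▹ w) i ≈ leading * v i * monomial x μᵉ + ⟨ monomial x , remainder i ⟩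

    private
      open Decomposition

      decompose : ∀ {w} → Span w → Decomposition w
      decompose base = record
        { leading = 1# ; remainder = λ _ → [] ; lower-≺ = λ _ → []
        ; equation = λ x i → trans (torus-v x i) (solve 2 (λ a b → a :* b := :1 :* b :* a :+ :0) refl (monomial x μᵉ) (v i)) }
      decompose (resp p su) = record
        { leading = leading d ; remainder = remainder d ; lower-≺ = lower-≺ d
        ; equation = λ x i → trans (sym (▹-congˡ (ρ (torusElement x)) p i)) (equation d x i) }
        where d = decompose su
      decompose null = record
        { leading = 0# ; remainder = λ _ → [] ; lower-≺ = λ _ → []
        ; equation = λ x i → trans (▹-0 (ρ (torusElement x)) i) (solve 2 (λ a b → :0 := :0 :* b :* a :+ :0) refl (monomial x μᵉ) (v i)) }
      decompose (plus {u} {w} su sw) = record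
        { leading = leading d + leading e ; remainder = λ i → remainder d i ++ remainder e i
        ; lower-≺ = λ i → ++⁺ (lower-≺ d i) (lower-≺ e i)
        ; equation = λ x i → begin
            (ρ (torusElement x) ▹ (u +ᵛ w)) i
              ≈⟨ ▹-+ (ρ (torusElement x)) u w i ⟩
            (ρ (torusElement x) ▹ u) i + (ρ (torusElement x) ▹ w) i
              ≈⟨ +-cong (equation d x i) (equation e x i) ⟩
            (leading d * v i * monomial x μᵉ + ⟨ monomial x , remainder d i ⟩) + (leading e * v i * monomial x μᵉ + ⟨ monomial x , remainder e i ⟩)
              ≈⟨ solve 6 (λ a b v x r s → (a :* v :* x :+ r) :+ (b :* v :* x :+ s) := (a :+ b) :* v :* x :+ (r :+ s)) refl
                   (leading d) (leading e) (v i) (monomial x μᵉ) ⟨ monomial x , remainder d i ⟩ ⟨ monomial x , remainder e i ⟩ ⟩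
            (leading d + leading e) * v i * monomial x μᵉ + (⟨ monomial x , remainder d i ⟩ + ⟨ monomial x , remainder e i ⟩)
              ≈⟨ +-congˡ (pair-++ (monomial x) (remainder d i) (remainder e i)) ⟨
            (leading d + leading e) * v i * monomial x μᵉ + ⟨ monomial x , remainder d i ++ remainder e i ⟩ ∎ }
        where
        d = decompose su
        e = decompose sw
      decompose (times a {u} su) = record
        { leading = a * leading d ; remainder = λ i → scale a (remainder d i)
        ; lower-≺ = λ i → weighted-All (remainder d i) (lower-≺ d i)
        ; equation = λ x i → begin
            (ρ (torusElement x) ▹ (a ∙ᵛ u)) i ≈⟨ ▹-∙ (ρ (torusElement x)) a u i ⟩
            a * (ρ (torusElement x) ▹ u) i ≈⟨ *-congˡ (equation d x i) ⟩
            a * (leading d * v i * monomial x μᵉ + ⟨ monomial x , remainder d i ⟩)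
              ≈⟨ solve 5 (λ a b v x r → a :* (b :* v :* x :+ r) := a :* b :* v :* x :+ a :* r) refl a (leading d) (v i) (monomial x μᵉ) ⟨ monomial x , remainder d i ⟩ ⟩
            a * leading d * v i * monomial x μᵉ + a * ⟨ monomial x , remainder d i ⟩
              ≈⟨ +-congˡ (pair-scale a (monomial x) (remainder d i)) ⟨
            a * leading d * v i * monomial x μᵉ + ⟨ monomial x , scale a (remainder d i) ⟩ ∎ }
        where d = decompose su
      decompose (lower s t {u} neg su) = record
        -- The torus passes `D (b s) (b t)` at the price of the factor x^σ with σ a negative root.
        -- Every exponent of `u`, the top one included, thereby becomes strictly lower, so no
        -- leading term survives.
        { leading = 0# ; remainder = λ i → reindex (σ +ᵉ_) (moved i)
        ; lower-≺ = λ i → reindex-All (σ +ᵉ_) (λ {κ} κ≼μ → +-≼-≺ σ κ μᵉ neg κ≼μ) (moved i)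
            (combination-All (A i) terms λ k → ≼-refl μᵉ ∷ All.map proj₁ (lower-≺ d k))
        ; equation = λ x i → begin
            (ρ (torusElement x) ▹ (A ▹ u)) i
              ≈⟨ *ᴹ-▹ (ρ (torusElement x)) A u i ⟨
            ((ρ (torusElement x) *ᴹ A) ▹ u) i
              ≈⟨ ▹-cong (torus-D x s t) (λ _ → refl) i ⟩
            (((eigenvalue x s * eigenvalue x t) ∙ᴹ (A *ᴹ ρ (torusElement x))) ▹ u) i
              ≈⟨ trans (∙ᴹ-▹ (eigenvalue x s * eigenvalue x t) (A *ᴹ ρ (torusElement x)) u i) (*-congˡ (*ᴹ-▹ A (ρ (torusElement x)) u i)) ⟩
            eigenvalue x s * eigenvalue x t * (A ▹ (ρ (torusElement x) ▹ u)) i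
              ≈⟨ *-cong (sym (trans (monomial-+ x (weightOf s) (weightOf t)) (*-cong (monomial-weightOf x s) (monomial-weightOf x t))))
                   (sum-cong λ k → *-congˡ (equation d x k)) ⟩
            monomial x σ * sum (λ k → A i k * ⟨ monomial x , terms k ⟩)
              ≈⟨ *-congˡ (pair-combination (monomial x) (A i) terms) ⟨
            monomial x σ * ⟨ monomial x , moved i ⟩
              ≈⟨ pair-* (monomial x σ) (monomial x) (moved i) ⟨
            ⟨ (λ κ → monomial x σ * monomial x κ) , moved i ⟩
              ≈⟨ pair-cong (moved i) (monomial-+ x σ) ⟨
            ⟨ (λ κ → monomial x (σ +ᵉ κ)) , moved i ⟩
              ≈⟨ pair-reindex (σ +ᵉ_) (monomial x) (moved i) ⟨
            ⟨ monomial x , reindex (σ +ᵉ_) (moved i) ⟩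
              ≈⟨ trans (+-congʳ (trans (*-congʳ (zeroˡ _)) (zeroˡ _))) (+-identityˡ _) ⟨
            0# * v i * monomial x μᵉ + ⟨ monomial x , reindex (σ +ᵉ_) (moved i) ⟩ ∎ }
        where
        d = decompose su
        A = D (b s) (b t)
        σ = weightOf s +ᵉ weightOf t
        terms : Fin n → Terms (Exponent m)
        terms k = (leading d * v k , μᵉ) ∷ remainder d k
        moved : Fin n → Terms (Exponent m)
        moved i = combination (A i) terms

    abstract
      decomposition : ∀ w → Decomposition w
      decomposition w = decompose (everything w)

    open Decomposition

    -- The coefficients of x^μ on both sides agree, and the strictly lower part of the decomposition
    -- contributes none. So the weight space of μ is a line.
    weight-vector : ∀ w → (∀ x i → (ρ (torusElement x) ▹ w) i ≈ monomial x μᵉ * w i) → w ≈ᵛ leading (decomposition w) ∙ᵛ v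
    weight-vector w eigen i = begin
      w i ≈⟨ trans (+-identityʳ _) (trans (*-congˡ (indicator-refl μᵉ)) (*-identityʳ _)) ⟨
      ⟨ indicator μᵉ , (w i , μᵉ) ∷ [] ⟩
        ≈⟨ independent-≈ ((w i , μᵉ) ∷ []) ((c * v i , μᵉ) ∷ R i) (λ x → begin
             w i * monomial x μᵉ + 0# ≈⟨ trans (+-identityʳ _) (*-comm _ _) ⟩
             monomial x μᵉ * w i ≈⟨ eigen x i ⟨
             (ρ (torusElement x) ▹ w) i ≈⟨ equation d x i ⟩
             c * v i * monomial x μᵉ + ⟨ monomial x , R i ⟩ ∎) (indicator μᵉ) (indicator-respectful μᵉ) ⟩
      c * v i * indicator μᵉ μᵉ + ⟨ indicator μᵉ , R i ⟩
        ≈⟨ +-cong (trans (*-congˡ (indicator-refl μᵉ)) (*-identityʳ _)) (pair-indicator-0 μᵉ (R i) (All.map ≺⇒≭ (lower-≺ d i))) ⟩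
      c * v i + 0# ≈⟨ +-identityʳ _ ⟩
      c * v i ∎
      where
      d = decomposition w
      c = leading d
      R = remainder d

    private
      c : Fin n → Carrier
      c j = leading (decomposition (basis j))

      R : Fin n → Fin n → Terms (Exponent m)
      R j = remainder (decomposition (basis j))

      entry : ∀ x i j → ρ (torusElement x) i j ≈ c j * v i * monomial x μᵉ + ⟨ monomial x , R j i ⟩
      entry x i j = trans (sym (⟪⟫-basisʳ (ρ (torusElement x) i) j)) (equation (decomposition (basis j)) x i)

      R-indicator : ∀ i j → ⟨ indicator μᵉ , R j i ⟩ ≈ 0#
      R-indicator i j = pair-indicator-0 μᵉ (R j i) (All.map ≺⇒≭ (lower-≺ (decomposition (basis j)) i))

      -- The coefficient of x^μ in ρ(t) is the rank-one matrix with entries v_i c_j. Applied to v it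
      -- must give v back, and comparing at a nonzero coordinate yields Σ c_j v_j = 1. The same sum
      -- is the trace of that matrix, the leading coefficient of the character.
      trace-leading : sum (λ j → c j * v j) ≈ 1#
      trace-leading = *-cancelˡ vi≉0 (begin
        v i * sum (λ j → c j * v j)
          ≈⟨ *-distribˡ-sum (v i) (λ j → c j * v j) ⟩
        sum (λ j → v i * (c j * v j))
          ≈⟨ sum-cong (λ j → trans (*-congˡ (trans (+-cong (trans (*-congˡ (indicator-refl μᵉ)) (*-identityʳ _)) (R-indicator i j)) (+-identityʳ _)))
               (solve 3 (λ a b d → b :* (d :* a) := a :* (d :* b)) refl (v i) (v j) (c j))) ⟨
        sum (λ j → v j * ⟨ indicator μᵉ , terms j ⟩)
          ≈⟨ pair-combination (indicator μᵉ) v terms ⟨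
        ⟨ indicator μᵉ , combination v terms ⟩
          ≈⟨ independent-≈ (combination v terms) ((v i , μᵉ) ∷ []) equal (indicator μᵉ) (indicator-respectful μᵉ) ⟩
        v i * indicator μᵉ μᵉ + 0#
          ≈⟨ trans (+-identityʳ _) (*-congˡ (indicator-refl μᵉ)) ⟩
        v i * 1# ∎)
        where
        nonzero-entry : ∃ λ i → ¬ v i ≈ 0#
        nonzero-entry = Fin.¬∀⟶∃¬ n (λ i → v i ≈ 0#) (λ i → v i ≟ 0#) nonzero
        i = proj₁ nonzero-entry
        vi≉0 = proj₂ nonzero-entry
        terms : Fin n → Terms (Exponent m)
        terms j = (c j * v i , μᵉ) ∷ R j i
        equal : ∀ x → ⟨ monomial x , combination v terms ⟩ ≈ v i * monomial x μᵉ + 0#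
        equal x = begin
          ⟨ monomial x , combination v terms ⟩ ≈⟨ pair-combinationʳ (monomial x) v terms ⟩
          sum (λ j → ⟨ monomial x , terms j ⟩ * v j) ≈⟨ sum-cong (λ j → *-congʳ (entry x i j)) ⟨
          (ρ (torusElement x) ▹ v) i ≈⟨ torus-v x i ⟩
          monomial x μᵉ * v i ≈⟨ trans (+-identityʳ _) (*-comm _ _) ⟨
          v i * monomial x μᵉ + 0# ∎

    lowerTerms : Terms (Exponent m)
    lowerTerms = concatSum λ i → R i i

    lowerTerms-≺ : AllExp (_≺ μᵉ) lowerTerms
    lowerTerms-≺ = concatSum-All _ λ i → lower-≺ (decomposition (basis i)) i

    character-expansion : ∀ x → character V x ≈ monomial x μᵉ + ⟨ monomial x , lowerTerms ⟩
    character-expansion x = begin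
      sum (λ i → ρ (torusElement x) i i)
        ≈⟨ sum-cong (λ i → entry x i i) ⟩
      sum (λ i → c i * v i * monomial x μᵉ + ⟨ monomial x , R i i ⟩)
        ≈⟨ ∑-distrib-+ (λ i → c i * v i * monomial x μᵉ) (λ i → ⟨ monomial x , R i i ⟩) ⟩
      sum (λ i → c i * v i * monomial x μᵉ) + sum (λ i → ⟨ monomial x , R i i ⟩)
        ≈⟨ +-cong (trans (sym (*-distribʳ-sum (monomial x μᵉ) (λ i → c i * v i))) (trans (*-congʳ trace-leading) (*-identityˡ _)))
             (sym (pair-concatSum (monomial x) (λ i → R i i))) ⟩
      monomial x μᵉ + ⟨ monomial x , lowerTerms ⟩ ∎

-- The radial operator at regular points

module Radial (K : CommutativeRing 0ℓ 0ℓ) where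
  open CommutativeRing K hiding (zero)
  open Arithmetic K
  open FormalSums K
  open Powers K
  open Symplectic K using (Torus; val; inv)

  open SetoidReasoning setoid

  -- The Euler operator x_a ∂/∂x_a exchanges the two, and Ẋ² = X̂² - 4.
  X̂ Ẋ : ∀ {m} → Torus m → Fin m → Carrier
  X̂ x a = val x a + inv x a
  Ẋ x a = val x a - inv x a

  inverse-factor : ∀ {α α′ β β′} → α * α′ ≈ 1# → β * β′ ≈ 1# → ∀ e → (α * β + e) * (β′ - α′) ≈ (α - β) + e * (β′ - α′)
  inverse-factor {α} {α′} {β} {β′} p q e = trans
    (solve 5 (λ α α′ β β′ e → (α :* β :+ e) :* (β′ :- α′) := (α :* (β :* β′) :- β :* (α :* α′)) :+ e :* (β′ :- α′)) refl α α′ β β′ e)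
    (+-congʳ (+-cong (trans (*-congˡ q) (*-identityʳ α)) (-‿cong (trans (*-congˡ p) (*-identityʳ β)))))

  -- Both factors αβ - 1 and αβ + 1 become functions symmetric or antisymmetric under inversion
  -- after multiplication by β⁻¹ - α⁻¹. This rewrites the coefficient (λ + 1)/(λ - 1) attached to a
  -- root with value λ in terms of X̂ and Ẋ.
  inverse-pairs : ∀ {α α′ β β′ p z} → α * α′ ≈ 1# → β * β′ ≈ 1# → (α * β - 1#) * p ≈ (α * β + 1#) * z →
                  ((α + α′) - (β + β′)) * p ≈ ((α - α′) - (β - β′)) * z
  inverse-pairs {α} {α′} {β} {β′} {p} {z} αα′ ββ′ eq = begin
    ((α + α′) - (β + β′)) * p
      ≈⟨ *-congʳ (trans (solve 4 (λ α α′ β β′ → (α :+ α′) :- (β :+ β′) := (α :- β) :+ :-1 :* (β′ :- α′)) refl α α′ β β′) (sym (inverse-factor αα′ ββ′ (- 1#)))) ⟩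
    (α * β - 1#) * (β′ - α′) * p
      ≈⟨ solve 3 (λ l k p → (l :* k) :* p := k :* (l :* p)) refl (α * β - 1#) (β′ - α′) p ⟩
    (β′ - α′) * ((α * β - 1#) * p)
      ≈⟨ trans (*-congˡ eq) (solve 3 (λ l k p → k :* (l :* p) := (l :* k) :* p) refl (α * β + 1#) (β′ - α′) z) ⟩
    (α * β + 1#) * (β′ - α′) * z
      ≈⟨ *-congʳ (trans (inverse-factor αα′ ββ′ 1#) (solve 4 (λ α α′ β β′ → (α :- β) :+ :1 :* (β′ :- α′) := (α :- α′) :- (β :- β′)) refl α α′ β β′)) ⟩
    ((α - α′) - (β - β′)) * z ∎

  -- A point off all root hyperplanes, with the inverses as data: x_a - x_a⁻¹ vanishes for the long
  -- roots, X_a - X_c for the short roots. Setting `r a a` to 0 allows sums over all pairs without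
  -- excluding the diagonal.
  record Regular {m} (x : Torus m) : Set where
    field
      s       : Fin m → Carrier
      s-inv   : ∀ a → Ẋ x a * s a ≈ 1#
      r       : Fin m → Fin m → Carrier
      r-inv   : ∀ a c → a ≢ c → (X̂ x a - X̂ x c) * r a c ≈ 1#
      r-diag  : ∀ a → r a a ≈ 0#

    r-antisym : ∀ a c → r c a ≈ - r a c
    r-antisym a c with a Fin.≟ c
    ... | yes ≡.refl = trans (r-diag a) (trans (solve 0 (:0 := :- :0) refl) (-‿cong (sym (r-diag a))))
    ... | no a≢c = begin
      r c a ≈⟨ *-identityˡ _ ⟨
      1# * r c a ≈⟨ *-congʳ (r-inv a c a≢c) ⟨
      (X̂ x a - X̂ x c) * r a c * r c a ≈⟨ solve 4 (λ p q r s → (p :- q) :* r :* s := :- (((q :- p) :* s) :* r)) refl (X̂ x a) (X̂ x c) (r a c) (r c a) ⟩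
      - (((X̂ x c - X̂ x a) * r c a) * r a c) ≈⟨ -‿cong (trans (*-congʳ (r-inv c a (a≢c ∘ ≡.sym))) (*-identityˡ _)) ⟩
      - r a c ∎

    drift : Fin m → Carrier
    drift a = 2# * (X̂ x a * s a) + sum λ c → 2# * (Ẋ x a * r a c)

    -- The symbol of the radial part of (minus one half of) the Casimir operator.
    symbol : Exponent m → Carrier
    symbol ν = sum (λ a → ι (ν a) * ι (ν a)) + sum (λ a → drift a * ι (ν a))

    radial : Exponent m → Carrier
    radial ν = symbol ν * monomial x ν

  open Regular public using (radial; symbol; drift)

  IsEigen : ∀ {m} → Terms (Exponent m) → Carrier → Set
  IsEigen p c = ∀ x (R : Regular x) → ⟨ radial R , p ⟩ ≈ c * ⟨ monomial x , p ⟩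

  θ : ∀ {m} → Torus m → Fin m → Exponent m → Carrier
  θ x a ν = ι (ν a) * monomial x ν

  pair-radial : ∀ {m} {x : Torus m} (R : Regular x) p → ⟨ radial R , p ⟩ ≈
    sum (λ a → ⟨ (λ ν → ι (ν a) * ι (ν a) * monomial x ν) , p ⟩) + sum (λ a → drift R a * ⟨ θ x a , p ⟩)
  pair-radial {m} {x} R p = begin
    ⟨ radial R , p ⟩
      ≈⟨ pair-cong p (λ ν → trans (distribʳ _ _ _) (+-cong (*-distribʳ-sum (monomial x ν) (λ a → ι (ν a) * ι (ν a)))
           (trans (*-distribʳ-sum (monomial x ν) (λ a → drift R a * ι (ν a))) (sum-cong λ a → *-assoc (drift R a) (ι (ν a)) (monomial x ν))))) ⟩
    ⟨ (λ ν → sum (λ a → ι (ν a) * ι (ν a) * monomial x ν) + sum (λ a → drift R a * θ x a ν)) , p ⟩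
      ≈⟨ pair-+ (λ ν → sum (λ a → ι (ν a) * ι (ν a) * monomial x ν)) (λ ν → sum (λ a → drift R a * θ x a ν)) p ⟩
    _ ≈⟨ +-cong (pair-sum (λ a ν → ι (ν a) * ι (ν a) * monomial x ν) p)
           (trans (pair-sum (λ a ν → drift R a * θ x a ν) p) (sum-cong λ a → pair-* (drift R a) (θ x a) p)) ⟩
    sum (λ a → ⟨ (λ ν → ι (ν a) * ι (ν a) * monomial x ν) , p ⟩) + sum (λ a → drift R a * ⟨ θ x a , p ⟩) ∎

  radial-cong : ∀ {m} {x : Torus m} (R : Regular x) {ν κ : Exponent m} → ν ≗ κ → radial R ν ≈ radial R κ
  radial-cong {x = x} R p = *-cong
    (+-cong (sum-cong λ a → reflexive (≡.cong (λ z → ι z * ι z) (p a))) (sum-cong λ a → reflexive (≡.cong (λ z → drift R a * ι z) (p a))))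
    (monomial-cong x p)

-- The Casimir element and its radial part

module Casimir (K : CommutativeRing 0ℓ 0ℓ) (F : IsCharZeroField K) {m n : ℕ}
               (V : Symplectic.Representation K m n) where
  open CommutativeRing K hiding (zero)
  open Arithmetic K
  open FieldArithmetic K F
  open LinearAlgebra K
  open FormalSums K
  open Powers K
  open LinearIndependence K F
  open SymplecticForm K F m
  open LieAction K F V
  open HighestWeightModule K F V
  open Radial K
  open Symplectic K using (Jblock; Torus; val; inv; torusElement; eigenvalue; character; IsIrreducible; HasHighestWeight)
  open Symplectic.Representation V using (ρ)
  open SetoidReasoning setoid

  dual : Index → Index
  dual (inj₁ a) = inj₂ a
  dual (inj₂ a) = inj₁ a

  sign : Index → Carrier
  sign (inj₁ a) = 1#
  sign (inj₂ a) = - 1#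

  Σᴵ : (Index → Carrier) → Carrier
  Σᴵ f = sum (λ a → f (inj₁ a)) + sum (λ a → f (inj₂ a))

  Σᴵ-cong : ∀ {f g : Index → Carrier} → (∀ s → f s ≈ g s) → Σᴵ f ≈ Σᴵ g
  Σᴵ-cong p = +-cong (sum-cong (p ∘ inj₁)) (sum-cong (p ∘ inj₂))

  Σᴵ-+ : ∀ (f g : Index → Carrier) → Σᴵ (λ s → f s + g s) ≈ Σᴵ f + Σᴵ g
  Σᴵ-+ f g = trans (+-cong (∑-distrib-+ (f ∘ inj₁) (g ∘ inj₁)) (∑-distrib-+ (f ∘ inj₂) (g ∘ inj₂)))
    (solve 4 (λ a b c d → (a :+ b) :+ (c :+ d) := (a :+ c) :+ (b :+ d)) refl (sum (f ∘ inj₁)) (sum (g ∘ inj₁)) (sum (f ∘ inj₂)) (sum (g ∘ inj₂)))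

  Σᴵ-* : ∀ a (f : Index → Carrier) → Σᴵ (λ s → a * f s) ≈ a * Σᴵ f
  Σᴵ-* a f = trans (+-cong (sym (*-distribˡ-sum a (f ∘ inj₁))) (sym (*-distribˡ-sum a (f ∘ inj₂)))) (sym (distribˡ a _ _))

  Σᴵ-comm : ∀ (f : Index → Index → Carrier) → Σᴵ (λ s → Σᴵ (f s)) ≈ Σᴵ (λ t → Σᴵ λ s → f s t)
  Σᴵ-comm f = trans (+-cong (∑-distrib-+ (λ a → sum λ c → f (inj₁ a) (inj₁ c)) (λ a → sum λ c → f (inj₁ a) (inj₂ c)))
                            (∑-distrib-+ (λ a → sum λ c → f (inj₂ a) (inj₁ c)) (λ a → sum λ c → f (inj₂ a) (inj₂ c))))
    (trans (+-cong (+-cong (∑-comm (λ a c → f (inj₁ a) (inj₁ c))) (∑-comm (λ a c → f (inj₁ a) (inj₂ c))))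
                   (+-cong (∑-comm (λ a c → f (inj₂ a) (inj₁ c))) (∑-comm (λ a c → f (inj₂ a) (inj₂ c)))))
    (trans (solve 4 (λ a b c d → (a :+ b) :+ (c :+ d) := (a :+ c) :+ (b :+ d)) refl _ _ _ _)
      (sym (+-cong (∑-distrib-+ (λ a → sum λ c → f (inj₁ c) (inj₁ a)) (λ a → sum λ c → f (inj₂ c) (inj₁ a)))
                   (∑-distrib-+ (λ a → sum λ c → f (inj₁ c) (inj₂ a)) (λ a → sum λ c → f (inj₂ c) (inj₂ a)))))))

  Σᴵ-sum : ∀ {k} (f : Index → Fin k → Carrier) → Σᴵ (λ s → sum (f s)) ≈ sum (λ l → Σᴵ λ s → f s l)
  Σᴵ-sum f = trans (+-cong (∑-comm (f ∘ inj₁)) (∑-comm (f ∘ inj₂))) (sym (∑-distrib-+ (λ l → sum λ a → f (inj₁ a) l) (λ l → sum λ a → f (inj₂ a) l)))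

  sum-split : ∀ l {k} (f : Fin (l ℕ.+ k) → Carrier) → sum f ≈ sum (λ a → f (a ↑ˡ k)) + sum (λ a → f (l ↑ʳ a))
  sum-split zero    f = sym (+-identityˡ _)
  sum-split (suc l) f = trans (+-congˡ (sum-split l (f ∘ suc))) (sym (+-assoc _ _ _))

  record IsLinear (A : Vector N → Carrier) : Set where
    field
      A-cong : ∀ {u w} → u ≈ᵛ w → A u ≈ A w
      A-+    : ∀ u w → A (u +ᵛ w) ≈ A u + A w
      A-∙    : ∀ a u → A (a ∙ᵛ u) ≈ a * A u

  module _ {A : Vector N → Carrier} (isLinear : IsLinear A) where
    open IsLinear isLinear

    private
      A-sum : ∀ {k} (c : Fin k → Carrier) (z : Fin k → Vector N) → A (λ i → sum λ l → c l * z l i) ≈ sum λ l → c l * A (z l)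
      A-sum {zero}  c z = trans (A-cong λ _ → sym (zeroˡ 0#)) (trans (A-∙ 0# 0ᵛ) (zeroˡ _))
      A-sum {suc k} c z = trans (A-+ (c zero ∙ᵛ z zero) (λ i → sum λ l → c (suc l) * z (suc l) i))
        (+-cong (A-∙ (c zero) (z zero)) (A-sum (c ∘ suc) (z ∘ suc)))

    linear-expand : ∀ w → A w ≈ Σᴵ λ s → w (join m m s) * A (b s)
    linear-expand w = begin
      A w ≈⟨ A-cong (λ i → sym (trans (sum-cong λ l → *-comm (w l) (basis l i)) (1ᴹ-▹ w i))) ⟩
      A (λ i → sum λ l → w l * basis l i) ≈⟨ A-sum w basis ⟩
      sum (λ l → w l * A (basis l)) ≈⟨ sum-split m (λ l → w l * A (basis l)) ⟩
      Σᴵ (λ s → w (join m m s) * A (b s)) ∎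

    private
      ω-coordinate : ∀ w s → ω (b s) w ≈ sign s * w (join m m (dual s))
      ω-coordinate w s = begin
        ω (b s) w ≈⟨ ⟪row⟫ (b s) w ⟨
        sum (λ j → row (b s) j * w j) ≈⟨ sum-cong (λ j → *-congʳ (row-b s j)) ⟩
        sum (λ j → Jblock s (splitAt m j) * w j) ≈⟨ sum-split m (λ j → Jblock s (splitAt m j) * w j) ⟩
        sum (λ a → Jblock s (splitAt m (a ↑ˡ m)) * w (a ↑ˡ m)) + sum (λ a → Jblock s (splitAt m (m ↑ʳ a)) * w (m ↑ʳ a))
          ≈⟨ +-cong (sum-cong λ a → *-congʳ (reflexive (≡.cong (Jblock s) (Fin.splitAt-↑ˡ m a m))))
                    (sum-cong λ a → *-congʳ (reflexive (≡.cong (Jblock s) (Fin.splitAt-↑ʳ m m a)))) ⟩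
        sum (λ a → Jblock s (inj₁ a) * w (a ↑ˡ m)) + sum (λ a → Jblock s (inj₂ a) * w (m ↑ʳ a))
          ≈⟨ blocks s ⟩
        sign s * w (join m m (dual s)) ∎
        where
        blocks : ∀ s → sum (λ a → Jblock s (inj₁ a) * w (a ↑ˡ m)) + sum (λ a → Jblock s (inj₂ a) * w (m ↑ʳ a)) ≈ sign s * w (join m m (dual s))
        blocks (inj₁ a) = trans (+-cong (sum-zero {m} _ λ c → zeroˡ (w (c ↑ˡ m))) (1ᴹ-▹ (λ c → w (m ↑ʳ c)) a)) (trans (+-identityˡ _) (sym (*-identityˡ _)))
        blocks (inj₂ a) = trans (+-cong
          (trans (sum-cong λ c → solve 2 (λ x y → (:- x) :* y := :-1 :* (x :* y)) refl (1ᴹ a c) (w (c ↑ˡ m)))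
            (trans (sym (*-distribˡ-sum (- 1#) (λ c → 1ᴹ a c * w (c ↑ˡ m)))) (*-congˡ (1ᴹ-▹ (λ c → w (c ↑ˡ m)) a))))
          (sum-zero {m} _ λ c → zeroˡ (w (m ↑ʳ c)))) (+-identityʳ _)

    -- The value ω(b_s, w) is `sign s` times the coordinate of w at `dual s`, so contraction with ω
    -- recovers the basis expansion of w. The sign comes from the antisymmetry of ω and is opposite
    -- in `contract₂`, which makes the two cancel in `Ω-central`.
    contract₁ : ∀ w → Σᴵ (λ s → sign s * (ω w (b s) * A (b (dual s)))) ≈ - A w
    contract₁ w = begin
      Σᴵ (λ s → sign s * (ω w (b s) * A (b (dual s))))
        ≈⟨ Σᴵ-cong (λ s → trans (*-congˡ (*-congʳ (trans (ω-antisym w (b s)) (-‿cong (ω-coordinate w s))))) (signs s)) ⟩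
      Σᴵ (λ s → - 1# * (w (join m m (dual s)) * A (b (dual s))))
        ≈⟨ trans (Σᴵ-* (- 1#) (λ s → w (join m m (dual s)) * A (b (dual s)))) (*-congˡ (+-comm _ _)) ⟩
      - 1# * Σᴵ (λ s → w (join m m s) * A (b s))
        ≈⟨ *-congˡ (linear-expand w) ⟨
      - 1# * A w
        ≈⟨ solve 1 (λ x → :-1 :* x := :- x) refl _ ⟩
      - A w ∎
      where
      signs : ∀ s → sign s * (- (sign s * w (join m m (dual s))) * A (b (dual s))) ≈ - 1# * (w (join m m (dual s)) * A (b (dual s)))
      signs (inj₁ a) = solve 2 (λ x y → :1 :* ((:- (:1 :* x)) :* y) := :-1 :* (x :* y)) refl _ _
      signs (inj₂ a) = solve 2 (λ x y → :-1 :* ((:- (:-1 :* x)) :* y) := :-1 :* (x :* y)) refl _ _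

    contract₂ : ∀ w → Σᴵ (λ s → sign s * (ω w (b (dual s)) * A (b s))) ≈ A w
    contract₂ w = begin
      Σᴵ (λ s → sign s * (ω w (b (dual s)) * A (b s)))
        ≈⟨ Σᴵ-cong (λ s → trans (*-congˡ (*-congʳ (trans (ω-antisym w (b (dual s))) (-‿cong (ω-coordinate w (dual s)))))) (signs s)) ⟩
      Σᴵ (λ s → w (join m m s) * A (b s))
        ≈⟨ linear-expand w ⟨
      A w ∎
      where
      signs : ∀ s → sign s * (- (sign (dual s) * w (join m m (dual (dual s)))) * A (b s)) ≈ w (join m m s) * A (b s)
      signs (inj₁ a) = solve 2 (λ x y → :1 :* ((:- (:-1 :* x)) :* y) := x :* y) refl _ _
      signs (inj₂ a) = solve 2 (λ x y → :-1 :* ((:- (:1 :* x)) :* y) := x :* y) refl _ _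

  -- The summand of the Casimir element; b_(dual s) is sign s times the ω-dual of b_s.
  casimirTerm : Index → Index → Matrix n
  casimirTerm s t = D (b s) (b t) *ᴹ D (b (dual s)) (b (dual t))

  Ω : Matrix n
  Ω i j = Σᴵ λ s → Σᴵ λ t → sign s * (sign t * casimirTerm s t i j)

  private
    sum-casimir : ∀ (u : Fin n → Carrier) (f : Index → Index → Fin n → Carrier) →
      sum (λ k → u k * Σᴵ λ s → Σᴵ λ t → sign s * (sign t * f s t k)) ≈ Σᴵ λ s → Σᴵ λ t → sign s * (sign t * sum λ k → u k * f s t k)
    sum-casimir u f = sym (begin
      Σᴵ (λ s → Σᴵ λ t → sign s * (sign t * sum λ k → u k * f s t k))
        ≈⟨ Σᴵ-cong (λ s → Σᴵ-cong λ t → trans (*-congˡ (*-distribˡ-sum (sign t) (λ k → u k * f s t k)))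
             (trans (*-distribˡ-sum (sign s) (λ k → sign t * (u k * f s t k)))
             (sum-cong λ k → solve 4 (λ p q a c → p :* (q :* (a :* c)) := a :* (p :* (q :* c))) refl (sign s) (sign t) (u k) (f s t k)))) ⟩
      Σᴵ (λ s → Σᴵ λ t → sum λ k → u k * (sign s * (sign t * f s t k)))
        ≈⟨ trans (Σᴵ-cong λ s → Σᴵ-sum (λ t k → u k * (sign s * (sign t * f s t k)))) (Σᴵ-sum (λ s k → Σᴵ λ t → u k * (sign s * (sign t * f s t k)))) ⟩
      sum (λ k → Σᴵ λ s → Σᴵ λ t → u k * (sign s * (sign t * f s t k)))
        ≈⟨ sum-cong (λ k → trans (Σᴵ-cong λ s → Σᴵ-* (u k) (λ t → sign s * (sign t * f s t k))) (Σᴵ-* (u k) (λ s → Σᴵ λ t → sign s * (sign t * f s t k)))) ⟩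
      sum (λ k → u k * Σᴵ λ s → Σᴵ λ t → sign s * (sign t * f s t k)) ∎)

  *ᴹ-Ω : ∀ (A : Matrix n) i j → (A *ᴹ Ω) i j ≈ Σᴵ λ s → Σᴵ λ t → sign s * (sign t * (A *ᴹ casimirTerm s t) i j)
  *ᴹ-Ω A i j = sum-casimir (A i) (λ s t k → casimirTerm s t k j)

  Ω-*ᴹ : ∀ (A : Matrix n) i j → (Ω *ᴹ A) i j ≈ Σᴵ λ s → Σᴵ λ t → sign s * (sign t * (casimirTerm s t *ᴹ A) i j)
  Ω-*ᴹ A i j = trans (sum-cong λ k → *-comm (Ω i k) (A k j)) (trans (sum-casimir (λ k → A k j) (λ s t k → casimirTerm s t i k))
    (Σᴵ-cong λ s → Σᴵ-cong λ t → *-congˡ {sign s} (*-congˡ {sign t} (sum-cong λ k → *-comm (A k j) (casimirTerm s t i k)))))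

  -- Each summand commutes by itself: dual indices carry inverse eigenvalues, so the four factors
  -- picked up cancel in pairs.
  Ω-torus : ∀ x → ρ (torusElement x) *ᴹ Ω ≈ᴹ Ω *ᴹ ρ (torusElement x)
  Ω-torus x i j = trans (*ᴹ-Ω R i j) (trans (Σᴵ-cong λ s → Σᴵ-cong λ t → *-congˡ {sign s} (*-congˡ {sign t} (commutes s t))) (sym (Ω-*ᴹ R i j)))
    where
    R = ρ (torusElement x)
    cancel : ∀ s → eigenvalue x s * eigenvalue x (dual s) ≈ 1#
    cancel (inj₁ a) = Symplectic.Torus.inverse x a
    cancel (inj₂ a) = trans (*-comm _ _) (Symplectic.Torus.inverse x a)
    commutes : ∀ s t → (R *ᴹ casimirTerm s t) i j ≈ (casimirTerm s t *ᴹ R) i j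
    commutes s t = begin
      (R *ᴹ (A *ᴹ B)) i j ≈⟨ *ᴹ-assoc R A B i j ⟨
      ((R *ᴹ A) *ᴹ B) i j ≈⟨ *ᴹ-cong {B = B} (torus-D x s t) (λ _ _ → refl) i j ⟩
      (((es * et) ∙ᴹ (A *ᴹ R)) *ᴹ B) i j ≈⟨ ∙ᴹ-*ᴹ (es * et) (A *ᴹ R) B i j ⟩
      es * et * ((A *ᴹ R) *ᴹ B) i j ≈⟨ *-congˡ (*ᴹ-assoc A R B i j) ⟩
      es * et * (A *ᴹ (R *ᴹ B)) i j ≈⟨ *-congˡ (*ᴹ-cong {A = A} (λ _ _ → refl) (torus-D x (dual s) (dual t)) i j) ⟩
      es * et * (A *ᴹ ((es′ * et′) ∙ᴹ (B *ᴹ R))) i j ≈⟨ *-congˡ (*ᴹ-∙ᴹ (es′ * et′) A (B *ᴹ R) i j) ⟩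
      es * et * (es′ * et′ * (A *ᴹ (B *ᴹ R)) i j)
        ≈⟨ solve 5 (λ p q r s z → p :* q :* (r :* s :* z) := (p :* r) :* (q :* s) :* z) refl es et es′ et′ ((A *ᴹ (B *ᴹ R)) i j) ⟩
      (es * es′) * (et * et′) * (A *ᴹ (B *ᴹ R)) i j ≈⟨ *-congʳ (trans (*-cong (cancel s) (cancel t)) (*-identityˡ 1#)) ⟩
      1# * (A *ᴹ (B *ᴹ R)) i j ≈⟨ *-identityˡ _ ⟩
      (A *ᴹ (B *ᴹ R)) i j ≈⟨ *ᴹ-assoc A B R i j ⟨
      ((A *ᴹ B) *ᴹ R) i j ∎
      where
      A = D (b s) (b t)
      B = D (b (dual s)) (b (dual t))
      es = eigenvalue x s
      et = eigenvalue x t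
      es′ = eigenvalue x (dual s)
      et′ = eigenvalue x (dual t)

  private
    bracket-square : ∀ w u v i j → (D w w *ᴹ D u v) i j ≈ (D u v *ᴹ D w w) i j + 2# * (ω w u * D w v i j + ω w v * D u w i j)
    bracket-square w u v i j = trans (bracket w w u v i j) (+-congˡ (solve 1 (λ x → x :+ x := :2 :* x) refl _))

    module _ (w : Vector N) (i j : Fin n) where
      Φ : Vector N → Vector N → Vector N → Vector N → Carrier
      Φ u v u′ v′ = (D u v *ᴹ D u′ v′) i j

      leibniz : ∀ u v u′ v′ → (D w w *ᴹ (D u v *ᴹ D u′ v′)) i j ≈ ((D u v *ᴹ D u′ v′) *ᴹ D w w) i j +
                2# * ((ω w u * Φ w v u′ v′ + ω w v * Φ u w u′ v′) + (ω w u′ * Φ u v w v′ + ω w v′ * Φ u v u′ w))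
      leibniz u v u′ v′ = begin
        (W *ᴹ (A *ᴹ B)) i j ≈⟨ *ᴹ-assoc W A B i j ⟨
        ((W *ᴹ A) *ᴹ B) i j ≈⟨ *ᴹ-cong {B = B} (bracket-square w u v) (λ _ _ → refl) i j ⟩
        ((A *ᴹ W +ᴹ 2# ∙ᴹ (ω w u ∙ᴹ D w v +ᴹ ω w v ∙ᴹ D u w)) *ᴹ B) i j
          ≈⟨ trans (*ᴹ-distribʳ (A *ᴹ W) (2# ∙ᴹ (ω w u ∙ᴹ D w v +ᴹ ω w v ∙ᴹ D u w)) B i j) (+-congˡ (trans (∙ᴹ-*ᴹ 2# (ω w u ∙ᴹ D w v +ᴹ ω w v ∙ᴹ D u w) B i j) (*-congˡ
               (trans (*ᴹ-distribʳ (ω w u ∙ᴹ D w v) (ω w v ∙ᴹ D u w) B i j) (+-cong (∙ᴹ-*ᴹ (ω w u) (D w v) B i j) (∙ᴹ-*ᴹ (ω w v) (D u w) B i j)))))) ⟩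
        ((A *ᴹ W) *ᴹ B) i j + 2# * (ω w u * Φ w v u′ v′ + ω w v * Φ u w u′ v′)
          ≈⟨ +-congʳ (trans (*ᴹ-assoc A W B i j) (trans (*ᴹ-cong {A = A} (λ _ _ → refl) (bracket-square w u′ v′) i j)
               (trans (*ᴹ-distribˡ A (B *ᴹ W) (2# ∙ᴹ (ω w u′ ∙ᴹ D w v′ +ᴹ ω w v′ ∙ᴹ D u′ w)) i j) (+-cong (sym (*ᴹ-assoc A B W i j)) (trans (*ᴹ-∙ᴹ 2# A (ω w u′ ∙ᴹ D w v′ +ᴹ ω w v′ ∙ᴹ D u′ w) i j) (*-congˡ
               (trans (*ᴹ-distribˡ A (ω w u′ ∙ᴹ D w v′) (ω w v′ ∙ᴹ D u′ w) i j) (+-cong (*ᴹ-∙ᴹ (ω w u′) A (D w v′) i j) (*ᴹ-∙ᴹ (ω w v′) A (D u′ w) i j))))))))) ⟩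
        (((A *ᴹ B) *ᴹ W) i j + 2# * (ω w u′ * Φ u v w v′ + ω w v′ * Φ u v u′ w)) + 2# * (ω w u * Φ w v u′ v′ + ω w v * Φ u w u′ v′)
          ≈⟨ solve 3 (λ z p q → (z :+ :2 :* p) :+ :2 :* q := z :+ :2 :* (q :+ p)) refl _ _ _ ⟩
        _ ∎
        where
        W = D w w
        A = D u v
        B = D u′ v′

      Φ₁-linear : ∀ v u′ v′ → IsLinear (λ u → Φ u v u′ v′)
      Φ₁-linear v u′ v′ = record
        { A-cong = λ p → *ᴹ-cong {B = D u′ v′} (D-cong p (λ _ → refl)) (λ _ _ → refl) i j
        ; A-+ = λ u z → trans (*ᴹ-cong {B = D u′ v′} (D-+ˡ u z v) (λ _ _ → refl) i j) (*ᴹ-distribʳ (D u v) (D z v) (D u′ v′) i j)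
        ; A-∙ = λ a u → trans (*ᴹ-cong {B = D u′ v′} (D-∙ˡ a u v) (λ _ _ → refl) i j) (∙ᴹ-*ᴹ a (D u v) (D u′ v′) i j) }

      Φ₂-linear : ∀ u u′ v′ → IsLinear (λ v → Φ u v u′ v′)
      Φ₂-linear u u′ v′ = record
        { A-cong = λ p → *ᴹ-cong {B = D u′ v′} (D-cong (λ _ → refl) p) (λ _ _ → refl) i j
        ; A-+ = λ v z → trans (*ᴹ-cong {B = D u′ v′} (D-+ʳ u v z) (λ _ _ → refl) i j) (*ᴹ-distribʳ (D u v) (D u z) (D u′ v′) i j)
        ; A-∙ = λ a v → trans (*ᴹ-cong {B = D u′ v′} (D-∙ʳ a u v) (λ _ _ → refl) i j) (∙ᴹ-*ᴹ a (D u v) (D u′ v′) i j) }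

      Φ₃-linear : ∀ u v v′ → IsLinear (λ u′ → Φ u v u′ v′)
      Φ₃-linear u v v′ = record
        { A-cong = λ p → *ᴹ-cong {A = D u v} (λ _ _ → refl) (D-cong p (λ _ → refl)) i j
        ; A-+ = λ z y → trans (*ᴹ-cong {A = D u v} (λ _ _ → refl) (D-+ˡ z y v′) i j) (*ᴹ-distribˡ (D u v) (D z v′) (D y v′) i j)
        ; A-∙ = λ a z → trans (*ᴹ-cong {A = D u v} (λ _ _ → refl) (D-∙ˡ a z v′) i j) (*ᴹ-∙ᴹ a (D u v) (D z v′) i j) }

      Φ₄-linear : ∀ u v u′ → IsLinear (λ v′ → Φ u v u′ v′)
      Φ₄-linear u v u′ = record
        { A-cong = λ p → *ᴹ-cong {A = D u v} (λ _ _ → refl) (D-cong (λ _ → refl) p) i j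
        ; A-+ = λ z y → trans (*ᴹ-cong {A = D u v} (λ _ _ → refl) (D-+ʳ u′ z y) i j) (*ᴹ-distribˡ (D u v) (D u′ z) (D u′ y) i j)
        ; A-∙ = λ a z → trans (*ᴹ-cong {A = D u v} (λ _ _ → refl) (D-∙ʳ a u′ z) i j) (*ᴹ-∙ᴹ a (D u v) (D u′ z) i j) }

  -- Leibniz's rule replaces each of the four vectors of a summand by a multiple of w. After
  -- contraction the first and third replacements cancel, and so do the second and fourth; this is
  -- the invariance of ω. Squares suffice because their stability already controls the whole group.
  Ω-central : ∀ w → D w w *ᴹ Ω ≈ᴹ Ω *ᴹ D w w
  Ω-central w i j = begin
    (D w w *ᴹ Ω) i j
      ≈⟨ *ᴹ-Ω (D w w) i j ⟩
    Σᴵ (λ s → Σᴵ λ t → sign s * (sign t * (D w w *ᴹ casimirTerm s t) i j))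
      ≈⟨ Σᴵ-cong (λ s → Σᴵ-cong λ t → trans (*-congˡ (*-congˡ (leibniz w i j (b s) (b t) (b (dual s)) (b (dual t)))))
           (solve 7 (λ p q z x₁ x₂ x₃ x₄ → p :* (q :* (z :+ :2 :* ((x₁ :+ x₂) :+ (x₃ :+ x₄)))) :=
             p :* (q :* z) :+ :2 :* (q :* (p :* x₁ :+ p :* x₃) :+ p :* (q :* x₂ :+ q :* x₄))) refl (sign s) (sign t)
             ((casimirTerm s t *ᴹ D w w) i j) (P₁ s t) (P₂ s t) (P₃ s t) (P₄ s t))) ⟩
    Σᴵ (λ s → Σᴵ λ t → sign s * (sign t * (casimirTerm s t *ᴹ D w w) i j) + 2# * (sign t * (sign s * P₁ s t + sign s * P₃ s t) + sign s * (sign t * P₂ s t + sign t * P₄ s t)))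
      ≈⟨ trans (Σᴵ-cong λ s → Σᴵ-+ (λ t → sign s * (sign t * (casimirTerm s t *ᴹ D w w) i j)) (λ t → 2# * (sign t * Q₁ s t + sign s * Q₂ s t))) (Σᴵ-+ (λ s → Σᴵ λ t → sign s * (sign t * (casimirTerm s t *ᴹ D w w) i j)) (λ s → Σᴵ λ t → 2# * (sign t * Q₁ s t + sign s * Q₂ s t))) ⟩
    Σᴵ (λ s → Σᴵ λ t → sign s * (sign t * (casimirTerm s t *ᴹ D w w) i j)) +
      Σᴵ (λ s → Σᴵ λ t → 2# * (sign t * (sign s * P₁ s t + sign s * P₃ s t) + sign s * (sign t * P₂ s t + sign t * P₄ s t)))
      ≈⟨ +-cong (sym (Ω-*ᴹ (D w w) i j)) (trans (Σᴵ-cong λ s → trans (Σᴵ-* 2# (λ t → sign t * Q₁ s t + sign s * Q₂ s t)) (*-congˡ (Σᴵ-+ (λ t → sign t * Q₁ s t) (λ t → sign s * Q₂ s t))))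
           (trans (Σᴵ-* 2# (λ s → Σᴵ (λ t → sign t * Q₁ s t) + Σᴵ (λ t → sign s * Q₂ s t))) (*-congˡ (Σᴵ-+ (λ s → Σᴵ (λ t → sign t * Q₁ s t)) (λ s → Σᴵ (λ t → sign s * Q₂ s t)))))) ⟩
    (Ω *ᴹ D w w) i j + 2# * (Σᴵ (λ s → Σᴵ λ t → sign t * Q₁ s t) + Σᴵ (λ s → Σᴵ λ t → sign s * Q₂ s t))
      ≈⟨ +-congˡ (*-congˡ (+-cong
           (trans (Σᴵ-comm (λ s t → sign t * Q₁ s t)) (trans (Σᴵ-cong λ t → trans (Σᴵ-* (sign t) (λ s → Q₁ s t)) (trans (*-congˡ (Q₁-0 t)) (zeroʳ _))) Σᴵ-0))
           (trans (Σᴵ-cong λ s → trans (Σᴵ-* (sign s) (Q₂ s)) (trans (*-congˡ (Q₂-0 s)) (zeroʳ _))) Σᴵ-0))) ⟩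
    (Ω *ᴹ D w w) i j + 2# * (0# + 0#)
      ≈⟨ solve 1 (λ x → x :+ :2 :* (:0 :+ :0) := x) refl _ ⟩
    (Ω *ᴹ D w w) i j ∎
    where
    P₁ P₂ P₃ P₄ Q₁ Q₂ : Index → Index → Carrier
    P₁ s t = ω w (b s) * Φ w i j w (b t) (b (dual s)) (b (dual t))
    P₂ s t = ω w (b t) * Φ w i j (b s) w (b (dual s)) (b (dual t))
    P₃ s t = ω w (b (dual s)) * Φ w i j (b s) (b t) w (b (dual t))
    P₄ s t = ω w (b (dual t)) * Φ w i j (b s) (b t) (b (dual s)) w
    Q₁ s t = sign s * P₁ s t + sign s * P₃ s t
    Q₂ s t = sign t * P₂ s t + sign t * P₄ s t
    Σᴵ-0 : Σᴵ (λ _ → 0#) ≈ 0#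
    Σᴵ-0 = trans (+-cong (sum-zero (λ (_ : Fin m) → 0#) (λ _ → refl)) (sum-zero (λ (_ : Fin m) → 0#) (λ _ → refl))) (+-identityˡ 0#)
    Q₁-0 : ∀ t → Σᴵ (λ s → Q₁ s t) ≈ 0#
    Q₁-0 t = trans (Σᴵ-+ (λ s → sign s * P₁ s t) (λ s → sign s * P₃ s t))
      (trans (+-cong (contract₁ (Φ₃-linear w i j w (b t) (b (dual t))) w) (contract₂ (Φ₁-linear w i j (b t) w (b (dual t))) w)) (-‿inverseˡ _))
    Q₂-0 : ∀ s → Σᴵ (Q₂ s) ≈ 0#
    Q₂-0 s = trans (Σᴵ-+ (λ t → sign t * P₂ s t) (λ t → sign t * P₄ s t))
      (trans (+-cong (contract₁ (Φ₄-linear w i j (b s) w (b (dual s))) w) (contract₂ (Φ₂-linear w i j (b s) (b (dual s)) w) w)) (-‿inverseˡ _))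

  charTerms : Terms (Exponent m)
  charTerms = concatSum λ i → torusTerms i i

  charTerms-monomial : ∀ x → ⟨ monomial x , charTerms ⟩ ≈ character V x
  charTerms-monomial x = trans (pair-concatSum (monomial x) (λ i → torusTerms i i)) (sum-cong λ i → torusTerms-monomial x i i)

  module _ (x : Torus m) where
    private
      R : Matrix n
      R = ρ (torusElement x)

    h hh : Fin m → Carrier
    h a = trace (H a *ᴹ R)
    hh a = trace (H a *ᴹ (H a *ᴹ R))

    charTerms-θ : ∀ a → ⟨ θ x a , charTerms ⟩ ≈ h a
    charTerms-θ a = trans (pair-concatSum _ (λ i → torusTerms i i)) (sum-cong λ i → torusTerms-θ x a i i)

    charTerms-θ² : ∀ a → ⟨ (λ ν → ι (ν a) * ι (ν a) * monomial x ν) , charTerms ⟩ ≈ hh a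
    charTerms-θ² a = trans (pair-concatSum _ (λ i → torusTerms i i)) (sum-cong λ i → second i i)
      where
      second : ∀ i j → ⟨ (λ ν → ι (ν a) * ι (ν a) * monomial x ν) , torusTerms i j ⟩ ≈ (H a *ᴹ (H a *ᴹ R)) i j
      second i j = begin
        ⟨ (λ ν → ι (ν a) * ι (ν a) * monomial x ν) , torusTerms i j ⟩
          ≈⟨ pair-cong (torusTerms i j) (λ ν → *-assoc _ _ _) ⟩
        ⟨ (λ ν → ι (ν a) * θ x a ν) , torusTerms i j ⟩
          ≈⟨ pair-weighted (λ ν → ι (ν a)) (θ x a) (torusTerms i j) ⟨
        ⟨ θ x a , weighted (λ ν → ι (ν a)) (torusTerms i j) ⟩
          ≈⟨ independent-≈ (weighted (λ ν → ι (ν a)) (torusTerms i j)) (combination (H a i) (λ k → torusTerms k j)) equal (θ x a)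
               (λ {ν} {κ} p → *-cong (reflexive (≡.cong ι (p a))) (monomial-cong x p)) ⟩
        ⟨ θ x a , combination (H a i) (λ k → torusTerms k j) ⟩
          ≈⟨ pair-combination (θ x a) (H a i) (λ k → torusTerms k j) ⟩
        sum (λ k → H a i k * ⟨ θ x a , torusTerms k j ⟩)
          ≈⟨ sum-cong (λ k → *-congˡ (torusTerms-θ x a k j)) ⟩
        (H a *ᴹ (H a *ᴹ R)) i j ∎
        where
        equal : ∀ y → ⟨ monomial y , weighted (λ ν → ι (ν a)) (torusTerms i j) ⟩ ≈ ⟨ monomial y , combination (H a i) (λ k → torusTerms k j) ⟩
        equal y = begin
          ⟨ monomial y , weighted (λ ν → ι (ν a)) (torusTerms i j) ⟩ ≈⟨ pair-weighted (λ ν → ι (ν a)) (monomial y) (torusTerms i j) ⟩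
          ⟨ (λ ν → ι (ν a) * monomial y ν) , torusTerms i j ⟩ ≈⟨ torusTerms-θ y a i j ⟩
          (H a *ᴹ ρ (torusElement y)) i j ≈⟨ sum-cong (λ k → *-congˡ (torusTerms-monomial y k j)) ⟨
          sum (λ k → H a i k * ⟨ monomial y , torusTerms k j ⟩) ≈⟨ pair-combination (monomial y) (H a i) (λ k → torusTerms k j) ⟨
          ⟨ monomial y , combination (H a i) (λ k → torusTerms k j) ⟩ ∎

    charTerms-radial : ∀ (reg : Regular x) → ⟨ radial reg , charTerms ⟩ ≈ sum hh + sum (λ a → drift reg a * h a)
    charTerms-radial reg = trans (pair-radial reg charTerms)
      (+-cong (sum-cong charTerms-θ²) (sum-cong λ a → *-congˡ (charTerms-θ a)))

    private
      tr : Matrix n → Carrier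
      tr A = trace (A *ᴹ R)

      tr-+ : ∀ A B → tr (A +ᴹ B) ≈ tr A + tr B
      tr-+ A B = trans (trace-cong (*ᴹ-distribʳ A B R)) (trace-+ (A *ᴹ R) (B *ᴹ R))

      tr-∙ : ∀ a A → tr (a ∙ᴹ A) ≈ a * tr A
      tr-∙ a A = trans (trace-cong (∙ᴹ-*ᴹ a A R)) (trace-∙ a (A *ᴹ R))

      tr-cong : ∀ {A B} → A ≈ᴹ B → tr A ≈ tr B
      tr-cong {A} {B} p = trace-cong (*ᴹ-cong {B = R} p λ _ _ → refl)

      -- Moving D(b_s,b_t) cyclically around the trace and past ρ(t).
      rotate : ∀ s t s′ t′ → tr (D (b s) (b t) *ᴹ D (b s′) (b t′)) ≈ eigenvalue x s * eigenvalue x t * tr (D (b s′) (b t′) *ᴹ D (b s) (b t))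
      rotate s t s′ t′ = begin
        trace ((A *ᴹ B) *ᴹ R) ≈⟨ trace-cong (*ᴹ-assoc A B R) ⟩
        trace (A *ᴹ (B *ᴹ R)) ≈⟨ trace-comm A (B *ᴹ R) ⟩
        trace ((B *ᴹ R) *ᴹ A) ≈⟨ trace-cong (*ᴹ-assoc B R A) ⟩
        trace (B *ᴹ (R *ᴹ A)) ≈⟨ trace-cong (*ᴹ-cong {A = B} (λ _ _ → refl) (torus-D x s t)) ⟩
        trace (B *ᴹ (λs ∙ᴹ (A *ᴹ R))) ≈⟨ trans (trace-cong (*ᴹ-∙ᴹ λs B (A *ᴹ R))) (trace-∙ λs (B *ᴹ (A *ᴹ R))) ⟩
        λs * trace (B *ᴹ (A *ᴹ R)) ≈⟨ *-congˡ (trace-cong (*ᴹ-assoc B A R)) ⟨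
        λs * trace ((B *ᴹ A) *ᴹ R) ∎
        where
        A = D (b s) (b t)
        B = D (b s′) (b t′)
        λs = eigenvalue x s * eigenvalue x t

      d : Index → Index → Carrier
      d s t = tr (D (b s) (b t))

      d-ef : ∀ a → d (inj₁ a) (inj₂ a) ≈ - h a
      d-ef a = sym (begin
        - h a ≈⟨ -‿cong (tr-∙ (- 1#) (D (b (inj₁ a)) (b (inj₂ a)))) ⟩
        - (- 1# * d (inj₁ a) (inj₂ a)) ≈⟨ solve 1 (λ z → :- (:-1 :* z) := z) refl _ ⟩
        d (inj₁ a) (inj₂ a) ∎)

      d-sym : ∀ s t → d s t ≈ d t s
      d-sym s t = tr-cong (D-sym (b s) (b t))

      commute : ∀ s t s′ t′ → tr (D (b s) (b t) *ᴹ D (b s′) (b t′)) ≈ tr (D (b s′) (b t′) *ᴹ D (b s) (b t)) +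
                ((Jblock s s′ * d t t′ + Jblock s t′ * d s′ t) + (Jblock t s′ * d s t′ + Jblock t t′ * d s′ s))
      commute s t s′ t′ = trans (tr-cong (bracket (b s) (b t) (b s′) (b t′)))
        (trans (tr-+ (D (b s′) (b t′) *ᴹ D (b s) (b t)) (Bracket (b s) (b t) (b s′) (b t′))) (+-congˡ
        (trans (tr-+ (ω (b s) (b s′) ∙ᴹ D (b t) (b t′) +ᴹ ω (b s) (b t′) ∙ᴹ D (b s′) (b t)) (ω (b t) (b s′) ∙ᴹ D (b s) (b t′) +ᴹ ω (b t) (b t′) ∙ᴹ D (b s′) (b s))) (+-cong
          (trans (tr-+ (ω (b s) (b s′) ∙ᴹ D (b t) (b t′)) (ω (b s) (b t′) ∙ᴹ D (b s′) (b t))) (+-cong (term s s′ t t′) (term s t′ s′ t)))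
          (trans (tr-+ (ω (b t) (b s′) ∙ᴹ D (b s) (b t′)) (ω (b t) (b t′) ∙ᴹ D (b s′) (b s))) (+-cong (term t s′ s t′) (term t t′ s′ s)))))))
        where
        term : ∀ p q u v → tr (ω (b p) (b q) ∙ᴹ D (b u) (b v)) ≈ Jblock p q * d u v
        term p q u v = trans (tr-∙ (ω (b p) (b q)) (D (b u) (b v))) (*-congʳ (ω-b p q))

      τ : Index → Index → Carrier
      τ s t = tr (casimirTerm s t)

      trace-Ω : tr Ω ≈ sum (λ a → sum λ c → (τ (inj₁ a) (inj₁ c) + τ (inj₂ a) (inj₂ c)) - (τ (inj₁ a) (inj₂ c) + τ (inj₂ a) (inj₁ c)))
      trace-Ω = begin
        sum (λ i → (Ω *ᴹ R) i i)
          ≈⟨ sum-cong (λ i → Ω-*ᴹ R i i) ⟩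
        sum (λ i → Σᴵ λ s → Σᴵ λ t → sign s * (sign t * (casimirTerm s t *ᴹ R) i i))
          ≈⟨ Σᴵ-sum (λ s i → Σᴵ λ t → sign s * (sign t * (casimirTerm s t *ᴹ R) i i)) ⟨
        Σᴵ (λ s → sum λ i → Σᴵ λ t → sign s * (sign t * (casimirTerm s t *ᴹ R) i i))
          ≈⟨ Σᴵ-cong (λ s → Σᴵ-sum (λ t i → sign s * (sign t * (casimirTerm s t *ᴹ R) i i))) ⟨
        Σᴵ (λ s → Σᴵ λ t → sum λ i → sign s * (sign t * (casimirTerm s t *ᴹ R) i i))
          ≈⟨ Σᴵ-cong (λ s → Σᴵ-cong λ t → trans (sym (*-distribˡ-sum (sign s) (λ i → sign t * (casimirTerm s t *ᴹ R) i i)))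
               (*-congˡ (sym (*-distribˡ-sum (sign t) (λ i → (casimirTerm s t *ᴹ R) i i))))) ⟩
        Σᴵ (λ s → Σᴵ λ t → sign s * (sign t * τ s t))
          ≈⟨ ∑-distrib-+ (λ a → Σᴵ (g (inj₁ a))) (λ a → Σᴵ (g (inj₂ a))) ⟨
        sum (λ a → Σᴵ (g (inj₁ a)) + Σᴵ (g (inj₂ a)))
          ≈⟨ sum-cong (λ a → trans (+-cong (sym (∑-distrib-+ (λ c → g (inj₁ a) (inj₁ c)) (λ c → g (inj₁ a) (inj₂ c)))) (sym (∑-distrib-+ (λ c → g (inj₂ a) (inj₁ c)) (λ c → g (inj₂ a) (inj₂ c)))))
               (trans (sym (∑-distrib-+ (λ c → g (inj₁ a) (inj₁ c) + g (inj₁ a) (inj₂ c)) (λ c → g (inj₂ a) (inj₁ c) + g (inj₂ a) (inj₂ c))))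
               (sum-cong λ c → solve 4 (λ p q r s → (:1 :* (:1 :* p) :+ :1 :* (:-1 :* q)) :+ (:-1 :* (:1 :* r) :+ :-1 :* (:-1 :* s))
                   := (p :+ s) :- (q :+ r)) refl (τ (inj₁ a) (inj₁ c)) (τ (inj₁ a) (inj₂ c)) (τ (inj₂ a) (inj₁ c)) (τ (inj₂ a) (inj₂ c))))) ⟩
        _ ∎
        where
        g : Index → Index → Carrier
        g s t = sign s * (sign t * τ s t)

      -- `P` gathers the contributions of the roots ±(ε_a + ε_c), the long roots when `a = c`. `M`
      -- gathers those of ±(ε_a - ε_c), the Cartan part when `a = c`.
      P M : Fin m → Fin m → Carrier
      P a c = τ (inj₁ a) (inj₁ c) + τ (inj₂ a) (inj₂ c)
      M a c = τ (inj₁ a) (inj₂ c) + τ (inj₂ a) (inj₁ c)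

      y : Fin m → Carrier
      y = inv x
      xv : Fin m → Carrier
      xv = val x
      xy≈1 : ∀ a → xv a * y a ≈ 1#
      xy≈1 = Symplectic.Torus.inverse x

      -- Cyclicity of the trace gives one relation between the two orders of a product of opposite
      -- root vectors, the commutator gives another. Eliminating both orders leaves the sum p + q in
      -- terms of the Cartan element alone.
      solve-pair : ∀ {p q z l} → p ≈ l * q → p ≈ q + z → (l - 1#) * (p + q) ≈ (l + 1#) * z
      solve-pair {p} {q} {z} {l} e₁ e₂ = begin
        (l - 1#) * (p + q) ≈⟨ solve 3 (λ l p q → (l :- :1) :* (p :+ q) := (l :* p :+ l :* q) :- (p :+ q)) refl l p q ⟩
        (l * p + l * q) - (p + q) ≈⟨ +-cong (+-cong (*-congˡ e₂) (sym e₁)) (-‿cong (+-congʳ e₂)) ⟩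
        (l * (q + z) + p) - ((q + z) + q) ≈⟨ +-congʳ (+-cong (solve 3 (λ l q z → l :* (q :+ z) := l :* q :+ l :* z) refl l q z) e₂) ⟩
        ((l * q + l * z) + (q + z)) - ((q + z) + q) ≈⟨ +-congʳ (+-congʳ (+-congʳ (trans (sym e₁) e₂))) ⟩
        (((q + z) + l * z) + (q + z)) - ((q + z) + q) ≈⟨ solve 3 (λ l q z → (((q :+ z) :+ l :* z) :+ (q :+ z)) :- ((q :+ z) :+ q) := (l :+ :1) :* z) refl l q z ⟩
        (l + 1#) * z ∎

      P-relation : ∀ a c z → ((Jblock (inj₁ a) (inj₂ a) * d (inj₁ c) (inj₂ c) + Jblock (inj₁ a) (inj₂ c) * d (inj₂ a) (inj₁ c)) +
                   (Jblock (inj₁ c) (inj₂ a) * d (inj₁ a) (inj₂ c) + Jblock (inj₁ c) (inj₂ c) * d (inj₂ a) (inj₁ a))) ≈ z →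
                   (xv a * xv c - 1#) * P a c ≈ (xv a * xv c + 1#) * z
      P-relation a c z eq = solve-pair (rotate (inj₁ a) (inj₁ c) (inj₂ a) (inj₂ c))
        (trans (commute (inj₁ a) (inj₁ c) (inj₂ a) (inj₂ c)) (+-congˡ eq))

      P-diagonal : ∀ a → Ẋ x a * P a a ≈ - (ι (+ 4) * (X̂ x a * h a))
      P-diagonal a = begin
        (xv a - y a) * P a a ≈⟨ *-congʳ (+-congʳ (trans (sym (*-identityʳ _)) (*-congˡ (sym (xy≈1 a))))) ⟩
        (xv a * (xv a * y a) - y a) * P a a ≈⟨ solve 3 (λ x y p → (x :* (x :* y) :- y) :* p := y :* ((x :* x :- :1) :* p)) refl (xv a) (y a) (P a a) ⟩
        y a * ((xv a * xv a - 1#) * P a a) ≈⟨ *-congˡ (P-relation a a (- (ι (+ 4) * h a)) (trans (+-cong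
             (+-cong (*-cong (1ᴹ-diagonal a) (d-ef a)) (*-cong (1ᴹ-diagonal a) (trans (d-sym (inj₂ a) (inj₁ a)) (d-ef a))))
             (+-cong (*-cong (1ᴹ-diagonal a) (d-ef a)) (*-cong (1ᴹ-diagonal a) (trans (d-sym (inj₂ a) (inj₁ a)) (d-ef a)))))
             (solve 1 (λ h → (:1 :* (:- h) :+ :1 :* (:- h)) :+ (:1 :* (:- h) :+ :1 :* (:- h)) := :- (con (+ 4) :* h)) refl (h a)))) ⟩
        y a * ((xv a * xv a + 1#) * - (ι (+ 4) * h a)) ≈⟨ solve 3 (λ x y h → y :* ((x :* x :+ :1) :* (:- (con (+ 4) :* h))) := :- (con (+ 4) :* ((x :* (x :* y) :+ y) :* h))) refl (xv a) (y a) (h a) ⟩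
        - (ι (+ 4) * ((xv a * (xv a * y a) + y a) * h a)) ≈⟨ -‿cong (*-congˡ (*-congʳ (+-congʳ (trans (*-congˡ (xy≈1 a)) (*-identityʳ _))))) ⟩
        - (ι (+ 4) * ((xv a + y a) * h a)) ∎

      M-diagonal : ∀ a → M a a ≈ 2# * hh a
      M-diagonal a = begin
        tr (E *ᴹ D (b (inj₂ a)) (b (inj₁ a))) + tr (D (b (inj₂ a)) (b (inj₁ a)) *ᴹ E)
          ≈⟨ +-cong (tr-cong (*ᴹ-cong {A = E} (λ _ _ → refl) (D-sym (b (inj₂ a)) (b (inj₁ a))))) (tr-cong (*ᴹ-cong {B = E} (D-sym (b (inj₂ a)) (b (inj₁ a))) (λ _ _ → refl))) ⟩
        tr (E *ᴹ E) + tr (E *ᴹ E)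
          ≈⟨ solve 1 (λ z → z :+ z := :2 :* z) refl _ ⟩
        2# * tr (E *ᴹ E)
          ≈⟨ *-congˡ (begin
            trace ((E *ᴹ E) *ᴹ R) ≈⟨ trace-cong (*ᴹ-assoc E E R) ⟩
            trace (E *ᴹ (E *ᴹ R)) ≈⟨ solve 1 (λ z → z := :-1 :* (:-1 :* z)) refl _ ⟩
            - 1# * (- 1# * trace (E *ᴹ (E *ᴹ R))) ≈⟨ *-congˡ (trans (sym (trace-∙ (- 1#) (E *ᴹ (E *ᴹ R)))) (trace-cong λ i j → sym (*ᴹ-∙ᴹ (- 1#) E (E *ᴹ R) i j))) ⟩
            - 1# * trace (E *ᴹ ((- 1#) ∙ᴹ (E *ᴹ R))) ≈⟨ trans (sym (trace-∙ (- 1#) (E *ᴹ ((- 1#) ∙ᴹ (E *ᴹ R))))) (trace-cong λ i j → sym (∙ᴹ-*ᴹ (- 1#) E ((- 1#) ∙ᴹ (E *ᴹ R)) i j)) ⟩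
            trace (H a *ᴹ ((- 1#) ∙ᴹ (E *ᴹ R))) ≈⟨ trace-cong (*ᴹ-cong {A = H a} (λ _ _ → refl) (λ i j → sym (∙ᴹ-*ᴹ (- 1#) E R i j))) ⟩
            trace (H a *ᴹ (H a *ᴹ R)) ∎) ⟩
        2# * hh a ∎
        where E = D (b (inj₁ a)) (b (inj₂ a))

      P-off : ∀ a c → a ≢ c → (X̂ x a - X̂ x c) * P a c ≈ (Ẋ x a - Ẋ x c) * - (h a + h c)
      P-off a c a≢c = inverse-pairs (xy≈1 a) (xy≈1 c) (P-relation a c (- (h a + h c)) (trans (+-cong
        (+-cong (*-cong (1ᴹ-diagonal a) (d-ef c)) (trans (*-congʳ (1ᴹ-offdiagonal a≢c)) (zeroˡ _)))
        (+-cong (trans (*-congʳ (1ᴹ-offdiagonal (a≢c ∘ ≡.sym))) (zeroˡ _)) (*-cong (1ᴹ-diagonal c) (trans (d-sym (inj₂ a) (inj₁ a)) (d-ef a)))))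
        (solve 2 (λ ha hc → (:1 :* (:- hc) :+ :0) :+ (:0 :+ :1 :* (:- ha)) := :- (ha :+ hc)) refl (h a) (h c))))

      -- The elimination of `P-off` with x_c inverted. Inversion leaves X̂ unchanged and negates Ẋ,
      -- so both pairs of short roots share the denominator X̂_a - X̂_c.
      M-off : ∀ a c → a ≢ c → (X̂ x a - X̂ x c) * M a c ≈ (Ẋ x a + Ẋ x c) * (h a - h c)
      M-off a c a≢c = begin
        (X̂ x a - X̂ x c) * M a c
          ≈⟨ *-congʳ (+-congˡ (-‿cong (+-comm _ _))) ⟩
        ((xv a + y a) - (y c + xv c)) * M a c
          ≈⟨ inverse-pairs (xy≈1 a) (trans (*-comm _ _) (xy≈1 c)) (solve-pair (rotate (inj₁ a) (inj₂ c) (inj₂ a) (inj₁ c)) (trans (commute (inj₁ a) (inj₂ c) (inj₂ a) (inj₁ c)) (+-congˡ (trans (+-cong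
               (+-cong (*-cong (1ᴹ-diagonal a) (trans (d-sym (inj₂ c) (inj₁ c)) (d-ef c))) (zeroˡ _))
               (+-cong (zeroˡ _) (*-cong (-‿cong (1ᴹ-diagonal c)) (trans (d-sym (inj₂ a) (inj₁ a)) (d-ef a)))))
               (solve 2 (λ ha hc → (:1 :* (:- hc) :+ :0) :+ (:0 :+ :-1 :* (:- ha)) := ha :- hc) refl (h a) (h c)))))) ⟩
        ((xv a - y a) - (y c - xv c)) * (h a - h c)
          ≈⟨ *-congʳ (solve 3 (λ d p q → d :- (p :- q) := d :+ (q :- p)) refl (Ẋ x a) (y c) (xv c)) ⟩
        (Ẋ x a + Ẋ x c) * (h a - h c) ∎

    -- For a ≠ c the contributions of the short roots combine to `r a c` times 2Ẋ_a h_a - 2Ẋ_c h_c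
    -- up to sign. As `r` is antisymmetric, summing over ordered pairs doubles the first half; this
    -- is the `U + U` below, and it matches twice the short-root part of the drift.
    radial-Ω : ∀ (reg : Regular x) → 2# * (sum hh + sum (λ a → drift reg a * h a)) + trace (Ω *ᴹ R) ≈ 0#
    radial-Ω reg = begin
      2# * (sum hh + sum (λ a → drift reg a * h a)) + tr Ω
        ≈⟨ +-congˡ (trans trace-Ω (trans (sum-cong λ a → trans (sum-cong (pairs a)) (sum-neg (G a))) (sum-neg (λ a → sum (G a))))) ⟩
      2# * (sum hh + sum (λ a → drift reg a * h a)) - sum (λ a → sum (G a))
        ≈⟨ +-cong total (-‿cong sum-G) ⟩
      (sum (λ a → diag a) + (U + U)) - (sum (λ a → diag a) + (U + U))
        ≈⟨ -‿inverseʳ _ ⟩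
      0# ∎
      where
      open Regular reg using (s; s-inv; r; r-inv; r-diag; r-antisym)
      diag : Fin m → Carrier
      diag a = 2# * hh a + ι (+ 4) * (s a * (X̂ x a * h a))
      u : Fin m → Fin m → Carrier
      u a c = r a c * (2# * (Ẋ x a * h a))
      U : Carrier
      U = sum λ a → sum (u a)
      G : Fin m → Fin m → Carrier
      G a c = 1ᴹ a c * diag a + r a c * (2# * (Ẋ x a * h a) - 2# * (Ẋ x c * h c))

      pairs : ∀ a c → (P a c - M a c) ≈ - G a c
      pairs a c with a Fin.≟ c
      ... | yes ≡.refl = begin
        P a a - M a a ≈⟨ +-congʳ (trans (sym (*-identityˡ _)) (*-congʳ (sym (s-inv a)))) ⟩
        Ẋ x a * s a * P a a - M a a ≈⟨ +-cong (trans (solve 3 (λ d s p → d :* s :* p := s :* (d :* p)) refl (Ẋ x a) (s a) (P a a)) (*-congˡ (P-diagonal a))) (-‿cong (M-diagonal a)) ⟩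
        s a * - (ι (+ 4) * (X̂ x a * h a)) - 2# * hh a ≈⟨ solve 4 (λ s xh hh e → s :* (:- (con (+ 4) :* xh)) :- :2 :* hh := :- (:1 :* (:2 :* hh :+ con (+ 4) :* (s :* xh)) :+ :0 :* (e :- e))) refl (s a) (X̂ x a * h a) (hh a) (2# * (Ẋ x a * h a)) ⟩
        - (1# * diag a + 0# * (2# * (Ẋ x a * h a) - 2# * (Ẋ x a * h a))) ≈⟨ -‿cong (+-cong (*-congʳ (1ᴹ-diagonal a)) (*-congʳ (r-diag a))) ⟨
        - G a a ∎
      ... | no a≢c = begin
        P a c - M a c ≈⟨ trans (sym (*-identityˡ _)) (*-congʳ (sym (r-inv a c a≢c))) ⟩
        (X̂ x a - X̂ x c) * r a c * (P a c - M a c) ≈⟨ solve 4 (λ d r p q → d :* r :* (p :- q) := r :* (d :* p :- d :* q)) refl (X̂ x a - X̂ x c) (r a c) (P a c) (M a c) ⟩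
        r a c * ((X̂ x a - X̂ x c) * P a c - (X̂ x a - X̂ x c) * M a c) ≈⟨ *-congˡ (+-cong (P-off a c a≢c) (-‿cong (M-off a c a≢c))) ⟩
        r a c * ((Ẋ x a - Ẋ x c) * - (h a + h c) - (Ẋ x a + Ẋ x c) * (h a - h c))
          ≈⟨ solve 6 (λ r p q ha hc g → r :* ((p :- q) :* (:- (ha :+ hc)) :- (p :+ q) :* (ha :- hc)) := :- (:0 :* g :+ r :* (:2 :* (p :* ha) :- :2 :* (q :* hc)))) refl (r a c) (Ẋ x a) (Ẋ x c) (h a) (h c) (diag a) ⟩
        - (0# * diag a + r a c * (2# * (Ẋ x a * h a) - 2# * (Ẋ x c * h c))) ≈⟨ -‿cong (+-congʳ (*-congʳ (1ᴹ-offdiagonal a≢c))) ⟨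
        - G a c ∎

      sum-G : sum (λ a → sum (G a)) ≈ sum diag + (U + U)
      sum-G = begin
        sum (λ a → sum (G a))
          ≈⟨ sum-cong (λ a → trans (∑-distrib-+ (λ c → 1ᴹ a c * diag a) (λ c → r a c * (2# * (Ẋ x a * h a) - 2# * (Ẋ x c * h c)))) (+-cong (1ᴹ-▹ (λ _ → diag a) a)
               (trans (sum-cong λ c → trans (solve 3 (λ r p q → r :* (p :- q) := r :* p :+ (:- r) :* q) refl (r a c) (2# * (Ẋ x a * h a)) (2# * (Ẋ x c * h c))) (+-congˡ (*-congʳ (sym (r-antisym a c))))) (∑-distrib-+ (u a) (λ c → u c a))))) ⟩
        sum (λ a → diag a + (sum (u a) + sum (λ c → u c a)))
          ≈⟨ trans (∑-distrib-+ diag (λ a → sum (u a) + sum (λ c → u c a))) (+-congˡ (trans (∑-distrib-+ (λ a → sum (u a)) (λ a → sum (λ c → u c a))) (+-congˡ (∑-comm (λ a c → u c a))))) ⟩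
        sum diag + (U + U) ∎

      total : 2# * (sum hh + sum (λ a → drift reg a * h a)) ≈ sum diag + (U + U)
      total = begin
        2# * (sum hh + sum (λ a → drift reg a * h a))
          ≈⟨ *-congˡ (sym (∑-distrib-+ hh (λ a → drift reg a * h a))) ⟩
        2# * sum (λ a → hh a + drift reg a * h a)
          ≈⟨ *-distribˡ-sum 2# (λ a → hh a + drift reg a * h a) ⟩
        sum (λ a → 2# * (hh a + drift reg a * h a))
          ≈⟨ sum-cong (λ a → trans (solve 5 (λ hh xh s w h → :2 :* (hh :+ (:2 :* (xh :* s) :+ w) :* h) := (:2 :* hh :+ con (+ 4) :* (s :* (xh :* h))) :+ (w :* h :+ w :* h)) refl
               (hh a) (X̂ x a) (s a) (sum λ c → 2# * (Ẋ x a * r a c)) (h a)) (+-congˡ (+-cong (inner a) (inner a)))) ⟩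
        sum (λ a → diag a + (sum (u a) + sum (u a)))
          ≈⟨ trans (∑-distrib-+ diag (λ a → sum (u a) + sum (u a))) (+-congˡ (∑-distrib-+ (λ a → sum (u a)) (λ a → sum (u a)))) ⟩
        sum diag + (U + U) ∎
        where
        inner : ∀ a → sum (λ c → 2# * (Ẋ x a * r a c)) * h a ≈ sum (u a)
        inner a = trans (*-distribʳ-sum (h a) (λ c → 2# * (Ẋ x a * r a c))) (sum-cong λ c →
          solve 3 (λ d r h → :2 :* (d :* r) :* h := r :* (:2 :* (d :* h))) refl (Ẋ x a) (r a c) (h a))

  module _ (irreducible : IsIrreducible V) (μ : Partition m) (highestWeight : HasHighestWeight V μ) where
    open HighestWeight irreducible μ highestWeight
    open HasHighestWeight highestWeight using (nonzero) renaming (vector to v)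

    private
      Ωv-weight : ∀ x i → (ρ (torusElement x) ▹ (Ω ▹ v)) i ≈ monomial x μᵉ * (Ω ▹ v) i
      Ωv-weight x i = begin
        (ρ (torusElement x) ▹ (Ω ▹ v)) i ≈⟨ *ᴹ-▹ (ρ (torusElement x)) Ω v i ⟨
        ((ρ (torusElement x) *ᴹ Ω) ▹ v) i ≈⟨ ▹-cong (Ω-torus x) (λ _ → refl) i ⟩
        ((Ω *ᴹ ρ (torusElement x)) ▹ v) i ≈⟨ *ᴹ-▹ Ω (ρ (torusElement x)) v i ⟩
        (Ω ▹ (ρ (torusElement x) ▹ v)) i ≈⟨ ▹-congˡ Ω (torus-v x) i ⟩
        (Ω ▹ (monomial x μᵉ ∙ᵛ v)) i ≈⟨ ▹-∙ Ω (monomial x μᵉ) v i ⟩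
        monomial x μᵉ * (Ω ▹ v) i ∎

      c₀ : Carrier
      c₀ = Decomposition.leading (decomposition (Ω ▹ v))

      -- Schur's argument without eigenvalue theory: Ω commutes with the torus, so Ω v has weight μ
      -- and is a multiple c₀ of v. The eigenspace of c₀ is then an invariant subspace containing v.
      Ω-scalar : ∀ w → Ω ▹ w ≈ᵛ c₀ ∙ᵛ w
      Ω-scalar = IsIrreducible.simple irreducible (λ w → Ω ▹ w ≈ᵛ c₀ ∙ᵛ w)
        (isInvariantSubspace (record
          { respects = λ p q i → trans (sym (▹-congˡ Ω p i)) (trans (q i) (*-congˡ (p i)))
          ; zero∈ = λ i → trans (▹-0 Ω i) (sym (zeroʳ c₀))
          ; +-closed = λ {u} {w} p q i → trans (▹-+ Ω u w i) (trans (+-cong (p i) (q i)) (sym (distribˡ c₀ (u i) (w i))))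
          ; ∙-closed = λ a {u} p i → trans (▹-∙ Ω a u i) (trans (*-congˡ (p i)) (solve 3 (λ a c u → a :* (c :* u) := c :* (a :* u)) refl a c₀ (u i))) })
          (λ z {w} p i → begin
            (Ω ▹ (D z z ▹ w)) i ≈⟨ *ᴹ-▹ Ω (D z z) w i ⟨
            ((Ω *ᴹ D z z) ▹ w) i ≈⟨ ▹-cong (Ω-central z) (λ _ → refl) i ⟨
            ((D z z *ᴹ Ω) ▹ w) i ≈⟨ *ᴹ-▹ (D z z) Ω w i ⟩
            (D z z ▹ (Ω ▹ w)) i ≈⟨ ▹-congˡ (D z z) p i ⟩
            (D z z ▹ (c₀ ∙ᵛ w)) i ≈⟨ ▹-∙ (D z z) c₀ w i ⟩
            c₀ * (D z z ▹ w) i ∎))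
        v (weight-vector (Ω ▹ v) Ωv-weight) nonzero

    charTerms-eigen : ∃ λ c → IsEigen charTerms c
    charTerms-eigen = - (½ * c₀) , λ x reg → let R = ρ (torusElement x) ; S = sum (hh x) + sum (λ a → drift reg a * h x a) in begin
      ⟨ radial reg , charTerms ⟩ ≈⟨ charTerms-radial x reg ⟩
      S ≈⟨ trans (sym (*-identityˡ S)) (*-congʳ (sym 2½≈1)) ⟩
      2# * ½ * S ≈⟨ solve 3 (λ h S t → :2 :* h :* S := h :* ((:2 :* S :+ t) :- t)) refl ½ S (trace (Ω *ᴹ R)) ⟩
      ½ * ((2# * S + trace (Ω *ᴹ R)) - trace (Ω *ᴹ R)) ≈⟨ *-congˡ (+-cong (radial-Ω x reg) (-‿cong (begin
        trace (Ω *ᴹ R) ≈⟨ sum-cong (λ i → Ω-scalar (λ k → R k i) i) ⟩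
        sum (λ i → c₀ * R i i) ≈⟨ *-distribˡ-sum c₀ (λ i → R i i) ⟨
        c₀ * character V x ≈⟨ *-congˡ (charTerms-monomial x) ⟨
        c₀ * ⟨ monomial x , charTerms ⟩ ∎))) ⟩
      ½ * (0# - c₀ * ⟨ monomial x , charTerms ⟩) ≈⟨ solve 3 (λ h c z → h :* (:0 :- c :* z) := (:- (h :* c)) :* z) refl ½ c₀ ⟨ monomial x , charTerms ⟩ ⟩
      - (½ * c₀) * ⟨ monomial x , charTerms ⟩ ∎

    -- `charTerms` and the expansion by weights are different lists with the same values at every
    -- torus point. By independence the radial pairing is the same for both.
    expansion-eigen : ∃ λ c → IsEigen ((1# , μᵉ) ∷ lowerTerms) c
    expansion-eigen = c , λ x reg → begin
      ⟨ radial reg , (1# , μᵉ) ∷ lowerTerms ⟩ ≈⟨ independent-≈ ((1# , μᵉ) ∷ lowerTerms) charTerms same (radial reg) (radial-cong reg) ⟩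
      ⟨ radial reg , charTerms ⟩ ≈⟨ proj₂ charTerms-eigen x reg ⟩
      c * ⟨ monomial x , charTerms ⟩ ≈⟨ *-congˡ (same x) ⟨
      c * ⟨ monomial x , (1# , μᵉ) ∷ lowerTerms ⟩ ∎
      where
      c = proj₁ charTerms-eigen
      same : ∀ x → ⟨ monomial x , (1# , μᵉ) ∷ lowerTerms ⟩ ≈ ⟨ monomial x , charTerms ⟩
      same x = trans (+-congʳ (*-identityˡ _)) (trans (sym (character-expansion x)) (sym (charTerms-monomial x)))

-- The Weyl group, dominance and Casimir values

module WeylGroup where
  -- Generators of the Weyl group of type C: the sign change of any one coordinate and the
  -- transposition of any two neighbours, moved along by `shift`.
  data Reflection : ℕ → Set where
    flip  : ∀ {m} → Reflection (suc m)
    swap  : ∀ {m} → Reflection (suc (suc m))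
    shift : ∀ {m} → Reflection m → Reflection (suc m)

  actᵉ : ∀ {m} → Reflection m → Exponent m → Exponent m
  actᵉ flip      ν zero          = ℤ.- ν zero
  actᵉ flip      ν (suc a)       = ν (suc a)
  actᵉ swap      ν zero          = ν (suc zero)
  actᵉ swap      ν (suc zero)    = ν zero
  actᵉ swap      ν (suc (suc a)) = ν (suc (suc a))
  actᵉ (shift σ) ν zero          = ν zero
  actᵉ (shift σ) ν (suc a)       = actᵉ σ (ν ∘ suc) a

  actᵉ-cong : ∀ {m} (σ : Reflection m) {ν κ : Exponent m} → ν ≗ κ → actᵉ σ ν ≗ actᵉ σ κ
  actᵉ-cong flip      p zero          = ≡.cong ℤ.-_ (p zero)
  actᵉ-cong flip      p (suc a)       = p (suc a)
  actᵉ-cong swap      p zero          = p (suc zero)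
  actᵉ-cong swap      p (suc zero)    = p zero
  actᵉ-cong swap      p (suc (suc a)) = p (suc (suc a))
  actᵉ-cong (shift σ) p zero          = p zero
  actᵉ-cong (shift σ) p (suc a)       = actᵉ-cong σ (p ∘ suc) a

  actᵉ-involutive : ∀ {m} (σ : Reflection m) ν → actᵉ σ (actᵉ σ ν) ≗ ν
  actᵉ-involutive flip      ν zero          = ℤ.neg-involutive (ν zero)
  actᵉ-involutive flip      ν (suc a)       = ≡.refl
  actᵉ-involutive swap      ν zero          = ≡.refl
  actᵉ-involutive swap      ν (suc zero)    = ≡.refl
  actᵉ-involutive swap      ν (suc (suc a)) = ≡.refl
  actᵉ-involutive (shift σ) ν zero          = ≡.refl
  actᵉ-involutive (shift σ) ν (suc a)       = actᵉ-involutive σ (ν ∘ suc) a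

  Dominant : ∀ {m} → Exponent m → Set
  Dominant {zero}  ν = ⊤
  Dominant {suc m} ν = +0 ℤ.≤ ν zero × (∀ a → ν (suc a) ℤ.≤ ν zero) × Dominant (ν ∘ suc)

  private
    i<j⇒0<j-i : ∀ {i j} → i ℤ.< j → +0 ℤ.< j ℤ.- i
    i<j⇒0<j-i {i} {j} p = ≡.subst (ℤ._< j ℤ.- i) (ℤ.+-inverseʳ i) (ℤ.+-monoˡ-< (ℤ.- i) p)

    0<j-i⇒i<j : ∀ {i j} → +0 ℤ.< j ℤ.- i → i ℤ.< j
    0<j-i⇒i<j {i} {j} p = ≡.subst₂ ℤ._<_ (ℤ.+-identityˡ i) (ℤsolve 2 (λ i j → j ⊟ i ⊞ i ⊜ j) ≡.refl i j) (ℤ.+-monoˡ-< i p)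

    *-positive : ∀ {i j} → +0 ℤ.< i → +0 ℤ.< j → +0 ℤ.< i ℤ.* j
    *-positive {ℤ.+[1+ i ]} {ℤ.+[1+ j ]} (ℤ.+<+ _) (ℤ.+<+ _) = ℤ.+<+ (ℕ.s≤s ℕ.z≤n)

  -- Flipping a negative entry adds -2h_aν_a > 0 to the product. Swapping neighbours with ν_a <
  -- ν_{a+1} adds (h_a - h_{a+1})(ν_{a+1} - ν_a) > 0.
  dominant-or-raised : ∀ {m} (ν : Exponent m) → Dominant ν ⊎ ∃ λ σ → ∀ h → Decreasing h → dot h ν ℤ.< dot h (actᵉ σ ν)
  dominant-or-raised {zero}  ν = inj₁ tt
  dominant-or-raised {suc m} ν with dominant-or-raised (ν ∘ suc)
  ... | inj₂ (σ , raise) = inj₂ (shift σ , λ h (_ , _ , dec) → ℤ.+-monoʳ-< (h zero ℤ.* ν zero) (raise (h ∘ suc) dec))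
  ... | inj₁ dom with +0 ℤ.≤? ν zero
  ...   | no ¬p = inj₂ (flip , λ h (0<h , _ , _) → ℤ.+-monoˡ-< (dot (h ∘ suc) (ν ∘ suc)) (0<j-i⇒i<j {h zero ℤ.* ν zero} {h zero ℤ.* ℤ.- ν zero} (≡.subst (+0 ℤ.<_)
            (ℤsolve 2 (λ h n → h ⊠ (⊟ n ⊞ ⊟ n) ⊜ h ⊠ (⊟ n) ⊟ h ⊠ n) ≡.refl (h zero) (ν zero))
            (*-positive 0<h (ℤ.+-mono-< (ℤ.neg-mono-< (ℤ.≰⇒> ¬p)) (ℤ.neg-mono-< (ℤ.≰⇒> ¬p)))))))
  dominant-or-raised {suc zero}    ν | inj₁ dom | yes p = inj₁ (p , (λ ()) , tt)
  dominant-or-raised {suc (suc m)} ν | inj₁ dom | yes p with ν (suc zero) ℤ.≤? ν zero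
  ...   | yes q = inj₁ (p , (λ { zero → q ; (suc a) → ℤ.≤-trans (proj₁ (proj₂ dom) a) q }) , dom)
  ...   | no ¬q = inj₂ (swap , λ h (_ , below , _) → 0<j-i⇒i<j (≡.subst (+0 ℤ.<_)
            (ℤsolve 5 (λ h₀ h₁ n₀ n₁ d → (h₀ ⊟ h₁) ⊠ (n₁ ⊟ n₀) ⊜ (h₀ ⊠ n₁ ⊞ (h₁ ⊠ n₀ ⊞ d)) ⊟ (h₀ ⊠ n₀ ⊞ (h₁ ⊠ n₁ ⊞ d)))
              ≡.refl (h zero) (h (suc zero)) (ν zero) (ν (suc zero)) (dot {m} (λ a → h (suc (suc a))) (λ a → ν (suc (suc a)))))
            (*-positive (i<j⇒0<j-i (below zero)) (i<j⇒0<j-i (ℤ.≰⇒> ¬q)))))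

  open Dominance

  private
    -- The generalisation that makes the induction work: `c` is the partial sum accumulated to the
    -- left and `W` the weight of the preceding coordinate. Integer weights drop by at least 1 at
    -- each step, so every nonnegative partial sum is counted at least once.
    abel : ∀ {m} (w δ : Exponent m) c W → Decreasing w → (∀ a → w a ℤ.< W) → +0 ℤ.< W →
           (∀ k → +0 ℤ.≤ c ℤ.+ psum δ k) → ∀ k → c ℤ.+ psum δ k ℤ.≤ c ℤ.* W ℤ.+ dot w δ
    abel {m} w δ c W dec below 0<W nonneg k = helper w δ dec below nonneg k
      where
      0≤c : +0 ℤ.≤ c
      0≤c = ≡.subst (+0 ℤ.≤_) (ℤ.+-identityʳ c) (nonneg 0)
      scaled : ∀ {w} → w ℤ.< W → c ℤ.+ c ℤ.* w ℤ.≤ c ℤ.* W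
      scaled {w} lt = ≡.subst (ℤ._≤ c ℤ.* W) (ℤ.*-suc c w) (ℤ.*-monoˡ-≤-nonNeg c {{ℤ.nonNegative 0≤c}} (ℤ.i<j⇒suc[i]≤j lt))
      c≤cW : c ℤ.≤ c ℤ.* W
      c≤cW = ≡.subst (ℤ._≤ c ℤ.* W) (≡.trans (≡.cong (λ z → c ℤ.+ z) (ℤ.*-zeroʳ c)) (ℤ.+-identityʳ c)) (scaled 0<W)
      helper : ∀ {m} (w δ : Exponent m) → Decreasing w → (∀ a → w a ℤ.< W) → (∀ k → +0 ℤ.≤ c ℤ.+ psum δ k) → ∀ k → c ℤ.+ psum δ k ℤ.≤ c ℤ.* W ℤ.+ dot w δ
      helper {zero}  w δ dec below nonneg zero    = ℤ.+-monoˡ-≤ +0 c≤cW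
      helper {zero}  w δ dec below nonneg (suc k) = ℤ.+-monoˡ-≤ +0 c≤cW
      helper {suc m} w δ (0<w , below′ , dec) below nonneg k = ℤ.≤-trans (cases k) (ℤ.≤-trans
        (ℤ.≤-reflexive (ℤsolve 4 (λ c w d r → c ⊞ ((c ⊞ d) ⊠ w ⊞ r) ⊜ (c ⊞ c ⊠ w) ⊞ (w ⊠ d ⊞ r)) ≡.refl c (w zero) (δ zero) rest))
        (ℤ.+-monoˡ-≤ (dot w δ) (scaled (below zero))))
        where
        rest = dot (w ∘ suc) (δ ∘ suc)
        nonneg′ : ∀ k → +0 ℤ.≤ (c ℤ.+ δ zero) ℤ.+ psum (δ ∘ suc) k
        nonneg′ k = ≡.subst (+0 ℤ.≤_) (≡.sym (ℤ.+-assoc c (δ zero) _)) (nonneg (suc k))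
        ih : ∀ k → (c ℤ.+ δ zero) ℤ.+ psum (δ ∘ suc) k ℤ.≤ (c ℤ.+ δ zero) ℤ.* w zero ℤ.+ rest
        ih = abel (w ∘ suc) (δ ∘ suc) (c ℤ.+ δ zero) (w zero) dec below′ 0<w nonneg′
        cases : ∀ k → c ℤ.+ psum δ k ℤ.≤ c ℤ.+ ((c ℤ.+ δ zero) ℤ.* w zero ℤ.+ rest)
        cases zero    = ℤ.+-monoʳ-≤ c (ℤ.≤-trans (nonneg′ 0) (ih 0))
        cases (suc k) = ≡.subst (ℤ._≤ c ℤ.+ ((c ℤ.+ δ zero) ℤ.* w zero ℤ.+ rest)) (≡.trans (ℤ.+-identityˡ _) (ℤ.+-assoc c (δ zero) (psum (δ ∘ suc) k)))
          (ℤ.+-mono-≤ 0≤c (ih k))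

    upper : ∀ {m} (w : Exponent m) → Decreasing w → ∃ λ W → (∀ a → w a ℤ.< W) × +0 ℤ.< W
    upper {zero}  w dec = + 1 , (λ ()) , ℤ.+<+ (ℕ.s≤s ℕ.z≤n)
    upper {suc m} w (0<w , below , _) = ℤ.suc (w zero) , (λ { zero → i<suc ; (suc a) → ℤ.<-trans (below a) i<suc }) , ℤ.<-trans 0<w i<suc
      where
      i<suc : w zero ℤ.< ℤ.suc (w zero)
      i<suc = ℤ.suc[i]≤j⇒i<j ℤ.≤-refl

    dot-diff : ∀ {m} (w μ ν : Exponent m) → dot w (λ a → μ a ℤ.+ ℤ.- ν a) ≡ dot w μ ℤ.- dot w ν
    dot-diff {zero}  w μ ν = ≡.refl
    dot-diff {suc m} w μ ν = ≡.trans (≡.cong (λ z → w zero ℤ.* (μ zero ℤ.+ ℤ.- ν zero) ℤ.+ z) (dot-diff (w ∘ suc) (μ ∘ suc) (ν ∘ suc)))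
      (ℤsolve 5 (λ w p q r s → w ⊠ (p ⊟ q) ⊞ (r ⊟ s) ⊜ (w ⊠ p ⊞ r) ⊟ (w ⊠ q ⊞ s)) ≡.refl (w zero) (μ zero) (ν zero) (dot (w ∘ suc) (μ ∘ suc)) (dot (w ∘ suc) (ν ∘ suc)))

  -- Summation by parts: ν ≺ μ is detected by every decreasing positive functional.
  ≺⇒dot-positive : ∀ {m} (w ν μ : Exponent m) → Decreasing w → ν ≺ μ → +0 ℤ.< dot w (λ a → μ a ℤ.+ ℤ.- ν a)
  ≺⇒dot-positive w ν μ dec (ν≼μ , k , lt) with upper w dec
  ... | W , below , 0<W = ℤ.<-≤-trans (≡.subst (+0 ℤ.<_) (≡.sym (eq k)) (i<j⇒0<j-i lt))
    (≡.subst₂ ℤ._≤_ (ℤ.+-identityˡ _) (ℤ.+-identityˡ _)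
      (abel w (λ a → μ a ℤ.+ ℤ.- ν a) +0 W dec below 0<W (λ l → ≡.subst (+0 ℤ.≤_) (≡.sym (≡.trans (ℤ.+-identityˡ _) (eq l))) (ℤ.i≤j⇒0≤j-i (ν≼μ l))) k))
    where
    eq : ∀ l → psum (λ a → μ a ℤ.+ ℤ.- ν a) l ≡ psum μ l ℤ.- psum ν l
    eq l = ≡.trans (psum-+ μ (λ a → ℤ.- ν a) l) (≡.cong (λ z → psum μ l ℤ.+ z) (psum-neg ν l))

  ≺⇒dot-< : ∀ {m} (w ν μ : Exponent m) → Decreasing w → ν ≺ μ → dot w ν ℤ.< dot w μ
  ≺⇒dot-< w ν μ dec p = 0<j-i⇒i<j (≡.subst (+0 ℤ.<_) (dot-diff w μ ν) (≺⇒dot-positive w ν μ dec p))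

  -- 2ρ = (2m, 2m-2, …, 2) is the sum of the positive roots.
  2ρ : ∀ {m} → Exponent m
  2ρ {suc m} zero    = + (2 ℕ.* suc m)
  2ρ {suc m} (suc a) = 2ρ a

  -- |ν + ρ|² - |ρ|²
  casimirValue : ∀ {m} → Exponent m → ℤ
  casimirValue {zero}  ν = +0
  casimirValue {suc m} ν = (ν zero ℤ.* ν zero ℤ.+ + (2 ℕ.* suc m) ℤ.* ν zero) ℤ.+ casimirValue (ν ∘ suc)

  private
    2ρ-bound : ∀ {m} (a : Fin m) → 2ρ a ℤ.< + (2 ℕ.* suc m)
    2ρ-bound {suc m} zero    = ℤ.+<+ (ℕ.*-monoʳ-< 2 (ℕ.n<1+n (suc m)))
    2ρ-bound {suc m} (suc a) = ℤ.<-trans (2ρ-bound a) (ℤ.+<+ (ℕ.*-monoʳ-< 2 (ℕ.n<1+n (suc m))))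

    sum-decreasing : ∀ {m} (μ ν : Exponent m) → Dominant μ → Dominant ν → Decreasing (λ a → (μ a ℤ.+ ν a) ℤ.+ 2ρ a)
    sum-decreasing {zero}  μ ν dμ dν = tt
    sum-decreasing {suc m} μ ν (0≤μ , μ≤ , dμ) (0≤ν , ν≤ , dν) =
      ℤ.+-mono-≤-< (ℤ.+-mono-≤ 0≤μ 0≤ν) (ℤ.+<+ (ℕ.s≤s ℕ.z≤n)) ,
      (λ a → ℤ.+-mono-≤-< (ℤ.+-mono-≤ (μ≤ a) (ν≤ a)) (2ρ-bound a)) , sum-decreasing (μ ∘ suc) (ν ∘ suc) dμ dν

    casimirValue-diff : ∀ {m} (μ ν : Exponent m) → casimirValue μ ℤ.- casimirValue ν ≡ dot (λ a → (μ a ℤ.+ ν a) ℤ.+ 2ρ a) (λ a → μ a ℤ.+ ℤ.- ν a)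
    casimirValue-diff {zero}  μ ν = ≡.refl
    casimirValue-diff {suc m} μ ν = ≡.trans
      (ℤsolve 5 (λ p q r s t → ((p ⊠ p ⊞ t ⊠ p) ⊞ r) ⊟ ((q ⊠ q ⊞ t ⊠ q) ⊞ s) ⊜ ((p ⊞ q) ⊞ t) ⊠ (p ⊟ q) ⊞ (r ⊟ s))
        ≡.refl (μ zero) (ν zero) (casimirValue (μ ∘ suc)) (casimirValue (ν ∘ suc)) (+ (2 ℕ.* suc m)))
      (≡.cong (λ z → (μ zero ℤ.+ ν zero ℤ.+ + (2 ℕ.* suc m)) ℤ.* (μ zero ℤ.+ ℤ.- ν zero) ℤ.+ z) (casimirValue-diff (μ ∘ suc) (ν ∘ suc)))

  -- A difference of squares: |μ+ρ|² - |ν+ρ|² pairs μ - ν with μ + ν + 2ρ, which is strictly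
  -- decreasing and positive when both exponents are dominant.
  casimirValue-< : ∀ {m} (ν μ : Exponent m) → Dominant ν → Dominant μ → ν ≺ μ → casimirValue ν ℤ.< casimirValue μ
  casimirValue-< ν μ dν dμ p = 0<j-i⇒i<j (≡.subst (+0 ℤ.<_) (≡.sym (casimirValue-diff μ ν))
    (≺⇒dot-positive _ ν μ (sum-decreasing μ ν dμ dν) p))

-- Uniqueness of symmetric eigenfunctions

module Uniqueness (K : CommutativeRing 0ℓ 0ℓ) (F : IsCharZeroField K) where
  open CommutativeRing K hiding (zero)
  open Arithmetic K
  open FieldArithmetic K F
  open FormalSums K
  open Powers K
  open LinearIndependence K F
  open Radial K
  open Dominance
  open WeylGroup
  open Symplectic K using (Torus; val; inv)
  open SetoidReasoning setoid

  actᵛ : ∀ {m} → Reflection m → (v w : Fin m → Carrier) → Fin m → Carrier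
  actᵛ flip      v w zero          = w zero
  actᵛ flip      v w (suc a)       = v (suc a)
  actᵛ swap      v w zero          = v (suc zero)
  actᵛ swap      v w (suc zero)    = v zero
  actᵛ swap      v w (suc (suc a)) = v (suc (suc a))
  actᵛ (shift σ) v w zero          = v zero
  actᵛ (shift σ) v w (suc a)       = actᵛ σ (v ∘ suc) (w ∘ suc) a

  actᵗ : ∀ {m} → Reflection m → Torus m → Torus m
  actᵗ σ x = record { val = actᵛ σ (val x) (inv x) ; inv = actᵛ σ (inv x) (val x) ; inverse = go σ (Symplectic.Torus.inverse x) }
    where
    go : ∀ {m} (σ : Reflection m) {v w : Fin m → Carrier} → (∀ a → v a * w a ≈ 1#) → ∀ a → actᵛ σ v w a * actᵛ σ w v a ≈ 1#
    go flip      p zero          = trans (*-comm _ _) (p zero)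
    go flip      p (suc a)       = p (suc a)
    go swap      p zero          = p (suc zero)
    go swap      p (suc zero)    = p zero
    go swap      p (suc (suc a)) = p (suc (suc a))
    go (shift σ) p zero          = p zero
    go (shift σ) p (suc a)       = go σ (p ∘ suc) a

  monomial-actᵗ : ∀ {m} (σ : Reflection m) x ν → monomial (actᵗ σ x) ν ≈ monomial x (actᵉ σ ν)
  monomial-actᵗ σ x = go σ (val x) (inv x)
    where
    go : ∀ {m} (σ : Reflection m) v w ν → monomialAt (actᵛ σ v w) (actᵛ σ w v) ν ≈ monomialAt v w (actᵉ σ ν)
    go flip      v w ν = *-congʳ (pow-swap (v zero) (w zero) (ν zero))
    go {suc (suc m)} swap v w ν = solve 3 (λ a b c → a :* (b :* c) := b :* (a :* c)) refl
      (pow (v (suc zero)) (w (suc zero)) (ν zero)) (pow (v zero) (w zero) (ν (suc zero))) (monomialAt {m} (λ a → v (suc (suc a))) (λ a → w (suc (suc a))) (λ a → ν (suc (suc a))))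
    go (shift σ) v w ν = *-congˡ (go σ (v ∘ suc) (w ∘ suc) (ν ∘ suc))

  IsSymmetric : ∀ {m} → (Torus m → Carrier) → Set
  IsSymmetric χ = ∀ σ x → χ (actᵗ σ x) ≈ χ x

  module Limits where
    open Convolution ℤ._+_

    E : ℕ → ℤ → Carrier
    E j n = 2^ (+ suc j ℤ.* n)

    E-+ : ∀ j i k → E j (i ℤ.+ k) ≈ E j i * E j k
    E-+ j i k = trans (reflexive (≡.cong 2^ (ℤ.*-distribˡ-+ (+ suc j) i k))) (2^-+ (+ suc j ℤ.* i) (+ suc j ℤ.* k))

    E-0 : ∀ j → E j +0 ≈ 1#
    E-0 j = reflexive (≡.cong 2^ (ℤ.*-zeroʳ (+ suc j)))

    -- F tends to c as the exponential variable E tends to infinity: F = (c + P)/(1 + Q)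
    -- with P and Q sums of negative powers.
    record Limit (F : ℕ → Carrier) (c : Carrier) : Set where
      field
        P Q   : Terms ℤ
        P<0   : AllExp (ℤ._< +0) P
        Q<0   : AllExp (ℤ._< +0) Q
        ratio : ∀ j → (1# + ⟨ E j , Q ⟩) * F j ≈ c + ⟨ E j , P ⟩
    open Limit

    limit-cong : ∀ {F G c d} → (∀ j → F j ≈ G j) → c ≈ d → Limit F c → Limit G d
    limit-cong p q l = record { P = P l ; Q = Q l ; P<0 = P<0 l ; Q<0 = Q<0 l
      ; ratio = λ j → trans (*-congˡ (sym (p j))) (trans (ratio l j) (+-congʳ q)) }

    limit-constant : ∀ c → Limit (λ _ → c) c
    limit-constant c = record { P = [] ; Q = [] ; P<0 = [] ; Q<0 = []
      ; ratio = λ j → solve 1 (λ c → (:1 :+ :0) :* c := c :+ :0) refl c }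

    limit-E : ∀ n → n ℤ.< +0 → Limit (λ j → E j n) 0#
    limit-E n n<0 = record { P = (1# , n) ∷ [] ; Q = [] ; P<0 = n<0 ∷ [] ; Q<0 = []
      ; ratio = λ j → solve 1 (λ e → (:1 :+ :0) :* e := :0 :+ (:1 :* e :+ :0)) refl (E j n) }

    private
      product-terms : ∀ {F G c d} (l : Limit F c) (k : Limit G d) → Terms ℤ
      product-terms l k = Q l ++ Q k ++ (Q l ⊛ Q k)

      +-neg : ∀ {i k} → i ℤ.< +0 → k ℤ.< +0 → i ℤ.+ k ℤ.< +0
      +-neg = ℤ.+-mono-<

      pair-E-⊛ : ∀ j p q → ⟨ E j , p ⊛ q ⟩ ≈ ⟨ E j , p ⟩ * ⟨ E j , q ⟩
      pair-E-⊛ j = pair-multiplicative (E j) (E-+ j)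

      pair-product : ∀ {F G c d} (l : Limit F c) (k : Limit G d) j → 1# + ⟨ E j , product-terms l k ⟩ ≈ (1# + ⟨ E j , Q l ⟩) * (1# + ⟨ E j , Q k ⟩)
      pair-product l k j = trans (+-congˡ (trans (pair-++ (E j) (Q l) _) (+-congˡ (trans (pair-++ (E j) (Q k) (Q l ⊛ Q k)) (+-congˡ (pair-E-⊛ j (Q l) (Q k)))))))
        (solve 2 (λ a b → :1 :+ (a :+ (b :+ a :* b)) := (:1 :+ a) :* (:1 :+ b)) refl ⟨ E j , Q l ⟩ ⟨ E j , Q k ⟩)

      product-<0 : ∀ {F G c d} (l : Limit F c) (k : Limit G d) → AllExp (ℤ._< +0) (product-terms l k)
      product-<0 l k = ++⁺ (Q<0 l) (++⁺ (Q<0 k) (⊛-All +-neg (Q<0 l) (Q<0 k)))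

    limit-+ : ∀ {F G c d} → Limit F c → Limit G d → Limit (λ j → F j + G j) (c + d)
    limit-+ {F} {G} {c} {d} l k = record
      { P = (P l ++ scale c (Q k) ++ P l ⊛ Q k) ++ (P k ++ scale d (Q l) ++ P k ⊛ Q l) ; Q = product-terms l k
      ; P<0 = ++⁺ (++⁺ (P<0 l) (++⁺ (weighted-All (Q k) (Q<0 k)) (⊛-All +-neg (P<0 l) (Q<0 k)))) (++⁺ (P<0 k) (++⁺ (weighted-All (Q l) (Q<0 l)) (⊛-All +-neg (P<0 k) (Q<0 l))))
      ; Q<0 = product-<0 l k
      ; ratio = λ j → let p = ⟨ E j , P l ⟩ ; q = ⟨ E j , Q l ⟩ ; r = ⟨ E j , P k ⟩ ; s = ⟨ E j , Q k ⟩ in begin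
          (1# + ⟨ E j , product-terms l k ⟩) * (F j + G j) ≈⟨ *-congʳ (pair-product l k j) ⟩
          ((1# + q) * (1# + s)) * (F j + G j) ≈⟨ solve 4 (λ a b f g → (a :* b) :* (f :+ g) := b :* (a :* f) :+ a :* (b :* g)) refl (1# + q) (1# + s) (F j) (G j) ⟩
          (1# + s) * ((1# + q) * F j) + (1# + q) * ((1# + s) * G j) ≈⟨ +-cong (*-congˡ (ratio l j)) (*-congˡ (ratio k j)) ⟩
          (1# + s) * (c + p) + (1# + q) * (d + r)
            ≈⟨ solve 6 (λ c d p q r s → (:1 :+ s) :* (c :+ p) :+ (:1 :+ q) :* (d :+ r) := (c :+ d) :+ ((p :+ (c :* s :+ p :* s)) :+ (r :+ (d :* q :+ r :* q)))) refl c d p q r s ⟩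
          (c + d) + ((p + (c * s + p * s)) + (r + (d * q + r * q)))
            ≈⟨ +-congˡ (trans (pair-++ (E j) (P l ++ scale c (Q k) ++ P l ⊛ Q k) (P k ++ scale d (Q l) ++ P k ⊛ Q l)) (+-cong (half j (P l) c (Q k)) (half j (P k) d (Q l)))) ⟨
          (c + d) + ⟨ E j , (P l ++ scale c (Q k) ++ P l ⊛ Q k) ++ (P k ++ scale d (Q l) ++ P k ⊛ Q l) ⟩ ∎ }
      where
      half : ∀ j p c q → ⟨ E j , p ++ scale c q ++ p ⊛ q ⟩ ≈ ⟨ E j , p ⟩ + (c * ⟨ E j , q ⟩ + ⟨ E j , p ⟩ * ⟨ E j , q ⟩)
      half j p c q = trans (pair-++ (E j) p (scale c q ++ p ⊛ q)) (+-congˡ (trans (pair-++ (E j) (scale c q) (p ⊛ q)) (+-cong (pair-scale c (E j) q) (pair-E-⊛ j p q))))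

    limit-* : ∀ {F G c d} → Limit F c → Limit G d → Limit (λ j → F j * G j) (c * d)
    limit-* {F} {G} {c} {d} l k = record
      { P = scale c (P k) ++ scale d (P l) ++ P l ⊛ P k ; Q = product-terms l k
      ; P<0 = ++⁺ (weighted-All (P k) (P<0 k)) (++⁺ (weighted-All (P l) (P<0 l)) (⊛-All +-neg (P<0 l) (P<0 k)))
      ; Q<0 = product-<0 l k
      ; ratio = λ j → let p = ⟨ E j , P l ⟩ ; q = ⟨ E j , Q l ⟩ ; r = ⟨ E j , P k ⟩ ; s = ⟨ E j , Q k ⟩ in begin
          (1# + ⟨ E j , product-terms l k ⟩) * (F j * G j) ≈⟨ *-congʳ (pair-product l k j) ⟩
          ((1# + q) * (1# + s)) * (F j * G j) ≈⟨ solve 4 (λ a b f g → (a :* b) :* (f :* g) := (a :* f) :* (b :* g)) refl (1# + q) (1# + s) (F j) (G j) ⟩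
          ((1# + q) * F j) * ((1# + s) * G j) ≈⟨ *-cong (ratio l j) (ratio k j) ⟩
          (c + p) * (d + r) ≈⟨ solve 4 (λ c d p r → (c :+ p) :* (d :+ r) := c :* d :+ (c :* r :+ (d :* p :+ p :* r))) refl c d p r ⟩
          c * d + (c * r + (d * p + p * r))
            ≈⟨ +-congˡ (trans (pair-++ (E j) (scale c (P k)) _) (+-cong (pair-scale c (E j) (P k)) (trans (pair-++ (E j) (scale d (P l)) _) (+-cong (pair-scale d (E j) (P l)) (pair-E-⊛ j (P l) (P k)))))) ⟨
          c * d + ⟨ E j , scale c (P k) ++ scale d (P l) ++ P l ⊛ P k ⟩ ∎ }

    limit-sum : ∀ {n} {F : Fin n → ℕ → Carrier} {c : Fin n → Carrier} → (∀ a → Limit (F a) (c a)) → Limit (λ j → sum λ a → F a j) (sum c)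
    limit-sum {zero}  l = limit-constant 0#
    limit-sum {suc n} l = limit-+ (l zero) (limit-sum (l ∘ suc))

    E-inverse : ∀ j n → E j n * E j (ℤ.- n) ≈ 1#
    E-inverse j n = trans (sym (E-+ j n (ℤ.- n))) (trans (reflexive (≡.cong (E j) (ℤ.+-inverseʳ n))) (E-0 j))

    -- Multiplying numerator and denominator by the power with exponent -n normalises the leading
    -- term of the denominator to 1.
    limit-quotient : ∀ {F c} n P Q → AllExp (ℤ._< n) P → AllExp (ℤ._< n) Q →
      (∀ j → (E j n + ⟨ E j , Q ⟩) * F j ≈ c * E j n + ⟨ E j , P ⟩) → Limit F c
    limit-quotient {F} {c} n P Q P<n Q<n quotient = record
      { P = lower P ; Q = lower Q ; P<0 = reindex-All (λ i → ℤ.- n ℤ.+ i) negative P P<n ; Q<0 = reindex-All (λ i → ℤ.- n ℤ.+ i) negative Q Q<n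
      ; ratio = λ j → let e = E j n ; e⁻¹ = E j (ℤ.- n) ; p = ⟨ E j , P ⟩ ; q = ⟨ E j , Q ⟩ in begin
          (1# + ⟨ E j , lower Q ⟩) * F j ≈⟨ *-congʳ (+-cong (sym (E-inverse j n)) (pair-lower j Q)) ⟩
          (e * e⁻¹ + e⁻¹ * q) * F j ≈⟨ solve 4 (λ e f q F → (e :* f :+ f :* q) :* F := f :* ((e :+ q) :* F)) refl e e⁻¹ q (F j) ⟩
          e⁻¹ * ((e + q) * F j) ≈⟨ *-congˡ (quotient j) ⟩
          e⁻¹ * (c * e + p) ≈⟨ solve 4 (λ e f c p → f :* (c :* e :+ p) := c :* (e :* f) :+ f :* p) refl e e⁻¹ c p ⟩
          c * (e * e⁻¹) + e⁻¹ * p ≈⟨ +-cong (trans (*-congˡ (E-inverse j n)) (*-identityʳ c)) (sym (pair-lower j P)) ⟩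
          c + ⟨ E j , lower P ⟩ ∎ }
      where
      lower : Terms ℤ → Terms ℤ
      lower = reindex λ i → ℤ.- n ℤ.+ i
      pair-lower : ∀ j p → ⟨ E j , lower p ⟩ ≈ E j (ℤ.- n) * ⟨ E j , p ⟩
      pair-lower j p = trans (pair-reindex (λ i → ℤ.- n ℤ.+ i) (E j) p) (trans (pair-cong p (E-+ j (ℤ.- n))) (pair-* (E j (ℤ.- n)) (E j) p))
      negative : ∀ {i} → i ℤ.< n → ℤ.- n ℤ.+ i ℤ.< +0
      negative {i} i<n = ≡.subst (ℤ.- n ℤ.+ i ℤ.<_) (ℤ.+-inverseˡ n) (ℤ.+-monoʳ-< (ℤ.- n) i<n)

    -- For the zero function, c plus a sum of negative powers vanishes at all parameters.
    -- Independence makes its coefficient at exponent 0, which is c, vanish.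
    limit-unique : ∀ {c} → Limit (λ _ → 0#) c → c ≈ 0#
    limit-unique {c} l = begin
      c ≈⟨ solve 1 (λ c → c := c :* :1 :+ :0) refl c ⟩
      c * 1# + 0# ≈⟨ +-cong (*-congˡ [0]) (trans (pair-cong-All (All.map (λ {t} → [<0] {t}) (P<0 l))) (pair-0 (P l))) ⟨
      ⟨ [ +0 ]ᶻ , (c , +0) ∷ P l ⟩ ≈⟨ independent₁ ((c , +0) ∷ P l) (λ j → begin
        c * E j +0 + ⟨ E j , P l ⟩ ≈⟨ +-congʳ (trans (*-congˡ (E-0 j)) (*-identityʳ c)) ⟩
        c + ⟨ E j , P l ⟩ ≈⟨ ratio l j ⟨
        (1# + ⟨ E j , Q l ⟩) * 0# ≈⟨ zeroʳ _ ⟩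
        0# ∎) [ +0 ]ᶻ ⟩
      0# ∎
      where
      [0] : [ +0 ]ᶻ +0 ≈ 1#
      [0] = refl
      [<0] : ∀ {t : Carrier × ℤ} → proj₂ t ℤ.< +0 → [ +0 ]ᶻ (proj₂ t) ≈ 0#
      [<0] {_ , -[1+ n ]} lt = refl
      [<0] {_ , + n} (ℤ.+<+ ())

  private
    dot-cong : ∀ {m} (h : Exponent m) {ν κ : Exponent m} → ν ≗ κ → dot h ν ≡ dot h κ
    dot-cong {zero}  h p = ≡.refl
    dot-cong {suc m} h p = ≡.cong₂ (λ y z → h zero ℤ.* y ℤ.+ z) (p zero) (dot-cong (h ∘ suc) (p ∘ suc))

  module _ {m} (h : Exponent m) (dec : Decreasing h) where
    open Limits

    private
      positive : ∀ {m} {h : Exponent m} → Decreasing h → ∀ a → +0 ℤ.< h a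
      positive (p , _ , _) zero    = p
      positive (_ , _ , d) (suc a) = positive d a

      decreasing : ∀ {m} {h : Exponent m} → Decreasing h → ∀ a c → a Fin.< c → h c ℤ.< h a
      decreasing (_ , below , _) zero    (suc c) _         = below c
      decreasing (_ , _ , d)     (suc a) (suc c) (ℕ.s≤s p) = decreasing d a c p

      x : ℕ → Torus m
      x = point h

      E-injective : ∀ j i k → E j i ≈ E j k → i ≡ k
      E-injective j i k p = ℤ.*-cancelˡ-≡ (+ suc j) i k (2^-injective _ _ p)

      E-neg : ∀ j n → 2^ (ℤ.- (+ suc j ℤ.* n)) ≈ E j (ℤ.- n)
      E-neg j n = reflexive (≡.cong 2^ (ℤ.neg-distribʳ-* (+ suc j) n))

      X̂-E : ∀ j a → X̂ (x j) a ≈ E j (h a) + E j (ℤ.- h a)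
      X̂-E j a = +-congˡ (E-neg j (h a))

      Ẋ-E : ∀ j a → Ẋ (x j) a ≈ E j (h a) - E j (ℤ.- h a)
      Ẋ-E j a = +-congˡ (-‿cong (E-neg j (h a)))

      -n<n : ∀ {n} → +0 ℤ.< n → ℤ.- n ℤ.< n
      -n<n p = ℤ.<-trans (ℤ.neg-mono-< p) p

      Ẋ≉0 : ∀ j a → ¬ Ẋ (x j) a ≈ 0#
      Ẋ≉0 j a p = ℤ.<-irrefl (≡.sym (E-injective j _ _ (x-y≈0⇒x≈y (trans (sym (Ẋ-E j a)) p)))) (-n<n (positive dec a))

      X̂-factor : ∀ j a c → X̂ (x j) a - X̂ (x j) c ≈ (E j (h a ℤ.+ h c) - 1#) * (E j (ℤ.- h c) - E j (ℤ.- h a))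
      X̂-factor j a c = begin
        X̂ (x j) a - X̂ (x j) c ≈⟨ +-cong (X̂-E j a) (-‿cong (X̂-E j c)) ⟩
        (xa + ya) - (xc + yc) ≈⟨ solve 4 (λ xa xc ya yc → (xa :+ ya) :- (xc :+ yc) := (xa :- xc) :+ :-1 :* (yc :- ya)) refl xa xc ya yc ⟩
        (xa - xc) + - 1# * (yc - ya) ≈⟨ inverse-factor (E-inverse j (h a)) (E-inverse j (h c)) (- 1#) ⟨
        (xa * xc - 1#) * (yc - ya) ≈⟨ *-congʳ (+-congʳ (E-+ j (h a) (h c))) ⟨
        (E j (h a ℤ.+ h c) - 1#) * (yc - ya) ∎
        where
        xa = E j (h a)
        xc = E j (h c)
        ya = E j (ℤ.- h a)
        yc = E j (ℤ.- h c)

      X̂-distinct : ∀ j a c → a ≢ c → ¬ X̂ (x j) a - X̂ (x j) c ≈ 0#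
      X̂-distinct j a c a≢c p = *-nonzero
        (λ q → ℤ.<-irrefl (≡.sym (E-injective j (h a ℤ.+ h c) +0 (trans (x-y≈0⇒x≈y q) (sym (E-0 j))))) (ℤ.+-mono-< (positive dec a) (positive dec c)))
        (λ q → h-distinct (ℤ.neg-injective (E-injective j (ℤ.- h c) (ℤ.- h a) (x-y≈0⇒x≈y q))))
        (trans (sym (X̂-factor j a c)) p)
        where
        h-distinct : h c ≢ h a
        h-distinct e with Fin.<-cmp a c
        ... | tri< a<c _ _ = ℤ.<-irrefl e (decreasing dec a c a<c)
        ... | tri≈ _ a≡c _ = a≢c a≡c
        ... | tri> _ _ c<a = ℤ.<-irrefl (≡.sym e) (decreasing dec c a c<a)

    abstract
      -- X̂_a - X̂_c is a product of two differences of powers of 2. Their exponents are distinct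
      -- because the entries of `h` are positive and pairwise distinct.
      regular : ∀ j → Regular (x j)
      regular j = record
        { s = λ a → proj₁ (inverse (Ẋ (x j) a) (Ẋ≉0 j a)) ; s-inv = λ a → proj₂ (inverse (Ẋ (x j) a) (Ẋ≉0 j a))
        ; r = r ; r-inv = r-inv ; r-diag = r-diag }
        where
        choose : (a c : Fin m) → Dec (a ≡ c) → Carrier
        choose a c (yes _)  = 0#
        choose a c (no a≢c) = proj₁ (inverse (X̂ (x j) a - X̂ (x j) c) (X̂-distinct j a c a≢c))
        r : Fin m → Fin m → Carrier
        r a c = choose a c (a Fin.≟ c)
        r-inv : ∀ a c → a ≢ c → (X̂ (x j) a - X̂ (x j) c) * r a c ≈ 1#
        r-inv a c a≢c = go (a Fin.≟ c)
          where
          go : (d : Dec (a ≡ c)) → (X̂ (x j) a - X̂ (x j) c) * choose a c d ≈ 1#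
          go (yes p) = ⊥-elim (a≢c p)
          go (no p)  = proj₂ (inverse (X̂ (x j) a - X̂ (x j) c) (X̂-distinct j a c p))
        r-diag : ∀ a → r a a ≈ 0#
        r-diag a = go (a Fin.≟ a)
          where
          go : (d : Dec (a ≡ a)) → choose a a d ≈ 0#
          go (yes _) = refl
          go (no p)  = ⊥-elim (p ≡.refl)

    private
      s : ∀ j → Fin m → Carrier
      s j = Regular.s (regular j)
      r : ∀ j → Fin m → Fin m → Carrier
      r j = Regular.r (regular j)

      limit-s : ∀ a → Limit (λ j → X̂ (x j) a * s j a) 1#
      limit-s a = limit-quotient (h a) ((1# , ℤ.- h a) ∷ []) ((- 1# , ℤ.- h a) ∷ []) (-n<n (positive dec a) ∷ []) (-n<n (positive dec a) ∷ []) λ j →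
        let e = E j (h a) ; f = E j (ℤ.- h a) in begin
        (e + (- 1# * f + 0#)) * (X̂ (x j) a * s j a)
          ≈⟨ solve 4 (λ e f X s → (e :+ (:-1 :* f :+ :0)) :* (X :* s) := X :* ((e :- f) :* s)) refl e f (X̂ (x j) a) (s j a) ⟩
        X̂ (x j) a * ((e - f) * s j a)
          ≈⟨ *-cong (X̂-E j a) (trans (*-congʳ (sym (Ẋ-E j a))) (Regular.s-inv (regular j) a)) ⟩
        (e + f) * 1#
          ≈⟨ solve 2 (λ e f → (e :+ f) :* :1 := :1 :* e :+ (:1 :* f :+ :0)) refl e f ⟩
        1# * e + (1# * f + 0#) ∎

      Ẋr-E : ∀ j a c → a ≢ c → ((E j (h a) + E j (ℤ.- h a)) - (E j (h c) + E j (ℤ.- h c))) * (Ẋ (x j) a * r j a c) ≈ E j (h a) - E j (ℤ.- h a)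
      Ẋr-E j a c a≢c = begin
        ((E j (h a) + E j (ℤ.- h a)) - (E j (h c) + E j (ℤ.- h c))) * (Ẋ (x j) a * r j a c)
          ≈⟨ *-congʳ (sym (+-cong (X̂-E j a) (-‿cong (X̂-E j c)))) ⟩
        (X̂ (x j) a - X̂ (x j) c) * (Ẋ (x j) a * r j a c)
          ≈⟨ solve 3 (λ X d r → X :* (d :* r) := d :* (X :* r)) refl (X̂ (x j) a - X̂ (x j) c) (Ẋ (x j) a) (r j a c) ⟩
        Ẋ (x j) a * ((X̂ (x j) a - X̂ (x j) c) * r j a c)
          ≈⟨ trans (*-cong (Ẋ-E j a) (Regular.r-inv (regular j) a c a≢c)) (*-identityʳ _) ⟩
        E j (h a) - E j (ℤ.- h a) ∎

      -h<h : ∀ {a c} → a Fin.< c → ℤ.- h c ℤ.< h a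
      -h<h {a} {c} a<c = ℤ.<-trans (-n<n (positive dec c)) (decreasing dec a c a<c)

      -- For a < c the power with exponent h_a dominates both Ẋ_a and X̂_a - X̂_c. For c < a the
      -- denominator is dominated by the larger power with exponent h_c, whence the limit 0 in
      -- `limit-r-above`.
      limit-r-below : ∀ a c → a Fin.< c → Limit (λ j → Ẋ (x j) a * r j a c) 1#
      limit-r-below a c a<c = limit-quotient (h a) ((- 1# , ℤ.- h a) ∷ []) ((1# , ℤ.- h a) ∷ (- 1# , h c) ∷ (- 1# , ℤ.- h c) ∷ [])
        (-n<n (positive dec a) ∷ []) (-n<n (positive dec a) ∷ decreasing dec a c a<c ∷ -h<h a<c ∷ []) λ j →
        trans (*-congʳ (solve 4 (λ e f g k → e :+ (:1 :* f :+ (:-1 :* g :+ (:-1 :* k :+ :0))) := (e :+ f) :- (g :+ k)) refl (E j (h a)) (E j (ℤ.- h a)) (E j (h c)) (E j (ℤ.- h c))))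
        (trans (Ẋr-E j a c (Fin.<⇒≢ a<c)) (solve 2 (λ e f → e :- f := :1 :* e :+ (:-1 :* f :+ :0)) refl (E j (h a)) (E j (ℤ.- h a))))

      limit-r-above : ∀ a c → c Fin.< a → Limit (λ j → Ẋ (x j) a * r j a c) 0#
      limit-r-above a c c<a = limit-quotient (h c) ((- 1# , h a) ∷ (1# , ℤ.- h a) ∷ []) ((1# , ℤ.- h c) ∷ (- 1# , h a) ∷ (- 1# , ℤ.- h a) ∷ [])
        (decreasing dec c a c<a ∷ -h<h c<a ∷ []) (-n<n (positive dec c) ∷ decreasing dec c a c<a ∷ -h<h c<a ∷ []) λ j →
        trans (solve 5 (λ e f g k F → (g :+ (:1 :* k :+ (:-1 :* e :+ (:-1 :* f :+ :0)))) :* F := :- (((e :+ f) :- (g :+ k)) :* F)) refl (E j (h a)) (E j (ℤ.- h a)) (E j (h c)) (E j (ℤ.- h c)) (Ẋ (x j) a * r j a c))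
        (trans (-‿cong (Ẋr-E j a c (Fin.<⇒≢ c<a ∘ ≡.sym))) (solve 3 (λ e f g → :- (e :- f) := :0 :* g :+ (:-1 :* e :+ (:1 :* f :+ :0))) refl (E j (h a)) (E j (ℤ.- h a)) (E j (h c))))

      above : ∀ {m} → Fin m → Fin m → Carrier
      above zero    zero    = 0#
      above zero    (suc c) = 1#
      above (suc a) zero    = 0#
      above (suc a) (suc c) = above a c

      above-< : ∀ {m} {a c : Fin m} → a Fin.< c → above a c ≈ 1#
      above-< {a = zero}  {suc c} p = refl
      above-< {a = suc a} {suc c} (ℕ.s≤s p) = above-< p

      above-≥ : ∀ {m} {a c : Fin m} → c Fin.≤ a → above a c ≈ 0#
      above-≥ {a = zero}  {zero}  p = refl
      above-≥ {a = suc a} {zero}  p = refl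
      above-≥ {a = suc a} {suc c} (ℕ.s≤s p) = above-≥ p

      limit-r : ∀ a c → Limit (λ j → Ẋ (x j) a * r j a c) (above a c)
      limit-r a c with Fin.<-cmp a c
      ... | tri< a<c _ _ = limit-cong (λ _ → refl) (sym (above-< a<c)) (limit-r-below a c a<c)
      ... | tri> _ _ c<a = limit-cong (λ _ → refl) (sym (above-≥ (ℕ.<⇒≤ c<a))) (limit-r-above a c c<a)
      ... | tri≈ _ ≡.refl _ = limit-cong (λ j → sym (trans (*-congˡ (Regular.r-diag (regular j) a)) (zeroʳ _))) (sym (above-≥ (ℕ.≤-refl {toℕ a}))) (limit-constant 0#)

      -- The long root 2ε_a contributes 2 to the drift and every later index c contributes 2, which
      -- is the coordinate of 2ρ at a.
      count : ∀ {m} (a : Fin m) → 2# * 1# + sum (λ c → 2# * above a c) ≈ ι (2ρ a)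
      count {suc m} zero = begin
        2# * 1# + (2# * 0# + sum (λ (c : Fin m) → 2# * 1#)) ≈⟨ +-congˡ (trans (+-congʳ (zeroʳ 2#)) (+-identityˡ _)) ⟩
        2# * 1# + sum (λ (c : Fin m) → 2# * 1#) ≈⟨ twos (suc m) ⟩
        ι (+ (2 ℕ.* suc m)) ∎
        where
        twos : ∀ k → sum {k} (λ _ → 2# * 1#) ≈ ι (+ (2 ℕ.* k))
        twos zero    = refl
        twos (suc k) = trans (+-congˡ (twos k)) (trans (+-congʳ (*-identityʳ 2#)) (trans (sym (ι-+ (+ 2) (+ (2 ℕ.* k)))) (reflexive (≡.cong (λ n → ι (+ n)) (≡.sym (ℕ.*-suc 2 k))))))
      count (suc a) = trans (+-congˡ (trans (+-congʳ (zeroʳ 2#)) (+-identityˡ _))) (count a)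

      limit-drift : ∀ a → Limit (λ j → drift (regular j) a) (ι (2ρ a))
      limit-drift a = limit-cong (λ _ → refl) (count a)
        (limit-+ (limit-* (limit-constant 2#) (limit-s a)) (limit-sum λ c → limit-* (limit-constant 2#) (limit-r a c)))

      ι-casimirValue : ∀ {m} (ν : Exponent m) → sum (λ a → ι (ν a) * ι (ν a)) + sum (λ a → ι (2ρ a) * ι (ν a)) ≈ ι (casimirValue ν)
      ι-casimirValue {zero}  ν = +-identityˡ 0#
      ι-casimirValue {suc m} ν = trans (solve 4 (λ p q r s → (p :+ q) :+ (r :+ s) := (p :+ r) :+ (q :+ s)) refl _ _ _ _)
        (trans (+-cong (sym (trans (ι-+ (ν zero ℤ.* ν zero) (+ (2 ℕ.* suc m) ℤ.* ν zero)) (+-cong (ι-* (ν zero) (ν zero)) (ι-* (+ (2 ℕ.* suc m)) (ν zero))))) (ι-casimirValue (ν ∘ suc)))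
          (sym (ι-+ (ν zero ℤ.* ν zero ℤ.+ + (2 ℕ.* suc m) ℤ.* ν zero) (casimirValue (ν ∘ suc)))))

      -- At infinity the radial operator has constant coefficients: the drift tends to 2ρ, so its
      -- symbol tends to |ν|² + (2ρ, ν).
      limit-symbol : ∀ ν → Limit (λ j → symbol (regular j) ν) (ι (casimirValue ν))
      limit-symbol ν = limit-cong (λ _ → refl) (ι-casimirValue ν)
        (limit-+ (limit-constant _) (limit-sum λ a → limit-* (limit-drift a) (limit-constant (ι (ν a)))))

    IsTop : Exponent m → Exponent m → Set
    IsTop τ κ = κ ≗ τ ⊎ dot h κ ℤ.< dot h τ

    private
      casimirValue-cong : ∀ {m} {ν κ : Exponent m} → ν ≗ κ → casimirValue ν ≡ casimirValue κ
      casimirValue-cong {zero}  p = ≡.refl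
      casimirValue-cong {suc m} p = ≡.cong₂ (λ y z → (y ℤ.* y ℤ.+ + (2 ℕ.* suc m) ℤ.* y) ℤ.+ z) (p zero) (casimirValue-cong (p ∘ suc))

    -- The eigenvalue equation is divided by the monomial of τ along the one-parameter subgroup. In
    -- the limit every exponent below the top dies and the asymptotic symbol at τ remains.
    top-coefficient : ∀ δ c τ → IsEigen δ c → AllExp (IsTop τ) δ → (ι (casimirValue τ) - c) * ⟨ indicator τ , δ ⟩ ≈ 0#
    top-coefficient δ c τ eigen top = limit-unique (limit-cong vanish refl (terms δ top))
      where
      G : ℕ → Exponent m → Carrier
      G j ν = (symbol (regular j) ν - c) * E j (dot h ν ℤ.- dot h τ)
      limit-symbol-c : ∀ ν → Limit (λ j → symbol (regular j) ν - c) (ι (casimirValue ν) - c)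
      limit-symbol-c ν = limit-+ (limit-symbol ν) (limit-constant (- c))
      term : ∀ ν → IsTop τ ν → Limit (λ j → G j ν) ((ι (casimirValue τ) - c) * indicator τ ν)
      term ν (inj₁ p) = limit-cong (λ j → *-congˡ (sym (trans (reflexive (≡.cong (E j) (≡.trans (≡.cong (ℤ._- dot h τ) (dot-cong h p)) (ℤ.+-inverseʳ (dot h τ))))) (E-0 j))))
        (*-cong (+-congʳ (reflexive (≡.cong ι (casimirValue-cong p)))) (sym (indicator-≗ p))) (limit-* (limit-symbol-c ν) (limit-constant 1#))
      term ν (inj₂ lt) = limit-cong (λ _ → refl) (trans (zeroʳ _) (sym (trans (*-congˡ (indicator-≭ λ p → ℤ.<-irrefl (dot-cong h p) lt)) (zeroʳ _))))
        (limit-* (limit-symbol-c ν) (limit-E (dot h ν ℤ.- dot h τ) (≡.subst (dot h ν ℤ.- dot h τ ℤ.<_) (ℤ.+-inverseʳ (dot h τ)) (ℤ.+-monoˡ-< (ℤ.- dot h τ) lt))))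
      terms : ∀ δ → AllExp (IsTop τ) δ → Limit (λ j → ⟨ G j , δ ⟩) ((ι (casimirValue τ) - c) * ⟨ indicator τ , δ ⟩)
      terms []            []       = limit-cong (λ _ → refl) (sym (zeroʳ _)) (limit-constant 0#)
      terms ((d , ν) ∷ δ) (t ∷ ts) = limit-cong (λ _ → refl)
        (solve 4 (λ d k i s → d :* (k :* i) :+ k :* s := k :* (d :* i :+ s)) refl d (ι (casimirValue τ) - c) (indicator τ ν) ⟨ indicator τ , δ ⟩)
        (limit-+ (limit-* (limit-constant d) (term ν t)) (terms δ ts))
      vanish : ∀ j → ⟨ G j , δ ⟩ ≈ 0#
      vanish j = begin
        ⟨ G j , δ ⟩
          ≈⟨ pair-cong δ (λ ν → trans (*-congˡ (trans (E-+ j (dot h ν) (ℤ.- dot h τ)) (*-congʳ (sym (monomial-point h j ν)))))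
               (solve 4 (λ s c e f → (s :- c) :* (e :* f) := f :* (s :* e :+ (:- c) :* e)) refl (symbol (regular j) ν) c (monomial (x j) ν) (E j (ℤ.- dot h τ)))) ⟩
        ⟨ (λ ν → E j (ℤ.- dot h τ) * (radial (regular j) ν + - c * monomial (x j) ν)) , δ ⟩
          ≈⟨ trans (pair-* (E j (ℤ.- dot h τ)) (λ ν → radial (regular j) ν + - c * monomial (x j) ν) δ) (*-congˡ (trans (pair-+ (radial (regular j)) (λ ν → - c * monomial (x j) ν) δ) (+-cong (eigen (x j) (regular j)) (pair-* (- c) (monomial (x j)) δ)))) ⟩
        E j (ℤ.- dot h τ) * (c * ⟨ monomial (x j) , δ ⟩ + - c * ⟨ monomial (x j) , δ ⟩)
          ≈⟨ solve 3 (λ e c m → e :* (c :* m :+ (:- c) :* m) := :0) refl (E j (ℤ.- dot h τ)) c ⟨ monomial (x j) , δ ⟩ ⟩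
        0# ∎

  private
    module _ {m} (τ : Exponent m) where
      remove : Terms (Exponent m) → Terms (Exponent m)
      remove []            = []
      remove ((d , ν) ∷ δ) with Fin.all? (λ a → ν a ℤ.≟ τ a)
      ... | yes _ = remove δ
      ... | no  _ = (d , ν) ∷ remove δ

      pair-remove : ∀ φ → Respectful φ → ∀ δ → ⟨ φ , δ ⟩ ≈ ⟨ φ , remove δ ⟩ + φ τ * ⟨ indicator τ , δ ⟩
      pair-remove φ resp []            = solve 1 (λ t → :0 := :0 :+ t :* :0) refl (φ τ)
      pair-remove φ resp ((d , ν) ∷ δ) with Fin.all? (λ a → ν a ℤ.≟ τ a)
      ... | yes p = trans (+-cong (*-congˡ (resp p)) (pair-remove φ resp δ))
        (solve 4 (λ d t r s → d :* t :+ (r :+ t :* s) := r :+ t :* (d :* :1 :+ s)) refl d (φ τ) ⟨ φ , remove δ ⟩ ⟨ indicator τ , δ ⟩)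
      ... | no  _ = trans (+-congˡ (pair-remove φ resp δ))
        (solve 5 (λ d n t r s → d :* n :+ (r :+ t :* s) := (d :* n :+ r) :+ t :* (d :* :0 :+ s)) refl d (φ ν) (φ τ) ⟨ φ , remove δ ⟩ ⟨ indicator τ , δ ⟩)

      remove-All : ∀ {P : Exponent m → Set} δ → AllExp P δ → AllExp P (remove δ)
      remove-All []            []       = []
      remove-All ((d , ν) ∷ δ) (p ∷ ps) with Fin.all? (λ a → ν a ℤ.≟ τ a)
      ... | yes _ = remove-All δ ps
      ... | no  _ = p ∷ remove-All δ ps

      remove-≤ : ∀ δ → List.length (remove δ) ℕ.≤ List.length δ
      remove-≤ []            = ℕ.z≤n
      remove-≤ ((d , ν) ∷ δ) with Fin.all? (λ a → ν a ℤ.≟ τ a)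
      ... | yes _ = ℕ.m≤n⇒m≤1+n (remove-≤ δ)
      ... | no  _ = ℕ.s≤s (remove-≤ δ)

      remove-< : ∀ δ → τ ∈ exponents δ → List.length (remove δ) ℕ.< List.length δ
      remove-< ((d , ν) ∷ δ) τ∈ with Fin.all? (λ a → ν a ℤ.≟ τ a)
      ... | yes _ = ℕ.s≤s (remove-≤ δ)
      remove-< ((d , ν) ∷ δ) (here ≡.refl) | no ¬p = ⊥-elim (¬p λ _ → ≡.refl)
      remove-< ((d , ν) ∷ δ) (there τ∈)    | no _  = ℕ.s≤s (remove-< δ τ∈)

      remove-⊆ : ∀ δ {κ} → κ ∈ exponents (remove δ) → κ ∈ exponents δ
      remove-⊆ ((d , ν) ∷ δ) κ∈ with Fin.all? (λ a → ν a ℤ.≟ τ a)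
      ... | yes _ = there (remove-⊆ δ κ∈)
      remove-⊆ ((d , ν) ∷ δ) (here p)   | no _ = here p
      remove-⊆ ((d , ν) ∷ δ) (there κ∈) | no _ = there (remove-⊆ δ κ∈)

    maximum : ∀ {m} (h : Exponent m) ν l → ∃ λ τ → τ ∈ ν ∷ l × (∀ {κ} → κ ∈ ν ∷ l → dot h κ ℤ.≤ dot h τ)
    maximum h ν []      = ν , here ≡.refl , λ { (here ≡.refl) → ℤ.≤-refl }
    maximum h ν (κ ∷ l) with maximum h κ l
    ... | τ , τ∈ , τ-max with ℤ.≤-total (dot h ν) (dot h τ)
    ...   | inj₁ ν≤τ = τ , there τ∈ , λ { (here ≡.refl) → ν≤τ ; (there κ∈) → τ-max κ∈ }
    ...   | inj₂ τ≤ν = ν , here ≡.refl , λ { (here ≡.refl) → ℤ.≤-refl ; (there κ∈) → ℤ.≤-trans (τ-max κ∈) τ≤ν }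

    All-exponents : ∀ {m} {P : Exponent m → Set} δ → (∀ {κ} → κ ∈ exponents δ → P κ) → AllExp P δ
    All-exponents δ p = All.tabulate λ t∈ → p (∈-map⁺ proj₂ t∈)

    exponents-All : ∀ {m} {P : Exponent m → Set} {δ} → AllExp P δ → ∀ {κ} → κ ∈ exponents δ → P κ
    exponents-All (p ∷ ps) (here ≡.refl) = p
    exponents-All (p ∷ ps) (there κ∈)    = exponents-All ps κ∈

  -- The highest exponent of a symmetric sum is dominant, so an eigenfunction has no exponent
  -- strictly below the one which determines its eigenvalue.
  symmetric-eigen-vanishes : ∀ {m} (μ : Exponent m) → Dominant μ → ∀ δ → AllExp (_≺ μ) δ → IsEigen δ (ι (casimirValue μ)) →
    IsSymmetric (λ x → ⟨ monomial x , δ ⟩) → ∀ x → ⟨ monomial x , δ ⟩ ≈ 0#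
  symmetric-eigen-vanishes {m} μ dμ δ₀ below₀ eigen₀ sym₀ with separating (exponents δ₀)
  ... | h , dec , sep = go (List.length δ₀) δ₀ ℕ.≤-refl (λ κ∈ → κ∈) below₀ eigen₀ sym₀
    where
    go : ∀ l δ → List.length δ ℕ.≤ l → (∀ {κ} → κ ∈ exponents δ → κ ∈ exponents δ₀) → AllExp (_≺ μ) δ →
         IsEigen δ (ι (casimirValue μ)) → IsSymmetric (λ x → ⟨ monomial x , δ ⟩) → ∀ x → ⟨ monomial x , δ ⟩ ≈ 0#
    go l       []      _   _   _     _     _     x = refl
    go (suc l) (t ∷ δ′) len sub below eigen symm x = trans (removed (monomial x) (monomial-cong x))
      (go l (remove τ δ) (ℕ.s≤s⁻¹ (ℕ.≤-trans (remove-< τ δ τ∈) len)) (λ κ∈ → sub (remove-⊆ τ δ κ∈)) (remove-All τ δ below)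
        (λ y R → trans (sym (removed (radial R) (radial-cong R))) (trans (eigen y R) (*-congˡ (removed (monomial y) (monomial-cong y)))))
        (λ σ y → trans (sym (removed (monomial (actᵗ σ y)) (monomial-cong (actᵗ σ y)))) (trans (symm σ y) (removed (monomial y) (monomial-cong y)))) x)
      where
      δ : Terms (Exponent m)
      δ = t ∷ δ′
      top : ∃ λ τ → τ ∈ exponents δ × (∀ {κ} → κ ∈ exponents δ → dot h κ ℤ.≤ dot h τ)
      top = maximum h (proj₂ t) (exponents δ′)
      τ = proj₁ top
      τ∈ = proj₁ (proj₂ top)
      isTop : AllExp (IsTop h dec τ) δ
      isTop = All-exponents δ λ {κ} κ∈ → split κ κ∈ (dot h κ ℤ.≟ dot h τ)
        where
        split : ∀ κ → κ ∈ exponents δ → Dec (dot h κ ≡ dot h τ) → IsTop h dec τ κ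
        split κ κ∈ (yes e) = inj₁ (sep (sub κ∈) (sub τ∈) e)
        split κ κ∈ (no ¬e) = inj₂ (ℤ.≤∧≢⇒< (proj₂ (proj₂ top) κ∈) ¬e)
      -- A dominant τ strictly below μ has a strictly smaller Casimir value, so the factor in front
      -- of its coefficient is invertible.
      dominant-case : Dominant τ → ⟨ indicator τ , δ ⟩ ≈ 0#
      dominant-case dτ = *-cancelˡ-0 (λ p → ℤ.<-irrefl (ι-injective {casimirValue τ} {casimirValue μ} (x-y≈0⇒x≈y p)) (casimirValue-< τ μ dτ dμ (exponents-All below τ∈)))
        (top-coefficient h dec δ (ι (casimirValue μ)) τ eigen isTop)
      -- Symmetry moves the coefficient of τ to the reflected exponent, whose product with h exceeds
      -- the maximum. That exponent does not occur at all.
      raised-case : (∃ λ σ → ∀ h → Decreasing h → dot h τ ℤ.< dot h (actᵉ σ τ)) → ⟨ indicator τ , δ ⟩ ≈ 0#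
      raised-case (σ , raise) = begin
        ⟨ indicator τ , δ ⟩
          ≈⟨ independent-≈ δ (reindex (actᵉ σ) δ) (λ y → trans (sym (symm σ y)) (trans (pair-cong δ (monomial-actᵗ σ y)) (sym (pair-reindex (actᵉ σ) (monomial y) δ)))) (indicator τ) (indicator-respectful τ) ⟩
        ⟨ indicator τ , reindex (actᵉ σ) δ ⟩
          ≈⟨ pair-indicator-0 τ (reindex (actᵉ σ) δ) (reindex-All (actᵉ σ) (λ {κ} p q → p λ a → ≡.trans (≡.sym (actᵉ-involutive σ κ a)) (actᵉ-cong σ q a)) δ absent) ⟩
        0# ∎
        where
        absent : AllExp (λ κ → ¬ κ ≗ actᵉ σ τ) δ
        absent = All-exponents δ λ {κ} κ∈ p → ℤ.<⇒≱ (raise h dec) (≡.subst (ℤ._≤ dot h τ) (dot-cong h p) (proj₂ (proj₂ top) κ∈))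
      coefficient-0 : ⟨ indicator τ , δ ⟩ ≈ 0#
      coefficient-0 with dominant-or-raised τ
      ... | inj₁ dτ = dominant-case dτ
      ... | inj₂ r  = raised-case r
      removed : ∀ φ → Respectful φ → ⟨ φ , δ ⟩ ≈ ⟨ φ , remove τ δ ⟩
      removed φ resp = trans (pair-remove τ φ resp δ) (trans (+-congˡ (trans (*-congˡ coefficient-0) (zeroʳ _))) (+-identityʳ _))

  -- The common ground on which characters and determinants are compared. The eigenvalue is left
  -- free, since the leading term forces it to be the Casimir value of μ; no separate computation of
  -- it is required on either side.
  record Expansion {m} (μ : Exponent m) (χ : Torus m → Carrier) : Set where
    field
      lower     : Terms (Exponent m)
      lower-≺   : AllExp (_≺ μ) lower
      value     : ∀ x → χ x ≈ monomial x μ + ⟨ monomial x , lower ⟩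
      constant  : Carrier
      eigen     : IsEigen ((1# , μ) ∷ lower) constant
      symmetric : IsSymmetric χ

    eigenvalue : constant ≈ ι (casimirValue μ)
    eigenvalue = sym (x-y≈0⇒x≈y (begin
      ι (casimirValue μ) - constant ≈⟨ *-identityʳ _ ⟨
      (ι (casimirValue μ) - constant) * 1# ≈⟨ *-congˡ (trans (+-cong (trans (*-identityˡ _) (indicator-refl μ)) (pair-indicator-0 μ lower (All.map ≺⇒≭ lower-≺))) (+-identityʳ 1#)) ⟨
      (ι (casimirValue μ) - constant) * ⟨ indicator μ , (1# , μ) ∷ lower ⟩
        ≈⟨ top-coefficient h dec ((1# , μ) ∷ lower) constant μ eigen (inj₁ (λ _ → ≡.refl) ∷ All.map (λ {t} p → inj₂ (≺⇒dot-< h (proj₂ t) μ dec p)) lower-≺) ⟩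
      0# ∎))
      where
      h : Exponent m
      -- Any strictly dominant functional serves here, as the leading exponent is already known; the
      -- empty list provides one.
      h = proj₁ (separating [])
      dec : Decreasing h
      dec = proj₁ (proj₂ (separating []))

  expansion-unique : ∀ {m} {μ : Exponent m} → Dominant μ → ∀ {χ χ′} → Expansion μ χ → Expansion μ χ′ → ∀ x → χ x ≈ χ′ x
  expansion-unique {m} {μ} dμ {χ} {χ′} e e′ x = begin
    χ x ≈⟨ E.value x ⟩
    monomial x μ + ⟨ monomial x , E.lower ⟩ ≈⟨ +-congˡ (x-y≈0⇒x≈y (trans (sym (pair-δ (monomial x))) (symmetric-eigen-vanishes μ dμ δ δ-≺ δ-eigen δ-symmetric x))) ⟩
    monomial x μ + ⟨ monomial x , E′.lower ⟩ ≈⟨ E′.value x ⟨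
    χ′ x ∎
    where
    module E = Expansion e
    module E′ = Expansion e′
    δ : Terms (Exponent m)
    δ = E.lower ++ scale (- 1#) E′.lower
    pair-δ : ∀ φ → ⟨ φ , δ ⟩ ≈ ⟨ φ , E.lower ⟩ - ⟨ φ , E′.lower ⟩
    pair-δ φ = trans (pair-++ φ E.lower _) (+-congˡ (trans (pair-scale (- 1#) φ E′.lower) (solve 1 (λ z → :-1 :* z := :- z) refl _)))
    δ-≺ : AllExp (_≺ μ) δ
    δ-≺ = ++⁺ E.lower-≺ (weighted-All E′.lower E′.lower-≺)
    lead : ∀ φ p q → (1# * φ + p) - (1# * φ + q) ≈ p - q
    lead = solve 3 (λ f p q → (:1 :* f :+ p) :- (:1 :* f :+ q) := p :- q) refl
    δ-eigen : IsEigen δ (ι (casimirValue μ))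
    δ-eigen y R = begin
      ⟨ radial R , δ ⟩ ≈⟨ pair-δ (radial R) ⟩
      ⟨ radial R , E.lower ⟩ - ⟨ radial R , E′.lower ⟩ ≈⟨ lead (radial R μ) _ _ ⟨
      ⟨ radial R , (1# , μ) ∷ E.lower ⟩ - ⟨ radial R , (1# , μ) ∷ E′.lower ⟩
        ≈⟨ +-cong (trans (E.eigen y R) (*-congʳ E.eigenvalue)) (-‿cong (trans (E′.eigen y R) (*-congʳ E′.eigenvalue))) ⟩
      ι (casimirValue μ) * ⟨ monomial y , (1# , μ) ∷ E.lower ⟩ - ι (casimirValue μ) * ⟨ monomial y , (1# , μ) ∷ E′.lower ⟩
        ≈⟨ trans (solve 3 (λ c p q → c :* p :- c :* q := c :* (p :- q)) refl (ι (casimirValue μ)) _ _) (*-congˡ (lead (monomial y μ) _ _)) ⟩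
      ι (casimirValue μ) * (⟨ monomial y , E.lower ⟩ - ⟨ monomial y , E′.lower ⟩)
        ≈⟨ *-congˡ (pair-δ (monomial y)) ⟨
      ι (casimirValue μ) * ⟨ monomial y , δ ⟩ ∎
    difference : ∀ y → ⟨ monomial y , δ ⟩ ≈ χ y - χ′ y
    difference y = trans (pair-δ (monomial y)) (sym (trans (+-cong (E.value y) (-‿cong (E′.value y)))
      (solve 3 (λ f p q → (f :+ p) :- (f :+ q) := p :- q) refl (monomial y μ) _ _)))
    δ-symmetric : IsSymmetric (λ y → ⟨ monomial y , δ ⟩)
    δ-symmetric σ y = trans (difference (actᵗ σ y)) (trans (+-cong (E.symmetric σ y) (-‿cong (E′.symmetric σ y))) (sym (difference y)))

-- Weyl symmetry of characters

module CharacterExpansion (K : CommutativeRing 0ℓ 0ℓ) (F : IsCharZeroField K) where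
  open CommutativeRing K hiding (zero)
  open Arithmetic K
  open FieldArithmetic K F
  open LinearAlgebra K
  open WeylGroup
  open Uniqueness K F
  open Symplectic K using (val; inv; Sp; matrix; Jblock; J; torusElement; eigenvalue; character; IsIrreducibleCharacter)
  open SetoidReasoning setoid

  private
    Ix : ℕ → Set
    Ix m = Fin m ⊎ Fin m

    lift : ∀ {m} → Ix m → Ix (suc m)
    lift = Sum.map suc suc

    exchange : ∀ {m} → Fin (suc (suc m)) → Fin (suc (suc m))
    exchange zero          = suc zero
    exchange (suc zero)    = zero
    exchange (suc (suc a)) = suc (suc a)

    -- The reflection σ permutes the basis vectors e_a and f_a up to sign.
    π : ∀ {m} → Reflection m → Ix m → Ix m
    π flip      (inj₁ zero)    = inj₂ zero
    π flip      (inj₁ (suc a)) = inj₁ (suc a)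
    π flip      (inj₂ zero)    = inj₁ zero
    π flip      (inj₂ (suc a)) = inj₂ (suc a)
    π swap      (inj₁ a)       = inj₁ (exchange a)
    π swap      (inj₂ a)       = inj₂ (exchange a)
    π (shift σ) (inj₁ zero)    = inj₁ zero
    π (shift σ) (inj₁ (suc a)) = lift (π σ (inj₁ a))
    π (shift σ) (inj₂ zero)    = inj₂ zero
    π (shift σ) (inj₂ (suc a)) = lift (π σ (inj₂ a))

    -- The one negative sign makes the flip act by e ↦ f and f ↦ -e, as preservation of ω requires.
    ε : ∀ {m} → Reflection m → Ix m → Carrier
    ε flip      (inj₁ a)       = 1#
    ε flip      (inj₂ zero)    = - 1#
    ε flip      (inj₂ (suc a)) = 1#
    ε swap      s              = 1#
    ε (shift σ) (inj₁ zero)    = 1#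
    ε (shift σ) (inj₁ (suc a)) = ε σ (inj₁ a)
    ε (shift σ) (inj₂ zero)    = 1#
    ε (shift σ) (inj₂ (suc a)) = ε σ (inj₂ a)

    π-lift : ∀ {m} (σ : Reflection m) s → π (shift σ) (lift s) ≡ lift (π σ s)
    π-lift σ (inj₁ a) = ≡.refl
    π-lift σ (inj₂ a) = ≡.refl

    π-involutive : ∀ {m} (σ : Reflection m) s → π σ (π σ s) ≡ s
    π-involutive flip (inj₁ zero)    = ≡.refl
    π-involutive flip (inj₁ (suc a)) = ≡.refl
    π-involutive flip (inj₂ zero)    = ≡.refl
    π-involutive flip (inj₂ (suc a)) = ≡.refl
    π-involutive swap (inj₁ zero)          = ≡.refl
    π-involutive swap (inj₁ (suc zero))    = ≡.refl
    π-involutive swap (inj₁ (suc (suc a))) = ≡.refl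
    π-involutive swap (inj₂ zero)          = ≡.refl
    π-involutive swap (inj₂ (suc zero))    = ≡.refl
    π-involutive swap (inj₂ (suc (suc a))) = ≡.refl
    π-involutive (shift σ) (inj₁ zero)    = ≡.refl
    π-involutive (shift σ) (inj₁ (suc a)) = ≡.trans (π-lift σ (π σ (inj₁ a))) (≡.cong lift (π-involutive σ (inj₁ a)))
    π-involutive (shift σ) (inj₂ zero)    = ≡.refl
    π-involutive (shift σ) (inj₂ (suc a)) = ≡.trans (π-lift σ (π σ (inj₂ a))) (≡.cong lift (π-involutive σ (inj₂ a)))

    ε² : ∀ {m} (σ : Reflection m) s → ε σ s * ε σ s ≈ 1#
    ε² flip      (inj₁ a)       = *-identityˡ 1#
    ε² flip      (inj₂ zero)    = solve 0 (:-1 :* :-1 := :1) refl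
    ε² flip      (inj₂ (suc a)) = *-identityˡ 1#
    ε² swap      s              = *-identityˡ 1#
    ε² (shift σ) (inj₁ zero)    = *-identityˡ 1#
    ε² (shift σ) (inj₁ (suc a)) = ε² σ (inj₁ a)
    ε² (shift σ) (inj₂ zero)    = *-identityˡ 1#
    ε² (shift σ) (inj₂ (suc a)) = ε² σ (inj₂ a)

    J-lift : ∀ {m} (s t : Ix m) → Jblock (lift s) (lift t) ≈ Jblock s t
    J-lift (inj₁ a) (inj₁ c) = refl
    J-lift (inj₁ a) (inj₂ c) = refl
    J-lift (inj₂ a) (inj₁ c) = refl
    J-lift (inj₂ a) (inj₂ c) = refl

    neg-0 : - 0# ≈ 0#
    neg-0 = solve 0 (:- :0 := :0) refl

    J-zeroˡ : ∀ {m} (t : Ix m) → (Jblock (inj₁ zero) (lift t) ≈ 0#) × (Jblock (inj₂ zero) (lift t) ≈ 0#)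
    J-zeroˡ (inj₁ c) = refl , neg-0
    J-zeroˡ (inj₂ c) = refl , refl

    J-zeroʳ : ∀ {m} (s : Ix m) → (Jblock (lift s) (inj₁ zero) ≈ 0#) × (Jblock (lift s) (inj₂ zero) ≈ 0#)
    J-zeroʳ (inj₁ c) = refl , refl
    J-zeroʳ (inj₂ c) = neg-0 , refl

    1ᴹ-exchange : ∀ {m} (a c : Fin (suc (suc m))) → 1ᴹ (exchange a) (exchange c) ≈ 1ᴹ a c
    1ᴹ-exchange zero          zero          = refl
    1ᴹ-exchange zero          (suc zero)    = refl
    1ᴹ-exchange zero          (suc (suc c)) = refl
    1ᴹ-exchange (suc zero)    zero          = refl
    1ᴹ-exchange (suc zero)    (suc zero)    = refl
    1ᴹ-exchange (suc zero)    (suc (suc c)) = refl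
    1ᴹ-exchange (suc (suc a)) zero          = refl
    1ᴹ-exchange (suc (suc a)) (suc zero)    = refl
    1ᴹ-exchange (suc (suc a)) (suc (suc c)) = refl

    J-π : ∀ {m} (σ : Reflection m) s t → ε σ s * (ε σ t * Jblock (π σ s) (π σ t)) ≈ Jblock s t
    J-π flip (inj₁ zero)    (inj₁ zero)    = solve 0 (:1 :* (:1 :* :0) := :0) refl
    J-π flip (inj₁ zero)    (inj₁ (suc c)) = solve 0 (:1 :* (:1 :* (:- :0)) := :0) refl
    J-π flip (inj₁ zero)    (inj₂ zero)    = solve 0 (:1 :* (:-1 :* :-1) := :1) refl
    J-π flip (inj₁ zero)    (inj₂ (suc c)) = solve 0 (:1 :* (:1 :* :0) := :0) refl
    J-π flip (inj₁ (suc a)) (inj₁ zero)    = solve 0 (:1 :* (:1 :* :0) := :0) refl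
    J-π flip (inj₁ (suc a)) (inj₁ (suc c)) = solve 0 (:1 :* (:1 :* :0) := :0) refl
    J-π flip (inj₁ (suc a)) (inj₂ zero)    = solve 0 (:1 :* (:-1 :* :0) := :0) refl
    J-π flip (inj₁ (suc a)) (inj₂ (suc c)) = trans (*-identityˡ _) (*-identityˡ _)
    J-π flip (inj₂ zero)    (inj₁ zero)    = solve 0 (:-1 :* (:1 :* :1) := :- :1) refl
    J-π flip (inj₂ zero)    (inj₁ (suc c)) = solve 0 (:-1 :* (:1 :* :0) := :- :0) refl
    J-π flip (inj₂ zero)    (inj₂ zero)    = solve 0 (:-1 :* (:-1 :* :0) := :0) refl
    J-π flip (inj₂ zero)    (inj₂ (suc c)) = solve 0 (:-1 :* (:1 :* :0) := :0) refl
    J-π flip (inj₂ (suc a)) (inj₁ zero)    = solve 0 (:1 :* (:1 :* :0) := :- :0) refl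
    J-π flip (inj₂ (suc a)) (inj₁ (suc c)) = trans (*-identityˡ _) (*-identityˡ _)
    J-π flip (inj₂ (suc a)) (inj₂ zero)    = solve 0 (:1 :* (:-1 :* (:- :0)) := :0) refl
    J-π flip (inj₂ (suc a)) (inj₂ (suc c)) = solve 0 (:1 :* (:1 :* :0) := :0) refl
    J-π swap (inj₁ a) (inj₁ c) = trans (*-identityˡ _) (*-identityˡ _)
    J-π swap (inj₁ a) (inj₂ c) = trans (trans (*-identityˡ _) (*-identityˡ _)) (1ᴹ-exchange a c)
    J-π swap (inj₂ a) (inj₁ c) = trans (trans (*-identityˡ _) (*-identityˡ _)) (-‿cong (1ᴹ-exchange a c))
    J-π swap (inj₂ a) (inj₂ c) = trans (*-identityˡ _) (*-identityˡ _)
    J-π (shift σ) (inj₁ zero)    (inj₁ zero)    = trans (*-identityˡ _) (*-identityˡ _)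
    J-π (shift σ) (inj₁ zero)    (inj₂ zero)    = trans (*-identityˡ _) (*-identityˡ _)
    J-π (shift σ) (inj₂ zero)    (inj₁ zero)    = trans (*-identityˡ _) (*-identityˡ _)
    J-π (shift σ) (inj₂ zero)    (inj₂ zero)    = trans (*-identityˡ _) (*-identityˡ _)
    J-π (shift σ) (inj₁ zero)    (inj₁ (suc c)) = trans (*-identityˡ _) (trans (*-congˡ (proj₁ (J-zeroˡ (π σ (inj₁ c))))) (zeroʳ _))
    J-π (shift σ) (inj₁ zero)    (inj₂ (suc c)) = trans (*-identityˡ _) (trans (*-congˡ (proj₁ (J-zeroˡ (π σ (inj₂ c))))) (zeroʳ _))
    J-π (shift σ) (inj₂ zero)    (inj₁ (suc c)) = trans (*-identityˡ _) (trans (*-congˡ (proj₂ (J-zeroˡ (π σ (inj₁ c))))) (trans (zeroʳ _) (sym neg-0)))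
    J-π (shift σ) (inj₂ zero)    (inj₂ (suc c)) = trans (*-identityˡ _) (trans (*-congˡ (proj₂ (J-zeroˡ (π σ (inj₂ c))))) (zeroʳ _))
    J-π (shift σ) (inj₁ (suc a)) (inj₁ zero)    = trans (*-congˡ (trans (*-identityˡ _) (proj₁ (J-zeroʳ (π σ (inj₁ a)))))) (zeroʳ _)
    J-π (shift σ) (inj₁ (suc a)) (inj₂ zero)    = trans (*-congˡ (trans (*-identityˡ _) (proj₂ (J-zeroʳ (π σ (inj₁ a)))))) (zeroʳ _)
    J-π (shift σ) (inj₂ (suc a)) (inj₁ zero)    = trans (*-congˡ (trans (*-identityˡ _) (proj₁ (J-zeroʳ (π σ (inj₂ a)))))) (trans (zeroʳ _) (sym neg-0))
    J-π (shift σ) (inj₂ (suc a)) (inj₂ zero)    = trans (*-congˡ (trans (*-identityˡ _) (proj₂ (J-zeroʳ (π σ (inj₂ a)))))) (zeroʳ _)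
    J-π (shift σ) (inj₁ (suc a)) (inj₁ (suc c)) = trans (*-congˡ (*-congˡ (J-lift (π σ (inj₁ a)) (π σ (inj₁ c))))) (J-π σ (inj₁ a) (inj₁ c))
    J-π (shift σ) (inj₁ (suc a)) (inj₂ (suc c)) = trans (*-congˡ (*-congˡ (J-lift (π σ (inj₁ a)) (π σ (inj₂ c))))) (J-π σ (inj₁ a) (inj₂ c))
    J-π (shift σ) (inj₂ (suc a)) (inj₁ (suc c)) = trans (*-congˡ (*-congˡ (J-lift (π σ (inj₂ a)) (π σ (inj₁ c))))) (J-π σ (inj₂ a) (inj₁ c))
    J-π (shift σ) (inj₂ (suc a)) (inj₂ (suc c)) = trans (*-congˡ (*-congˡ (J-lift (π σ (inj₂ a)) (π σ (inj₂ c))))) (J-π σ (inj₂ a) (inj₂ c))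

    eigenvalue-π : ∀ {m} (σ : Reflection m) (v w : Fin m → Carrier) s → [ v , w ]′ (π σ s) ≡ [ actᵛ σ v w , actᵛ σ w v ]′ s
    eigenvalue-π flip v w (inj₁ zero)    = ≡.refl
    eigenvalue-π flip v w (inj₁ (suc a)) = ≡.refl
    eigenvalue-π flip v w (inj₂ zero)    = ≡.refl
    eigenvalue-π flip v w (inj₂ (suc a)) = ≡.refl
    eigenvalue-π swap v w (inj₁ zero)          = ≡.refl
    eigenvalue-π swap v w (inj₁ (suc zero))    = ≡.refl
    eigenvalue-π swap v w (inj₁ (suc (suc a))) = ≡.refl
    eigenvalue-π swap v w (inj₂ zero)          = ≡.refl
    eigenvalue-π swap v w (inj₂ (suc zero))    = ≡.refl
    eigenvalue-π swap v w (inj₂ (suc (suc a))) = ≡.refl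
    eigenvalue-π (shift σ) v w (inj₁ zero)    = ≡.refl
    eigenvalue-π (shift σ) v w (inj₂ zero)    = ≡.refl
    eigenvalue-π (shift σ) v w (inj₁ (suc a)) = ≡.trans (lifted (π σ (inj₁ a))) (eigenvalue-π σ (v ∘ suc) (w ∘ suc) (inj₁ a))
      where
      lifted : ∀ s → [ v , w ]′ (lift s) ≡ [ v ∘ suc , w ∘ suc ]′ s
      lifted (inj₁ _) = ≡.refl
      lifted (inj₂ _) = ≡.refl
    eigenvalue-π (shift σ) v w (inj₂ (suc a)) = ≡.trans (lifted (π σ (inj₂ a))) (eigenvalue-π σ (v ∘ suc) (w ∘ suc) (inj₂ a))
      where
      lifted : ∀ s → [ v , w ]′ (lift s) ≡ [ v ∘ suc , w ∘ suc ]′ s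
      lifted (inj₁ _) = ≡.refl
      lifted (inj₂ _) = ≡.refl

  module _ {m n : ℕ} (V : Symplectic.Representation K m n) (σ : Reflection m) where
    open SymplecticForm K F m
    open LieAction K F V using (ρ-cong; ρ-∙; ρ-1; torusElement-b)
    open Symplectic.Representation V using (ρ)

    private
      wMatrix : Matrix N
      wMatrix i j = ε σ (splitAt m j) * b (π σ (splitAt m j)) i

      wMatrix-symplectic : wMatrix ᵀ *ᴹ J m *ᴹ wMatrix ≈ᴹ J m
      wMatrix-symplectic i j = begin
        ω (ε σ s ∙ᵛ b (π σ s)) (ε σ t ∙ᵛ b (π σ t)) ≈⟨ trans (ω-∙ˡ (ε σ s) (b (π σ s)) _) (*-congˡ (ω-∙ʳ (ε σ t) (b (π σ s)) (b (π σ t)))) ⟩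
        ε σ s * (ε σ t * ω (b (π σ s)) (b (π σ t))) ≈⟨ *-congˡ (*-congˡ (ω-b (π σ s) (π σ t))) ⟩
        ε σ s * (ε σ t * Jblock (π σ s) (π σ t)) ≈⟨ J-π σ s t ⟩
        Jblock s t ∎
        where
        s t : Index
        s = splitAt m i
        t = splitAt m j

      w : Sp m
      w = record { matrix = wMatrix ; symplectic = wMatrix-symplectic }

      w-b : ∀ s → matrix w ▹ b s ≈ᵛ ε σ s ∙ᵛ b (π σ s)
      w-b s i = trans (⟪⟫-basisʳ (wMatrix i) (join m m s)) (reflexive (≡.cong (λ t → ε σ t * b (π σ t) i) (Fin.splitAt-join m m s)))

      basis-ext : ∀ {A B : Matrix N} → (∀ s → A ▹ b s ≈ᵛ B ▹ b s) → A ≈ᴹ B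
      basis-ext {A} {B} p i j = begin
        A i j ≈⟨ ⟪⟫-basisʳ (A i) j ⟨
        (A ▹ basis j) i ≡⟨ ≡.cong (λ l → (A ▹ basis l) i) (Fin.join-splitAt m m j) ⟨
        (A ▹ b (splitAt m j)) i ≈⟨ p (splitAt m j) i ⟩
        (B ▹ b (splitAt m j)) i ≡⟨ ≡.cong (λ l → (B ▹ basis l) i) (Fin.join-splitAt m m j) ⟩
        (B ▹ basis j) i ≈⟨ ⟪⟫-basisʳ (B i) j ⟩
        B i j ∎

      η : Index → Carrier
      η s = ε σ s * ε σ (π σ s)

      w²-b : ∀ s → matrix (w ∙ˢ w) ▹ b s ≈ᵛ η s ∙ᵛ b s
      w²-b s i = begin
        (matrix (w ∙ˢ w) ▹ b s) i ≈⟨ *ᴹ-▹ wMatrix wMatrix (b s) i ⟩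
        (wMatrix ▹ (wMatrix ▹ b s)) i ≈⟨ ▹-congˡ wMatrix (w-b s) i ⟩
        (wMatrix ▹ (ε σ s ∙ᵛ b (π σ s))) i ≈⟨ ▹-∙ wMatrix (ε σ s) (b (π σ s)) i ⟩
        ε σ s * (wMatrix ▹ b (π σ s)) i ≈⟨ *-congˡ (w-b (π σ s) i) ⟩
        ε σ s * (ε σ (π σ s) * b (π σ (π σ s)) i) ≡⟨ ≡.cong (λ t → ε σ s * (ε σ (π σ s) * b t i)) (π-involutive σ s) ⟩
        ε σ s * (ε σ (π σ s) * b s i) ≈⟨ *-assoc _ _ _ ⟨
        η s * b s i ∎

      -- The lift of a reflection squares to a diagonal matrix of signs, not always to 1 (a flip
      -- gives -1 on a plane), so its order divides 4. Its inverse can then be written as w³, which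
      -- is what the conjugation inside the trace uses.
      w⁴ : matrix ((w ∙ˢ w) ∙ˢ (w ∙ˢ w)) ≈ᴹ 1ᴹ
      w⁴ = basis-ext λ s i → begin
        (matrix ((w ∙ˢ w) ∙ˢ (w ∙ˢ w)) ▹ b s) i ≈⟨ *ᴹ-▹ (matrix (w ∙ˢ w)) (matrix (w ∙ˢ w)) (b s) i ⟩
        (matrix (w ∙ˢ w) ▹ (matrix (w ∙ˢ w) ▹ b s)) i ≈⟨ ▹-congˡ (matrix (w ∙ˢ w)) (w²-b s) i ⟩
        (matrix (w ∙ˢ w) ▹ (η s ∙ᵛ b s)) i ≈⟨ trans (▹-∙ (matrix (w ∙ˢ w)) (η s) (b s) i) (*-congˡ (w²-b s i)) ⟩
        η s * (η s * b s i) ≈⟨ solve 3 (λ p q x → (p :* q) :* ((p :* q) :* x) := (p :* p) :* (q :* q) :* x) refl (ε σ s) (ε σ (π σ s)) (b s i) ⟩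
        (ε σ s * ε σ s) * (ε σ (π σ s) * ε σ (π σ s)) * b s i ≈⟨ *-congʳ (trans (*-cong (ε² σ s) (ε² σ (π σ s))) (*-identityˡ 1#)) ⟩
        1# * b s i ≈⟨ *-identityˡ _ ⟩
        b s i ≈⟨ 1ᴹ-▹ (b s) i ⟨
        (1ᴹ ▹ b s) i ∎

      conjugate : ∀ x → matrix (w ∙ˢ torusElement (actᵗ σ x)) ≈ᴹ matrix (torusElement x ∙ˢ w)
      conjugate x = basis-ext λ s i → begin
        (matrix (w ∙ˢ torusElement (actᵗ σ x)) ▹ b s) i ≈⟨ *ᴹ-▹ wMatrix (matrix (torusElement (actᵗ σ x))) (b s) i ⟩
        (wMatrix ▹ (matrix (torusElement (actᵗ σ x)) ▹ b s)) i ≈⟨ ▹-congˡ wMatrix (torusElement-b (actᵗ σ x) s) i ⟩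
        (wMatrix ▹ (eigenvalue (actᵗ σ x) s ∙ᵛ b s)) i ≈⟨ trans (▹-∙ wMatrix (eigenvalue (actᵗ σ x) s) (b s) i) (*-congˡ (w-b s i)) ⟩
        eigenvalue (actᵗ σ x) s * (ε σ s * b (π σ s) i) ≈⟨ *-congʳ (reflexive (≡.sym (eigenvalue-π σ (val x) (inv x) s))) ⟩
        eigenvalue x (π σ s) * (ε σ s * b (π σ s) i) ≈⟨ solve 3 (λ p q r → p :* (q :* r) := q :* (p :* r)) refl (eigenvalue x (π σ s)) (ε σ s) (b (π σ s) i) ⟩
        ε σ s * (eigenvalue x (π σ s) * b (π σ s) i) ≈⟨ *-congˡ (torusElement-b x (π σ s) i) ⟨
        ε σ s * (matrix (torusElement x) ▹ b (π σ s)) i ≈⟨ ▹-∙ (matrix (torusElement x)) (ε σ s) (b (π σ s)) i ⟨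
        (matrix (torusElement x) ▹ (ε σ s ∙ᵛ b (π σ s))) i ≈⟨ ▹-congˡ (matrix (torusElement x)) (w-b s) i ⟨
        (matrix (torusElement x) ▹ (wMatrix ▹ b s)) i ≈⟨ *ᴹ-▹ (matrix (torusElement x)) wMatrix (b s) i ⟨
        (matrix (torusElement x ∙ˢ w) ▹ b s) i ∎

    character-symmetric : ∀ x → character V (actᵗ σ x) ≈ character V x
    character-symmetric x = begin
      trace R′ ≈⟨ trace-cong (λ i j → trans (sym (1ᴹ-▹ (λ k → R′ k j) i)) (*ᴹ-cong {B = R′} (λ k l → sym (W³W k l)) (λ _ _ → refl) i j)) ⟩
      trace ((W³ *ᴹ W) *ᴹ R′) ≈⟨ trace-cong (*ᴹ-assoc W³ W R′) ⟩
      trace (W³ *ᴹ (W *ᴹ R′)) ≈⟨ trace-cong (*ᴹ-cong {A = W³} (λ _ _ → refl) conj) ⟩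
      trace (W³ *ᴹ (R *ᴹ W)) ≈⟨ trace-cong (λ i j → sym (*ᴹ-assoc W³ R W i j)) ⟩
      trace ((W³ *ᴹ R) *ᴹ W) ≈⟨ trace-comm (W³ *ᴹ R) W ⟩
      trace (W *ᴹ (W³ *ᴹ R)) ≈⟨ trace-cong (λ i j → sym (*ᴹ-assoc W W³ R i j)) ⟩
      trace ((W *ᴹ W³) *ᴹ R) ≈⟨ trace-cong (λ i j → trans (*ᴹ-cong {B = R} WW³ (λ _ _ → refl) i j) (1ᴹ-▹ (λ k → R k j) i)) ⟩
      trace R ∎
      where
      R R′ W W³ : Matrix n
      R = ρ (torusElement x)
      R′ = ρ (torusElement (actᵗ σ x))
      W = ρ w
      W³ = ρ (w ∙ˢ (w ∙ˢ w))
      WW³ : W *ᴹ W³ ≈ᴹ 1ᴹ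
      WW³ i j = trans (sym (ρ-∙ w (w ∙ˢ (w ∙ˢ w)) i j)) (trans (ρ-cong {x = w ∙ˢ (w ∙ˢ (w ∙ˢ w))} {y = 1ˢ}
        (λ k l → trans (sym (*ᴹ-assoc wMatrix wMatrix (matrix (w ∙ˢ w)) k l)) (w⁴ k l)) i j) (ρ-1 i j))
      W³W : W³ *ᴹ W ≈ᴹ 1ᴹ
      W³W i j = trans (sym (ρ-∙ (w ∙ˢ (w ∙ˢ w)) w i j)) (trans (ρ-cong {x = (w ∙ˢ (w ∙ˢ w)) ∙ˢ w} {y = 1ˢ}
        (λ k l → trans (*ᴹ-assoc wMatrix (matrix (w ∙ˢ w)) wMatrix k l) (trans (*ᴹ-cong {A = wMatrix} (λ _ _ → refl) (*ᴹ-assoc wMatrix wMatrix wMatrix) k l)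
          (trans (sym (*ᴹ-assoc wMatrix wMatrix (matrix (w ∙ˢ w)) k l)) (w⁴ k l)))) i j) (ρ-1 i j))
      conj : W *ᴹ R′ ≈ᴹ R *ᴹ W
      conj i j = trans (sym (ρ-∙ w (torusElement (actᵗ σ x)) i j)) (trans (ρ-cong {x = w ∙ˢ torusElement (actᵗ σ x)} {y = torusElement x ∙ˢ w} (conjugate x) i j) (ρ-∙ (torusElement x) w i j))

  weightᵉ : ∀ {m} → Partition m → Exponent m
  weightᵉ μ a = + Partition.part μ a

  irreducible-expansion : ∀ {m} (μ : Partition m) χ → IsIrreducibleCharacter μ χ → Expansion (weightᵉ μ) χ
  irreducible-expansion {m} μ χ irr = record
    { lower     = lowerTerms
    ; lower-≺   = lowerTerms-≺
    ; value     = λ x → trans (I.isCharacter x) (character-expansion x)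
    ; constant  = proj₁ eigen
    ; eigen     = proj₂ eigen
    ; symmetric = λ σ x → trans (I.isCharacter (actᵗ σ x)) (trans (character-symmetric I.representation σ x) (sym (I.isCharacter x)))
    }
    where
    module I = IsIrreducibleCharacter irr
    open HighestWeightModule.HighestWeight K F I.representation I.irreducible μ I.highestWeight
    eigen = Casimir.expansion-eigen K F I.representation I.irreducible μ I.highestWeight

infixl 6 _↓ _↑
_↓ _↑ : ℤ → ℤ
p ↓ = p ℤ.+ -[1+ 0 ]
p ↑ = p ℤ.+ + 1

-- Dual Jacobi-Trudi determinants as eigenfunctions

module DualJacobiTrudi (K : CommutativeRing 0ℓ 0ℓ) where
  open CommutativeRing K hiding (zero)
  open Arithmetic K
  open SetoidReasoning setoid

  -- Laurent polynomials in an auxiliary variable y, as functions of the exponent.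
  Seq : Set
  Seq = ℤ → Carrier

  -- Multiplication by y + y⁻¹ and by y - y⁻¹.
  Y Z : Seq → Seq
  Y u p = u (p ↓) + u (p ↑)
  Z u p = u (p ↓) - u (p ↑)

  private
    down-up : ∀ p → (p ↓) ↑ ≡ p
    down-up p = ≡.trans (ℤ.+-assoc p -[1+ 0 ] (+ 1)) (ℤ.+-identityʳ p)

    up-down : ∀ p → (p ↑) ↓ ≡ p
    up-down p = ≡.trans (ℤ.+-assoc p (+ 1) -[1+ 0 ]) (ℤ.+-identityʳ p)

    at : ∀ (u : Seq) {p q} → p ≡ q → u p ≈ u q
    at u e = reflexive (≡.cong u e)

  Y-cong : ∀ {u w : Seq} → (∀ p → u p ≈ w p) → ∀ p → Y u p ≈ Y w p
  Y-cong h p = +-cong (h _) (h _)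

  Z-cong : ∀ {u w : Seq} → (∀ p → u p ≈ w p) → ∀ p → Z u p ≈ Z w p
  Z-cong h p = +-cong (h _) (-‿cong (h _))

  ZY≈YZ : ∀ u p → Z (Y u) p ≈ Y (Z u) p
  ZY≈YZ u p = trans (+-cong (+-congˡ (at u (down-up p))) (-‿cong (+-congʳ (at u (up-down p)))))
    (trans (solve 3 (λ a b c → (a :+ b) :- (b :+ c) := (a :- b) :+ (b :- c)) refl (u (p ↓ ↓)) (u p) (u (p ↑ ↑)))
    (sym (+-cong (+-congˡ (-‿cong (at u (down-up p)))) (+-congʳ (at u (up-down p))))))

  Y²≈Z²+4 : ∀ u p → Y (Y u) p ≈ Z (Z u) p + ι (+ 4) * u p
  Y²≈Z²+4 u p = trans (+-cong (+-congˡ (at u (down-up p))) (+-congʳ (at u (up-down p))))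
    (trans (solve 3 (λ a b c → (a :+ b) :+ (b :+ c) := ((a :- b) :- (b :- c)) :+ con (+ 4) :* b) refl (u (p ↓ ↓)) (u p) (u (p ↑ ↑)))
    (+-congʳ (sym (+-cong (+-congˡ (-‿cong (at u (down-up p)))) (-‿cong (+-congʳ (at u (up-down p))))))))

  δ₀ : Seq
  δ₀ +0       = 1#
  δ₀ ℤ.+[1+ n ] = 0#
  δ₀ -[1+ n ] = 0#

  -- The coefficients of ∏ (X_i + y + y⁻¹) and of its partial derivatives.
  e : ∀ {m} → (Fin m → Carrier) → Seq
  e {zero}  X p = δ₀ p
  e {suc m} X p = X zero * e (X ∘ suc) p + Y (e (X ∘ suc)) p

  d : ∀ {m} → Fin m → (Fin m → Carrier) → Seq
  d zero    X p = e (X ∘ suc) p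
  d (suc a) X p = X zero * d a (X ∘ suc) p + Y (d a (X ∘ suc)) p

  d-factor : ∀ {m} (a : Fin m) X p → X a * d a X p + Y (d a X) p ≈ e X p
  d-factor zero    X p = refl
  d-factor (suc a) X p = begin
    X (suc a) * (X zero * D p + Y D p) + ((X zero * D p⁻ + Y D p⁻) + (X zero * D p⁺ + Y D p⁺))
      ≈⟨ solve 7 (λ xa x0 d0 d- d+ yd- yd+ → xa :* (x0 :* d0 :+ (d- :+ d+)) :+ ((x0 :* d- :+ yd-) :+ (x0 :* d+ :+ yd+)) :=
           x0 :* (xa :* d0 :+ (d- :+ d+)) :+ ((xa :* d- :+ yd-) :+ (xa :* d+ :+ yd+))) refl (X (suc a)) (X zero) (D p) (D p⁻) (D p⁺) (Y D p⁻) (Y D p⁺) ⟩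
    X zero * (X (suc a) * D p + Y D p) + ((X (suc a) * D p⁻ + Y D p⁻) + (X (suc a) * D p⁺ + Y D p⁺))
      ≈⟨ +-cong (*-congˡ (d-factor a (X ∘ suc) p)) (+-cong (d-factor a (X ∘ suc) p⁻) (d-factor a (X ∘ suc) p⁺)) ⟩
    e X p ∎
    where
    D = d a (X ∘ suc)
    p⁻ = p ↓
    p⁺ = p ↑

  private
    ι⁻ : ∀ p → ι (p ↓) ≈ ι p - 1#
    ι⁻ p = ι-+ p -[1+ 0 ]

    ι⁺ : ∀ p → ι (p ↑) ≈ ι p + 1#
    ι⁺ p = ι-+ p (+ 1)

  -- y d/dy ∏ (X_i + y + y⁻¹) = Σ_a (y - y⁻¹) ∏_{i≠a} (X_i + y + y⁻¹)
  Θe : ∀ {m} (X : Fin m → Carrier) p → sum (λ a → Z (d a X) p) ≈ ι p * e X p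
  Θe {zero}  X +0         = sym (zeroˡ _)
  Θe {zero}  X ℤ.+[1+ n ] = sym (zeroʳ _)
  Θe {zero}  X -[1+ n ]   = sym (zeroʳ _)
  Θe {suc m} X p = begin
    Z e′ p + sum (λ a → (X zero * D a p⁻ + Y (D a) p⁻) - (X zero * D a p⁺ + Y (D a) p⁺))
      ≈⟨ +-congˡ (sum-cong λ a → trans (solve 5 (λ x a b c d → (x :* a :+ b) :- (x :* c :+ d) := x :* (a :- c) :+ (b :- d)) refl (X zero) (D a p⁻) (Y (D a) p⁻) (D a p⁺) (Y (D a) p⁺)) (+-congˡ (ZY≈YZ (D a) p))) ⟩
    Z e′ p + sum (λ a → X zero * Z (D a) p + (Z (D a) p⁻ + Z (D a) p⁺))
      ≈⟨ +-congˡ (trans (∑-distrib-+ (λ a → X zero * Z (D a) p) (λ a → Z (D a) p⁻ + Z (D a) p⁺)) (+-cong (sym (*-distribˡ-sum (X zero) (λ a → Z (D a) p))) (∑-distrib-+ (λ a → Z (D a) p⁻) (λ a → Z (D a) p⁺)))) ⟩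
    Z e′ p + (X zero * sum (λ a → Z (D a) p) + (sum (λ a → Z (D a) p⁻) + sum (λ a → Z (D a) p⁺)))
      ≈⟨ +-congˡ (+-cong (*-congˡ (Θe (X ∘ suc) p)) (+-cong (trans (Θe (X ∘ suc) p⁻) (*-congʳ (ι⁻ p))) (trans (Θe (X ∘ suc) p⁺) (*-congʳ (ι⁺ p))))) ⟩
    (e′ p⁻ - e′ p⁺) + (X zero * (ι p * e′ p) + ((ι p - 1#) * e′ p⁻ + (ι p + 1#) * e′ p⁺))
      ≈⟨ solve 5 (λ x P a b c → (b :- c) :+ (x :* (P :* a) :+ ((P :- :1) :* b :+ (P :+ :1) :* c)) := P :* (x :* a :+ (b :+ c))) refl (X zero) (ι p) (e′ p) (e′ p⁻) (e′ p⁺) ⟩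
    ι p * e X p ∎
    where
    e′ = e (X ∘ suc)
    D : Fin m → Seq
    D a = d a (X ∘ suc)
    p⁻ = p ↓
    p⁺ = p ↑

  ΘE : ∀ {m} → (Fin m → Carrier) → Seq
  ΘE X p = ι p * e X p

  -- The part of `Regular` about pairs of coordinates, for arbitrary `X`, so that it passes to the
  -- tail in an induction on the number of variables.
  record Separated {m} (X : Fin m → Carrier) (r : Fin m → Fin m → Carrier) : Set where
    field
      r-inv     : ∀ a c → a ≢ c → (X a - X c) * r a c ≈ 1#
      r-antisym : ∀ a c → r c a ≈ - r a c
      r-diag    : ∀ a → r a a ≈ 0#

  private
    Separated-tail : ∀ {m} {X : Fin (suc m) → Carrier} {r} → Separated X r → Separated (X ∘ suc) (λ a c → r (suc a) (suc c))
    Separated-tail S = record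
      { r-inv = λ a c p → r-inv (suc a) (suc c) (p ∘ Fin.suc-injective) ; r-antisym = λ a c → r-antisym (suc a) (suc c) ; r-diag = r-diag ∘ suc }
      where open Separated S

  A T : ∀ {m} (X : Fin m → Carrier) (r : Fin m → Fin m → Carrier) → Seq
  A X r p = sum λ a → X a * d a X p
  T X r p = sum λ a → sum λ c → (X a * X a - ι (+ 4)) * r a c * d a X p

  -- The radial operator applied to ∏ (X_i + y + y⁻¹).
  L : ∀ {m} (X : Fin m → Carrier) (r : Fin m → Fin m → Carrier) → Seq
  L X r p = ι (+ 3) * A X r p + 2# * T X r p

  private
    module Step {m} (X : Fin (suc m) → Carrier) (r : Fin (suc m) → Fin (suc m) → Carrier) (S : Separated X r) where
      open Separated S
      X′ : Fin m → Carrier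
      X′ = X ∘ suc
      r′ : Fin m → Fin m → Carrier
      r′ a c = r (suc a) (suc c)
      e′ : Seq
      e′ = e X′

      A-suc : ∀ p → A X r p ≈ X zero * e′ p + (X zero * A X′ r′ p + Y (A X′ r′) p)
      A-suc p = +-congˡ (begin
        sum (λ a → X′ a * (X zero * d a X′ p + Y (d a X′) p))
          ≈⟨ sum-cong (λ a → solve 5 (λ xa x0 u v w → xa :* (x0 :* u :+ (v :+ w)) := x0 :* (xa :* u) :+ (xa :* v :+ xa :* w)) refl (X′ a) (X zero) (d a X′ p) (d a X′ (p ↓)) (d a X′ (p ↑))) ⟩
        sum (λ a → X zero * (X′ a * d a X′ p) + (X′ a * d a X′ (p ↓) + X′ a * d a X′ (p ↑)))
          ≈⟨ trans (∑-distrib-+ (λ a → X zero * (X′ a * d a X′ p)) _) (+-cong (sym (*-distribˡ-sum (X zero) (λ a → X′ a * d a X′ p))) (∑-distrib-+ (λ a → X′ a * d a X′ (p ↓)) (λ a → X′ a * d a X′ (p ↑)))) ⟩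
        X zero * A X′ r′ p + Y (A X′ r′) p ∎)

      -- With x and y the two variables, (x² - 4)(y + Y) - (y² - 4)(x + Y) is divisible by x - y,
      -- which cancels `r`. What remains is the full product up to Z², because Y² = Z² + 4.
      cross : ∀ p a → (X zero * X zero - ι (+ 4)) * r zero (suc a) * e′ p + (X′ a * X′ a - ι (+ 4)) * r (suc a) zero * d (suc a) X p
              ≈ e X p - Z (Z (d a X′)) p
      cross p a = begin
        (X zero * X zero - ι (+ 4)) * r zero (suc a) * e′ p + (X′ a * X′ a - ι (+ 4)) * r (suc a) zero * (X zero * D p + Y D p)
          ≈⟨ +-cong (*-congˡ (sym (d-factor a X′ p))) (*-congʳ (*-congˡ (r-antisym zero (suc a)))) ⟩
        (X zero * X zero - ι (+ 4)) * r zero (suc a) * (X′ a * D p + Y D p) + (X′ a * X′ a - ι (+ 4)) * - r zero (suc a) * (X zero * D p + Y D p)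
          ≈⟨ solve 5 (λ x y r u v → (x :* x :- con (+ 4)) :* r :* (y :* u :+ v) :+ (y :* y :- con (+ 4)) :* (:- r) :* (x :* u :+ v) :=
               (x :- y) :* r :* ((x :* (y :* u :+ v) :+ y :* v) :+ con (+ 4) :* u)) refl (X zero) (X′ a) (r zero (suc a)) (D p) (Y D p) ⟩
        (X zero - X′ a) * r zero (suc a) * ((X zero * (X′ a * D p + Y D p) + X′ a * Y D p) + ι (+ 4) * D p)
          ≈⟨ trans (*-congʳ (r-inv zero (suc a) λ ())) (*-identityˡ _) ⟩
        (X zero * (X′ a * D p + Y D p) + X′ a * Y D p) + ι (+ 4) * D p
          ≈⟨ solve 4 (λ f g q z → (f :+ g) :+ q := (f :+ (g :+ (z :+ q))) :- z) refl (X zero * (X′ a * D p + Y D p)) (X′ a * Y D p) (ι (+ 4) * D p) (Z (Z D) p) ⟩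
        (X zero * (X′ a * D p + Y D p) + (X′ a * Y D p + (Z (Z D) p + ι (+ 4) * D p))) - Z (Z D) p
          ≈⟨ +-congʳ (+-cong (*-congˡ (d-factor a X′ p)) (+-congˡ (sym (Y²≈Z²+4 D p)))) ⟩
        (X zero * e′ p + (X′ a * (D p⁻ + D p⁺) + (Y D p⁻ + Y D p⁺))) - Z (Z D) p
          ≈⟨ +-congʳ (+-congˡ (solve 5 (λ x a b c d → x :* (a :+ b) :+ (c :+ d) := (x :* a :+ c) :+ (x :* b :+ d)) refl (X′ a) (D p⁻) (D p⁺) (Y D p⁻) (Y D p⁺))) ⟩
        (X zero * e′ p + ((X′ a * D p⁻ + Y D p⁻) + (X′ a * D p⁺ + Y D p⁺))) - Z (Z D) p
          ≈⟨ +-congʳ (+-congˡ (+-cong (d-factor a X′ p⁻) (d-factor a X′ p⁺))) ⟩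
        e X p - Z (Z D) p ∎
        where
        D = d a X′
        p⁻ = p ↓
        p⁺ = p ↑

      T-suc : ∀ p → T X r p ≈ (X zero * T X′ r′ p + Y (T X′ r′) p) + (ι (+ m) * e X p - Z (ΘE X′) p)
      T-suc p = begin
        (k zero * r zero zero * e′ p + sum (λ c → k zero * r zero (suc c) * e′ p)) + sum (λ a → k (suc a) * r (suc a) zero * d (suc a) X p + sum (λ c → k (suc a) * r′ a c * d (suc a) X p))
          ≈⟨ +-cong (trans (+-congʳ (trans (*-congʳ (trans (*-congˡ (r-diag zero)) (zeroʳ _))) (zeroˡ _))) (+-identityˡ _)) (∑-distrib-+ (λ a → k (suc a) * r (suc a) zero * d (suc a) X p) (λ a → sum (λ c → k (suc a) * r′ a c * d (suc a) X p))) ⟩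
        sum (λ c → k zero * r zero (suc c) * e′ p) + (sum (λ a → k (suc a) * r (suc a) zero * d (suc a) X p) + sum (λ a → sum (λ c → k (suc a) * r′ a c * d (suc a) X p)))
          ≈⟨ trans (solve 3 (λ p q r → p :+ (q :+ r) := r :+ (p :+ q)) refl _ _ _) (+-cong double (sym (∑-distrib-+ (λ c → k zero * r zero (suc c) * e′ p) (λ a → k (suc a) * r (suc a) zero * d (suc a) X p)))) ⟩
        (X zero * T X′ r′ p + Y (T X′ r′) p) + sum (λ a → k zero * r zero (suc a) * e′ p + k (suc a) * r (suc a) zero * d (suc a) X p)
          ≈⟨ +-congˡ (trans (sum-cong (cross p)) (trans (∑-distrib-+ (λ (_ : Fin m) → e X p) (λ a → - Z (Z (d a X′)) p)) (+-cong (sum-constant m (e X p)) (trans (sum-neg (λ a → Z (Z (d a X′)) p)) (-‿cong ZZ))))) ⟩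
        (X zero * T X′ r′ p + Y (T X′ r′) p) + (ι (+ m) * e X p - Z (ΘE X′) p) ∎
        where
        k : Fin (suc m) → Carrier
        k a = X a * X a - ι (+ 4)
        ZZ : sum (λ a → Z (Z (d a X′)) p) ≈ Z (ΘE X′) p
        ZZ = trans (∑-distrib-+ (λ a → Z (d a X′) (p ↓)) (λ a → - Z (d a X′) (p ↑))) (+-cong (Θe X′ _) (trans (sum-neg (λ a → Z (d a X′) (p ↑))) (-‿cong (Θe X′ _))))
        t : Fin m → Fin m → Seq
        t a c q = k (suc a) * r′ a c * d a X′ q
        double : sum (λ a → sum (λ c → k (suc a) * r′ a c * d (suc a) X p)) ≈ X zero * T X′ r′ p + Y (T X′ r′) p
        double = begin
          sum (λ a → sum (λ c → k (suc a) * r′ a c * (X zero * d a X′ p + Y (d a X′) p)))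
            ≈⟨ sum-cong (λ a → trans (sum-cong λ c → solve 5 (λ k x u v w → k :* (x :* u :+ (v :+ w)) := x :* (k :* u) :+ (k :* v :+ k :* w)) refl (k (suc a) * r′ a c) (X zero) (d a X′ p) (d a X′ (p ↓)) (d a X′ (p ↑)))
                 (trans (∑-distrib-+ (λ c → X zero * t a c p) (λ c → t a c (p ↓) + t a c (p ↑))) (+-cong (sym (*-distribˡ-sum (X zero) (λ c → t a c p))) (∑-distrib-+ (λ c → t a c (p ↓)) (λ c → t a c (p ↑)))))) ⟩
          sum (λ a → X zero * sum (λ c → t a c p) + (sum (λ c → t a c (p ↓)) + sum (λ c → t a c (p ↑))))
            ≈⟨ trans (∑-distrib-+ (λ a → X zero * sum (λ c → t a c p)) (λ a → sum (λ c → t a c (p ↓)) + sum (λ c → t a c (p ↑)))) (+-cong (sym (*-distribˡ-sum (X zero) (λ a → sum λ c → t a c p))) (∑-distrib-+ (λ a → sum λ c → t a c (p ↓)) (λ a → sum λ c → t a c (p ↑)))) ⟩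
          X zero * T X′ r′ p + Y (T X′ r′) p ∎

      L-suc : ∀ p → L X r p ≈ (X zero * L X′ r′ p + Y (L X′ r′) p) + (ι (+ 3) * (X zero * e′ p) + 2# * (ι (+ m) * e X p - Z (ΘE X′) p))
      L-suc p = trans (+-cong (*-congˡ (A-suc p)) (*-congˡ (T-suc p)))
        (solve 9 (λ x0 xe a a- a+ t t- t+ s → con (+ 3) :* (xe :+ (x0 :* a :+ (a- :+ a+))) :+ :2 :* ((x0 :* t :+ (t- :+ t+)) :+ s) :=
          (x0 :* (con (+ 3) :* a :+ :2 :* t) :+ ((con (+ 3) :* a- :+ :2 :* t-) :+ (con (+ 3) :* a+ :+ :2 :* t+))) :+ (con (+ 3) :* xe :+ :2 :* s)) refl
          (X zero) (X zero * e′ p) (A X′ r′ p) (A X′ r′ (p ↓)) (A X′ r′ (p ↑)) (T X′ r′ p) (T X′ r′ (p ↓)) (T X′ r′ (p ↑)) (ι (+ m) * e X p - Z (ΘE X′) p))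

  -- L applied to (y - y⁻¹) ∏ (X_i + y + y⁻¹) is (m+1)² - (y d/dy)².
  Z-L : ∀ {m} (X : Fin m → Carrier) r → Separated X r → ∀ p → Z (L X r) p ≈ (ι (+ suc m) * ι (+ suc m) - ι p * ι p) * Z (e X) p
  Z-L {zero} X r S p = begin
    Z (L X r) p ≈⟨ solve 0 (((con (+ 3) :* :0) :+ :2 :* :0) :- ((con (+ 3) :* :0) :+ :2 :* :0) := :0) refl ⟩
    0# ≈⟨ base p ⟨
    (1# * 1# - ι p * ι p) * Z δ₀ p ∎
    where
    base : ∀ p → (1# * 1# - ι p * ι p) * Z δ₀ p ≈ 0#
    base +0                   = solve 0 ((:1 :* :1 :- :0 :* :0) :* (:0 :- :0) := :0) refl
    base ℤ.+[1+ zero ]        = solve 0 ((:1 :* :1 :- :1 :* :1) :* (:1 :- :0) := :0) refl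
    base ℤ.+[1+ suc n ]       = trans (*-congˡ (-‿inverseʳ 0#)) (zeroʳ _)
    base -[1+ zero ]          = solve 0 ((:1 :* :1 :- con -[1+ 0 ] :* con -[1+ 0 ]) :* (:0 :- :1) := :0) refl
    base -[1+ suc n ]         = trans (*-congˡ (-‿inverseʳ 0#)) (zeroʳ _)
  Z-L {suc m} X r S p = begin
    L X r p⁻ - L X r p⁺
      ≈⟨ +-cong (Step.L-suc X r S p⁻) (-‿cong (Step.L-suc X r S p⁺)) ⟩
    ((X zero * L′ p⁻ + Y L′ p⁻) + (ι (+ 3) * (X zero * e′ p⁻) + 2# * (ι (+ m) * e X p⁻ - Z (ΘE X′) p⁻))) - ((X zero * L′ p⁺ + Y L′ p⁺) + (ι (+ 3) * (X zero * e′ p⁺) + 2# * (ι (+ m) * e X p⁺ - Z (ΘE X′) p⁺)))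
      ≈⟨ solve 12 (λ x a b c d n e f g h i j → ((x :* a :+ b) :+ (con (+ 3) :* (x :* c) :+ :2 :* (n :* e :- f))) :- ((x :* d :+ g) :+ (con (+ 3) :* (x :* h) :+ :2 :* (n :* i :- j))) :=
           (x :* (a :- d) :+ (b :- g)) :+ (con (+ 3) :* (x :* (c :- h)) :+ :2 :* (n :* (e :- i) :- (f :- j)))) refl
           (X zero) (L′ p⁻) (Y L′ p⁻) (e′ p⁻) (L′ p⁺) (ι (+ m)) (e X p⁻) (Z (ΘE X′) p⁻) (Y L′ p⁺) (e′ p⁺) (e X p⁺) (Z (ΘE X′) p⁺) ⟩
    (X zero * Z L′ p + Z (Y L′) p) + (ι (+ 3) * (X zero * Z e′ p) + 2# * (ι (+ m) * Z (e X) p - Z (Z (ΘE X′)) p))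
      ≈⟨ +-cong (+-cong (*-congˡ (ih p)) (trans (ZY≈YZ L′ p) (+-cong (trans (ih p⁻) (*-congʳ (+-congˡ (-‿cong (*-cong (ι⁻ p) (ι⁻ p)))))) (trans (ih p⁺) (*-congʳ (+-congˡ (-‿cong (*-cong (ι⁺ p) (ι⁺ p))))))))) refl ⟩
    (X zero * ((M * M - P * P) * Z e′ p) + ((M * M - (P - 1#) * (P - 1#)) * Z e′ p⁻ + (M * M - (P + 1#) * (P + 1#)) * Z e′ p⁺)) + (ι (+ 3) * (X zero * Z e′ p) + 2# * (ι (+ m) * Z (e X) p - Z (Z (ΘE X′)) p))
      ≈⟨ +-cong (+-congˡ (+-cong (*-congˡ zed⁻) (*-congˡ zed⁺))) (+-congˡ (*-congˡ (+-cong (*-congˡ Zee) (-‿cong ZZΘ)))) ⟩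
    (X zero * ((M * M - P * P) * (e₋ - e₊)) + ((M * M - (P - 1#) * (P - 1#)) * (e₋₋ - e₀) + (M * M - (P + 1#) * (P + 1#)) * (e₀ - e₊₊))) +
      (ι (+ 3) * (X zero * (e₋ - e₊)) + 2# * (ι (+ m) * ((X zero * e₋ + (e₋₋ + e₀)) - (X zero * e₊ + (e₀ + e₊₊))) - (((P - 1# - 1#) * e₋₋ - P * e₀) - (P * e₀ - (P + 1# + 1#) * e₊₊))))
      ≈⟨ +-congʳ (+-cong (*-congˡ (*-congʳ (+-congʳ (*-cong M≈ M≈)))) (+-cong (*-congʳ (+-congʳ (*-cong M≈ M≈))) (*-congʳ (+-congʳ (*-cong M≈ M≈))))) ⟩
    _ ≈⟨ solve 8 (λ x n P a b c d e → (x :* (((:1 :+ n) :* (:1 :+ n) :- P :* P) :* (b :- d)) :+ (((:1 :+ n) :* (:1 :+ n) :- (P :- :1) :* (P :- :1)) :* (a :- c) :+ ((:1 :+ n) :* (:1 :+ n) :- (P :+ :1) :* (P :+ :1)) :* (c :- e))) :+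
           (con (+ 3) :* (x :* (b :- d)) :+ :2 :* (n :* ((x :* b :+ (a :+ c)) :- (x :* d :+ (c :+ e))) :- (((P :- :1 :- :1) :* a :- P :* c) :- (P :* c :- (P :+ :1 :+ :1) :* e)))) :=
           ((:2 :+ n) :* (:2 :+ n) :- P :* P) :* ((x :* b :+ (a :+ c)) :- (x :* d :+ (c :+ e)))) refl (X zero) (ι (+ m)) P e₋₋ e₋ e₀ e₊ e₊₊ ⟩
    ((2# + ι (+ m)) * (2# + ι (+ m)) - P * P) * ((X zero * e₋ + (e₋₋ + e₀)) - (X zero * e₊ + (e₀ + e₊₊)))
      ≈⟨ *-cong (+-congʳ (*-cong (sym (ι-+ (+ 2) (+ m))) (sym (ι-+ (+ 2) (+ m))))) (sym Zee) ⟩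
    (ι (+ suc (suc m)) * ι (+ suc (suc m)) - P * P) * Z (e X) p ∎
    where
    X′ = X ∘ suc
    r′ : Fin m → Fin m → Carrier
    r′ a c = r (suc a) (suc c)
    e′ = e X′
    L′ = L X′ r′
    p⁻ = p ↓
    p⁺ = p ↑
    P = ι p
    M = ι (+ suc m)
    e₋₋ = e′ (p⁻ ↓)
    e₋ = e′ p⁻
    e₀ = e′ p
    e₊ = e′ p⁺
    e₊₊ = e′ (p⁺ ↑)
    ih : ∀ q → Z L′ q ≈ (M * M - ι q * ι q) * Z e′ q
    ih = Z-L X′ r′ (Separated-tail S)
    M≈ : M ≈ 1# + ι (+ m)
    M≈ = ι-+ (+ 1) (+ m)
    zed⁻ : Z e′ p⁻ ≈ e₋₋ - e₀
    zed⁻ = +-congˡ (-‿cong (at e′ (down-up p)))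
    zed⁺ : Z e′ p⁺ ≈ e₀ - e₊₊
    zed⁺ = +-congʳ (at e′ (up-down p))
    Zee : Z (e X) p ≈ (X zero * e₋ + (e₋₋ + e₀)) - (X zero * e₊ + (e₀ + e₊₊))
    Zee = +-cong (+-congˡ (+-congˡ (at e′ (down-up p)))) (-‿cong (+-congˡ (+-congʳ (at e′ (up-down p)))))
    ZZΘ : Z (Z (ΘE X′)) p ≈ ((P - 1# - 1#) * e₋₋ - P * e₀) - (P * e₀ - (P + 1# + 1#) * e₊₊)
    ZZΘ = +-cong (+-cong (*-congʳ (trans (ι⁻ p⁻) (+-congʳ (ι⁻ p)))) (-‿cong (at (ΘE X′) (down-up p)))) (-‿cong (+-cong (at (ΘE X′) (up-down p)) (-‿cong (*-congʳ (trans (ι⁺ p⁺) (+-congʳ (ι⁺ p)))))))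

  -- The one-variable kernel identity; D plays the role of G / (X + y + y⁻¹).
  kernel : ∀ X (D G : Seq) → (∀ p → X * D p + Y D p ≈ G p) → ∀ p q →
    (X * X - ι (+ 4)) * (Y D p * D q - D p * Y D q) ≈ (Y G p * G q - G p * Y G q) - Z (Z D) p * G q + G p * Z (Z D) q
  kernel X D G h p q = begin
    (X * X - ι (+ 4)) * (u₁ * v₀ - u₀ * v₁)
      ≈⟨ solve 7 (λ X u₀ u₁ v₀ v₁ s t → (X :* X :- con (+ 4)) :* (u₁ :* v₀ :- u₀ :* v₁) :=
           ((X :* u₁ :+ (s :+ con (+ 4) :* u₀)) :* (X :* v₀ :+ v₁) :- (X :* u₀ :+ u₁) :* (X :* v₁ :+ (t :+ con (+ 4) :* v₀))) :- s :* (X :* v₀ :+ v₁) :+ (X :* u₀ :+ u₁) :* t)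
           refl X u₀ u₁ v₀ v₁ (Z (Z D) p) (Z (Z D) q) ⟩
    ((X * u₁ + (Z (Z D) p + ι (+ 4) * u₀)) * (X * v₀ + v₁) - (X * u₀ + u₁) * (X * v₁ + (Z (Z D) q + ι (+ 4) * v₀))) - Z (Z D) p * (X * v₀ + v₁) + (X * u₀ + u₁) * Z (Z D) q
      ≈⟨ +-cong (+-cong (+-cong (*-cong (YG p) (h q)) (-‿cong (*-cong (h p) (YG q)))) (-‿cong (*-congˡ (h q)))) (*-congʳ (h p)) ⟩
    (Y G p * G q - G p * Y G q) - Z (Z D) p * G q + G p * Z (Z D) q ∎
    where
    u₀ = D p
    u₁ = Y D p
    v₀ = D q
    v₁ = Y D q
    YG : ∀ p → X * Y D p + (Z (Z D) p + ι (+ 4) * D p) ≈ Y G p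
    YG p = trans (+-congˡ (sym (Y²≈Z²+4 D p))) (trans (solve 5 (λ x a b c d → x :* (a :+ b) :+ (c :+ d) := (x :* a :+ c) :+ (x :* b :+ d)) refl X (D (p ↓)) (D (p ↑)) (Y D (p ↓)) (Y D (p ↑)))
      (+-cong (h _) (h _)))

  g : ∀ {m} → (Fin m → Carrier) → Seq
  g X = Z (e X)

  -- The dual Jacobi–Trudi determinant.
  f : ∀ {m} → (Fin m → Carrier) → ℤ → ℤ → Carrier
  f X p q = Y (g X) p * g X q - g X p * Y (g X) q

  Zd-factor : ∀ {m} (a : Fin m) X p → X a * Z (d a X) p + Y (Z (d a X)) p ≈ g X p
  Zd-factor a X p = begin
    X a * Z (d a X) p + Y (Z (d a X)) p ≈⟨ +-congˡ (ZY≈YZ (d a X) p) ⟨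
    X a * Z (d a X) p + Z (Y (d a X)) p ≈⟨ solve 5 (λ x u v s t → x :* (u :- v) :+ (s :- t) := (x :* u :+ s) :- (x :* v :+ t)) refl (X a) (d a X (p ↓)) (d a X (p ↑)) (Y (d a X) (p ↓)) (Y (d a X) (p ↑)) ⟩
    (X a * d a X (p ↓) + Y (d a X) (p ↓)) - (X a * d a X (p ↑) + Y (d a X) (p ↑)) ≈⟨ +-cong (d-factor a X (p ↓)) (-‿cong (d-factor a X (p ↑))) ⟩
    g X p ∎

  sum-Z³d : ∀ {m} (X : Fin m → Carrier) p → sum (λ a → Z (Z (Z (d a X))) p) ≈ (ι p - 2#) * g X (p ↓) - (ι p + 2#) * g X (p ↑)
  sum-Z³d X p = begin
    sum (λ a → Z (Z (Z (d a X))) p)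
      ≈⟨ sum-Z (λ a → Z (Z (d a X))) p ⟩
    Z (λ q → sum λ a → Z (Z (d a X)) q) p
      ≈⟨ Z-cong (λ q → trans (sum-Z (λ a → Z (d a X)) q) (Z-cong (Θe X) q)) p ⟩
    (ι p⁻⁻ * e X p⁻⁻ - ι (p⁻ ↑) * e X (p⁻ ↑)) - (ι (p⁺ ↓) * e X (p⁺ ↓) - ι p⁺⁺ * e X p⁺⁺)
      ≈⟨ +-cong (+-cong (*-congʳ (trans (ι⁻ p⁻) (+-congʳ (ι⁻ p)))) (-‿cong (at (ΘE X) (down-up p)))) (-‿cong (+-cong (at (ΘE X) (up-down p)) (-‿cong (*-congʳ (trans (ι⁺ p⁺) (+-congʳ (ι⁺ p))))))) ⟩
    ((ι p - 1# - 1#) * e X p⁻⁻ - ι p * e X p) - (ι p * e X p - (ι p + 1# + 1#) * e X p⁺⁺)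
      ≈⟨ solve 4 (λ P a b c → ((P :- :1 :- :1) :* a :- P :* b) :- (P :* b :- (P :+ :1 :+ :1) :* c) := (P :- :2) :* (a :- b) :- (P :+ :2) :* (b :- c)) refl (ι p) (e X p⁻⁻) (e X p) (e X p⁺⁺) ⟩
    (ι p - 2#) * (e X p⁻⁻ - e X p) - (ι p + 2#) * (e X p - e X p⁺⁺)
      ≈⟨ +-cong (*-congˡ (+-congˡ (-‿cong (at (e X) (down-up p))))) (-‿cong (*-congˡ (+-congʳ (at (e X) (up-down p))))) ⟨
    (ι p - 2#) * g X p⁻ - (ι p + 2#) * g X p⁺ ∎
    where
    p⁻ = p ↓
    p⁺ = p ↑
    p⁻⁻ = p⁻ ↓
    p⁺⁺ = p⁺ ↑
    sum-Z : ∀ {m} (u : Fin m → Seq) p → sum (λ a → Z (u a) p) ≈ Z (λ q → sum λ a → u a q) p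
    sum-Z u p = trans (∑-distrib-+ (λ a → u a (p ↓)) (λ a → - u a (p ↑))) (+-congˡ (sum-neg (λ a → u a (p ↑))))

  -- Gradient term of the radial operator on the product of two generating functions.
  cross-sum : ∀ {m} (X : Fin m → Carrier) p q → sum (λ a → (X a * X a - ι (+ 4)) * (Y (Z (d a X)) p * Z (d a X) q - Z (d a X) p * Y (Z (d a X)) q)) ≈
    ι (+ m) * f X p q - ((ι p - 2#) * g X (p ↓) - (ι p + 2#) * g X (p ↑)) * g X q + g X p * ((ι q - 2#) * g X (q ↓) - (ι q + 2#) * g X (q ↑))
  cross-sum {m} X p q = begin
    sum (λ a → (X a * X a - ι (+ 4)) * (Y (Z (d a X)) p * Z (d a X) q - Z (d a X) p * Y (Z (d a X)) q))
      ≈⟨ sum-cong (λ a → kernel (X a) (Z (d a X)) (g X) (Zd-factor a X) p q) ⟩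
    sum (λ a → f X p q - Z (Z (Z (d a X))) p * g X q + g X p * Z (Z (Z (d a X))) q)
      ≈⟨ trans (∑-distrib-+ (λ a → f X p q - Z (Z (Z (d a X))) p * g X q) (λ a → g X p * Z (Z (Z (d a X))) q)) (+-cong
           (trans (∑-distrib-+ (λ (_ : Fin m) → f X p q) (λ a → - (Z (Z (Z (d a X))) p * g X q))) (+-cong (sum-constant m (f X p q)) (trans (sum-neg (λ a → Z (Z (Z (d a X))) p * g X q)) (-‿cong (trans (sym (*-distribʳ-sum (g X q) (λ a → Z (Z (Z (d a X))) p))) (*-congʳ (sum-Z³d X p)))))))
           (trans (sym (*-distribˡ-sum (g X p) (λ a → Z (Z (Z (d a X))) q))) (*-congˡ (sum-Z³d X q)))) ⟩
    _ ∎

  -- With M = m + 1, the two rows contribute M² - p² and M² - q². The shift in `Y` and the gradient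
  -- term together add 2M + 1. The value is 0 at p = M + 1, q = M, the parameters of the trivial
  -- representation.
  eigenvalueOf : ℕ → ℤ → ℤ → Carrier
  eigenvalueOf m p q = 2# * (ι (+ suc m) * ι (+ suc m)) + 2# * ι (+ suc m) + 1# - ι p * ι p - ι q * ι q

  module Lists where
    open FormalSums K
    open Powers K
    open Radial K
    open Symplectic K using (Torus; val; inv)

    cons : ∀ {m} → ℤ → Exponent m → Exponent (suc m)
    cons k ν zero    = k
    cons k ν (suc a) = ν a

    none : Exponent 0
    none ()

    -- The sequence `e` at X_a = x_a + x_a⁻¹, written as an explicit sum over exponents: dominance
    -- and the radial pairing refer to exponents and cannot be read off values.
    eL : ∀ m → ℤ → Terms (Exponent m)
    eL zero    +0       = (1# , none) ∷ []
    eL zero    ℤ.+[1+ n ] = []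
    eL zero    -[1+ n ] = []
    eL (suc m) p        = (reindex (cons (+ 1)) (eL m p) ++ reindex (cons -[1+ 0 ]) (eL m p)) ++
                          (reindex (cons +0) (eL m (p ↓)) ++ reindex (cons +0) (eL m (p ↑)))

    pair-eL-suc : ∀ m (φ : Exponent (suc m) → Carrier) p → ⟨ φ , eL (suc m) p ⟩ ≈
      (⟨ φ ∘ cons (+ 1) , eL m p ⟩ + ⟨ φ ∘ cons -[1+ 0 ] , eL m p ⟩) + (⟨ φ ∘ cons +0 , eL m (p ↓) ⟩ + ⟨ φ ∘ cons +0 , eL m (p ↑) ⟩)
    pair-eL-suc m φ p = trans (pair-++ φ (reindex (cons (+ 1)) (eL m p) ++ reindex (cons -[1+ 0 ]) (eL m p)) _)
      (+-cong (trans (pair-++ φ (reindex (cons (+ 1)) (eL m p)) _) (+-cong (pair-reindex (cons (+ 1)) φ (eL m p)) (pair-reindex (cons -[1+ 0 ]) φ (eL m p))))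
              (trans (pair-++ φ (reindex (cons +0) (eL m (p ↓))) _) (+-cong (pair-reindex (cons +0) φ (eL m (p ↓))) (pair-reindex (cons +0) φ (eL m (p ↑))))))

    private
      module _ {m} (v w : Fin (suc m) → Carrier) where
        mon′ : Exponent m → Carrier
        mon′ = monomialAt (v ∘ suc) (w ∘ suc)

        split-suc : ∀ (φ : Exponent (suc m) → Carrier) (ψ : Exponent m → Carrier) c₁ c₂ c₃ → (∀ ν → φ (cons (+ 1) ν) ≈ c₁ * ψ ν) → (∀ ν → φ (cons -[1+ 0 ] ν) ≈ c₂ * ψ ν) → (∀ ν → φ (cons +0 ν) ≈ c₃ * ψ ν) →
          ∀ p → ⟨ φ , eL (suc m) p ⟩ ≈ (c₁ + c₂) * ⟨ ψ , eL m p ⟩ + c₃ * Y (λ q → ⟨ ψ , eL m q ⟩) p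
        split-suc φ ψ c₁ c₂ c₃ h₁ h₂ h₃ p = trans (pair-eL-suc m φ p) (trans (+-cong
          (+-cong (trans (pair-cong (eL m p) h₁) (pair-* c₁ ψ (eL m p))) (trans (pair-cong (eL m p) h₂) (pair-* c₂ ψ (eL m p))))
          (+-cong (trans (pair-cong (eL m _) h₃) (pair-* c₃ ψ (eL m _))) (trans (pair-cong (eL m _) h₃) (pair-* c₃ ψ (eL m _)))))
          (solve 6 (λ a b c s t u → (a :* s :+ b :* s) :+ (c :* t :+ c :* u) := (a :+ b) :* s :+ c :* (t :+ u)) refl c₁ c₂ c₃ ⟨ ψ , eL m p ⟩ ⟨ ψ , eL m (p ↓) ⟩ ⟨ ψ , eL m (p ↑) ⟩))

      value : ∀ m (v w : Fin m → Carrier) p → ⟨ monomialAt v w , eL m p ⟩ ≈ e (λ a → v a + w a) p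
      value zero    v w +0         = trans (+-identityʳ _) (*-identityˡ 1#)
      value zero    v w ℤ.+[1+ n ] = refl
      value zero    v w -[1+ n ]   = refl
      value (suc m) v w p = trans (split-suc v w (monomialAt v w) (mon′ v w) (v zero) (w zero) 1# (λ ν → *-congʳ (*-identityʳ _)) (λ ν → *-congʳ (*-identityʳ _)) (λ ν → refl) p)
        (+-cong (*-congˡ (value m (v ∘ suc) (w ∘ suc) p)) (trans (*-identityˡ _) (Y-cong (value m (v ∘ suc) (w ∘ suc)) p)))

      gradient : ∀ m (v w : Fin m → Carrier) a p → ⟨ (λ ν → ι (ν a) * monomialAt v w ν) , eL m p ⟩ ≈ (v a - w a) * d a (λ c → v c + w c) p
      gradient (suc m) v w zero p = trans (split-suc v w (λ ν → ι (ν zero) * monomialAt v w ν) (mon′ v w) (v zero) (- w zero) 0#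
          (λ ν → solve 2 (λ x u → :1 :* (x :* :1 :* u) := x :* u) refl (v zero) (mon′ v w ν))
          (λ ν → solve 2 (λ x u → :-1 :* (x :* :1 :* u) := (:- x) :* u) refl (w zero) (mon′ v w ν)) (λ ν → trans (zeroˡ _) (sym (zeroˡ _))) p)
        (trans (+-cong (*-congˡ (value m (v ∘ suc) (w ∘ suc) p)) (zeroˡ _)) (+-identityʳ _))
      gradient (suc m) v w (suc a) p = trans (split-suc v w (λ ν → ι (ν (suc a)) * monomialAt v w ν) (λ ν → ι (ν a) * mon′ v w ν) (v zero) (w zero) 1#
          (λ ν → solve 3 (λ i x u → i :* (x :* :1 :* u) := x :* (i :* u)) refl (ι (ν a)) (v zero) (mon′ v w ν))
          (λ ν → solve 3 (λ i x u → i :* (x :* :1 :* u) := x :* (i :* u)) refl (ι (ν a)) (w zero) (mon′ v w ν))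
          (λ ν → solve 2 (λ i u → i :* (:1 :* u) := :1 :* (i :* u)) refl (ι (ν a)) (mon′ v w ν)) p)
        (trans (+-cong (*-congˡ (gradient m (v ∘ suc) (w ∘ suc) a p)) (trans (*-identityˡ _) (Y-cong (gradient m (v ∘ suc) (w ∘ suc) a) p)))
          (solve 5 (λ s k u t r → s :* (k :* u) :+ (k :* t :+ k :* r) := k :* (s :* u :+ (t :+ r))) refl _ _ _ _ _))

      -- Each X_a enters linearly, and the square of the Euler operator fixes x_a + x_a⁻¹.
      hessian : ∀ m (v w : Fin m → Carrier) a p → ⟨ (λ ν → ι (ν a) * ι (ν a) * monomialAt v w ν) , eL m p ⟩ ≈ (v a + w a) * d a (λ c → v c + w c) p
      hessian (suc m) v w zero p = trans (split-suc v w (λ ν → ι (ν zero) * ι (ν zero) * monomialAt v w ν) (mon′ v w) (v zero) (w zero) 0#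
          (λ ν → solve 2 (λ x u → :1 :* :1 :* (x :* :1 :* u) := x :* u) refl (v zero) (mon′ v w ν))
          (λ ν → solve 2 (λ x u → :-1 :* :-1 :* (x :* :1 :* u) := x :* u) refl (w zero) (mon′ v w ν)) (λ ν → trans (*-congʳ (zeroˡ 0#)) (trans (zeroˡ _) (sym (zeroˡ _)))) p)
        (trans (+-cong (*-congˡ (value m (v ∘ suc) (w ∘ suc) p)) (zeroˡ _)) (+-identityʳ _))
      hessian (suc m) v w (suc a) p = trans (split-suc v w (λ ν → ι (ν (suc a)) * ι (ν (suc a)) * monomialAt v w ν) (λ ν → ι (ν a) * ι (ν a) * mon′ v w ν) (v zero) (w zero) 1#
          (λ ν → solve 3 (λ i x u → i :* (x :* :1 :* u) := x :* (i :* u)) refl (ι (ν a) * ι (ν a)) (v zero) (mon′ v w ν))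
          (λ ν → solve 3 (λ i x u → i :* (x :* :1 :* u) := x :* (i :* u)) refl (ι (ν a) * ι (ν a)) (w zero) (mon′ v w ν))
          (λ ν → solve 2 (λ i u → i :* (:1 :* u) := :1 :* (i :* u)) refl (ι (ν a) * ι (ν a)) (mon′ v w ν)) p)
        (trans (+-cong (*-congˡ (hessian m (v ∘ suc) (w ∘ suc) a p)) (trans (*-identityˡ _) (Y-cong (hessian m (v ∘ suc) (w ∘ suc) a) p)))
          (solve 5 (λ s k u t r → s :* (k :* u) :+ (k :* t :+ k :* r) := k :* (s :* u :+ (t :+ r))) refl _ _ _ _ _))

    eL-value : ∀ {m} (x : Torus m) p → ⟨ monomial x , eL m p ⟩ ≈ e (X̂ x) p
    eL-value {m} x = value m (val x) (inv x)

    eL-θ : ∀ {m} (x : Torus m) a p → ⟨ θ x a , eL m p ⟩ ≈ Ẋ x a * d a (X̂ x) p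
    eL-θ {m} x = gradient m (val x) (inv x)

    Ẋ² : ∀ {m} (x : Torus m) a → Ẋ x a * Ẋ x a ≈ X̂ x a * X̂ x a - ι (+ 4)
    Ẋ² x a = trans (solve 2 (λ v w → (v :- w) :* (v :- w) := (v :+ w) :* (v :+ w) :- con (+ 4) :* (v :* w)) refl (val x a) (inv x a))
      (+-congˡ (-‿cong (trans (*-congˡ (Symplectic.Torus.inverse x a)) (*-identityʳ _))))

    eL-radial : ∀ {m} (x : Torus m) (R : Regular x) p → ⟨ radial R , eL m p ⟩ ≈ L (X̂ x) (Regular.r R) p
    eL-radial {m} x R p = begin
      ⟨ radial R , eL m p ⟩
        ≈⟨ pair-radial R (eL m p) ⟩
      _ ≈⟨ +-cong (sum-cong λ a → hessian m (val x) (inv x) a p) (sum-cong λ a → *-congˡ (eL-θ x a p)) ⟩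
      sum (λ a → X̂ x a * D a) + sum (λ a → drift R a * (Ẋ x a * D a))
        ≈⟨ +-congˡ (sum-cong drifted) ⟩
      sum (λ a → X̂ x a * D a) + sum (λ a → 2# * (X̂ x a * D a) + 2# * sum (λ c → (X̂ x a * X̂ x a - ι (+ 4)) * r a c * D a))
        ≈⟨ +-congˡ (trans (∑-distrib-+ (λ a → 2# * (X̂ x a * D a)) (λ a → 2# * sum (λ c → (X̂ x a * X̂ x a - ι (+ 4)) * r a c * D a))) (+-cong (sym (*-distribˡ-sum 2# (λ a → X̂ x a * D a))) (sym (*-distribˡ-sum 2# (λ a → sum (λ c → (X̂ x a * X̂ x a - ι (+ 4)) * r a c * D a)))))) ⟩
      A (X̂ x) r p + (2# * A (X̂ x) r p + 2# * T (X̂ x) r p)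
        ≈⟨ solve 2 (λ a t → a :+ (:2 :* a :+ t) := con (+ 3) :* a :+ t) refl (A (X̂ x) r p) (2# * T (X̂ x) r p) ⟩
      L (X̂ x) r p ∎
      where
      open Regular R using (s; s-inv; r)
      D : Fin m → Carrier
      D a = d a (X̂ x) p
      drifted : ∀ a → drift R a * (Ẋ x a * D a) ≈ 2# * (X̂ x a * D a) + 2# * sum (λ c → (X̂ x a * X̂ x a - ι (+ 4)) * r a c * D a)
      drifted a = begin
        (2# * (X̂ x a * s a) + sum (λ c → 2# * (Ẋ x a * r a c))) * (Ẋ x a * D a)
          ≈⟨ solve 5 (λ X s d D t → (:2 :* (X :* s) :+ t) :* (d :* D) := :2 :* ((d :* s) :* (X :* D)) :+ t :* (d :* D)) refl (X̂ x a) (s a) (Ẋ x a) (D a) (sum (λ c → 2# * (Ẋ x a * r a c))) ⟩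
        2# * ((Ẋ x a * s a) * (X̂ x a * D a)) + sum (λ c → 2# * (Ẋ x a * r a c)) * (Ẋ x a * D a)
          ≈⟨ +-cong (*-congˡ (trans (*-congʳ (s-inv a)) (*-identityˡ _))) (trans (*-distribʳ-sum (Ẋ x a * D a) (λ c → 2# * (Ẋ x a * r a c)))
               (trans (sum-cong λ c → trans (solve 3 (λ d r D → :2 :* (d :* r) :* (d :* D) := :2 :* ((d :* d) :* r :* D)) refl (Ẋ x a) (r a c) (D a)) (*-congˡ (*-congʳ (*-congʳ (Ẋ² x a)))))
                 (sym (*-distribˡ-sum 2# (λ c → (X̂ x a * X̂ x a - ι (+ 4)) * r a c * D a))))) ⟩
        2# * (X̂ x a * D a) + 2# * sum (λ c → (X̂ x a * X̂ x a - ι (+ 4)) * r a c * D a) ∎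

    regular⇒separated : ∀ {m} {x : Torus m} (R : Regular x) → Separated (X̂ x) (Regular.r R)
    regular⇒separated {x = x} R = record { r-inv = r-inv ; r-diag = r-diag ; r-antisym = r-antisym }
      where open Regular R

    private
      symbol-+ : ∀ {m} {x : Torus m} (R : Regular x) ν κ → symbol R (ν +ᵉ κ) ≈ symbol R ν + symbol R κ + 2# * sum (λ a → ι (ν a) * ι (κ a))
      symbol-+ {m} R ν κ = begin
        sum (λ a → ι (ν a ℤ.+ κ a) * ι (ν a ℤ.+ κ a)) + sum (λ a → drift R a * ι (ν a ℤ.+ κ a))
          ≈⟨ +-cong (sum-cong λ a → trans (*-cong (ι-+ (ν a) (κ a)) (ι-+ (ν a) (κ a))) (solve 2 (λ x y → (x :+ y) :* (x :+ y) := (x :* x :+ y :* y) :+ :2 :* (x :* y)) refl (ι (ν a)) (ι (κ a))))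
                    (sum-cong λ a → trans (*-congˡ (ι-+ (ν a) (κ a))) (distribˡ (drift R a) (ι (ν a)) (ι (κ a)))) ⟩
        sum (λ a → (ι (ν a) * ι (ν a) + ι (κ a) * ι (κ a)) + 2# * (ι (ν a) * ι (κ a))) + sum (λ a → drift R a * ι (ν a) + drift R a * ι (κ a))
          ≈⟨ +-cong (trans (∑-distrib-+ (λ a → ι (ν a) * ι (ν a) + ι (κ a) * ι (κ a)) (λ a → 2# * (ι (ν a) * ι (κ a)))) (+-cong (∑-distrib-+ (λ a → ι (ν a) * ι (ν a)) (λ a → ι (κ a) * ι (κ a))) (sym (*-distribˡ-sum 2# (λ a → ι (ν a) * ι (κ a))))))
                    (∑-distrib-+ (λ a → drift R a * ι (ν a)) (λ a → drift R a * ι (κ a))) ⟩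
        _ ≈⟨ solve 5 (λ a b c d e → ((a :+ b) :+ c) :+ (d :+ e) := (a :+ d) :+ (b :+ e) :+ c) refl (sum (λ a → ι (ν a) * ι (ν a))) (sum (λ a → ι (κ a) * ι (κ a))) (2# * sum (λ a → ι (ν a) * ι (κ a))) (sum (λ a → drift R a * ι (ν a))) (sum (λ a → drift R a * ι (κ a))) ⟩
        symbol R ν + symbol R κ + 2# * sum (λ a → ι (ν a) * ι (κ a)) ∎

      radial-+ : ∀ {m} {x : Torus m} (R : Regular x) ν κ → radial R (ν +ᵉ κ) ≈ (radial R ν * monomial x κ + monomial x ν * radial R κ) + 2# * sum (λ a → θ x a ν * θ x a κ)
      radial-+ {m} {x} R ν κ = begin
        symbol R (ν +ᵉ κ) * monomial x (ν +ᵉ κ)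
          ≈⟨ *-cong (symbol-+ R ν κ) (monomial-+ x ν κ) ⟩
        (symbol R ν + symbol R κ + 2# * S) * (monomial x ν * monomial x κ)
          ≈⟨ solve 5 (λ s t S u v → (s :+ t :+ :2 :* S) :* (u :* v) := (s :* u :* v :+ u :* (t :* v)) :+ :2 :* (S :* (u :* v))) refl (symbol R ν) (symbol R κ) S (monomial x ν) (monomial x κ) ⟩
        (radial R ν * monomial x κ + monomial x ν * radial R κ) + 2# * (S * (monomial x ν * monomial x κ))
          ≈⟨ +-congˡ (*-congˡ (trans (*-distribʳ-sum (monomial x ν * monomial x κ) (λ a → ι (ν a) * ι (κ a))) (sum-cong λ a → solve 4 (λ i j u v → (i :* j) :* (u :* v) := (i :* u) :* (j :* v)) refl (ι (ν a)) (ι (κ a)) (monomial x ν) (monomial x κ)))) ⟩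
        (radial R ν * monomial x κ + monomial x ν * radial R κ) + 2# * sum (λ a → θ x a ν * θ x a κ) ∎
        where S = sum (λ a → ι (ν a) * ι (κ a))

    open Convolution

    infixl 7 _⊛ᵉ_
    _⊛ᵉ_ : ∀ {m} → Terms (Exponent m) → Terms (Exponent m) → Terms (Exponent m)
    _⊛ᵉ_ = _⊛_ _+ᵉ_

    -- Leibniz's rule for a second-order operator: the failure to be a derivation is twice the
    -- product of gradients.
    pair-radial-⊛ : ∀ {m} {x : Torus m} (R : Regular x) p q → ⟨ radial R , p ⊛ᵉ q ⟩ ≈
      (⟨ radial R , p ⟩ * ⟨ monomial x , q ⟩ + ⟨ monomial x , p ⟩ * ⟨ radial R , q ⟩) + 2# * sum (λ a → ⟨ θ x a , p ⟩ * ⟨ θ x a , q ⟩)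
    pair-radial-⊛ {m} {x} R p q = begin
      ⟨ radial R , p ⊛ᵉ q ⟩
        ≈⟨ trans (pair-⊛ _+ᵉ_ (radial R) p q) (pair-cong p λ ν → trans (pair-cong q (radial-+ R ν)) (trans (pair-+ (λ κ → radial R ν * monomial x κ + monomial x ν * radial R κ) (λ κ → 2# * sum (λ a → θ x a ν * θ x a κ)) q)
             (+-cong (pair-+ (λ κ → radial R ν * monomial x κ) (λ κ → monomial x ν * radial R κ) q) (trans (pair-* 2# (λ κ → sum (λ a → θ x a ν * θ x a κ)) q) (*-congˡ (pair-sum (λ a κ → θ x a ν * θ x a κ) q)))))) ⟩
      ⟨ (λ ν → (⟨ (λ κ → radial R ν * monomial x κ) , q ⟩ + ⟨ (λ κ → monomial x ν * radial R κ) , q ⟩) + 2# * sum (λ a → ⟨ (λ κ → θ x a ν * θ x a κ) , q ⟩)) , p ⟩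
        ≈⟨ trans (pair-+ (λ ν → ⟨ (λ κ → radial R ν * monomial x κ) , q ⟩ + ⟨ (λ κ → monomial x ν * radial R κ) , q ⟩) (λ ν → 2# * sum (λ a → ⟨ (λ κ → θ x a ν * θ x a κ) , q ⟩)) p)
             (+-cong (pair-+ (λ ν → ⟨ (λ κ → radial R ν * monomial x κ) , q ⟩) (λ ν → ⟨ (λ κ → monomial x ν * radial R κ) , q ⟩) p)
                     (trans (pair-* 2# (λ ν → sum (λ a → ⟨ (λ κ → θ x a ν * θ x a κ) , q ⟩)) p) (*-congˡ (pair-sum (λ a ν → ⟨ (λ κ → θ x a ν * θ x a κ) , q ⟩) p)))) ⟩
      _ ≈⟨ +-cong (+-cong (pair-⊗ _+ᵉ_ (radial R) (monomial x) p q) (pair-⊗ _+ᵉ_ (monomial x) (radial R) p q)) (*-congˡ (sum-cong λ a → pair-⊗ _+ᵉ_ (θ x a) (θ x a) p q)) ⟩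
      (⟨ radial R , p ⟩ * ⟨ monomial x , q ⟩ + ⟨ monomial x , p ⟩ * ⟨ radial R , q ⟩) + 2# * sum (λ a → ⟨ θ x a , p ⟩ * ⟨ θ x a , q ⟩) ∎

    gL YgL : ∀ m → ℤ → Terms (Exponent m)
    gL m p = eL m (p ↓) ++ scale (- 1#) (eL m (p ↑))
    YgL m p = gL m (p ↓) ++ gL m (p ↑)

    fL : ∀ m → ℤ → ℤ → Terms (Exponent m)
    fL m p q = YgL m p ⊛ᵉ gL m q ++ scale (- 1#) (gL m p ⊛ᵉ YgL m q)

    private
      minus : ∀ z → - 1# * z ≈ - z
      minus = solve 1 (λ z → :-1 :* z := :- z) refl

    pair-gL : ∀ m φ (u : Seq) → (∀ p → ⟨ φ , eL m p ⟩ ≈ u p) → ∀ p → ⟨ φ , gL m p ⟩ ≈ Z u p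
    pair-gL m φ u h p = trans (pair-++ φ (eL m (p ↓)) _) (+-cong (h _) (trans (pair-scale (- 1#) φ (eL m (p ↑))) (trans (minus _) (-‿cong (h _)))))

    pair-YgL : ∀ m φ (u : Seq) → (∀ p → ⟨ φ , eL m p ⟩ ≈ u p) → ∀ p → ⟨ φ , YgL m p ⟩ ≈ Y (Z u) p
    pair-YgL m φ u h p = trans (pair-++ φ (gL m (p ↓)) _) (+-cong (pair-gL m φ u h (p ↓)) (pair-gL m φ u h (p ↑)))

    module _ {m} (x : Torus m) where
      private
        X = X̂ x
        mon-mult = pair-multiplicative _+ᵉ_ (monomial x) (monomial-+ x)
        gv = pair-gL m (monomial x) (e X) (eL-value x)
        Ygv = pair-YgL m (monomial x) (e X) (eL-value x)

      fL-value : ∀ p q → ⟨ monomial x , fL m p q ⟩ ≈ f X p q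
      fL-value p q = trans (pair-++ (monomial x) (YgL m p ⊛ᵉ gL m q) _) (+-cong (trans (mon-mult (YgL m p) (gL m q)) (*-cong (Ygv p) (gv q)))
        (trans (pair-scale (- 1#) (monomial x) (gL m p ⊛ᵉ YgL m q)) (trans (minus _) (-‿cong (trans (mon-mult (gL m p) (YgL m q)) (*-cong (gv p) (Ygv q)))))))

      private
        module _ (R : Regular x) where
          M = ι (+ suc m)
          λg : Seq
          λg p = (M * M - ι p * ι p) * g X p
          gr : ∀ p → ⟨ radial R , gL m p ⟩ ≈ λg p
          gr p = trans (pair-gL m (radial R) (L X (Regular.r R)) (eL-radial x R) p) (Z-L X (Regular.r R) (regular⇒separated R) p)
          Ygr : ∀ p → ⟨ radial R , YgL m p ⟩ ≈ Y λg p
          Ygr p = trans (pair-++ (radial R) (gL m (p ↓)) _) (+-cong (gr (p ↓)) (gr (p ↑)))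
          θe : ∀ a p → ⟨ θ x a , eL m p ⟩ ≈ Ẋ x a * d a X p
          θe = eL-θ x
          θg : ∀ a p → ⟨ θ x a , gL m p ⟩ ≈ Ẋ x a * Z (d a X) p
          θg a p = trans (pair-gL m (θ x a) (λ q → Ẋ x a * d a X q) (θe a) p) (solve 3 (λ k u v → k :* u :- k :* v := k :* (u :- v)) refl _ _ _)
          θYg : ∀ a p → ⟨ θ x a , YgL m p ⟩ ≈ Ẋ x a * Y (Z (d a X)) p
          θYg a p = trans (pair-++ (θ x a) (gL m (p ↓)) _) (trans (+-cong (θg a (p ↓)) (θg a (p ↑))) (sym (distribˡ _ _ _)))

          -- The single functions `g` are eigenfunctions, but `Y` mixes neighbouring eigenvalues and
          -- neither product is one by itself. In the antisymmetric combination the gradient term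
          -- evaluated by `cross-sum` compensates exactly, leaving a polynomial identity in the
          -- values of `g` around p and q.
          radial-f : ∀ p q → ⟨ radial R , fL m p q ⟩ ≈ eigenvalueOf m p q * f X p q
          radial-f p q = begin
            ⟨ radial R , fL m p q ⟩
              ≈⟨ trans (pair-++ (radial R) (YgL m p ⊛ᵉ gL m q) _) (+-congˡ (trans (pair-scale (- 1#) (radial R) (gL m p ⊛ᵉ YgL m q)) (minus _))) ⟩
            ⟨ radial R , YgL m p ⊛ᵉ gL m q ⟩ - ⟨ radial R , gL m p ⊛ᵉ YgL m q ⟩
              ≈⟨ +-cong (trans (pair-radial-⊛ R (YgL m p) (gL m q)) (+-cong (+-cong (*-cong (Ygr p) (gv q)) (*-cong (Ygv p) (gr q))) (*-congˡ (sum-cong λ a → *-cong (θYg a p) (θg a q)))))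
                   (-‿cong (trans (pair-radial-⊛ R (gL m p) (YgL m q)) (+-cong (+-cong (*-cong (gr p) (Ygv q)) (*-cong (gv p) (Ygr q))) (*-congˡ (sum-cong λ a → *-cong (θg a p) (θYg a q)))))) ⟩
            ((Y λg p * g X q + Y (g X) p * λg q) + 2# * S₁) - ((λg p * Y (g X) q + g X p * Y λg q) + 2# * S₂)
              ≈⟨ solve 6 (λ a b c d s t → ((a :+ b) :+ :2 :* s) :- ((c :+ d) :+ :2 :* t) := ((a :+ b) :- (c :+ d)) :+ :2 :* (s :- t)) refl (Y λg p * g X q) (Y (g X) p * λg q) (λg p * Y (g X) q) (g X p * Y λg q) S₁ S₂ ⟩
            ((Y λg p * g X q + Y (g X) p * λg q) - (λg p * Y (g X) q + g X p * Y λg q)) + 2# * (S₁ - S₂)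
              ≈⟨ +-cong (+-cong (+-congʳ (*-congʳ (Yλg p))) (-‿cong (+-congˡ (*-congˡ (Yλg q))))) (*-congˡ (trans gradient-difference (cross-sum X p q))) ⟩
            _ ≈⟨ +-cong (+-cong (+-cong (*-congʳ (+-cong (*-congʳ (+-congʳ (*-cong M≈ M≈))) (*-congʳ (+-congʳ (*-cong M≈ M≈))))) (*-congˡ (*-congʳ (+-congʳ (*-cong M≈ M≈)))))
                   (-‿cong (+-cong (*-congʳ (*-congʳ (+-congʳ (*-cong M≈ M≈)))) (*-congˡ (+-cong (*-congʳ (+-congʳ (*-cong M≈ M≈))) (*-congʳ (+-congʳ (*-cong M≈ M≈)))))))) refl ⟩
            _ ≈⟨ solve 9 (λ n P Q a b c s t u →
                   (((((:1 :+ n) :* (:1 :+ n) :- (P :- :1) :* (P :- :1)) :* a :+ ((:1 :+ n) :* (:1 :+ n) :- (P :+ :1) :* (P :+ :1)) :* c) :* t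
                      :+ (a :+ c) :* (((:1 :+ n) :* (:1 :+ n) :- Q :* Q) :* t)) :-
                    ((((:1 :+ n) :* (:1 :+ n) :- P :* P) :* b) :* (s :+ u)
                      :+ b :* (((:1 :+ n) :* (:1 :+ n) :- (Q :- :1) :* (Q :- :1)) :* s :+ ((:1 :+ n) :* (:1 :+ n) :- (Q :+ :1) :* (Q :+ :1)) :* u))) :+
                   :2 :* (n :* ((a :+ c) :* t :- b :* (s :+ u)) :- ((P :- :2) :* a :- (P :+ :2) :* c) :* t :+ b :* ((Q :- :2) :* s :- (Q :+ :2) :* u)) :=
                   (:2 :* ((:1 :+ n) :* (:1 :+ n)) :+ :2 :* (:1 :+ n) :+ :1 :- P :* P :- Q :* Q) :* ((a :+ c) :* t :- b :* (s :+ u)))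
                   refl (ι (+ m)) (ι p) (ι q) (g X (p ↓)) (g X p) (g X (p ↑)) (g X (q ↓)) (g X q) (g X (q ↑)) ⟩
            (2# * ((1# + ι (+ m)) * (1# + ι (+ m))) + 2# * (1# + ι (+ m)) + 1# - ι p * ι p - ι q * ι q) * f X p q
              ≈⟨ *-congʳ (+-congʳ (+-congʳ (+-congʳ (+-cong (*-congˡ (*-cong M≈ M≈)) (*-congˡ M≈))))) ⟨
            eigenvalueOf m p q * f X p q ∎
            where
            M≈ : M ≈ 1# + ι (+ m)
            M≈ = ι-+ (+ 1) (+ m)
            S₁ S₂ : Carrier
            S₁ = sum λ a → (Ẋ x a * Y (Z (d a X)) p) * (Ẋ x a * Z (d a X) q)
            S₂ = sum λ a → (Ẋ x a * Z (d a X) p) * (Ẋ x a * Y (Z (d a X)) q)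
            Yλg : ∀ p → Y λg p ≈ (M * M - (ι p - 1#) * (ι p - 1#)) * g X (p ↓) + (M * M - (ι p + 1#) * (ι p + 1#)) * g X (p ↑)
            Yλg p = +-cong (*-congʳ (+-congˡ (-‿cong (*-cong (ι⁻ p) (ι⁻ p))))) (*-congʳ (+-congˡ (-‿cong (*-cong (ι⁺ p) (ι⁺ p)))))
            gradient-difference : S₁ - S₂ ≈ sum (λ a → (X a * X a - ι (+ 4)) * (Y (Z (d a X)) p * Z (d a X) q - Z (d a X) p * Y (Z (d a X)) q))
            gradient-difference = trans (+-congˡ (sym (sum-neg (λ a → (Ẋ x a * Z (d a X) p) * (Ẋ x a * Y (Z (d a X)) q)))))
              (trans (sym (∑-distrib-+ (λ a → (Ẋ x a * Y (Z (d a X)) p) * (Ẋ x a * Z (d a X) q)) (λ a → - ((Ẋ x a * Z (d a X) p) * (Ẋ x a * Y (Z (d a X)) q)))))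
              (sum-cong λ a → trans (solve 5 (λ k a b c d → (k :* a) :* (k :* b) :- (k :* c) :* (k :* d) := (k :* k) :* (a :* b :- c :* d)) refl (Ẋ x a) (Y (Z (d a X)) p) (Z (d a X) q) (Z (d a X) p) (Y (Z (d a X)) q)) (*-congʳ (Ẋ² x a))))

      fL-radial : ∀ (R : Regular x) p q → ⟨ radial R , fL m p q ⟩ ≈ eigenvalueOf m p q * ⟨ monomial x , fL m p q ⟩
      fL-radial R p q = trans (radial-f R p q) (*-congˡ (sym (fL-value p q)))

    fL-eigen : ∀ m p q → IsEigen (fL m p q) (eigenvalueOf m p q)
    fL-eigen m p q x R = fL-radial x R p q

-- Leading exponents of the determinants

module JacobiTrudi (K : CommutativeRing 0ℓ 0ℓ) (F : IsCharZeroField K) where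
  open CommutativeRing K hiding (zero)
  open Arithmetic K
  open FieldArithmetic K F
  open FormalSums K
  open Powers K
  open LinearIndependence K F using (Respectful)
  open Radial K
  open Dominance
  open WeylGroup
  open Uniqueness K F
  open CharacterExpansion K F
  open DualJacobiTrudi K
  open DualJacobiTrudi.Lists K
  open Convolution
  open Symplectic K using (val; inv; IsIrreducibleCharacter)
  open SetoidReasoning setoid

  -- For B = m - p this is met by the exponents in the coefficient of y^p: every entry is at most 1,
  -- and a positive p uses up at least p factors for powers of y.
  Bounded : ∀ {m} → ℤ → Exponent m → Set
  Bounded B ν = ∀ k → psum ν k ℤ.≤ + k × psum ν k ℤ.≤ B

  private
    mono : ∀ {m} {B E : ℤ} {ν : Exponent m} → B ℤ.≤ E → Bounded B ν → Bounded E ν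
    mono B≤C bd k = proj₁ (bd k) , ℤ.≤-trans (proj₂ (bd k)) B≤C

    impossible : ∀ {m} {B} {ν : Exponent m} {P : Set} → B ℤ.< +0 → Bounded B ν → P
    impossible B<0 bd = ⊥-elim (ℤ.<⇒≱ B<0 (proj₂ (bd 0)))

    shift-down : ∀ m p → + m ℤ.- (p ↓) ≡ + suc m ℤ.- p
    shift-down m p = ≡.trans (ℤsolve 2 (λ n p → n ⊟ (p ⊞ # -[1+ 0 ]) ⊜ (# (+ 1) ⊞ n) ⊟ p) ≡.refl (+ m) p) ≡.refl

    shift-same : ∀ m p → + 1 ℤ.+ (+ m ℤ.- p) ≡ + suc m ℤ.- p
    shift-same m p = ℤsolve 2 (λ n p → # (+ 1) ⊞ (n ⊟ p) ⊜ (# (+ 1) ⊞ n) ⊟ p) ≡.refl (+ m) p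

    shift-up : ∀ m p → + 2 ℤ.+ (+ m ℤ.- (p ↑)) ≡ + suc m ℤ.- p
    shift-up m p = ℤsolve 2 (λ n p → # (+ 2) ⊞ (n ⊟ (p ⊞ # (+ 1))) ⊜ (# (+ 1) ⊞ n) ⊟ p) ≡.refl (+ m) p

    i≤n+i : ∀ n i → i ℤ.≤ + n ℤ.+ i
    i≤n+i n i = ≡.subst (ℤ._≤ + n ℤ.+ i) (ℤ.+-identityˡ i) (ℤ.+-monoˡ-≤ i (ℤ.+≤+ ℕ.z≤n))

    bounded-1 : ∀ {m} B (ν : Exponent m) → Bounded B ν → Bounded (+ 1 ℤ.+ B) (cons (+ 1) ν)
    bounded-1 B ν bd zero    = ℤ.≤-refl , ℤ.≤-trans (proj₂ (bd 0)) (i≤n+i 1 B)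
    bounded-1 B ν bd (suc k) = ℤ.+-monoʳ-≤ (+ 1) (proj₁ (bd k)) , ℤ.+-monoʳ-≤ (+ 1) (proj₂ (bd k))

    bounded-0 : ∀ {m} B (ν : Exponent m) → Bounded B ν → Bounded B (cons +0 ν)
    bounded-0 B ν bd zero    = ℤ.≤-refl , proj₂ (bd 0)
    bounded-0 B ν bd (suc k) = ≡.subst (ℤ._≤ + suc k) (≡.sym (ℤ.+-identityˡ _)) (ℤ.≤-trans (proj₁ (bd k)) (ℤ.+≤+ (ℕ.n≤1+n k))) , ≡.subst (ℤ._≤ B) (≡.sym (ℤ.+-identityˡ _)) (proj₂ (bd k))

    lower-psum : ∀ i → -[1+ 0 ] ℤ.+ i ℤ.≤ i
    lower-psum i = ≡.subst (-[1+ 0 ] ℤ.+ i ℤ.≤_) (ℤ.+-identityˡ i) (ℤ.+-monoˡ-≤ i ℤ.-≤+)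

    bounded--1 : ∀ {m} B (ν : Exponent m) → Bounded B ν → Bounded B (cons -[1+ 0 ] ν)
    bounded--1 B ν bd zero    = ℤ.≤-refl , proj₂ (bd 0)
    bounded--1 B ν bd (suc k) = ℤ.≤-trans (lower-psum _) (ℤ.≤-trans (proj₁ (bd k)) (ℤ.+≤+ (ℕ.n≤1+n k))) , ℤ.≤-trans (lower-psum _) (proj₂ (bd k))

  eL-bounded : ∀ m p → AllExp (Bounded (+ m ℤ.- p)) (eL m p)
  eL-bounded zero    +0         = (λ { zero → ℤ.≤-refl , ℤ.≤-refl ; (suc k) → ℤ.+≤+ ℕ.z≤n , ℤ.≤-refl }) ∷ []
  eL-bounded zero    ℤ.+[1+ n ] = []
  eL-bounded zero    -[1+ n ]   = []
  eL-bounded (suc m) p = ++⁺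
    (++⁺ (reindex-All (cons (+ 1)) (λ {ν} bd → ≡.subst (λ B → Bounded B (cons (+ 1) ν)) (shift-same m p) (bounded-1 _ ν bd)) (eL m p) (eL-bounded m p))
         (reindex-All (cons -[1+ 0 ]) (λ {ν} bd → mono (≡.subst (+ m ℤ.- p ℤ.≤_) (shift-same m p) (i≤n+i 1 _)) (bounded--1 _ ν bd)) (eL m p) (eL-bounded m p)))
    (++⁺ (reindex-All (cons +0) (λ {ν} bd → ≡.subst (λ B → Bounded B (cons +0 ν)) (shift-down m p) (bounded-0 _ ν bd)) (eL m (p ↓)) (eL-bounded m (p ↓)))
         (reindex-All (cons +0) (λ {ν} bd → mono (≡.subst (+ m ℤ.- (p ↑) ℤ.≤_) (shift-up m p) (i≤n+i 2 _)) (bounded-0 _ ν bd)) (eL m (p ↑)) (eL-bounded m (p ↑))))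

  ones : ∀ {m} → ℕ → Exponent m
  ones {zero}  a       = none
  ones {suc m} zero    = cons +0 (ones {m} zero)
  ones {suc m} (suc a) = cons (+ 1) (ones {m} a)

  -- Bounded like the highest weight 1^a of the a-th exterior power, and different from it.
  Low : ∀ {m} → ℕ → Exponent m → Set
  Low a ν = Bounded (+ a) ν × ∃ λ k → psum ν k ℤ.< + (k ℕ.⊓ a)

  record Lead {m} (a : ℕ) (p : Terms (Exponent m)) : Set where
    field
      rest     : Terms (Exponent m)
      rest-low : AllExp (Low a) rest
      splits   : ∀ φ → ⟨ φ , p ⟩ ≈ φ (ones a) + ⟨ φ , rest ⟩
  open Lead

  private
    low-1 : ∀ {m} a {ν : Exponent m} → Low a ν → Low (suc a) (cons (+ 1) ν)
    low-1 a {ν} (bd , k , lt) = bounded-1 (+ a) ν bd , suc k , ℤ.+-monoʳ-< (+ 1) lt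

    low-0 : ∀ {m} {ν : Exponent m} → Low 0 ν → Low 0 (cons +0 ν)
    low-0 {ν = ν} (bd , k , lt) = bounded-0 +0 ν bd , suc k , ≡.subst₂ ℤ._<_ (≡.sym (ℤ.+-identityˡ _)) (≡.cong +_ (≡.trans (ℕ.⊓-zeroʳ k) ≡.refl)) lt

    low-first : ∀ {m} a c {ν : Exponent m} → c ℤ.≤ +0 → Bounded (+ suc a) (cons c ν) → Low (suc a) (cons c ν)
    low-first a c c≤0 bd = bd , 1 , ℤ.≤-<-trans (ℤ.≤-reflexive (ℤ.+-identityʳ c)) (ℤ.≤-<-trans c≤0 (ℤ.+<+ (ℕ.s≤s ℕ.z≤n)))

    bounded⇒low : ∀ {m} a {B} {ν : Exponent m} → B ℤ.< + a → Bounded B ν → Low a ν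
    bounded⇒low a {B} {ν} B<a bd = mono (ℤ.<⇒≤ B<a) bd , a , ≡.subst (λ n → psum ν a ℤ.< + n) (≡.sym (ℕ.⊓-idem a)) (ℤ.≤-<-trans (proj₂ (bd a)) B<a)

  -- The leading monomial x_1⋯x_a comes from exactly one choice, x_i from the leading a factors and
  -- y from all others; the recursion follows it. Once `a` is 0, the other sublists have a negative
  -- bound and hence no exponents.
  eL-lead : ∀ m a → a ℕ.≤ m → ∀ p → p ≡ + m ℤ.- + a → Lead a (eL m p)
  eL-lead zero    zero    _  p ≡.refl = record { rest = [] ; rest-low = [] ; splits = λ φ → +-congʳ (*-identityˡ _) }
  eL-lead (suc m) zero    _  p eq = record
    { rest = (reindex (cons (+ 1)) (eL m p) ++ reindex (cons -[1+ 0 ]) (eL m p)) ++ (reindex (cons +0) (rest ih) ++ reindex (cons +0) (eL m (p ↑)))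
    ; rest-low = ++⁺ (++⁺ (reindex-All (cons (+ 1)) (impossible empty) (eL m p) (eL-bounded m p)) (reindex-All (cons -[1+ 0 ]) (impossible empty) (eL m p) (eL-bounded m p)))
        (++⁺ (reindex-All (cons +0) (λ {ν} → low-0 {m} {ν}) (rest ih) (rest-low ih)) (reindex-All (cons +0) (impossible empty′) (eL m (p ↑)) (eL-bounded m (p ↑))))
    ; splits = λ φ → begin
        ⟨ φ , eL (suc m) p ⟩
          ≈⟨ pair-eL-suc m φ p ⟩
        (⟨ φ ∘ cons (+ 1) , eL m p ⟩ + ⟨ φ ∘ cons -[1+ 0 ] , eL m p ⟩) + (⟨ φ ∘ cons +0 , eL m (p ↓) ⟩ + ⟨ φ ∘ cons +0 , eL m (p ↑) ⟩)
          ≈⟨ +-congˡ (+-congʳ (splits ih (φ ∘ cons +0))) ⟩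
        (⟨ φ ∘ cons (+ 1) , eL m p ⟩ + ⟨ φ ∘ cons -[1+ 0 ] , eL m p ⟩) + ((φ (ones zero) + ⟨ φ ∘ cons +0 , rest ih ⟩) + ⟨ φ ∘ cons +0 , eL m (p ↑) ⟩)
          ≈⟨ solve 4 (λ a b c d → a :+ ((b :+ c) :+ d) := b :+ (a :+ (c :+ d))) refl _ _ _ _ ⟩
        φ (ones zero) + ((⟨ φ ∘ cons (+ 1) , eL m p ⟩ + ⟨ φ ∘ cons -[1+ 0 ] , eL m p ⟩) + (⟨ φ ∘ cons +0 , rest ih ⟩ + ⟨ φ ∘ cons +0 , eL m (p ↑) ⟩))
          ≈⟨ +-congˡ (four φ (eL m p) (eL m p) (rest ih) (eL m (p ↑))) ⟨
        _ ∎ }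
    where
    four : ∀ φ p q r s → ⟨ φ , (reindex (cons (+ 1)) p ++ reindex (cons -[1+ 0 ]) q) ++ (reindex (cons +0) r ++ reindex (cons +0) s) ⟩ ≈
           (⟨ φ ∘ cons (+ 1) , p ⟩ + ⟨ φ ∘ cons -[1+ 0 ] , q ⟩) + (⟨ φ ∘ cons +0 , r ⟩ + ⟨ φ ∘ cons +0 , s ⟩)
    four φ p q r s = trans (pair-++ φ (reindex (cons (+ 1)) p ++ reindex (cons -[1+ 0 ]) q) _) (+-cong
      (trans (pair-++ φ (reindex (cons (+ 1)) p) _) (+-cong (pair-reindex (cons (+ 1)) φ p) (pair-reindex (cons -[1+ 0 ]) φ q)))
      (trans (pair-++ φ (reindex (cons +0) r) _) (+-cong (pair-reindex (cons +0) φ r) (pair-reindex (cons +0) φ s))))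
    ih : Lead 0 (eL m (p ↓))
    ih = eL-lead m zero ℕ.z≤n (p ↓) (≡.trans (≡.cong (ℤ._+ -[1+ 0 ]) eq) (ℤsolve 1 (λ n → (# (+ 1) ⊞ n) ⊞ # +0 ⊞ # -[1+ 0 ] ⊜ n ⊞ # +0) ≡.refl (+ m)))
    empty : + m ℤ.- p ℤ.< +0
    empty = ≡.subst (ℤ._< +0) (≡.sym (≡.trans (≡.cong (λ z → + m ℤ.- z) eq) (ℤsolve 1 (λ n → n ⊟ ((# (+ 1) ⊞ n) ⊞ # +0) ⊜ # -[1+ 0 ]) ≡.refl (+ m)))) ℤ.-<+
    empty′ : + m ℤ.- (p ↑) ℤ.< +0
    empty′ = ≡.subst (ℤ._< +0) (≡.sym (≡.trans (≡.cong (λ z → + m ℤ.- (z ↑)) eq) (ℤsolve 1 (λ n → n ⊟ ((# (+ 1) ⊞ n) ⊞ # +0 ⊞ # (+ 1)) ⊜ # -[1+ 1 ]) ≡.refl (+ m)))) ℤ.-<+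
  eL-lead (suc m) (suc a) (ℕ.s≤s a≤m) p eq = record
    { rest = (reindex (cons (+ 1)) (rest ih) ++ reindex (cons -[1+ 0 ]) (eL m p)) ++ (reindex (cons +0) (eL m (p ↓)) ++ reindex (cons +0) (eL m (p ↑)))
    ; rest-low = ++⁺ (++⁺ (reindex-All (cons (+ 1)) (λ {ν} → low-1 {m} a {ν}) (rest ih) (rest-low ih))
          (reindex-All (cons -[1+ 0 ]) (λ {ν} bd → low-first a -[1+ 0 ] {ν} ℤ.-≤+ (mono (≡.subst (ℤ._≤ + suc a) (≡.sym here-bound) (ℤ.+≤+ (ℕ.n≤1+n a))) (bounded--1 _ ν bd))) (eL m p) (eL-bounded m p)))
        (++⁺ (reindex-All (cons +0) (λ {ν} bd → low-first a +0 {ν} ℤ.≤-refl (mono (ℤ.≤-reflexive down-bound) (bounded-0 _ ν bd))) (eL m (p ↓)) (eL-bounded m (p ↓)))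
             (reindex-All (cons +0) (λ {ν} bd → low-first a +0 {ν} ℤ.≤-refl (mono (≡.subst (+ m ℤ.- (p ↑) ℤ.≤_) up-bound (i≤n+i 2 _)) (bounded-0 _ ν bd))) (eL m (p ↑)) (eL-bounded m (p ↑))))
    ; splits = λ φ → begin
        ⟨ φ , eL (suc m) p ⟩
          ≈⟨ pair-eL-suc m φ p ⟩
        (⟨ φ ∘ cons (+ 1) , eL m p ⟩ + ⟨ φ ∘ cons -[1+ 0 ] , eL m p ⟩) + (⟨ φ ∘ cons +0 , eL m (p ↓) ⟩ + ⟨ φ ∘ cons +0 , eL m (p ↑) ⟩)
          ≈⟨ +-congʳ (+-congʳ (splits ih (φ ∘ cons (+ 1)))) ⟩
        ((φ (ones (suc a)) + ⟨ φ ∘ cons (+ 1) , rest ih ⟩) + ⟨ φ ∘ cons -[1+ 0 ] , eL m p ⟩) + (⟨ φ ∘ cons +0 , eL m (p ↓) ⟩ + ⟨ φ ∘ cons +0 , eL m (p ↑) ⟩)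
          ≈⟨ solve 4 (λ b c d e → ((b :+ c) :+ d) :+ e := b :+ ((c :+ d) :+ e)) refl _ _ _ _ ⟩
        φ (ones (suc a)) + ((⟨ φ ∘ cons (+ 1) , rest ih ⟩ + ⟨ φ ∘ cons -[1+ 0 ] , eL m p ⟩) + (⟨ φ ∘ cons +0 , eL m (p ↓) ⟩ + ⟨ φ ∘ cons +0 , eL m (p ↑) ⟩))
          ≈⟨ +-congˡ (trans (pair-++ φ (reindex (cons (+ 1)) (rest ih) ++ reindex (cons -[1+ 0 ]) (eL m p)) _) (+-cong
               (trans (pair-++ φ (reindex (cons (+ 1)) (rest ih)) _) (+-cong (pair-reindex (cons (+ 1)) φ (rest ih)) (pair-reindex (cons -[1+ 0 ]) φ (eL m p))))
               (trans (pair-++ φ (reindex (cons +0) (eL m (p ↓))) _) (+-cong (pair-reindex (cons +0) φ (eL m (p ↓))) (pair-reindex (cons +0) φ (eL m (p ↑))))))) ⟨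
        _ ∎ }
    where
    p≡ : p ≡ + m ℤ.- + a
    p≡ = ≡.trans eq (ℤsolve 2 (λ n a → (# (+ 1) ⊞ n) ⊟ (# (+ 1) ⊞ a) ⊜ n ⊟ a) ≡.refl (+ m) (+ a))
    ih : Lead a (eL m p)
    ih = eL-lead m a a≤m p p≡
    here-bound : + m ℤ.- p ≡ + a
    here-bound = ≡.trans (≡.cong (λ z → + m ℤ.- z) p≡) (ℤsolve 2 (λ n a → n ⊟ (n ⊟ a) ⊜ a) ≡.refl (+ m) (+ a))
    down-bound : + m ℤ.- (p ↓) ≡ + suc a
    down-bound = ≡.trans (≡.cong (λ z → + m ℤ.- (z ↓)) p≡) (ℤsolve 2 (λ n a → n ⊟ ((n ⊟ a) ⊞ # -[1+ 0 ]) ⊜ # (+ 1) ⊞ a) ≡.refl (+ m) (+ a))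
    up-bound : + 2 ℤ.+ (+ m ℤ.- (p ↑)) ≡ + suc a
    up-bound = ≡.trans (≡.cong (λ z → + 2 ℤ.+ (+ m ℤ.- (z ↑))) p≡) (ℤsolve 2 (λ n a → # (+ 2) ⊞ (n ⊟ ((n ⊟ a) ⊞ # (+ 1))) ⊜ # (+ 1) ⊞ a) ≡.refl (+ m) (+ a))

  private
    psum-ones : ∀ {m} a → a ℕ.≤ m → ∀ k → psum (ones {m} a) k ≡ + (k ℕ.⊓ a)
    psum-ones {m}     a       _  zero    = ≡.refl
    psum-ones {zero}  zero    _  (suc k) = ≡.refl
    psum-ones {suc m} zero    _  (suc k) = ≡.trans (ℤ.+-identityˡ _) (≡.trans (psum-ones {m} zero ℕ.z≤n k) (≡.cong +_ (ℕ.⊓-zeroʳ k)))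
    psum-ones {suc m} (suc a) (ℕ.s≤s a≤m) (suc k) = ≡.cong (λ z → + 1 ℤ.+ z) (psum-ones {m} a a≤m k)

    bounded-⊓ : ∀ {m} a {ν : Exponent m} → Bounded (+ a) ν → ∀ k → psum ν k ℤ.≤ + (k ℕ.⊓ a)
    bounded-⊓ a bd k with ℕ.≤-total k a
    ... | inj₁ k≤a = ≡.subst (λ n → _ ℤ.≤ + n) (≡.sym (ℕ.m≤n⇒m⊓n≡m k≤a)) (proj₁ (bd k))
    ... | inj₂ a≤k = ≡.subst (λ n → _ ℤ.≤ + n) (≡.sym (ℕ.m≥n⇒m⊓n≡n a≤k)) (proj₂ (bd k))

    ones-bounded : ∀ {m} a → a ℕ.≤ m → Bounded (+ a) (ones {m} a)
    ones-bounded a a≤m k = ≡.subst (ℤ._≤ + k) (≡.sym (psum-ones a a≤m k)) (ℤ.+≤+ (ℕ.m⊓n≤m k a)) , ≡.subst (ℤ._≤ + a) (≡.sym (psum-ones a a≤m k)) (ℤ.+≤+ (ℕ.m⊓n≤n k a))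

  module _ {m : ℕ} (a b : ℕ) (b≤a : b ℕ.≤ a) (a≤m : a ℕ.≤ m) where
    private
      b≤m : b ℕ.≤ m
      b≤m = ℕ.≤-trans b≤a a≤m

      p q : ℤ
      -- `Y (g X)` at p reaches down to `e` at `p ↓ ↓`, and `g X` at q to `e` at `q ↓`. The offsets
      -- 2 and 1 turn these indices into m - b and m - a, where the leading exponents are 1^b and
      -- 1^a.
      p = + suc (suc m) ℤ.- + b
      q = + suc m ℤ.- + a

      top : Exponent m
      top = ones b +ᵉ ones a

      psum-top : ∀ k → psum top k ≡ + (k ℕ.⊓ b) ℤ.+ + (k ℕ.⊓ a)
      psum-top k = ≡.trans (psum-+ (ones b) (ones a) k) (≡.cong₂ ℤ._+_ (psum-ones b b≤m k) (psum-ones a a≤m k))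

      low+bounded : ∀ {ν κ : Exponent m} → Low b ν → Bounded (+ a) κ → (ν +ᵉ κ) ≺ top
      low+bounded {ν} {κ} (bν , k , lt) bκ =
        (λ l → ≡.subst₂ ℤ._≤_ (≡.sym (psum-+ ν κ l)) (≡.sym (psum-top l)) (ℤ.+-mono-≤ (bounded-⊓ b {ν} bν l) (bounded-⊓ a {κ} bκ l))) ,
        k , ≡.subst₂ ℤ._<_ (≡.sym (psum-+ ν κ k)) (≡.sym (psum-top k)) (ℤ.+-mono-<-≤ lt (bounded-⊓ a {κ} bκ k))

      bounded+low : ∀ {ν κ : Exponent m} → Bounded (+ b) ν → Low a κ → (ν +ᵉ κ) ≺ top
      bounded+low {ν} {κ} bν (bκ , k , lt) =
        (λ l → ≡.subst₂ ℤ._≤_ (≡.sym (psum-+ ν κ l)) (≡.sym (psum-top l)) (ℤ.+-mono-≤ (bounded-⊓ b {ν} bν l) (bounded-⊓ a {κ} bκ l))) ,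
        k , ≡.subst₂ ℤ._<_ (≡.sym (psum-+ ν κ k)) (≡.sym (psum-top k)) (ℤ.+-mono-≤-< (bounded-⊓ b {ν} bν k) lt)

      -- (1^{b-1}) + (1^{a+1}) is strictly dominated by (1^b) + (1^a) because b ≤ a.
      unbalanced : ∀ {ν κ : Exponent m} → Bounded (+ b ℤ.- + 1) ν → Bounded (+ 1 ℤ.+ + a) κ → (ν +ᵉ κ) ≺ top
      unbalanced {ν} {κ} bν bκ = weak , b , strict
        where
        weak : (ν +ᵉ κ) ≼ top
        weak k with ℕ.≤-total k b | ℕ.≤-total k a
        ... | inj₁ k≤b | _ = ≡.subst₂ ℤ._≤_ (≡.sym (psum-+ ν κ k)) (≡.sym (≡.trans (psum-top k) (≡.cong₂ (λ i j → + i ℤ.+ + j) (ℕ.m≤n⇒m⊓n≡m k≤b) (ℕ.m≤n⇒m⊓n≡m (ℕ.≤-trans k≤b b≤a)))))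
          (ℤ.+-mono-≤ (proj₁ (bν k)) (proj₁ (bκ k)))
        ... | inj₂ b≤k | inj₁ k≤a = ≡.subst₂ ℤ._≤_ (≡.sym (psum-+ ν κ k)) (≡.sym (≡.trans (psum-top k) (≡.cong₂ (λ i j → + i ℤ.+ + j) (ℕ.m≥n⇒m⊓n≡n b≤k) (ℕ.m≤n⇒m⊓n≡m k≤a))))
          (ℤ.+-mono-≤ (ℤ.≤-trans (proj₂ (bν k)) (≡.subst (+ b ℤ.- + 1 ℤ.≤_) (ℤ.+-identityʳ (+ b)) (ℤ.+-monoʳ-≤ (+ b) ℤ.-≤+))) (proj₁ (bκ k)))
        ... | inj₂ b≤k | inj₂ a≤k = ≡.subst₂ ℤ._≤_ (≡.sym (psum-+ ν κ k)) (≡.sym (≡.trans (psum-top k) (≡.trans (≡.cong₂ (λ i j → + i ℤ.+ + j) (ℕ.m≥n⇒m⊓n≡n b≤k) (ℕ.m≥n⇒m⊓n≡n a≤k))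
            (ℤsolve 2 (λ b a → b ⊞ a ⊜ (b ⊟ # (+ 1)) ⊞ (# (+ 1) ⊞ a)) ≡.refl (+ b) (+ a)))))
          (ℤ.+-mono-≤ (proj₂ (bν k)) (proj₂ (bκ k)))
        strict : psum (ν +ᵉ κ) b ℤ.< psum top b
        strict = ≡.subst₂ ℤ._<_ (≡.sym (psum-+ ν κ b)) (≡.sym (≡.trans (psum-top b) (≡.cong₂ (λ i j → + i ℤ.+ + j) (ℕ.⊓-idem b) (ℕ.m≤n⇒m⊓n≡m b≤a))))
          (ℤ.+-mono-<-≤ (ℤ.≤-<-trans (proj₂ (bν b)) (≡.subst (+ b ℤ.- + 1 ℤ.<_) (ℤ.+-identityʳ (+ b)) (ℤ.+-monoʳ-< (+ b) ℤ.-<+))) (proj₁ (bκ b)))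

      all-bounded : ∀ r B → + m ℤ.- r ℤ.≤ B → AllExp (Bounded B) (eL m r)
      all-bounded r B le = All.map (mono le) (eL-bounded m r)

      scaled : ∀ {P : Exponent m → Set} {c} {l} → AllExp P l → AllExp P (scale c l)
      scaled {l = l} = weighted-All l

      all-low : ∀ r c B → + m ℤ.- r ≡ B → B ℤ.< + c → AllExp (Low c) (eL m r)
      all-low r c B e lt = All.map (λ bd → bounded⇒low c lt (≡.subst (λ B → Bounded B _) e bd)) (eL-bounded m r)

      leadP : Lead b (eL m (p ↓ ↓))
      leadP = eL-lead m b b≤m _ (ℤsolve 2 (λ n b → ((# (+ 2) ⊞ n) ⊟ b) ⊞ # -[1+ 0 ] ⊞ # -[1+ 0 ] ⊜ n ⊟ b) ≡.refl (+ m) (+ b))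

      leadQ : Lead a (eL m (q ↓))
      leadQ = eL-lead m a a≤m _ (ℤsolve 2 (λ n a → ((# (+ 1) ⊞ n) ⊟ a) ⊞ # -[1+ 0 ] ⊜ n ⊟ a) ≡.refl (+ m) (+ a))

      tailP tailQ : Terms (Exponent m)
      tailP = rest leadP ++ (scale (- 1#) (eL m (p ↓ ↑)) ++ gL m (p ↑))
      tailQ = rest leadQ ++ scale (- 1#) (eL m (q ↑))

      pair-P : ∀ φ → ⟨ φ , YgL m p ⟩ ≈ ⟨ φ , (1# , ones b) ∷ tailP ⟩
      pair-P φ = begin
        ⟨ φ , YgL m p ⟩
          ≈⟨ trans (pair-++ φ (gL m (p ↓)) _) (+-congʳ (trans (pair-++ φ (eL m (p ↓ ↓)) _) (+-congʳ (splits leadP φ)))) ⟩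
        ((φ (ones b) + ⟨ φ , rest leadP ⟩) + ⟨ φ , scale (- 1#) (eL m (p ↓ ↑)) ⟩) + ⟨ φ , gL m (p ↑) ⟩
          ≈⟨ solve 4 (λ a b c d → ((a :+ b) :+ c) :+ d := :1 :* a :+ (b :+ (c :+ d))) refl (φ (ones b)) _ _ _ ⟩
        1# * φ (ones b) + (⟨ φ , rest leadP ⟩ + (⟨ φ , scale (- 1#) (eL m (p ↓ ↑)) ⟩ + ⟨ φ , gL m (p ↑) ⟩))
          ≈⟨ +-congˡ (trans (pair-++ φ (rest leadP) _) (+-congˡ (pair-++ φ (scale (- 1#) (eL m (p ↓ ↑))) _))) ⟨
        ⟨ φ , (1# , ones b) ∷ tailP ⟩ ∎

      pair-Q : ∀ φ → ⟨ φ , gL m q ⟩ ≈ ⟨ φ , (1# , ones a) ∷ tailQ ⟩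
      pair-Q φ = begin
        ⟨ φ , gL m q ⟩
          ≈⟨ trans (pair-++ φ (eL m (q ↓)) _) (+-congʳ (splits leadQ φ)) ⟩
        (φ (ones a) + ⟨ φ , rest leadQ ⟩) + ⟨ φ , scale (- 1#) (eL m (q ↑)) ⟩
          ≈⟨ trans (+-assoc _ _ _) (+-cong (sym (*-identityˡ _)) (sym (pair-++ φ (rest leadQ) _))) ⟩
        ⟨ φ , (1# , ones a) ∷ tailQ ⟩ ∎

      below : ∀ (c : ℕ) k → + c ℤ.- + suc k ℤ.< + c
      below c k = ≡.subst (+ c ℤ.- + suc k ℤ.<_) (ℤ.+-identityʳ (+ c)) (ℤ.+-monoʳ-< (+ c) ℤ.-<+)

      tailP-low : AllExp (Low b) tailP
      tailP-low = ++⁺ (rest-low leadP) (++⁺ (scaled (all-low _ b (+ b ℤ.- + 2) (ℤsolve 2 (λ n b → n ⊟ (((# (+ 2) ⊞ n) ⊟ b) ⊞ # -[1+ 0 ] ⊞ # (+ 1)) ⊜ b ⊟ # (+ 2)) ≡.refl (+ m) (+ b)) (below b 1)))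
        (++⁺ (all-low _ b (+ b ℤ.- + 2) (ℤsolve 2 (λ n b → n ⊟ (((# (+ 2) ⊞ n) ⊟ b) ⊞ # (+ 1) ⊞ # -[1+ 0 ]) ⊜ b ⊟ # (+ 2)) ≡.refl (+ m) (+ b)) (below b 1))
             (scaled (all-low _ b (+ b ℤ.- + 4) (ℤsolve 2 (λ n b → n ⊟ (((# (+ 2) ⊞ n) ⊟ b) ⊞ # (+ 1) ⊞ # (+ 1)) ⊜ b ⊟ # (+ 4)) ≡.refl (+ m) (+ b)) (below b 3)))))

      tailQ-low : AllExp (Low a) tailQ
      tailQ-low = ++⁺ (rest-low leadQ) (scaled (all-low _ a (+ a ℤ.- + 2) (ℤsolve 2 (λ n a → n ⊟ (((# (+ 1) ⊞ n) ⊟ a) ⊞ # (+ 1)) ⊜ a ⊟ # (+ 2)) ≡.refl (+ m) (+ a)) (below a 1)))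

      gLp-bounded : AllExp (Bounded (+ b ℤ.- + 1)) (gL m p)
      gLp-bounded = ++⁺ (all-bounded (p ↓) _ (ℤ.≤-reflexive (ℤsolve 2 (λ n b → n ⊟ (((# (+ 2) ⊞ n) ⊟ b) ⊞ # -[1+ 0 ]) ⊜ b ⊟ # (+ 1)) ≡.refl (+ m) (+ b))))
        (scaled (all-bounded (p ↑) _ (≡.subst (+ m ℤ.- (p ↑) ℤ.≤_) (ℤsolve 2 (λ n b → # (+ 2) ⊞ (n ⊟ (((# (+ 2) ⊞ n) ⊟ b) ⊞ # (+ 1))) ⊜ b ⊟ # (+ 1)) ≡.refl (+ m) (+ b)) (i≤n+i 2 _))))

      YgLq-bounded : AllExp (Bounded (+ 1 ℤ.+ + a)) (YgL m q)
      YgLq-bounded = ++⁺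
        (++⁺ (all-bounded (q ↓ ↓) _ (ℤ.≤-reflexive (ℤsolve 2 (λ n a → n ⊟ (((# (+ 1) ⊞ n) ⊟ a) ⊞ # -[1+ 0 ] ⊞ # -[1+ 0 ]) ⊜ # (+ 1) ⊞ a) ≡.refl (+ m) (+ a))))
             (scaled (all-bounded (q ↓ ↑) _ (≡.subst (+ m ℤ.- (q ↓ ↑) ℤ.≤_) (ℤsolve 2 (λ n a → # (+ 2) ⊞ (n ⊟ (((# (+ 1) ⊞ n) ⊟ a) ⊞ # -[1+ 0 ] ⊞ # (+ 1))) ⊜ # (+ 1) ⊞ a) ≡.refl (+ m) (+ a)) (i≤n+i 2 _)))))
        (++⁺ (all-bounded (q ↑ ↓) _ (≡.subst (+ m ℤ.- (q ↑ ↓) ℤ.≤_) (ℤsolve 2 (λ n a → # (+ 2) ⊞ (n ⊟ (((# (+ 1) ⊞ n) ⊟ a) ⊞ # (+ 1) ⊞ # -[1+ 0 ])) ⊜ # (+ 1) ⊞ a) ≡.refl (+ m) (+ a)) (i≤n+i 2 _)))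
             (scaled (all-bounded (q ↑ ↑) _ (≡.subst (+ m ℤ.- (q ↑ ↑) ℤ.≤_) (ℤsolve 2 (λ n a → # (+ 4) ⊞ (n ⊟ (((# (+ 1) ⊞ n) ⊟ a) ⊞ # (+ 1) ⊞ # (+ 1))) ⊜ # (+ 1) ⊞ a) ≡.refl (+ m) (+ a)) (i≤n+i 4 _)))))

      lowerF : Terms (Exponent m)
      lowerF = (scale 1# (reindex (ones b +ᵉ_) tailQ) ++ tailP ⊛ᵉ ((1# , ones a) ∷ tailQ)) ++ scale (- 1#) (gL m p ⊛ᵉ YgL m q)

      lowerF-≺ : AllExp (_≺ top) lowerF
      lowerF-≺ = ++⁺ (++⁺ (scaled (reindex-All (ones b +ᵉ_) (λ {κ} lo → bounded+low {ones b} {κ} (ones-bounded b b≤m) lo) tailQ tailQ-low))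
          (⊛-All _+ᵉ_ (λ {ν} {κ} → low+bounded {ν} {κ}) tailP-low (ones-bounded a a≤m ∷ All.map proj₁ tailQ-low)))
        (scaled (⊛-All _+ᵉ_ (λ {ν} {κ} → unbalanced {ν} {κ}) gLp-bounded YgLq-bounded))

      pair-F : ∀ φ → ⟨ φ , fL m p q ⟩ ≈ φ top + ⟨ φ , lowerF ⟩
      pair-F φ = begin
        ⟨ φ , YgL m p ⊛ᵉ gL m q ++ scale (- 1#) (gL m p ⊛ᵉ YgL m q) ⟩
          ≈⟨ pair-++ φ (YgL m p ⊛ᵉ gL m q) _ ⟩
        ⟨ φ , YgL m p ⊛ᵉ gL m q ⟩ + ⟨ φ , scale (- 1#) (gL m p ⊛ᵉ YgL m q) ⟩
          ≈⟨ +-congʳ (begin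
               ⟨ φ , YgL m p ⊛ᵉ gL m q ⟩ ≈⟨ pair-⊛ _+ᵉ_ φ (YgL m p) (gL m q) ⟩
               ⟨ (λ ν → ⟨ (λ κ → φ (ν +ᵉ κ)) , gL m q ⟩) , YgL m p ⟩ ≈⟨ trans (pair-cong (YgL m p) (λ ν → pair-Q (λ κ → φ (ν +ᵉ κ)))) (pair-P _) ⟩
               ⟨ (λ ν → ⟨ (λ κ → φ (ν +ᵉ κ)) , (1# , ones a) ∷ tailQ ⟩) , (1# , ones b) ∷ tailP ⟩ ≈⟨ pair-⊛ _+ᵉ_ φ ((1# , ones b) ∷ tailP) ((1# , ones a) ∷ tailQ) ⟨
               ⟨ φ , ((1# , ones b) ∷ tailP) ⊛ᵉ ((1# , ones a) ∷ tailQ) ⟩ ∎) ⟩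
        ((1# * 1#) * φ top + ⟨ φ , scale 1# (reindex (ones b +ᵉ_) tailQ) ++ tailP ⊛ᵉ ((1# , ones a) ∷ tailQ) ⟩) + ⟨ φ , scale (- 1#) (gL m p ⊛ᵉ YgL m q) ⟩
          ≈⟨ trans (+-assoc _ _ _) (+-cong (trans (*-congʳ (*-identityˡ 1#)) (*-identityˡ _)) (sym (pair-++ φ (scale 1# (reindex (ones b +ᵉ_) tailQ) ++ tailP ⊛ᵉ ((1# , ones a) ∷ tailQ)) _))) ⟩
        φ top + ⟨ φ , lowerF ⟩ ∎

    f-expansion : ∀ (μ : Exponent m) → μ ≗ top → Expansion μ (λ x → f (X̂ x) p q)
    f-expansion μ μ≗top = record
      { lower     = lowerF
      ; lower-≺   = All.map (λ (ν≼ , k , lt) → (λ l → ≡.subst (_ ℤ.≤_) (psum-μ l) (ν≼ l)) , k , ≡.subst (_ ℤ.<_) (psum-μ k) lt) lowerF-≺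
      ; value     = λ x → trans (sym (fL-value x p q)) (trans (pair-F (monomial x)) (+-congʳ (sym (monomial-cong x μ≗top))))
      ; constant  = eigenvalueOf m p q
      ; eigen     = λ x R → trans (expand (radial R) (radial-cong R)) (trans (fL-eigen m p q x R) (*-congˡ (sym (expand (monomial x) (monomial-cong x)))))
      ; symmetric = λ σ x → f-cong (e-symmetric σ (val x) (inv x)) p q
      }
      where
      psum-μ : ∀ k → psum top k ≡ psum μ k
      psum-μ k = ≡.sym (psum-cong μ≗top k)
      expand : ∀ φ → Respectful φ → ⟨ φ , (1# , μ) ∷ lowerF ⟩ ≈ ⟨ φ , fL m p q ⟩
      expand φ resp = trans (+-congʳ (trans (*-identityˡ _) (resp μ≗top))) (sym (pair-F φ))
      f-cong : ∀ {X X′ : Fin m → Carrier} → (∀ p → e X p ≈ e X′ p) → ∀ p q → f X p q ≈ f X′ p q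
      f-cong h p q = +-cong (*-cong (Y-cong (Z-cong h) p) (Z-cong h q)) (-‿cong (*-cong (Z-cong h p) (Y-cong (Z-cong h) q)))
      e-symmetric : ∀ {m} (σ : Reflection m) v w p → e (λ a → actᵛ σ v w a + actᵛ σ w v a) p ≈ e (λ a → v a + w a) p
      e-symmetric flip v w p = +-congʳ (*-congʳ (+-comm _ _))
      e-symmetric {suc (suc m)} swap v w p = solve 7 (λ x y u a b c d → y :* (x :* u :+ (a :+ b)) :+ ((x :* a :+ c) :+ (x :* b :+ d)) := x :* (y :* u :+ (a :+ b)) :+ ((y :* a :+ c) :+ (y :* b :+ d))) refl
        (v zero + w zero) (v (suc zero) + w (suc zero)) (e″ p) (e″ (p ↓)) (e″ (p ↑)) (Y e″ (p ↓)) (Y e″ (p ↑))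
        where
        e″ : Seq
        e″ = e {m} λ a → v (suc (suc a)) + w (suc (suc a))
      e-symmetric (shift σ) v w p = +-cong (*-congˡ (e-symmetric σ (v ∘ suc) (w ∘ suc) p)) (Y-cong (e-symmetric σ (v ∘ suc) (w ∘ suc)) p)

  private
    twoOneZero-ones : ∀ {m} c d (i : Fin m) → + twoOneZero c d (toℕ i) ≡ ones c i ℤ.+ ones (c ℕ.+ d) i
    twoOneZero-ones zero    zero    i       = ≡.sym (≡.cong₂ ℤ._+_ (ones-0 i) (ones-0 i))
      where
      ones-0 : ∀ {m} (i : Fin m) → ones 0 i ≡ +0
      ones-0 zero    = ≡.refl
      ones-0 (suc i) = ones-0 i
    twoOneZero-ones zero    (suc d) zero    = ≡.refl
    twoOneZero-ones zero    (suc d) (suc i) = twoOneZero-ones zero d i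
    twoOneZero-ones (suc c) d       zero    = ≡.refl
    twoOneZero-ones (suc c) d       (suc i) = twoOneZero-ones c d i

    dominant : ∀ {m} (part : Fin m → ℕ) → (∀ {i j} → i Fin.≤ j → part j ℕ.≤ part i) → Dominant (λ i → + part i)
    dominant {zero}  part dec = tt
    dominant {suc m} part dec = ℤ.+≤+ ℕ.z≤n , (λ a → ℤ.+≤+ (dec {zero} {suc a} ℕ.z≤n)) , dominant (part ∘ suc) (λ i≤j → dec (ℕ.s≤s i≤j))

  -- The diagram of (2^c,1^d) has columns of lengths c + d and c. One row of the determinant belongs
  -- to each column, and the sum of 1^(c+d) and 1^c is the highest weight.
  jacobi-trudi : ∀ {m} c d → c ℕ.+ d ℕ.≤ m → ∀ {χ} → IsIrreducibleCharacter {m} ⟨2^ c ,1^ d ⟩ χ → ∀ x →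
                 χ x ≈ f (X̂ x) (+ suc (suc m) ℤ.- + c) (+ suc m ℤ.- + (c ℕ.+ d))
  jacobi-trudi {m} c d c+d≤m {χ} irr = expansion-unique (dominant (Partition.part μ) (Partition.decreasing μ)) (irreducible-expansion μ χ irr)
    (f-expansion (c ℕ.+ d) c (ℕ.m≤m+n c d) c+d≤m (weightᵉ μ) (twoOneZero-ones c d))
    where
    μ : Partition m
    μ = ⟨2^ c ,1^ d ⟩

double : ℕ → ℕ
double zero    = zero
double (suc n) = suc (suc (double n))

-- Telescoping of the double alternating sum

module AlternatingSums (K : CommutativeRing 0ℓ 0ℓ) where
  open CommutativeRing K hiding (zero)
  open Arithmetic K
  open Symplectic K using (_^_)
  open SetoidReasoning setoid

  sgn : ℕ → Carrier
  sgn n = (- 1#) ^ n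

  sum-snoc : ∀ n (u : ℕ → Carrier) → sum {suc n} (λ k → u (toℕ k)) ≈ sum {n} (λ k → u (toℕ k)) + u n
  sum-snoc zero    u = +-comm _ _
  sum-snoc (suc n) u = trans (+-congˡ (sum-snoc n (u ∘ suc))) (sym (+-assoc _ _ _))

  private
    sgn-suc : ∀ n x → sgn (suc n) * x ≈ - (sgn n * x)
    sgn-suc n x = solve 2 (λ s x → :-1 :* s :* x := :- (s :* x)) refl (sgn n) x

    sum-sgn-suc : ∀ n (u : ℕ → Carrier) → sum {n} (λ k → sgn (suc (toℕ k)) * u (toℕ k)) ≈ - sum {n} (λ k → sgn (toℕ k) * u (toℕ k))
    sum-sgn-suc n u = trans (sum-cong {n} λ k → sgn-suc (toℕ k) (u (toℕ k))) (sum-neg {n} λ k → sgn (toℕ k) * u (toℕ k))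

    telescope : ∀ k (u : ℕ → Carrier) → sum {suc k} (λ z → sgn (toℕ z) * (u (toℕ z) + u (suc (toℕ z)))) ≈ u 0 + sgn k * u (suc k)
    telescope zero    u = solve 2 (λ a b → :1 :* (a :+ b) :+ :0 := a :+ :1 :* b) refl (u 0) (u 1)
    telescope (suc k) u = begin
      1# * (u 0 + u 1) + sum {suc k} (λ z → sgn (suc (toℕ z)) * (u (suc (toℕ z)) + u (suc (suc (toℕ z)))))
        ≈⟨ +-congˡ (trans (sum-sgn-suc (suc k) (λ z → u (suc z) + u (suc (suc z)))) (-‿cong (telescope k (u ∘ suc)))) ⟩
      1# * (u 0 + u 1) - (u 1 + sgn k * u (suc (suc k)))
        ≈⟨ solve 4 (λ a b s c → :1 :* (a :+ b) :- (b :+ s :* c) := a :+ :-1 :* s :* c) refl (u 0) (u 1) (sgn k) (u (suc (suc k))) ⟩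
      u 0 + sgn (suc k) * u (suc (suc k)) ∎

  module _ (γ : ℕ → Carrier) where
    -- The determinant `f` at p = 2z + s + 2 and q = s + 1, for an arbitrary sequence γ in place of
    -- `g`; the shift s becomes 2l.
    term : ℕ → ℕ → Carrier
    term s z = (γ (suc (double z ℕ.+ s)) + γ (suc (suc (suc (double z ℕ.+ s))))) * γ (suc s) - γ (suc (suc (double z ℕ.+ s))) * (γ s + γ (suc (suc s)))

    doubleSum : ℕ → ℕ → Carrier
    doubleSum h s = sum {suc h} λ l → sum {suc (h ℕ.∸ toℕ l)} λ z → sgn (toℕ z) * term (double (toℕ l) ℕ.+ s) (toℕ z)

    squares : ℕ → Carrier
    squares l = γ (suc l) * γ (suc l) - γ (suc (suc l)) * γ (suc (suc l))

    private
      β : ℕ → ℕ → Carrier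
      β k s = sum {suc k} λ z → sgn (toℕ z) * γ (double (toℕ z) ℕ.+ s)

      shift2 : ∀ l s → double l ℕ.+ suc (suc s) ≡ suc (suc (double l ℕ.+ s))
      shift2 l s = ≡.trans (ℕ.+-suc (double l) (suc s)) (≡.cong suc (ℕ.+-suc (double l) s))

      β-suc : ∀ k s → β (suc k) s ≈ γ s - β k (suc (suc s))
      β-suc k s = +-cong (*-identityˡ _) (trans (sum-sgn-suc (suc k) (λ z → γ (suc (suc (double z ℕ.+ s)))))
        (-‿cong (sum-cong {suc k} λ z → *-congˡ {sgn (toℕ z)} (reflexive (≡.cong γ (≡.sym (shift2 (toℕ z) s)))))))

      -- The first products of the determinants telescope in z down to one square, the far end being
      -- zero by hypothesis. The second ones share a factor free of z and leave an alternating tail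
      -- of γ.
      inner : ∀ k s → γ (suc (suc (suc (double k ℕ.+ s)))) ≈ 0# → sum {suc k} (λ z → sgn (toℕ z) * term s (toℕ z)) ≈ γ (suc s) * γ (suc s) - β k (suc (suc s)) * (γ s + γ (suc (suc s)))
      inner k s end = begin
        sum {suc k} (λ z → sgn (toℕ z) * term s (toℕ z))
          ≈⟨ sum-cong {suc k} (λ z → trans (solve 5 (λ s u a v b → s :* (u :* a :- v :* b) := (s :* u) :* a :+ :- ((s :* v) :* b)) refl (sgn (toℕ z)) (u (toℕ z) + u (suc (toℕ z))) (γ (suc s)) (γ (suc (suc (double (toℕ z) ℕ.+ s)))) (γ s + γ (suc (suc s))))
               (+-congˡ {sgn (toℕ z) * (u (toℕ z) + u (suc (toℕ z))) * γ (suc s)} (-‿cong (*-congʳ (*-congˡ {sgn (toℕ z)} (reflexive (≡.cong γ (≡.sym (shift2 (toℕ z) s))))))))) ⟩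
        sum {suc k} (λ z → sgn (toℕ z) * (u (toℕ z) + u (suc (toℕ z))) * γ (suc s) + - (sgn (toℕ z) * γ (double (toℕ z) ℕ.+ suc (suc s)) * (γ s + γ (suc (suc s)))))
          ≈⟨ ∑-distrib-+ {suc k} (λ z → sgn (toℕ z) * (u (toℕ z) + u (suc (toℕ z))) * γ (suc s)) (λ z → - (sgn (toℕ z) * γ (double (toℕ z) ℕ.+ suc (suc s)) * (γ s + γ (suc (suc s))))) ⟩
        _ ≈⟨ +-cong (trans (sym (*-distribʳ-sum {suc k} (γ (suc s)) (λ z → sgn (toℕ z) * (u (toℕ z) + u (suc (toℕ z)))))) (*-congʳ (trans (telescope k u) (trans (+-congˡ (trans (*-congˡ end) (zeroʳ _))) (+-identityʳ _)))))
               (trans (sum-neg {suc k} (λ z → sgn (toℕ z) * γ (double (toℕ z) ℕ.+ suc (suc s)) * (γ s + γ (suc (suc s))))) (-‿cong (sym (*-distribʳ-sum {suc k} (γ s + γ (suc (suc s))) (λ z → sgn (toℕ z) * γ (double (toℕ z) ℕ.+ suc (suc s))))))) ⟩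
        γ (suc s) * γ (suc s) - β k (suc (suc s)) * (γ s + γ (suc (suc s))) ∎
        where
        u : ℕ → Carrier
        u z = γ (suc (double z ℕ.+ s))

      -- Induction by removing l = 0 and raising s by 2. The correction γ_s β is needed for the
      -- induction: the one at s + 2 cancels against the tail of `inner`, because β_{h+1}(s+2) =
      -- γ_{s+2} - β_h(s+4). At s = 0 it vanishes with γ_0.
      doubleSum-squares′ : ∀ h s → γ (suc (suc (suc (double h ℕ.+ s)))) ≈ 0# →
        doubleSum h s ≈ sum {suc h} (λ l → squares (double (toℕ l) ℕ.+ s)) - γ s * β h (suc (suc s))
      doubleSum-squares′ zero s end = begin
        sum {1} (λ z → sgn (toℕ z) * term s (toℕ z)) + 0#
          ≈⟨ +-congʳ (inner 0 s end) ⟩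
        (γ (suc s) * γ (suc s) - (1# * γ (suc (suc s)) + 0#) * (γ s + γ (suc (suc s)))) + 0#
          ≈⟨ solve 3 (λ a b c → (a :* a :- (:1 :* b :+ :0) :* (c :+ b)) :+ :0 := ((a :* a :- b :* b) :+ :0) :- c :* (:1 :* b :+ :0)) refl (γ (suc s)) (γ (suc (suc s))) (γ s) ⟩
        (squares s + 0#) - γ s * β 0 (suc (suc s)) ∎
      doubleSum-squares′ (suc h) s end = begin
        sum {suc (suc h)} (λ z → sgn (toℕ z) * term s (toℕ z)) + sum {suc h} (λ l → sum {suc (h ℕ.∸ toℕ l)} λ z → sgn (toℕ z) * term (suc (suc (double (toℕ l) ℕ.+ s))) (toℕ z))
          ≈⟨ +-cong (inner (suc h) s end) (sum-cong {suc h} λ l → sum-cong {suc (h ℕ.∸ toℕ l)} λ z → *-congˡ {sgn (toℕ z)} (reflexive (≡.cong (λ n → term n (toℕ z)) (≡.sym (shift2 (toℕ l) s))))) ⟩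
        (γ (suc s) * γ (suc s) - β (suc h) (suc (suc s)) * (γ s + γ (suc (suc s)))) + doubleSum h (suc (suc s))
          ≈⟨ +-congˡ (doubleSum-squares′ h (suc (suc s)) (trans (reflexive (≡.cong (λ n → γ (suc (suc (suc n)))) (shift2 h s))) end)) ⟩
        (γ (suc s) * γ (suc s) - β (suc h) (suc (suc s)) * (γ s + γ (suc (suc s)))) + (T - γ (suc (suc s)) * β h (suc (suc (suc (suc s)))))
          ≈⟨ +-congʳ (+-congˡ (-‿cong (*-congʳ (β-suc h (suc (suc s)))))) ⟩
        (γ (suc s) * γ (suc s) - (γ (suc (suc s)) - B) * (γ s + γ (suc (suc s)))) + (T - γ (suc (suc s)) * B)
          ≈⟨ solve 5 (λ a b c B T → (a :* a :- (b :- B) :* (c :+ b)) :+ (T :- b :* B) := ((a :* a :- b :* b) :+ T) :- c :* (b :- B)) refl (γ (suc s)) (γ (suc (suc s))) (γ s) B T ⟩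
        (squares s + T) - γ s * (γ (suc (suc s)) - B)
          ≈⟨ +-cong (+-congˡ (sum-cong {suc h} λ l → reflexive (≡.cong squares (shift2 (toℕ l) s)))) (-‿cong (*-congˡ (sym (β-suc h (suc (suc s)))))) ⟩
        (squares s + sum {suc h} (λ l → squares (suc (suc (double (toℕ l) ℕ.+ s))))) - γ s * β (suc h) (suc (suc s)) ∎
        where
        T B : Carrier
        T = sum {suc h} (λ l → squares (double (toℕ l) ℕ.+ suc (suc s)))
        B = β h (suc (suc (suc (suc s))))

    doubleSum-squares : ∀ h → γ 0 ≈ 0# → γ (suc (suc (suc (double h)))) ≈ 0# → doubleSum h 0 ≈ sum {suc h} (λ l → squares (double (toℕ l)))
    doubleSum-squares h γ₀ end = trans (doubleSum-squares′ h 0 (trans (reflexive (≡.cong (λ n → γ (suc (suc (suc n)))) (ℕ.+-identityʳ (double h)))) end))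
      (trans (+-congˡ (-‿cong (trans (*-congʳ γ₀) (zeroˡ _)))) (trans (trans (+-congˡ (solve 0 (:- :0 := :0) refl)) (+-identityʳ _))
        (sum-cong {suc h} λ l → reflexive (≡.cong squares (ℕ.+-identityʳ (double (toℕ l)))))))

    module _ (ε : ℕ → Carrier) (γ₀ : γ 0 ≈ 0#) (γ-suc : ∀ n → γ (suc n) ≈ ε n - ε (suc (suc n))) where
      -- The value of the finite window sum treated in `window-partial`, with indices p and -p
      -- folded together so that only nonnegative indices of γ and ε remain.
      partial : ℕ → Carrier
      partial zero    = γ 1 * ε 0
      partial (suc n) = partial n + sgn n * (γ n * ε (suc n) - γ (suc (suc n)) * ε (suc n))

      sgn-double : ∀ h → sgn (double h) ≈ 1#
      sgn-double zero    = refl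
      sgn-double (suc h) = trans (solve 1 (λ s → :-1 :* (:-1 :* s) := s) refl (sgn (double h))) (sgn-double h)

      -- In each square one factor γ_{n+1} is replaced by ε_n - ε_{n+2}; regrouping by the index of
      -- ε gives the increments of `partial`. The two boundary products carry indices of ε beyond
      -- the support in the application.
      squares-partial : ∀ h → sum {suc h} (λ l → squares (double (toℕ l))) ≈ (partial (suc (double h)) - γ (suc (double h)) * ε (suc (suc (double h)))) + γ (suc (suc (double h))) * ε (suc (suc (suc (double h))))
      squares-partial zero = begin
        (γ 1 * γ 1 - γ 2 * γ 2) + 0#
          ≈⟨ +-congʳ (+-cong (*-congˡ (γ-suc 0)) (-‿cong (*-congˡ (γ-suc 1)))) ⟩
        (γ 1 * (ε 0 - ε 2) - γ 2 * (ε 1 - ε 3)) + 0#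
          ≈⟨ solve 6 (λ a b e₀ e₁ e₂ e₃ → (a :* (e₀ :- e₂) :- b :* (e₁ :- e₃)) :+ :0 := ((a :* e₀ :+ :1 :* (:0 :* e₁ :- b :* e₁)) :- a :* e₂) :+ b :* e₃) refl (γ 1) (γ 2) (ε 0) (ε 1) (ε 2) (ε 3) ⟩
        ((γ 1 * ε 0 + 1# * (0# * ε 1 - γ 2 * ε 1)) - γ 1 * ε 2) + γ 2 * ε 3
          ≈⟨ +-congʳ (+-congʳ (+-congˡ (*-congˡ (+-congʳ (*-congʳ (sym γ₀)))))) ⟩
        (partial 1 - γ 1 * ε 2) + γ 2 * ε 3 ∎
      squares-partial (suc h) = begin
        sum {suc (suc h)} (λ l → squares (double (toℕ l)))
          ≈⟨ sum-snoc (suc h) (λ l → squares (double l)) ⟩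
        sum {suc h} (λ l → squares (double (toℕ l))) + squares (suc (suc n))
          ≈⟨ +-cong (squares-partial h) (+-cong (*-congˡ (γ-suc (suc (suc n)))) (-‿cong (*-congˡ (γ-suc (suc (suc (suc n))))))) ⟩
        ((P - γ (suc n) * ε₂) + γ (suc (suc n)) * ε₃) + (c * (ε₂ - ε₄) - d * (ε₃ - ε₅))
          ≈⟨ solve 9 (λ P a b c d e₂ e₃ e₄ e₅ → ((P :- a :* e₂) :+ b :* e₃) :+ (c :* (e₂ :- e₄) :- d :* (e₃ :- e₅)) :=
               (((P :+ (:-1 :* :1) :* (a :* e₂ :- c :* e₂)) :+ (:-1 :* (:-1 :* :1)) :* (b :* e₃ :- d :* e₃)) :- c :* e₄) :+ d :* e₅) refl P (γ (suc n)) (γ (suc (suc n))) c d ε₂ ε₃ ε₄ ε₅ ⟩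
        (((P + - 1# * 1# * (γ (suc n) * ε₂ - c * ε₂)) + - 1# * (- 1# * 1#) * (γ (suc (suc n)) * ε₃ - d * ε₃)) - c * ε₄) + d * ε₅
          ≈⟨ +-congʳ (+-congʳ (+-cong (+-congˡ (*-congʳ (*-congˡ (sym (sgn-double h))))) (*-congʳ (*-congˡ (*-congˡ (sym (sgn-double h))))))) ⟩
        (partial (suc (suc (suc n))) - c * ε₄) + d * ε₅ ∎
        where
        n = double h
        P = partial (suc n)
        c = γ (suc (suc (suc n)))
        d = γ (suc (suc (suc (suc n))))
        ε₂ = ε (suc (suc n))
        ε₃ = ε (suc (suc (suc n)))
        ε₄ = ε (suc (suc (suc (suc n))))
        ε₅ = ε (suc (suc (suc (suc (suc n)))))

-- The binomial sum as two coefficients of a product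

module LeftHandSide (K : CommutativeRing 0ℓ 0ℓ) where
  open CommutativeRing K hiding (zero)
  open Arithmetic K
  open SemiringMult semiring using (×-assoc-*; ×-homo-+)
  open Symplectic K using (_·_; elementarySum; product)
  open DualJacobiTrudi K
  open SetoidReasoning setoid

  private
    total : List Carrier → Carrier
    total = List.foldr _+_ 0#

    total-++ : ∀ xs ys → total (xs ++ ys) ≈ total xs + total ys
    total-++ []       ys = sym (+-identityˡ _)
    total-++ (x ∷ xs) ys = trans (+-congˡ (total-++ xs ys)) (sym (+-assoc _ _ _))

    product-cong : ∀ {k} {u w : Fin k → Carrier} → (∀ j → u j ≈ w j) → product u ≈ product w
    product-cong {zero}  h = refl
    product-cong {suc k} h = *-cong (h zero) (product-cong (h ∘ suc))

    elementary-suc : ∀ {m} k (z : Fin (suc m) → Carrier) → elementarySum (suc k) z ≈ z zero * elementarySum k (z ∘ suc) + elementarySum (suc k) (z ∘ suc)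
    elementary-suc {m} k z = begin
      total (List.map Π (List.map first (increasing k m) ++ List.map (Vec.map suc) (increasing (suc k) m)))
        ≡⟨ ≡.cong total (List.map-++ Π (List.map first (increasing k m)) _) ⟩
      total (List.map Π (List.map first (increasing k m)) ++ List.map Π (List.map (Vec.map suc) (increasing (suc k) m)))
        ≈⟨ total-++ (List.map Π (List.map first (increasing k m))) _ ⟩
      total (List.map Π (List.map first (increasing k m))) + total (List.map Π (List.map (Vec.map suc) (increasing (suc k) m)))
        ≈⟨ +-cong (with-first (increasing k m)) (without-first (increasing (suc k) m)) ⟩
      z zero * elementarySum k (z ∘ suc) + elementarySum (suc k) (z ∘ suc) ∎
      where
      Π : ∀ {k} → Vec (Fin (suc m)) k → Carrier
      Π is = product λ j → z (Vec.lookup is j)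
      first : Vec (Fin m) k → Vec (Fin (suc m)) (suc k)
      first is = zero ∷ Vec.map suc is
      shifted : ∀ {k} (is : Vec (Fin m) k) → Π (Vec.map suc is) ≈ product λ j → z (suc (Vec.lookup is j))
      shifted is = product-cong λ j → reflexive (≡.cong z (lookup-map j suc is))
      with-first : ∀ l → total (List.map Π (List.map first l)) ≈ z zero * total (List.map (λ is → product λ j → z (suc (Vec.lookup is j))) l)
      with-first []       = sym (zeroʳ _)
      with-first (is ∷ l) = trans (+-cong (*-congˡ (shifted is)) (with-first l)) (sym (distribˡ _ _ _))
      without-first : ∀ {k} (l : List (Vec (Fin m) k)) → total (List.map Π (List.map (Vec.map suc) l)) ≈ total (List.map (λ is → product λ j → z (suc (Vec.lookup is j))) l)
      without-first []       = refl
      without-first (is ∷ l) = +-cong (shifted is) (without-first l)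

    elementary-0 : ∀ {m} k (z : Fin m → Carrier) → m ℕ.< k → elementarySum k z ≈ 0#
    elementary-0 {zero}  (suc k) z lt = refl
    elementary-0 {suc m} (suc k) z (ℕ.s≤s lt) = trans (elementary-suc k z) (trans (+-cong (trans (*-congˡ (elementary-0 k (z ∘ suc) lt)) (zeroʳ _)) (elementary-0 (suc k) (z ∘ suc) (ℕ.m≤n⇒m≤1+n lt))) (+-identityˡ 0#))

    -- The left-hand side with an arbitrary weight β(r) for r unchosen indices. An unchosen factor
    -- raises the argument of β by one, which for the weight (y + y⁻¹)^r is multiplication by y +
    -- y⁻¹, so the sum becomes the expansion of ∏ (z_i + y + y⁻¹).
    Ψ : ∀ m → (Fin m → Carrier) → (ℕ → Carrier) → Carrier
    Ψ m z β = sum {suc m} λ k → β (m ℕ.∸ toℕ k) * elementarySum (toℕ k) z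

    Ψ-suc : ∀ m z β → Ψ (suc m) z β ≈ z zero * Ψ m (z ∘ suc) β + Ψ m (z ∘ suc) (β ∘ suc)
    Ψ-suc m z β = begin
      β (suc m) * elementarySum 0 z + sum {suc m} (λ k → β (m ℕ.∸ toℕ k) * elementarySum (suc (toℕ k)) z)
        ≈⟨ +-congˡ (sum-cong {suc m} λ k → trans (*-congˡ {β (m ℕ.∸ toℕ k)} (elementary-suc (toℕ k) z)) (solve 4 (λ b z p q → b :* (z :* p :+ q) := z :* (b :* p) :+ b :* q) refl (β (m ℕ.∸ toℕ k)) (z zero) (elementarySum (toℕ k) z′) (elementarySum (suc (toℕ k)) z′))) ⟩
      β (suc m) * elementarySum 0 z + sum {suc m} (λ k → z zero * (β (m ℕ.∸ toℕ k) * elementarySum (toℕ k) z′) + β (m ℕ.∸ toℕ k) * elementarySum (suc (toℕ k)) z′)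
        ≈⟨ +-congˡ (trans (∑-distrib-+ {suc m} (λ k → z zero * (β (m ℕ.∸ toℕ k) * elementarySum (toℕ k) z′)) (λ k → β (m ℕ.∸ toℕ k) * elementarySum (suc (toℕ k)) z′)) (+-congʳ (sym (*-distribˡ-sum {suc m} (z zero) (λ k → β (m ℕ.∸ toℕ k) * elementarySum (toℕ k) z′))))) ⟩
      β (suc m) * elementarySum 0 z + (z zero * Ψ m z′ β + sum {suc m} (λ k → β (m ℕ.∸ toℕ k) * elementarySum (suc (toℕ k)) z′))
        ≈⟨ solve 3 (λ a b c → a :+ (b :+ c) := b :+ (a :+ c)) refl _ _ _ ⟩
      z zero * Ψ m z′ β + sum {suc (suc m)} (λ k → w (toℕ k))
        -- The extra top term is zero, since m variables admit no increasing tuple of length m + 1.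
        -- Below it the truncated subtraction is exact.
        ≈⟨ +-congˡ (trans (AlternatingSums.sum-snoc K (suc m) w) (trans (+-cong (sum-cong {suc m} λ k → *-congʳ {elementarySum (toℕ k) z′} (reflexive (≡.cong β (ℕ.+-∸-assoc 1 (ℕ.s≤s⁻¹ (Fin.toℕ<n k)))))) (trans (*-congˡ (elementary-0 (suc m) z′ ℕ.≤-refl)) (zeroʳ _))) (+-identityʳ _))) ⟩
      z zero * Ψ m z′ β + Ψ m z′ (β ∘ suc) ∎
      where
      z′ = z ∘ suc
      w : ℕ → Carrier
      w k = β (suc m ℕ.∸ k) * elementarySum k z′

    -- (y + y⁻¹)^r
    Yʳ : ℕ → Seq
    Yʳ zero    = δ₀
    Yʳ (suc r) = Y (Yʳ r)

    Ψ-+ : ∀ m z β β′ → Ψ m z (λ r → β r + β′ r) ≈ Ψ m z β + Ψ m z β′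
    Ψ-+ m z β β′ = trans (sum-cong {suc m} λ k → distribʳ (elementarySum (toℕ k) z) (β (m ℕ.∸ toℕ k)) (β′ (m ℕ.∸ toℕ k))) (∑-distrib-+ {suc m} (λ k → β (m ℕ.∸ toℕ k) * elementarySum (toℕ k) z) (λ k → β′ (m ℕ.∸ toℕ k) * elementarySum (toℕ k) z))

    e-Ψ : ∀ {m} (z : Fin m → Carrier) n → e z n ≈ Ψ m z (λ r → Yʳ r n)
    e-Ψ {zero}  z n = sym (trans (+-identityʳ _) (trans (*-congˡ (+-identityʳ 1#)) (*-identityʳ _)))
    e-Ψ {suc m} z n = trans (+-cong (*-congˡ (e-Ψ (z ∘ suc) n)) (trans (+-cong (e-Ψ (z ∘ suc) _) (e-Ψ (z ∘ suc) _)) (sym (Ψ-+ m (z ∘ suc) (λ r → Yʳ r (n ℤ.+ -[1+ 0 ])) (λ r → Yʳ r (n ℤ.+ + 1))))))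
      (sym (Ψ-suc m z (λ r → Yʳ r n)))

    at : ∀ r {p q} → p ≡ q → Yʳ r p ≈ Yʳ r q
    at r e = reflexive (≡.cong (Yʳ r) e)

    beyond : ∀ r k → Yʳ r (+ (r ℕ.+ suc k)) ≈ 0#
    beyond zero    k = refl
    beyond (suc r) k = trans (+-cong (beyond r k) (trans (at r (≡.cong +_ (eq r k))) (beyond r (suc (suc k))))) (+-identityˡ 0#)
      where
      eq : ∀ r k → suc (r ℕ.+ suc k) ℕ.+ 1 ≡ r ℕ.+ suc (suc (suc k))
      eq r k = ≡.trans (ℕ.+-comm (suc (r ℕ.+ suc k)) 1) (≡.sym (≡.trans (ℕ.+-suc r (suc (suc k))) (≡.cong suc (ℕ.+-suc r (suc k)))))

    _·1 : ℕ → Carrier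
    n ·1 = n · 1#

    binomial : ∀ r j → Yʳ r (+ r ℤ.- + double j) ≈ (r C j) ·1
    binomial zero    zero    = sym (+-identityʳ 1#)
    binomial zero    (suc j) = refl
    binomial (suc r) zero    = trans (+-cong (trans (at r (ℤsolve 1 (λ r → (# (+ 1) ⊞ r) ⊞ # +0 ⊞ # -[1+ 0 ] ⊜ r ⊞ # +0) ≡.refl (+ r))) (binomial r zero))
      (trans (at r (ℤsolve 1 (λ r → (# (+ 1) ⊞ r) ⊞ # +0 ⊞ # (+ 1) ⊜ r ⊞ # (+ 2)) ≡.refl (+ r))) (beyond r 1))) (trans (+-identityʳ _) (reflexive (≡.cong _·1 (≡.trans (C0 r) (≡.sym (C0 (suc r)))))))
      where
      C0 : ∀ n → n C 0 ≡ 1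
      C0 n = ≡.trans (nCk≡nC[n∸k] {0} {n} ℕ.z≤n) (nCn≡1 n)
    binomial (suc r) (suc j) = begin
      Yʳ r (+ suc r ℤ.- + double (suc j) ℤ.+ -[1+ 0 ]) + Yʳ r (+ suc r ℤ.- + double (suc j) ℤ.+ + 1)
        ≈⟨ +-cong (trans (at r (ℤsolve 2 (λ r d → ((# (+ 1) ⊞ r) ⊟ d) ⊞ # -[1+ 0 ] ⊜ r ⊟ d) ≡.refl (+ r) (+ double (suc j)))) (binomial r (suc j)))
             (trans (at r (ℤsolve 2 (λ r d → ((# (+ 1) ⊞ r) ⊟ (# (+ 2) ⊞ d)) ⊞ # (+ 1) ⊜ r ⊟ d) ≡.refl (+ r) (+ double j))) (binomial r j)) ⟩
      (r C suc j) ·1 + (r C j) ·1 ≈⟨ +-comm _ _ ⟩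
      (r C j) ·1 + (r C suc j) ·1 ≈⟨ ×-homo-+ 1# (r C j) (r C suc j) ⟨
      (r C j ℕ.+ r C suc j) ·1 ≡⟨ ≡.cong _·1 (nCk+nC[k+1]≡[n+1]C[k+1] r j) ⟩
      (suc r C suc j) ·1 ∎

    odd-vanishes : ∀ r j → Yʳ r (+ suc r ℤ.- + double j) ≈ 0#
    odd-vanishes zero    zero    = refl
    odd-vanishes zero    (suc j) = refl
    odd-vanishes (suc r) zero    = trans (+-cong (trans (at r (ℤsolve 1 (λ r → (# (+ 2) ⊞ r) ⊞ # +0 ⊞ # -[1+ 0 ] ⊜ (# (+ 1) ⊞ r) ⊞ # +0) ≡.refl (+ r))) (odd-vanishes r zero))
      (trans (at r (ℤsolve 1 (λ r → (# (+ 2) ⊞ r) ⊞ # +0 ⊞ # (+ 1) ⊜ r ⊞ # (+ 3)) ≡.refl (+ r))) (beyond r 2))) (+-identityˡ 0#)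
    odd-vanishes (suc r) (suc j) = trans (+-cong
      (trans (at r (ℤsolve 2 (λ r d → ((# (+ 2) ⊞ r) ⊟ d) ⊞ # -[1+ 0 ] ⊜ (# (+ 1) ⊞ r) ⊟ d) ≡.refl (+ r) (+ double (suc j)))) (odd-vanishes r (suc j)))
      (trans (at r (ℤsolve 2 (λ r d → ((# (+ 2) ⊞ r) ⊟ (# (+ 2) ⊞ d)) ⊞ # (+ 1) ⊜ (# (+ 1) ⊞ r) ⊟ d) ≡.refl (+ r) (+ double j))) (odd-vanishes r j))) (+-identityˡ 0#)

    halves : ∀ r → r ≡ double ℕ.⌊ r /2⌋ ⊎ r ≡ suc (double ℕ.⌊ r /2⌋)
    halves zero          = inj₁ ≡.refl
    halves (suc zero)    = inj₂ ≡.refl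
    halves (suc (suc r)) with halves r
    ... | inj₁ p = inj₁ (≡.cong (λ n → suc (suc n)) p)
    ... | inj₂ p = inj₂ (≡.cong (λ n → suc (suc n)) p)

    -- Only exponents of the parity of r occur in (y + y⁻¹)^r, so exactly one of y⁰ and y¹
    -- contributes, and it is the central binomial coefficient. This is the origin of the floor in
    -- the theorem.
    central : ∀ r → Yʳ r +0 + Yʳ r (+ 1) ≈ (r C ℕ.⌊ r /2⌋) ·1
    central r with halves r
    ... | inj₁ p = trans (+-cong (trans (at r (zero≡ r (double ℕ.⌊ r /2⌋) p)) (binomial r ℕ.⌊ r /2⌋)) (trans (at r (one≡ r (double ℕ.⌊ r /2⌋) p)) (odd-vanishes r ℕ.⌊ r /2⌋))) (+-identityʳ _)
      where
      zero≡ : ∀ r d → r ≡ d → +0 ≡ + r ℤ.- + d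
      zero≡ r _ ≡.refl = ≡.sym (ℤ.+-inverseʳ (+ r))
      one≡ : ∀ r d → r ≡ d → + 1 ≡ + suc r ℤ.- + d
      one≡ r _ ≡.refl = ℤsolve 1 (λ r → # (+ 1) ⊜ (# (+ 1) ⊞ r) ⊟ r) ≡.refl (+ r)
    ... | inj₂ p = trans (+-cong (trans (at r (zero≡ r (double ℕ.⌊ r /2⌋) p)) (odd-vanishes r (suc ℕ.⌊ r /2⌋))) (trans (at r (one≡ r (double ℕ.⌊ r /2⌋) p)) (binomial r ℕ.⌊ r /2⌋))) (+-identityˡ _)
      where
      zero≡ : ∀ r d → r ≡ suc d → +0 ≡ + suc r ℤ.- + suc (suc d)
      zero≡ r d ≡.refl = ≡.sym (ℤ.+-inverseʳ (+ suc (suc d)))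
      one≡ : ∀ r d → r ≡ suc d → + 1 ≡ + r ℤ.- + d
      one≡ r d ≡.refl = ℤsolve 1 (λ d → # (+ 1) ⊜ (# (+ 1) ⊞ d) ⊟ d) ≡.refl (+ d)

  binomial-sum : ∀ {m} (z : Fin m → Carrier) → sum {suc m} (λ k → ((m ℕ.∸ toℕ k) C ℕ.⌊ m ℕ.∸ toℕ k /2⌋) · elementarySum (toℕ k) z) ≈ e z +0 + e z (+ 1)
  binomial-sum {m} z = begin
    sum {suc m} (λ k → ((m ℕ.∸ toℕ k) C ℕ.⌊ m ℕ.∸ toℕ k /2⌋) · elementarySum (toℕ k) z)
      ≈⟨ sum-cong {suc m} (λ k → trans (sym (trans (×-assoc-* (c (m ℕ.∸ toℕ k)) 1# (elementarySum (toℕ k) z)) (×-congʳ (c (m ℕ.∸ toℕ k)) (*-identityˡ _)))) (*-congʳ (sym (central (m ℕ.∸ toℕ k))))) ⟩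
    Ψ m z (λ r → Yʳ r +0 + Yʳ r (+ 1))
      ≈⟨ Ψ-+ m z (λ r → Yʳ r +0) (λ r → Yʳ r (+ 1)) ⟩
    Ψ m z (λ r → Yʳ r +0) + Ψ m z (λ r → Yʳ r (+ 1))
      ≈⟨ +-cong (e-Ψ z +0) (e-Ψ z (+ 1)) ⟨
    e z +0 + e z (+ 1) ∎
    where
    open MonoidMult +-monoid using (×-congʳ)
    c : ℕ → ℕ
    c r = r C ℕ.⌊ r /2⌋

-- The product at iy and -iy, and the signed squares

module SignedSquares (K : CommutativeRing 0ℓ 0ℓ) where
  open CommutativeRing K hiding (zero)
  open Arithmetic K
  open Powers K
  open DualJacobiTrudi K
  open AlternatingSums K
  open SetoidReasoning setoid

  private
    at : ∀ (u : Seq) {p q} → p ≡ q → u p ≈ u q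
    at u e = reflexive (≡.cong u e)

  e-cong : ∀ {m} {X X′ : Fin m → Carrier} → (∀ i → X i ≈ X′ i) → ∀ p → e X p ≈ e X′ p
  e-cong {zero}  h p = refl
  e-cong {suc m} h p = +-cong (*-cong (h zero) (e-cong (h ∘ suc) p)) (+-cong (e-cong (h ∘ suc) _) (e-cong (h ∘ suc) _))

  e-even : ∀ {m} (X : Fin m → Carrier) p → e X (ℤ.- p) ≈ e X p
  e-even {zero}  X +0         = refl
  e-even {zero}  X ℤ.+[1+ n ] = refl
  e-even {zero}  X -[1+ n ]   = refl
  e-even {suc m} X p = +-cong (*-congˡ (e-even X′ p)) (trans (+-cong
    (trans (at (e X′) (≡.sym (ℤ.neg-distrib-+ p (+ 1)))) (e-even X′ (p ↑)))
    (trans (at (e X′) (≡.sym (ℤ.neg-distrib-+ p -[1+ 0 ]))) (e-even X′ (p ↓)))) (+-comm _ _))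
    where X′ = X ∘ suc

  e-beyond : ∀ {m} (X : Fin m → Carrier) n → m ℕ.< n → e X (+ n) ≈ 0#
  e-beyond {zero}  X (suc n) lt = refl
  e-beyond {suc m} X (suc n) (ℕ.s≤s lt) = trans (+-cong (trans (*-congˡ (e-beyond X′ (suc n) (ℕ.m≤n⇒m≤1+n lt))) (zeroʳ _))
    (trans (+-cong (e-beyond X′ n lt) (e-beyond X′ (suc n ℕ.+ 1) (ℕ.≤-trans (ℕ.m≤n⇒m≤1+n lt) (ℕ.m≤m+n (suc n) 1)))) (+-identityˡ 0#))) (+-identityˡ 0#)
    where X′ = X ∘ suc

  g-odd : ∀ {m} (X : Fin m → Carrier) p → g X (ℤ.- p) ≈ - g X p
  g-odd X p = trans (+-cong (trans (at (e X) (≡.sym (ℤ.neg-distrib-+ p (+ 1)))) (e-even X (p ↑)))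
    (-‿cong (trans (at (e X) (≡.sym (ℤ.neg-distrib-+ p -[1+ 0 ]))) (e-even X (p ↓)))))
    (solve 2 (λ a b → a :- b := :- (b :- a)) refl (e X (p ↑)) (e X (p ↓)))

  -- The sum over |p| ≤ n, a finite substitute for the sum over all integers; n is taken at least as
  -- large as the support of `e`.
  window : ℕ → Seq → Carrier
  window zero    u = u +0
  window (suc n) u = window n u + (u (+ suc n) + u -[1+ n ])

  window-cong : ∀ n {u w : Seq} → (∀ p → u p ≈ w p) → window n u ≈ window n w
  window-cong zero    h = h +0
  window-cong (suc n) h = +-cong (window-cong n h) (+-cong (h _) (h _))

  window-+ : ∀ n (u w : Seq) → window n (λ p → u p + w p) ≈ window n u + window n w
  window-+ zero    u w = refl
  window-+ (suc n) u w = trans (+-congʳ (window-+ n u w)) (solve 6 (λ a b c d s t → (a :+ b) :+ ((c :+ d) :+ (s :+ t)) := (a :+ (c :+ s)) :+ (b :+ (d :+ t))) refl _ _ _ _ _ _)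

  window-* : ∀ n c (u : Seq) → window n (λ p → c * u p) ≈ c * window n u
  window-* zero    c u = refl
  window-* (suc n) c u = trans (+-congʳ (window-* n c u)) (solve 4 (λ c a b d → c :* a :+ (c :* b :+ c :* d) := c :* (a :+ (b :+ d))) refl c _ _ _)

  window-shift : ∀ n (u : Seq) → window n (λ p → u (p ↑)) + u (ℤ.- + n) ≈ window n u + u (+ suc n)
  window-shift zero    u = +-comm _ _
  window-shift (suc n) u = begin
    (window n (λ p → u (p ↑)) + (u (+ (suc n ℕ.+ 1)) + u (-[1+ n ] ↑))) + u -[1+ n ]
      ≈⟨ +-congʳ (+-congˡ (+-cong (at u (≡.cong +_ (ℕ.+-comm (suc n) 1))) (at u (lower n)))) ⟩
    (window n (λ p → u (p ↑)) + (u (+ suc (suc n)) + u (ℤ.- + n))) + u -[1+ n ]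
      ≈⟨ solve 4 (λ a b c d → (a :+ (b :+ c)) :+ d := (a :+ c) :+ (b :+ d)) refl _ _ _ _ ⟩
    (window n (λ p → u (p ↑)) + u (ℤ.- + n)) + (u (+ suc (suc n)) + u -[1+ n ])
      ≈⟨ +-congʳ (window-shift n u) ⟩
    (window n u + u (+ suc n)) + (u (+ suc (suc n)) + u -[1+ n ])
      ≈⟨ solve 4 (λ a b c d → (a :+ b) :+ (c :+ d) := (a :+ (b :+ d)) :+ c) refl _ _ _ _ ⟩
    (window n u + (u (+ suc n) + u -[1+ n ])) + u (+ suc (suc n)) ∎
    where
    lower : ∀ n → -[1+ n ] ↑ ≡ ℤ.- + n
    lower zero    = ≡.refl
    lower (suc n) = ≡.refl

  -- Summation by parts: `Y` is self-adjoint, and the boundary values shifted in and out of the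
  -- window lie beyond the support of the smaller product.
  window-e : ∀ {m} (X : Fin (suc m) → Carrier) n → m ℕ.< n → ∀ (φ : Seq) →
    window n (λ p → φ p * e X p) ≈ X zero * window n (λ p → φ p * e (X ∘ suc) p) + window n (λ p → Y φ p * e (X ∘ suc) p)
  window-e X n m<n φ = begin
    window n (λ p → φ p * (X zero * e′ p + (e′ (p ↓) + e′ (p ↑))))
      ≈⟨ window-cong n (λ p → solve 5 (λ f x a b c → f :* (x :* a :+ (b :+ c)) := x :* (f :* a) :+ (f :* c :+ f :* b)) refl (φ p) (X zero) (e′ p) (e′ (p ↓)) (e′ (p ↑))) ⟩
    window n (λ p → X zero * (φ p * e′ p) + (φ p * e′ (p ↑) + φ p * e′ (p ↓)))
      ≈⟨ trans (window-+ n _ _) (+-cong (window-* n (X zero) _) (trans (window-+ n _ _) (+-cong up down))) ⟩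
    X zero * window n (λ p → φ p * e′ p) + (window n (λ p → φ (p ↓) * e′ p) + window n (λ p → φ (p ↑) * e′ p))
      ≈⟨ +-congˡ (trans (sym (window-+ n _ _)) (window-cong n λ p → sym (distribʳ _ _ _))) ⟩
    X zero * window n (λ p → φ p * e′ p) + window n (λ p → Y φ p * e′ p) ∎
    where
    e′ = e (X ∘ suc)
    vanishing : ∀ k → n ℕ.≤ k → e′ (+ k) ≈ 0#
    vanishing k n≤k = e-beyond (X ∘ suc) k (ℕ.≤-trans m<n n≤k)
    shifted : ∀ (u : Seq) → u (ℤ.- + n) ≈ 0# → u (+ suc n) ≈ 0# → window n (λ p → u (p ↑)) ≈ window n u
    shifted u lo hi = trans (sym (trans (+-congˡ lo) (+-identityʳ _))) (trans (window-shift n u) (trans (+-congˡ hi) (+-identityʳ _)))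
    up : window n (λ p → φ p * e′ (p ↑)) ≈ window n (λ p → φ (p ↓) * e′ p)
    up = trans (window-cong n λ p → *-congʳ (at φ (≡.sym (≡.trans (ℤ.+-assoc p (+ 1) -[1+ 0 ]) (ℤ.+-identityʳ p)))))
      (shifted (λ p → φ (p ↓) * e′ p) (trans (*-congˡ (trans (e-even (X ∘ suc) (+ n)) (vanishing n ℕ.≤-refl))) (zeroʳ _)) (trans (*-congˡ (vanishing (suc n) (ℕ.n≤1+n n))) (zeroʳ _)))
    down : window n (λ p → φ p * e′ (p ↓)) ≈ window n (λ p → φ (p ↑) * e′ p)
    down = sym (trans (window-cong n λ p → *-congˡ (at e′ (≡.sym (≡.trans (ℤ.+-assoc p (+ 1) -[1+ 0 ]) (ℤ.+-identityʳ p)))))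
      (shifted (λ p → φ p * e′ (p ↓))
        (trans (*-congˡ (trans (at e′ (≡.sym (ℤ.neg-distrib-+ (+ n) (+ 1)))) (trans (e-even (X ∘ suc) (+ (n ℕ.+ 1))) (vanishing (n ℕ.+ 1) (ℕ.m≤m+n n 1))))) (zeroʳ _))
        (trans (*-congˡ (vanishing n ℕ.≤-refl)) (zeroʳ _))))

  s : ℤ → Carrier
  s = pow (- 1#) (- 1#)

  private
    -1²≈1 : - 1# * - 1# ≈ 1#
    -1²≈1 = solve 0 (:-1 :* :-1 := :1) refl

    s-odd : ∀ p q → q ≡ + 1 ⊎ q ≡ -[1+ 0 ] → s (p ℤ.+ q) ≈ - s p
    s-odd p _ (inj₁ ≡.refl) = trans (pow-+ (- 1#) (- 1#) -1²≈1 p (+ 1)) (solve 1 (λ s → s :* (:-1 :* :1) := :- s) refl (s p))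
    s-odd p _ (inj₂ ≡.refl) = trans (pow-+ (- 1#) (- 1#) -1²≈1 p -[1+ 0 ]) (solve 1 (λ s → s :* (:-1 :* :1) := :- s) refl (s p))

    s-flip : ∀ {p q} → q ≡ p ↑ ⊎ q ≡ p ↓ → s q ≈ - s p
    s-flip {p} (inj₁ ≡.refl) = s-odd p _ (inj₁ ≡.refl)
    s-flip {p} (inj₂ ≡.refl) = s-odd p _ (inj₂ ≡.refl)

  -- ∏ (X_i² - 2 + y² + y⁻²) is the product of the values of ∏ (X_i + t + t⁻¹) at
  -- t = i y and t = - i y.
  e-squares : ∀ {m} (X : Fin m → Carrier) n → m ℕ.≤ n → ∀ k →
    e (λ i → X i * X i - 2#) k ≈ window n (λ p → s (k ℤ.- p) * e X (k ℤ.+ k ℤ.- p) * e X p)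
  e-squares {zero} X n _ k = sym (trans (centre n _ (λ _ → zeroʳ _) (λ _ → zeroʳ _)) (base k))
    where
    centre : ∀ n (u : Seq) → (∀ j → u (+ suc j) ≈ 0#) → (∀ j → u -[1+ j ] ≈ 0#) → window n u ≈ u +0
    centre zero    u hi lo = refl
    centre (suc n) u hi lo = trans (+-cong (centre n u hi lo) (trans (+-cong (hi n) (lo n)) (+-identityˡ 0#))) (+-identityʳ _)
    base : ∀ k → s (k ℤ.- +0) * δ₀ (k ℤ.+ k ℤ.- +0) * 1# ≈ δ₀ k
    base +0         = solve 0 (:1 :* :1 :* :1 := :1) refl
    base ℤ.+[1+ j ] = trans (*-congʳ (zeroʳ _)) (zeroˡ 1#)
    base -[1+ j ]   = trans (*-congʳ (zeroʳ _)) (zeroˡ 1#)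
  e-squares {suc m} X n m<n k = sym (begin
    window n (λ p → φ p * e X p)
      ≈⟨ window-e X n m<n φ ⟩
    x * window n (λ p → φ p * e′ p) + window n (λ p → Y φ p * e′ p)
      ≈⟨ +-congʳ (sym (window-* n x _)) ⟩
    window n (λ p → x * (φ p * e′ p)) + window n (λ p → Y φ p * e′ p)
      ≈⟨ window-+ n _ _ ⟨
    window n (λ p → x * (φ p * e′ p) + Y φ p * e′ p)
      ≈⟨ window-cong n pointwise ⟩
    window n (λ p → (x * x - 2#) * U k p + (U (k ↓) p + U (k ↑) p))
      ≈⟨ trans (window-+ n _ _) (+-cong (window-* n (x * x - 2#) (U k)) (window-+ n _ _)) ⟩
    (x * x - 2#) * window n (U k) + (window n (U (k ↓)) + window n (U (k ↑)))
      ≈⟨ +-cong (*-congˡ (ih k)) (+-cong (ih (k ↓)) (ih (k ↑))) ⟨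
    e (λ i → X i * X i - 2#) k ∎)
    where
    x = X zero
    e′ = e (X ∘ suc)
    φ : Seq
    φ p = s (k ℤ.- p) * e X (k ℤ.+ k ℤ.- p)
    U : ℤ → Seq
    U k p = s (k ℤ.- p) * e′ (k ℤ.+ k ℤ.- p) * e′ p
    ih : ∀ k → e (λ i → X (suc i) * X (suc i) - 2#) k ≈ window n (U k)
    ih = e-squares (X ∘ suc) n (ℕ.≤-trans (ℕ.n≤1+n m) m<n)
    -- Each unit shift changes the sign of `s`, so the terms linear in x cancel. The two returning
    -- shifts give the -2, and the double shifts give the neighbours `k ↓` and `k ↑`.
    pointwise : ∀ p → x * (φ p * e′ p) + Y φ p * e′ p ≈ (x * x - 2#) * U k p + (U (k ↓) p + U (k ↑) p)
    pointwise p = begin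
      x * (S * (x * E₀ + (E₋ + E₊)) * e′ p) + (s (k ℤ.- (p ↓)) * e X (k ℤ.+ k ℤ.- (p ↓)) + s (k ℤ.- (p ↑)) * e X (k ℤ.+ k ℤ.- (p ↑))) * e′ p
        ≈⟨ +-congˡ (*-congʳ (+-cong
             (*-cong (s-flip {k ℤ.- p} (inj₁ (ℤsolve 2 (λ k p → k ⊟ (p ⊞ # -[1+ 0 ]) ⊜ (k ⊟ p) ⊞ # (+ 1)) ≡.refl k p)))
               (trans (at (e X) (ℤsolve 2 (λ k p → (k ⊞ k) ⊟ (p ⊞ # -[1+ 0 ]) ⊜ (k ⊞ k ⊟ p) ⊞ # (+ 1)) ≡.refl k p)) (+-congˡ (+-congʳ (at e′ (ℤsolve 1 (λ r → r ⊞ # (+ 1) ⊞ # -[1+ 0 ] ⊜ r) ≡.refl r))))))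
             (*-cong (s-flip {k ℤ.- p} (inj₂ (ℤsolve 2 (λ k p → k ⊟ (p ⊞ # (+ 1)) ⊜ (k ⊟ p) ⊞ # -[1+ 0 ]) ≡.refl k p)))
               (trans (at (e X) (ℤsolve 2 (λ k p → (k ⊞ k) ⊟ (p ⊞ # (+ 1)) ⊜ (k ⊞ k ⊟ p) ⊞ # -[1+ 0 ]) ≡.refl k p)) (+-congˡ (+-congˡ (at e′ (ℤsolve 1 (λ r → r ⊞ # -[1+ 0 ] ⊞ # (+ 1) ⊜ r) ≡.refl r)))))))) ⟩
      x * (S * (x * E₀ + (E₋ + E₊)) * e′ p) + (- S * (x * E₊ + (E₀ + E₊₊)) + - S * (x * E₋ + (E₋₋ + E₀))) * e′ p
        ≈⟨ solve 8 (λ x S a b c d f t → x :* (S :* (x :* a :+ (b :+ c)) :* t) :+ ((:- S) :* (x :* c :+ (a :+ d)) :+ (:- S) :* (x :* b :+ (f :+ a))) :* t :=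
             (x :* x :- :2) :* (S :* a :* t) :+ ((:- S) :* f :* t :+ (:- S) :* d :* t)) refl x S E₀ E₋ E₊ E₊₊ E₋₋ (e′ p) ⟩
      (x * x - 2#) * U k p + (- S * E₋₋ * e′ p + - S * E₊₊ * e′ p)
        ≈⟨ +-congˡ (+-cong
             (*-congʳ (*-cong (sym (s-flip {k ℤ.- p} (inj₂ (ℤsolve 2 (λ k p → (k ⊞ # -[1+ 0 ]) ⊟ p ⊜ (k ⊟ p) ⊞ # -[1+ 0 ]) ≡.refl k p))))
               (at e′ (ℤsolve 2 (λ k p → (k ⊞ k ⊟ p) ⊞ # -[1+ 0 ] ⊞ # -[1+ 0 ] ⊜ ((k ⊞ # -[1+ 0 ]) ⊞ (k ⊞ # -[1+ 0 ])) ⊟ p) ≡.refl k p))))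
             (*-congʳ (*-cong (sym (s-flip {k ℤ.- p} (inj₁ (ℤsolve 2 (λ k p → (k ⊞ # (+ 1)) ⊟ p ⊜ (k ⊟ p) ⊞ # (+ 1)) ≡.refl k p))))
               (at e′ (ℤsolve 2 (λ k p → (k ⊞ k ⊟ p) ⊞ # (+ 1) ⊞ # (+ 1) ⊜ ((k ⊞ # (+ 1)) ⊞ (k ⊞ # (+ 1))) ⊟ p) ≡.refl k p))))) ⟩
      (x * x - 2#) * U k p + (U (k ↓) p + U (k ↑) p) ∎
      where
      r = k ℤ.+ k ℤ.- p
      S = s (k ℤ.- p)
      E₀ = e′ r
      E₋ = e′ (r ↓)
      E₊ = e′ (r ↑)
      E₋₋ = e′ (r ↓ ↓)
      E₊₊ = e′ (r ↑ ↑)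

  module _ {m} (X : Fin m → Carrier) where
    γ ε : ℕ → Carrier
    γ n = g X (+ n)
    ε n = e X (+ n)

    γ-0 : γ 0 ≈ 0#
    γ-0 = x≈y⇒x-y≈0 (e-even X (+ 1))

    γ-suc : ∀ n → γ (suc n) ≈ ε n - ε (suc (suc n))
    γ-suc n = +-congˡ (-‿cong (at (e X) (≡.cong (λ k → + suc k) (ℕ.+-comm n 1))))

    private
      -- By evenness of `e` the convolutions for k = 0 and k = 1 involve e at p and at p - 2 with
      -- opposite signs, and their difference is a value of `g` at p - 1.
      difference : ∀ n → m ℕ.≤ n → e (λ i → X i * X i - 2#) +0 + e (λ i → X i * X i - 2#) (+ 1) ≈ window n (λ p → - s p * g X (p ↓) * e X p)
      difference n m≤n = trans (+-cong (e-squares X n m≤n +0) (e-squares X n m≤n (+ 1))) (trans (sym (window-+ n _ _)) (window-cong n pointwise))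
        where
        s-even : ∀ p → s (ℤ.- p) ≈ s p
        s-even p = sym (pow-swap (- 1#) (- 1#) p)
        pointwise : ∀ p → s (+0 ℤ.- p) * e X (+0 ℤ.- p) * e X p + s (+ 1 ℤ.- p) * e X (+ 2 ℤ.- p) * e X p ≈ - s p * g X (p ↓) * e X p
        pointwise p = begin
          s (+0 ℤ.- p) * e X (+0 ℤ.- p) * e X p + s (+ 1 ℤ.- p) * e X (+ 2 ℤ.- p) * e X p
            ≈⟨ +-cong (*-congʳ (*-cong (trans (at s (ℤ.+-identityˡ (ℤ.- p))) (s-even p)) (trans (at (e X) (ℤ.+-identityˡ (ℤ.- p))) (trans (e-even X p) (at (e X) (ℤsolve 1 (λ p → p ⊜ p ⊞ # -[1+ 0 ] ⊞ # (+ 1)) ≡.refl p))))))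
                 (*-congʳ (*-cong (trans (s-flip {ℤ.- p} (inj₁ (ℤ.+-comm (+ 1) (ℤ.- p)))) (-‿cong (s-even p))) (trans (at (e X) (ℤsolve 1 (λ p → # (+ 2) ⊟ p ⊜ ⊟ (p ⊞ # -[1+ 0 ] ⊞ # -[1+ 0 ])) ≡.refl p)) (e-even X _)))) ⟩
          s p * e X (p ↓ ↑) * e X p + - s p * e X (p ↓ ↓) * e X p
            ≈⟨ solve 4 (λ s a b t → s :* a :* t :+ (:- s) :* b :* t := (:- s) :* (b :- a) :* t) refl (s p) (e X (p ↓ ↑)) (e X (p ↓ ↓)) (e X p) ⟩
          - s p * g X (p ↓) * e X p ∎

      -- The terms at n + 1 and -(n + 1) are combined using that `g` is odd and `e` even.
      window-partial : ∀ n → window n (λ p → - s p * g X (p ↓) * e X p) ≈ partial γ ε γ-0 γ-suc n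
      window-partial zero    = trans (*-congʳ (*-congˡ (g-odd X (+ 1)))) (solve 2 (λ a b → :-1 :* (:- a) :* b := a :* b) refl (γ 1) (ε 0))
      window-partial (suc n) = +-cong (window-partial n) (begin
        - s (+ suc n) * g X (+ n) * ε (suc n) + - s -[1+ n ] * g X (-[1+ n ] ↓) * e X -[1+ n ]
          ≈⟨ +-congˡ (*-cong (*-congˡ (trans (at (g X) (≡.sym (ℤ.neg-distrib-+ (+ suc n) (+ 1)))) (trans (g-odd X (+ (suc n ℕ.+ 1))) (-‿cong (at (g X) (≡.cong +_ (ℕ.+-comm (suc n) 1))))))) (e-even X (+ suc n))) ⟩
        - ((- 1#) * sgn n) * γ n * ε (suc n) + - ((- 1#) * sgn n) * - γ (suc (suc n)) * ε (suc n)
          ≈⟨ solve 4 (λ s a b t → (:- (:-1 :* s)) :* a :* t :+ (:- (:-1 :* s)) :* (:- b) :* t := s :* (a :* t :- b :* t)) refl (sgn n) (γ n) (γ (suc (suc n))) (ε (suc n)) ⟩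
        sgn n * (γ n * ε (suc n) - γ (suc (suc n)) * ε (suc n)) ∎)

    γ-beyond : ∀ n → m ℕ.< n → γ (suc n) ≈ 0#
    γ-beyond n m<n = trans (γ-suc n) (trans (+-cong (e-beyond X n m<n) (-‿cong (e-beyond X (suc (suc n)) (ℕ.≤-trans m<n (ℕ.m≤n+m n 2))))) (-‿inverseʳ 0#))

    -- The bound on m does three things: it makes the telescoping end at a vanishing γ, kills both
    -- boundary products, and lets the window cover the support.
    doubleSum-γ : ∀ h → m ℕ.≤ suc (double h) → doubleSum γ h 0 ≈ e (λ i → X i * X i - 2#) +0 + e (λ i → X i * X i - 2#) (+ 1)
    doubleSum-γ h m≤ = begin
      doubleSum γ h 0
        ≈⟨ doubleSum-squares γ h γ-0 (γ-beyond n (ℕ.s≤s m≤)) ⟩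
      sum {suc h} (λ l → squares γ (double (toℕ l)))
        ≈⟨ squares-partial γ ε γ-0 γ-suc h ⟩
      (partial γ ε γ-0 γ-suc (suc (double h)) - γ (suc (double h)) * ε n) + γ n * ε (suc n)
        ≈⟨ +-cong (+-cong (sym (window-partial (suc (double h)))) (-‿cong (trans (*-congˡ (e-beyond X n (ℕ.s≤s m≤))) (zeroʳ _)))) (trans (*-congˡ (e-beyond X (suc n) (ℕ.m≤n⇒m≤1+n (ℕ.s≤s m≤)))) (zeroʳ _)) ⟩
      (window (suc (double h)) (λ p → - s p * g X (p ↓) * e X p) - 0#) + 0#
        ≈⟨ solve 1 (λ a → (a :- :0) :+ :0 := a) refl _ ⟩
      window (suc (double h)) (λ p → - s p * g X (p ↓) * e X p)
        ≈⟨ difference (suc (double h)) m≤ ⟨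
      e (λ i → X i * X i - 2#) +0 + e (λ i → X i * X i - 2#) (+ 1) ∎
      where n = suc (suc (double h))

-- The identity over a field of characteristic zero

module CharacterSum (K : CommutativeRing 0ℓ 0ℓ) (F : IsCharZeroField K) where
  open CommutativeRing K hiding (zero)
  open Arithmetic K
  open Symplectic K using (_^_; _·_; ∑≤-syntax; elementarySum; Torus; val; inv; IsIrreducibleCharacter)
  open Radial K using (X̂)
  open DualJacobiTrudi K
  open JacobiTrudi K F
  open AlternatingSums K
  open LeftHandSide K
  open SignedSquares K
  open SetoidReasoning setoid

  private
    2*≡double : ∀ n → 2 ℕ.* n ≡ double n
    2*≡double zero    = ≡.refl
    2*≡double (suc n) = ≡.cong suc (≡.trans (ℕ.+-suc n (n ℕ.+ 0)) (≡.cong suc (2*≡double n)))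

    double-+ : ∀ a b → double a ℕ.+ double b ≡ double (a ℕ.+ b)
    double-+ zero    b = ≡.refl
    double-+ (suc a) b = ≡.cong (λ n → suc (suc n)) (double-+ a b)

    double-mono : ∀ {a b} → a ℕ.≤ b → double a ℕ.≤ double b
    double-mono ℕ.z≤n     = ℕ.z≤n
    double-mono (ℕ.s≤s p) = ℕ.s≤s (ℕ.s≤s (double-mono p))

    half-bounds : ∀ m → double ℕ.⌊ m /2⌋ ℕ.≤ m × m ℕ.≤ suc (double ℕ.⌊ m /2⌋)
    half-bounds zero          = ℕ.z≤n , ℕ.z≤n
    half-bounds (suc zero)    = ℕ.z≤n , ℕ.≤-refl
    half-bounds (suc (suc m)) = ℕ.s≤s (ℕ.s≤s (proj₁ (half-bounds m))) , ℕ.s≤s (ℕ.s≤s (proj₂ (half-bounds m)))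

    f-term : ∀ {m} (X : Fin m → Carrier) s z → f X (+ suc (suc (double z ℕ.+ s))) (+ suc s) ≈ term (γ X) s z
    f-term X s z = +-cong (*-congʳ (+-congˡ (up (suc (double z ℕ.+ s))))) (-‿cong (*-congˡ (+-congˡ (up s))))
      where
      up : ∀ n → g X (+ suc n ℤ.+ + 1) ≈ γ X (suc (suc n))
      up n = reflexive (≡.cong (λ k → g X (+ k)) (ℕ.+-comm (suc n) 1))

    -- Equations instead of truncated subtraction: substituting m = c + 2z + 2l turns the
    -- determinant parameters m + 2 - c and m + 1 - (c + d) into 2z + 2l + 2 and 2l + 1.
    irreducible-term : ∀ {m} l z c d → c ℕ.+ d ℕ.+ double l ≡ m → d ≡ double z → ∀ {χ} → IsIrreducibleCharacter {m} ⟨2^ c ,1^ d ⟩ χ → ∀ x →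
                       χ x ≈ term (γ (X̂ x)) (double l) z
    irreducible-term l z c _ ≡.refl ≡.refl {χ} irr x = begin
      χ x
        ≈⟨ jacobi-trudi c (double z) (ℕ.m≤m+n _ (double l)) irr x ⟩
      f (X̂ x) (+ suc (suc (c ℕ.+ double z ℕ.+ double l)) ℤ.- + c) (+ suc (c ℕ.+ double z ℕ.+ double l) ℤ.- + (c ℕ.+ double z))
        ≡⟨ ≡.cong₂ (f (X̂ x))
             (ℤsolve 3 (λ c z l → (# (+ 2) ⊞ ((c ⊞ z) ⊞ l)) ⊟ c ⊜ # (+ 2) ⊞ (z ⊞ l)) ≡.refl (+ c) (+ double z) (+ double l))
             (ℤsolve 3 (λ c z l → (# (+ 1) ⊞ ((c ⊞ z) ⊞ l)) ⊟ (c ⊞ z) ⊜ # (+ 1) ⊞ l) ≡.refl (+ c) (+ double z) (+ double l)) ⟩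
      f (X̂ x) (+ suc (suc (double z ℕ.+ double l))) (+ suc (double l))
        ≈⟨ f-term (X̂ x) (double l) z ⟩
      term (γ (X̂ x)) (double l) z ∎

  character-sum : ∀ m (χ : Partition m → Torus m → Carrier) → (∀ μ → IsIrreducibleCharacter μ (χ μ)) → ∀ x →
    (∑[ k ≤ m ] ((m ℕ.∸ k) C ℕ.⌊ m ℕ.∸ k /2⌋) · elementarySum k (λ i → val x i ^ 2 + inv x i ^ 2)) ≈
    (∑[ l ≤ ℕ.⌊ m /2⌋ ] ∑[ z ≤ ℕ.⌊ m /2⌋ ℕ.∸ l ] (- 1#) ^ z * χ ⟨2^ m ℕ.∸ 2 ℕ.* l ℕ.∸ 2 ℕ.* z ,1^ 2 ℕ.* z ⟩ x)
  character-sum m χ irr x = begin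
    (∑[ k ≤ m ] ((m ℕ.∸ k) C ℕ.⌊ m ℕ.∸ k /2⌋) · elementarySum k (λ i → val x i ^ 2 + inv x i ^ 2))
      ≈⟨ binomial-sum (λ i → val x i ^ 2 + inv x i ^ 2) ⟩
    e (λ i → val x i ^ 2 + inv x i ^ 2) +0 + e (λ i → val x i ^ 2 + inv x i ^ 2) (+ 1)
      ≈⟨ +-cong (e-cong square +0) (e-cong square (+ 1)) ⟩
    e (λ i → X̂ x i * X̂ x i - 2#) +0 + e (λ i → X̂ x i * X̂ x i - 2#) (+ 1)
      ≈⟨ doubleSum-γ (X̂ x) h (proj₂ (half-bounds m)) ⟨
    doubleSum (γ (X̂ x)) h 0
      ≈⟨ sum-cong {suc h} (λ l → sum-cong {suc (h ℕ.∸ toℕ l)} λ z → *-congˡ {sgn (toℕ z)} (summand (toℕ l) (toℕ z) (ℕ.s≤s⁻¹ (Fin.toℕ<n l)) (ℕ.s≤s⁻¹ (Fin.toℕ<n z)))) ⟩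
    (∑[ l ≤ h ] ∑[ z ≤ h ℕ.∸ l ] (- 1#) ^ z * χ ⟨2^ m ℕ.∸ 2 ℕ.* l ℕ.∸ 2 ℕ.* z ,1^ 2 ℕ.* z ⟩ x) ∎
    where
    h = ℕ.⌊ m /2⌋
    square : ∀ i → val x i ^ 2 + inv x i ^ 2 ≈ X̂ x i * X̂ x i - 2#
    square i = trans (solve 2 (λ v w → v :* (v :* :1) :+ w :* (w :* :1) := (v :+ w) :* (v :+ w) :- :2 :* (v :* w)) refl (val x i) (inv x i))
      (+-congˡ (-‿cong (trans (*-congˡ (Torus.inverse x i)) (*-identityʳ 2#))))
    summand : ∀ l z → l ℕ.≤ h → z ℕ.≤ h ℕ.∸ l → term (γ (X̂ x)) (double l ℕ.+ 0) z ≈ χ ⟨2^ m ℕ.∸ 2 ℕ.* l ℕ.∸ 2 ℕ.* z ,1^ 2 ℕ.* z ⟩ x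
    summand l z l≤h z≤ = trans (reflexive (≡.cong (λ n → term (γ (X̂ x)) n z) (ℕ.+-identityʳ (double l))))
      (sym (irreducible-term l z (m ℕ.∸ 2 ℕ.* l ℕ.∸ 2 ℕ.* z) (2 ℕ.* z) total (2*≡double z) (irr _) x))
      where
      bound : 2 ℕ.* l ℕ.+ 2 ℕ.* z ℕ.≤ m
      -- The ranges give l + z ≤ ⌊m/2⌋, hence 2l + 2z ≤ m, and both truncated subtractions in the
      -- partition are exact.
      bound = ≡.subst (ℕ._≤ m) (≡.sym (≡.trans (≡.cong₂ ℕ._+_ (2*≡double l) (2*≡double z)) (double-+ l z)))
        (ℕ.≤-trans (double-mono (≡.subst (l ℕ.+ z ℕ.≤_) (ℕ.m+[n∸m]≡n l≤h) (ℕ.+-monoʳ-≤ l z≤))) (proj₁ (half-bounds m)))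
      total : m ℕ.∸ 2 ℕ.* l ℕ.∸ 2 ℕ.* z ℕ.+ 2 ℕ.* z ℕ.+ double l ≡ m
      total = ≡.trans (≡.cong₂ ℕ._+_ (ℕ.m∸n+n≡m (ℕ.m+n≤o⇒m≤o∸n (2 ℕ.* z) (≡.subst (ℕ._≤ m) (ℕ.+-comm (2 ℕ.* l) (2 ℕ.* z)) bound))) (≡.sym (2*≡double l)))
        (ℕ.m∸n+n≡m (ℕ.m+n≤o⇒m≤o (2 ℕ.* l) bound))

-- The complex numbers as a field of characteristic zero

module ComplexField (ℝ : Reals) where
  open Reals ℝ
  open CommutativeRing commutativeRing hiding (zero)
  open Arithmetic commutativeRing
  private
    module < = IsStrictTotalOrder isStrictTotalOrder

    square-pos : ∀ x → ¬ x ≈ 0# → 0# < x * x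
    square-pos x x≉0 with <.compare 0# x
    ... | tri< 0<x _ _ = *-pos x x 0<x 0<x
    ... | tri≈ _ 0≈x _ = ⊥-elim (x≉0 (sym 0≈x))
    ... | tri> _ _ x<0 = <.<-respʳ-≈ (solve 1 (λ x → (:- x) :* (:- x) := x :* x) refl x) (*-pos (- x) (- x) 0<-x 0<-x)
      where
      0<-x : 0# < - x
      0<-x = <.<-respʳ-≈ (+-identityˡ (- x)) (<.<-respˡ-≈ (-‿inverseʳ x) (+-mono-< x 0# (- x) x<0))

    +-pos : ∀ {x y} → 0# < x → 0# < y → 0# < x + y
    +-pos {x} {y} 0<x 0<y = <.trans 0<y (<.<-respˡ-≈ (+-identityˡ y) (+-mono-< 0# x y 0<x))

    pos-nonzero : ∀ {x} → 0# < x → ¬ x ≈ 0#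
    pos-nonzero 0<x x≈0 = <.irrefl (sym x≈0) 0<x

    0<1 : 0# < 1#
    0<1 = <.<-respʳ-≈ (*-identityˡ 1#) (square-pos 1# 1≉0)

    norm : Carrier → Carrier → Carrier
    norm a b = a * a + b * b

    -- Nonzero squares are positive in an ordered field. Equality with 0 is decided by the order,
    -- which permits the case split on the two coordinates.
    norm-nonzero : ∀ a b → ¬ (a ≈ 0# × b ≈ 0#) → ¬ norm a b ≈ 0#
    norm-nonzero a b ab≉0 with a <.≟ 0# | b <.≟ 0#
    ... | yes a≈0 | yes b≈0 = ⊥-elim (ab≉0 (a≈0 , b≈0))
    ... | yes a≈0 | no b≉0 = pos-nonzero (<.<-respʳ-≈ (sym (trans (+-congʳ (trans (*-congˡ a≈0) (zeroʳ a))) (+-identityˡ _))) (square-pos b b≉0))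
    ... | no a≉0 | yes b≈0 = pos-nonzero (<.<-respʳ-≈ (sym (trans (+-congˡ (trans (*-congˡ b≈0) (zeroʳ b))) (+-identityʳ _))) (square-pos a a≉0))
    ... | no a≉0 | no b≉0 = pos-nonzero (+-pos (square-pos a a≉0) (square-pos b b≉0))

    module ℂ = CommutativeRing (complexNumbers ℝ)
    open MonoidMult ℂ.+-monoid using () renaming (_×_ to _·ᶜ_)

    multiple-pos : ∀ n → 0# < proj₁ (suc n ·ᶜ ℂ.1#)
    multiple-pos zero    = <.<-respʳ-≈ (sym (+-identityʳ 1#)) 0<1
    multiple-pos (suc n) = +-pos 0<1 (multiple-pos n)

  -- Inverses are conjugates divided by the norm a² + b². Characteristic zero is seen in the real
  -- part, where positive multiples of 1 stay positive.
  isCharZeroField : IsCharZeroField (complexNumbers ℝ)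
  isCharZeroField = record
    { _≟_     = λ (a , b) (c , d) → (a <.≟ c) ×-dec (b <.≟ d)
    ; inverse = λ (a , b) ab≉0 → let i , ni≈1 = inverse (norm a b) (norm-nonzero a b ab≉0) in
        (a * i , - (b * i)) ,
        trans (solve 3 (λ a b i → a :* (a :* i) :- b :* (:- (b :* i)) := (a :* a :+ b :* b) :* i) refl a b i) ni≈1 ,
        solve 3 (λ a b i → a :* (:- (b :* i)) :+ b :* (a :* i) := :0) refl a b i
    ; n·1≉0   = λ n (re≈0 , _) → pos-nonzero (multiple-pos n) re≈0
    }

mainTheorem7 : (ℝ : Reals) → let open Symplectic (complexNumbers ℝ) in
    (m : ℕ) → 1 ≤ m →
    (χ : Partition m → Torus m → Carrier) →
    (∀ μ → IsIrreducibleCharacter μ (χ μ)) →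
    (x : Torus m) →
    (∑[ k ≤ m ] ((m ∸ k) C ⌊ m ∸ k /2⌋) · elementarySum k (λ i → val x i ^ 2 + inv x i ^ 2))
    ≈
    (∑[ l ≤ ⌊ m /2⌋ ] ∑[ z ≤ ⌊ m /2⌋ ∸ l ]
    (- 1#) ^ z * χ ⟨2^ m ∸ 2 ℕ.* l ∸ 2 ℕ.* z ,1^ 2 ℕ.* z ⟩ x)
mainTheorem7 ℝ m _ = CharacterSum.character-sum (complexNumbers ℝ) (ComplexField.isCharZeroField ℝ) m
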